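{- Let $\bar Y_n$ be the out-degree of a node chosen uniformly at random from the inserted nodes $\{1,\dots,n\}$ of a random ordered increasing $k$-tree of size $n\ge1$. Then for $m\ge0$, \[ \mathbb{P}\{\bar Y_n=m\}=\frac{1}{n\binom{n-\frac{k}{k+1}}{n}}\sum_{\ell=0}^{m}\frac{\binom{m}{\ell}(-1)^{\ell}}{k(\ell+2)+1}\left(\binom{n+\frac{1}{k+1}}{n}-\binom{n-\frac{k(\ell+2)}{k+1}}{n}\right). \] As $n\to\infty$, $\bar Y_n$ converges in distribution to a discrete random variable $\bar Y$ with \[ \mathbb{P}\{\bar Y=m\}=p_m:=\frac{k+1}{k(m+1)\binom{m+2+\frac1k}{m+1}},\quad m\ge0, \] and $p_m\sim\frac{k+1}{k}\Gamma(2+\frac1k)\,m^{ -2-\frac1k}$ as $m\to\infty$.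
   Context: Fix an integer $k\ge1$. An ordered increasing $k$-tree of size $n\ge0$ is built as follows. Start with the root-clique $K_0$: $k$ pairwise adjacent vertices labelled $0_1,\dots,0_k$ (the root nodes; each label $0_\ell$ has value $0$). For $j=1,\dots,n$ in turn, node $j$ is inserted by choosing a currently existing $k$-clique $K$ and attaching $j$ to it, i.e. adding edges from $j$ to all $k$ vertices of $K$; $j$ is then a child of $K$ and the vertices of $K$ are the parents of $j$. The $k$-cliques available for attachment are the root-clique and, for every previously inserted node $x$ attached to a clique $K'$, the $k$ cliques $\{x\}\cup(K'\setminus\{w\})$, $w\in K'$. The children of each $k$-clique are linearly ordered: if $K$ currently has $d^+(K)$ children, there are $d^+(K)+1$ positions at which the new child may be placed, and the choice of position is part of the structure. Thus there are $1+(k+1)(j-1)$ ways to insert node $j$, and distinct sequences of choices give distinct trees. A random ordered increasing $k$-tree of size $n$ is one chosen uniformly among all of them; equivalently, it is produced by the process in which node $n$ is attached to the clique $K$ with probability $\frac{d^+(K)+1}{1+(k+1)(n-1)}$ (and a uniformly random position among the $d^+(K)+1$). The out-degree of a node $u$ is the number of nodes having $u$ as a parent (for a root node this is its number of non-root neighbours). For real $x$ and integer $m\ge0$, $\binom{x}{m}=x(x-1)\cdots(x-m+1)/m!$, and $\binom{x}{m}=0$ for $m<0$. -}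

module Defs where

open import Algebra.Bundles using (CommutativeRing)
open import Data.Bool using (if_then_else_)
open import Data.Empty using (⊥; ⊥-elim)
open import Data.Fin using (Fin)
import Data.Fin.Properties as Fin
open import Data.Integer using (ℤ; +_; -[1+_]; +[1+_]; +≤+; +<+)
import Data.Integer as ℤ
import Data.Integer.Properties as ℤ
open import Data.List using (List; []; _∷_; _++_; map; concatMap; allFin; applyUpTo; filter; length; cartesianProduct)
open import Data.List.Membership.Propositional using (_∈_)
open import Data.List.Membership.Propositional.Properties using (∈-allFin; ∈-map⁺; ∈-map⁻; ∈-++⁺ˡ; ∈-++⁺ʳ; ∈-concatMap⁺; ∈-++⁻)
open import Data.List.Relation.Unary.Any using (here)
import Data.List.Relation.Unary.Any as Any
import Data.List.Relation.Unary.All.Properties as All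
import Data.List.Relation.Unary.All as All
import Data.List.Relation.Unary.AllPairs as AllPairs
import Data.List.Relation.Unary.AllPairs.Properties as AllPairs
open import Data.List.Relation.Unary.Unique.Propositional using (Unique; []; _∷_)
import Data.List.Relation.Unary.Unique.Propositional.Properties as Unique
open import Data.Nat using (ℕ; zero; suc; _!; s≤s; z≤n)
import Data.Nat as ℕ
import Data.Nat.Properties as ℕ
open import Data.Nat.Properties using (_!≢0)
open import Data.Product using (Σ; ∃; _×_; _,_; proj₁; proj₂)
open import Data.Rational
open import Data.Rational.Properties hiding (_≟_)
import Data.Rational.Properties as ℚ
import Data.Rational.Unnormalised as ℚᵘ
import Data.Rational.Unnormalised.Properties as ℚᵘ
open import Data.Rational.Solver using (module +-*-Solver)
open import Data.Sum using (_⊎_; inj₁; inj₂)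
open import Data.Vec using (Vec; tabulate; _[_]≔_)
import Data.Vec.Membership.DecPropositional as VecMembership
open import Function using (_∘_)
open import Relation.Binary.Definitions using (DecidableEquality)
open import Relation.Binary.PropositionalEquality using (_≡_; refl; sym; trans; cong; cong₂; subst; subst₂)
open import Relation.Nullary using (Dec; yes; no; does; ¬_)
open import Relation.Nullary.Decidable using (map′)
open import Relation.Unary using (Pred; Decidable)
open import Level using (0ℓ)

open import Algebra.Properties.CommutativeSemiring.Exp (CommutativeRing.commutativeSemiring +-*-commutativeRing) public using (_^_)

import Data.Integer.Solver
module ℤS = Data.Integer.Solver.+-*-Solver
open +-*-Solver using (solve; _:=_; _:+_; _:*_; _:-_; :-_; con)

fromℕ : ℕ → ℚ
fromℕ n = + n / 1

-- Division made total by p ÷₀ 0 = 0; as a denominator, 0 occurs below only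
-- outside the intended range (size n = 0, or 0 to a negative power).
infixl 7 _÷₀_
_÷₀_ : ℚ → ℚ → ℚ
p ÷₀ q with q ℚ.≟ 0ℚ
... | yes _   = 0ℚ
... | no q≢0 = (p ÷ q) {{≢-nonZero q≢0}}

-- ∑ n f = f 0 + … + f (n − 1)
∑ : ℕ → (ℕ → ℚ) → ℚ
∑ zero    f = 0ℚ
∑ (suc n) f = ∑ n f + f n

fallingFactorial : ℚ → ℕ → ℚ
fallingFactorial x zero    = 1ℚ
fallingFactorial x (suc m) = fallingFactorial x m * (x - fromℕ m)

binom : ℚ → ℕ → ℚ
binom x m = fallingFactorial x m ÷₀ fromℕ (m !)

_⟶ℚ_ : (ℕ → ℚ) → ℚ → Set
a ⟶ℚ L = ∀ ε → 0ℚ < ε → ∃ λ N → ∀ n → N ℕ.≤ n → ∣ a n - L ∣ ≤ ε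

-- The clique `new w`, created by the insertion of node x at the clique K′,
-- is {x} ∪ (K′ ∖ {w-th vertex of K′}).
data Clique (k : ℕ) : ℕ → Set where
  rootClique : Clique k 0
  old        : ∀ {n} → Clique k n → Clique k (suc n)
  new        : ∀ {n} → Fin k → Clique k (suc n)

old-injective : ∀ {k n} {K L : Clique k n} → old K ≡ old L → K ≡ L
old-injective refl = refl

new-injective : ∀ {k n} {v w : Fin k} → new {n = n} v ≡ new w → v ≡ w
new-injective refl = refl

_≟ᶜ_ : ∀ {k n} → DecidableEquality (Clique k n)
rootClique ≟ᶜ rootClique = yes refl
old K      ≟ᶜ old L      = map′ (cong old) old-injective (K ≟ᶜ L)
old _      ≟ᶜ new _      = no λ ()
new _      ≟ᶜ old _      = no λ ()
new v      ≟ᶜ new w      = map′ (cong new) new-injective (v Fin.≟ w)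

-- A tree is the sequence of choices that builds it: at each step a clique K
-- and one of the d⁺(K) + 1 positions among the children of K.
mutual
  data Tree (k : ℕ) : ℕ → Set where
    root   : Tree k 0
    insert : ∀ {n} (T : Tree k n) (K : Clique k n) → Fin (suc (d⁺ T K)) → Tree k (suc n)

  d⁺ : ∀ {k n} → Tree k n → Clique k n → ℕ
  d⁺ root           _       = 0
  d⁺ (insert T K _) (old L) = if does (L ≟ᶜ K) then suc (d⁺ T L) else d⁺ T L
  d⁺ (insert T K _) (new _) = 0

-- rootNode ℓ has label 0 with index ℓ + 1; the inserted nodes are node 1, node 2, …
data Node (k : ℕ) : Set where
  rootNode : Fin k → Node k
  node     : ℕ → Node k

rootNode-injective : ∀ {k} {v w : Fin k} → rootNode v ≡ rootNode w → v ≡ w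
rootNode-injective refl = refl

node-injective : ∀ {k i j} → node {k} i ≡ node j → i ≡ j
node-injective refl = refl

_≟ⁿ_ : ∀ {k} → DecidableEquality (Node k)
rootNode v ≟ⁿ rootNode w = map′ (cong rootNode) rootNode-injective (v Fin.≟ w)
rootNode _ ≟ⁿ node _     = no λ ()
node _     ≟ⁿ rootNode _ = no λ ()
node i     ≟ⁿ node j     = map′ (cong node) node-injective (i ℕ.≟ j)

vertices : ∀ {k n} → Tree k n → Clique k n → Vec (Node k) k
vertices root                   rootClique = tabulate rootNode
vertices (insert T K _)         (old L)    = vertices T L
vertices (insert {n = n} T K _) (new w)    = vertices T K [ w ]≔ node (suc n)

outDegree : ∀ {k n} → Tree k n → Node k → ℕ
outDegree         root           u = 0
outDegree {k = k} (insert T K _) u =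
  if does (u ∈? vertices T K) then suc (outDegree T u) else outDegree T u
  where open VecMembership (_≟ⁿ_ {k}) using (_∈?_)

allCliques : ∀ k n → List (Clique k n)
allCliques k zero    = rootClique ∷ []
allCliques k (suc n) = map old (allCliques k n) ++ map new (allFin k)

allTrees : ∀ k n → List (Tree k n)
allTrees k zero    = root ∷ []
allTrees k (suc n) =
  concatMap (λ T → concatMap (λ K → map (insert T K) (allFin (suc (d⁺ T K)))) (allCliques k n))
            (allTrees k n)

-- `allTrees k n` lists every tree of size n exactly once.
allCliques-complete : ∀ {k n} (K : Clique k n) → K ∈ allCliques k n
allCliques-complete rootClique = here refl
allCliques-complete (old K)    = ∈-++⁺ˡ (∈-map⁺ old (allCliques-complete K))
allCliques-complete {k} {suc n} (new w) = ∈-++⁺ʳ (map old (allCliques k n)) (∈-map⁺ new (∈-allFin w))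

allTrees-complete : ∀ {k n} (T : Tree k n) → T ∈ allTrees k n
allTrees-complete root = here refl
allTrees-complete (insert T K p) =
  ∈-concatMap⁺ _ (Any.map (λ { refl →
    ∈-concatMap⁺ _ (Any.map (λ { refl → ∈-map⁺ (insert T K) (∈-allFin p) }) (allCliques-complete K)) })
    (allTrees-complete T))

concatMap-unique : {A B : Set} (f : A → List B) (origin : B → A) →
                   (∀ x {y} → y ∈ f x → origin y ≡ x) → (∀ x → Unique (f x)) →
                   ∀ {xs} → Unique xs → Unique (concatMap f xs)
concatMap-unique f origin origin-f f-unique xs-unique =
  Unique.concat⁺ (All.map⁺ (All.universal f-unique _))
    (AllPairs.map⁺ (AllPairs.map (λ x≢x′ {y} (y∈ , y∈′) →
      x≢x′ (trans (sym (origin-f _ y∈)) (origin-f _ y∈′))) xs-unique))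

allCliques-unique : ∀ k n → Unique (allCliques k n)
allCliques-unique k zero    = All.[] ∷ []
allCliques-unique k (suc n) = Unique.++⁺
  (Unique.map⁺ old-injective (allCliques-unique k n))
  (Unique.map⁺ new-injective (Unique.allFin⁺ k))
  λ (old∈ , new∈) → disjoint (∈-map⁻ old old∈) (∈-map⁻ new new∈)
  where
  disjoint : ∀ {K} → ∃ (λ L → L ∈ allCliques k n × K ≡ old L) → ∃ (λ w → w ∈ allFin k × K ≡ new w) → ⊥
  disjoint (_ , _ , refl) (_ , _ , ())

insert-injective : ∀ {k n} {T : Tree k n} {K p q} → insert T K p ≡ insert T K q → p ≡ q
insert-injective refl = refl

allTrees-unique : ∀ k n → Unique (allTrees k n)
allTrees-unique k zero    = All.[] ∷ []
allTrees-unique k (suc n) = concatMap-unique _ tree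
  (λ T y∈ → tree-insert T (allCliques k n) y∈)
  (λ T → concatMap-unique _ clique
    (λ K y∈ → clique-insert T K (∈-map⁻ (insert T K) y∈))
    (λ K → Unique.map⁺ insert-injective (Unique.allFin⁺ (suc (d⁺ T K))))
    (allCliques-unique k n))
  (allTrees-unique k n)
  where
  tree : Tree k (suc n) → Tree k n
  tree (insert T _ _) = T
  clique : Tree k (suc n) → Clique k n
  clique (insert _ K _) = K
  clique-insert : ∀ T K {y} → ∃ (λ p → p ∈ allFin (suc (d⁺ T K)) × y ≡ insert T K p) → clique y ≡ K
  clique-insert T K (_ , _ , refl) = refl
  tree-insert : ∀ T Ks {y} → y ∈ concatMap (λ K → map (insert T K) (allFin (suc (d⁺ T K)))) Ks → tree y ≡ T
  tree-insert T (K ∷ Ks) y∈ with ∈-++⁻ (map (insert T K) (allFin (suc (d⁺ T K)))) y∈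
  ... | inj₂ y∈′ = tree-insert T Ks y∈′
  ... | inj₁ y∈′ with ∈-map⁻ (insert T K) y∈′
  ...   | _ , _ , refl = refl

insertedNodes : ∀ k n → List (Node k)
insertedNodes k n = applyUpTo (node ∘ suc) n

uniformPr : {A : Set} {P : Pred A 0ℓ} → List A → Decidable P → ℚ
uniformPr xs P? = fromℕ (length (filter P? xs)) ÷₀ fromℕ (length xs)

ℙ[Ȳ_≡_] : ∀ {k} → ℕ → ℕ → ℚ
ℙ[Ȳ_≡_] {k} n m =
  uniformPr (cartesianProduct (allTrees k n) (insertedNodes k n))
            (λ (T , u) → outDegree T u ℕ.≟ m)

exactProbability : ℕ → ℕ → ℕ → ℚ
exactProbability k n m =
  1ℚ ÷₀ (fromℕ n * binom (fromℕ n - + k / suc k) n)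
  * ∑ (suc m) (λ ℓ →
      (binom (fromℕ m) ℓ * (- 1ℚ) ^ ℓ) ÷₀ fromℕ (k ℕ.* (ℓ ℕ.+ 2) ℕ.+ 1)
      * (binom (fromℕ n + + 1 / suc k) n
         - binom (fromℕ n - + (k ℕ.* (ℓ ℕ.+ 2)) / suc k) n))

limitProbability : (k : ℕ) .{{_ : ℕ.NonZero k}} → ℕ → ℚ
limitProbability k m =
  fromℕ (suc k) ÷₀ (fromℕ (k ℕ.* (m ℕ.+ 1)) * binom (fromℕ (m ℕ.+ 2) + + 1 / k) (m ℕ.+ 1))

IsDistribution : (ℕ → ℚ) → Set
IsDistribution p = (∀ m → 0ℚ ≤ p m) × ((λ n → ∑ n p) ⟶ℚ 1ℚ)

cdf : (ℕ → ℚ) → ℚ → ℚ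
cdf p x with floor x
... | + j      = ∑ (suc j) p
... | -[1+ _ ] = 0ℚ

ContinuousAt : (ℚ → ℚ) → ℚ → Set
ContinuousAt F x = ∀ ε → 0ℚ < ε → ∃ λ δ → 0ℚ < δ × (∀ y → ∣ y - x ∣ ≤ δ → ∣ F y - F x ∣ ≤ ε)

-- Convergence of the distribution functions at the continuity points of the
-- limit.  All functions involved are constant between consecutive integers, so
-- it is enough to look at rational points.
_⟶ᵈ_ : (ℕ → ℕ → ℚ) → (ℕ → ℚ) → Set
p ⟶ᵈ q = ∀ x → ContinuousAt (cdf q) x → (λ n → cdf (p n) x) ⟶ℚ cdf q x

IsCauchy : (ℕ → ℚ) → Set
IsCauchy x = ∀ ε → 0ℚ < ε → ∃ λ N → ∀ m n → N ℕ.≤ m → N ℕ.≤ n → ∣ x m - x n ∣ ≤ ε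

-- Cauchy sequences of rationals; two of them are equal as reals when their
-- difference tends to 0.
record ℝ : Set where
  constructor mkℝ
  field
    seq    : ℕ → ℚ
    cauchy : IsCauchy seq

open ℝ public

infix 4 _≤ℝ_
_≤ℝ_ : ℝ → ℝ → Set
x ≤ℝ y = ∀ ε → 0ℚ < ε → ∃ λ N → ∀ n → N ℕ.≤ n → seq x n ≤ seq y n + ε

p≤q⇒0≤q-p : ∀ {p q} → p ≤ q → 0ℚ ≤ q - p
p≤q⇒0≤q-p {p} {q} p≤q = subst (_≤ q - p) (+-inverseʳ p) (+-monoˡ-≤ (- p) p≤q)

0≤q-p⇒p≤q : ∀ {p q} → 0ℚ ≤ q - p → p ≤ q
0≤q-p⇒p≤q {p} {q} h = begin
  p            ≡⟨ sym (+-identityʳ p) ⟩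
  p + 0ℚ       ≤⟨ +-monoʳ-≤ p h ⟩
  p + (q - p)  ≡⟨ solve 2 (λ p q → p :+ (q :- p) := q) refl p q ⟩
  q            ∎
  where open ≤-Reasoning

∣p∣≤q : ∀ {p q} → p ≤ q → - p ≤ q → ∣ p ∣ ≤ q
∣p∣≤q {p} p≤q -p≤q with ∣p∣≡p∨∣p∣≡-p p
... | inj₁ eq = subst (_≤ _) (sym eq) p≤q
... | inj₂ eq = subst (_≤ _) (sym eq) -p≤q

p≤∣p∣ : ∀ p → p ≤ ∣ p ∣
p≤∣p∣ p with ≤-total 0ℚ p
... | inj₁ 0≤p = ≤-reflexive (sym (0≤p⇒∣p∣≡p 0≤p))
... | inj₂ p≤0 = ≤-trans p≤0 (0≤∣p∣ p)

∣p-q∣≡∣q-p∣ : ∀ p q → ∣ p - q ∣ ≡ ∣ q - p ∣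
∣p-q∣≡∣q-p∣ p q = trans (sym (∣-p∣≡∣p∣ (p - q)))
  (cong ∣_∣ (solve 2 (λ p q → :- (p :- q) := q :- p) refl p q))

∣p-r∣≤∣p-q∣+∣q-r∣ : ∀ p q r → ∣ p - r ∣ ≤ ∣ p - q ∣ + ∣ q - r ∣
∣p-r∣≤∣p-q∣+∣q-r∣ p q r = subst (λ s → ∣ s ∣ ≤ ∣ p - q ∣ + ∣ q - r ∣)
  (solve 3 (λ p q r → (p :- q) :+ (q :- r) := p :- r) refl p q r)
  (∣p+q∣≤∣p∣+∣q∣ (p - q) (q - r))

∣∣p∣-∣q∣∣≤∣p-q∣ : ∀ p q → ∣ ∣ p ∣ - ∣ q ∣ ∣ ≤ ∣ p - q ∣
∣∣p∣-∣q∣∣≤∣p-q∣ p q = ∣p∣≤q (one p q) (begin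
  - (∣ p ∣ - ∣ q ∣)  ≡⟨ solve 2 (λ a b → :- (a :- b) := b :- a) refl ∣ p ∣ ∣ q ∣ ⟩
  ∣ q ∣ - ∣ p ∣      ≤⟨ one q p ⟩
  ∣ q - p ∣          ≡⟨ ∣p-q∣≡∣q-p∣ q p ⟩
  ∣ p - q ∣          ∎)
  where
  open ≤-Reasoning
  one : ∀ p q → ∣ p ∣ - ∣ q ∣ ≤ ∣ p - q ∣
  one p q = begin
    ∣ p ∣ - ∣ q ∣                  ≡⟨ cong (λ s → ∣ s ∣ - ∣ q ∣) (solve 2 (λ p q → p := (p :- q) :+ q) refl p q) ⟩
    ∣ (p - q) + q ∣ - ∣ q ∣        ≤⟨ +-monoˡ-≤ (- ∣ q ∣) (∣p+q∣≤∣p∣+∣q∣ (p - q) q) ⟩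
    (∣ p - q ∣ + ∣ q ∣) - ∣ q ∣    ≡⟨ solve 2 (λ a b → (a :+ b) :- b := a) refl ∣ p - q ∣ ∣ q ∣ ⟩
    ∣ p - q ∣                      ∎

½-pos : ∀ {ε} → 0ℚ < ε → 0ℚ < ½ * ε
½-pos {ε} 0<ε = subst (_< ½ * ε) (*-zeroʳ ½) (*-monoʳ-<-pos ½ 0<ε)

½+½ : ∀ ε → ½ * ε + ½ * ε ≡ ε
½+½ ε = trans (sym (*-distribʳ-+ ε ½ ½)) (*-identityˡ ε)

*-mono-≤-nonNeg : ∀ {p q r s} → 0ℚ ≤ p → 0ℚ ≤ s → p ≤ q → r ≤ s → p * r ≤ q * s
*-mono-≤-nonNeg {p} {q} {r} {s} 0≤p 0≤s p≤q r≤s = ≤-trans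
  (*-monoˡ-≤-nonNeg p {{nonNegative 0≤p}} r≤s)
  (*-monoʳ-≤-nonNeg s {{nonNegative 0≤s}} p≤q)

0≤p*q : ∀ {p q} → 0ℚ ≤ p → 0ℚ ≤ q → 0ℚ ≤ p * q
0≤p*q {p} {q} 0≤p 0≤q = nonNegative⁻¹ (p * q)
  {{nonNeg*nonNeg⇒nonNeg p {{nonNegative 0≤p}} q {{nonNegative 0≤q}}}}

fromℚ : ℚ → ℝ
fromℚ q = mkℝ (λ _ → q) λ ε 0<ε → 0 , λ _ _ _ _ →
  subst (λ s → ∣ s ∣ ≤ ε) (sym (+-inverseʳ q)) (<⇒≤ 0<ε)

infixl 6 _+ℝ_ _-ℝ_
infixl 7 _*ℝ_

_+ℝ_ : ℝ → ℝ → ℝ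
x +ℝ y = mkℝ (λ n → seq x n + seq y n) λ ε 0<ε →
  let (M , hx) = cauchy x (½ * ε) (½-pos 0<ε)
      (N , hy) = cauchy y (½ * ε) (½-pos 0<ε)
  in M ℕ.⊔ N , λ m n le le′ → let open ≤-Reasoning in begin
    ∣ (seq x m + seq y m) - (seq x n + seq y n) ∣
      ≡⟨ cong ∣_∣ (solve 4 (λ a b c d → (a :+ b) :- (c :+ d) := (a :- c) :+ (b :- d)) refl
                           (seq x m) (seq y m) (seq x n) (seq y n)) ⟩
    ∣ (seq x m - seq x n) + (seq y m - seq y n) ∣
      ≤⟨ ∣p+q∣≤∣p∣+∣q∣ (seq x m - seq x n) (seq y m - seq y n) ⟩
    ∣ seq x m - seq x n ∣ + ∣ seq y m - seq y n ∣
      ≤⟨ +-mono-≤ (hx m n (ℕ.m⊔n≤o⇒m≤o M N le) (ℕ.m⊔n≤o⇒m≤o M N le′))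
                  (hy m n (ℕ.m⊔n≤o⇒n≤o M N le) (ℕ.m⊔n≤o⇒n≤o M N le′)) ⟩
    ½ * ε + ½ * ε
      ≡⟨ ½+½ ε ⟩
    ε ∎

-ℝ_ : ℝ → ℝ
-ℝ x = mkℝ (λ n → - seq x n) λ ε 0<ε →
  let (N , h) = cauchy x ε 0<ε
  in N , λ m n le le′ → subst (_≤ ε)
       (trans (∣p-q∣≡∣q-p∣ (seq x m) (seq x n))
              (cong ∣_∣ (solve 2 (λ a b → b :- a := (:- a) :- (:- b)) refl (seq x m) (seq x n))))
       (h m n le le′)

_-ℝ_ : ℝ → ℝ → ℝ
x -ℝ y = x +ℝ (-ℝ y)

∣_∣ℝ : ℝ → ℝ
∣ x ∣ℝ = mkℝ (λ n → ∣ seq x n ∣) λ ε 0<ε →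
  let (N , h) = cauchy x ε 0<ε
  in N , λ m n le le′ → ≤-trans (∣∣p∣-∣q∣∣≤∣p-q∣ (seq x m) (seq x n)) (h m n le le′)

eventuallyBounded : ∀ x → ∃ λ C → 0ℚ < C × (∃ λ N → ∀ n → N ℕ.≤ n → ∣ seq x n ∣ ≤ C)
eventuallyBounded x with cauchy x 1ℚ (positive⁻¹ 1ℚ)
... | N , h = 1ℚ + ∣ seq x N ∣
  , positive⁻¹ (1ℚ + ∣ seq x N ∣) {{pos+nonNeg⇒pos 1ℚ ∣ seq x N ∣ {{∣-∣-nonNeg (seq x N)}}}}
  , N , λ n le → let open ≤-Reasoning in begin
    ∣ seq x n ∣
      ≡⟨ cong ∣_∣ (solve 2 (λ a b → a := (a :- b) :+ b) refl (seq x n) (seq x N)) ⟩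
    ∣ (seq x n - seq x N) + seq x N ∣
      ≤⟨ ∣p+q∣≤∣p∣+∣q∣ (seq x n - seq x N) (seq x N) ⟩
    ∣ seq x n - seq x N ∣ + ∣ seq x N ∣
      ≤⟨ +-monoˡ-≤ ∣ seq x N ∣ (h n N le ℕ.≤-refl) ⟩
    1ℚ + ∣ seq x N ∣ ∎

_*ℝ_ : ℝ → ℝ → ℝ
x *ℝ y = mkℝ (λ n → seq x n * seq y n) cauchy-*
  where
  open ≤-Reasoning
  C = proj₁ (eventuallyBounded x)
  D = proj₁ (eventuallyBounded y)
  0<C = proj₁ (proj₂ (eventuallyBounded x))
  0<D = proj₁ (proj₂ (eventuallyBounded y))
  Nx = proj₁ (proj₂ (proj₂ (eventuallyBounded x)))
  Ny = proj₁ (proj₂ (proj₂ (eventuallyBounded y)))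
  instance
    C+D-pos : Positive (C + D)
    C+D-pos = pos+pos⇒pos C {{positive 0<C}} D {{positive 0<D}}
    C+D-nonZero : NonZero (C + D)
    C+D-nonZero = pos⇒nonZero (C + D)
  cauchy-* : IsCauchy (λ n → seq x n * seq y n)
  cauchy-* ε 0<ε = (Nx ℕ.⊔ Ny) ℕ.⊔ (M ℕ.⊔ N) , λ m n le le′ →
    let xm = seq x m ; xn = seq x n ; ym = seq y m ; yn = seq y n
        bx = proj₂ (proj₂ (proj₂ (eventuallyBounded x))) m
               (ℕ.m⊔n≤o⇒m≤o Nx Ny (ℕ.m⊔n≤o⇒m≤o (Nx ℕ.⊔ Ny) (M ℕ.⊔ N) le))
        by = proj₂ (proj₂ (proj₂ (eventuallyBounded y))) n
               (ℕ.m⊔n≤o⇒n≤o Nx Ny (ℕ.m⊔n≤o⇒m≤o (Nx ℕ.⊔ Ny) (M ℕ.⊔ N) le′))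
        dx = hx m n (ℕ.m⊔n≤o⇒m≤o M N (ℕ.m⊔n≤o⇒n≤o (Nx ℕ.⊔ Ny) (M ℕ.⊔ N) le))
                    (ℕ.m⊔n≤o⇒m≤o M N (ℕ.m⊔n≤o⇒n≤o (Nx ℕ.⊔ Ny) (M ℕ.⊔ N) le′))
        dy = hy m n (ℕ.m⊔n≤o⇒n≤o M N (ℕ.m⊔n≤o⇒n≤o (Nx ℕ.⊔ Ny) (M ℕ.⊔ N) le))
                    (ℕ.m⊔n≤o⇒n≤o M N (ℕ.m⊔n≤o⇒n≤o (Nx ℕ.⊔ Ny) (M ℕ.⊔ N) le′))
    in begin
    ∣ xm * ym - xn * yn ∣
      ≡⟨ cong ∣_∣ (solve 4 (λ a b c d → a :* b :- c :* d := a :* (b :- d) :+ (a :- c) :* d) refl xm ym xn yn) ⟩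
    ∣ xm * (ym - yn) + (xm - xn) * yn ∣
      ≤⟨ ∣p+q∣≤∣p∣+∣q∣ (xm * (ym - yn)) ((xm - xn) * yn) ⟩
    ∣ xm * (ym - yn) ∣ + ∣ (xm - xn) * yn ∣
      ≡⟨ cong₂ _+_ (∣p*q∣≡∣p∣*∣q∣ xm (ym - yn)) (∣p*q∣≡∣p∣*∣q∣ (xm - xn) yn) ⟩
    ∣ xm ∣ * ∣ ym - yn ∣ + ∣ xm - xn ∣ * ∣ yn ∣
      ≤⟨ +-mono-≤ (*-mono-≤-nonNeg (0≤∣p∣ xm) (<⇒≤ 0<δ) bx dy)
                  (*-mono-≤-nonNeg (0≤∣p∣ (xm - xn)) (<⇒≤ 0<D) dx by) ⟩
    C * δ + δ * D
      ≡⟨ solve 3 (λ c δ d → c :* δ :+ δ :* d := δ :* (c :+ d)) refl C δ D ⟩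
    (ε * 1/ (C + D)) * (C + D)
      ≡⟨ *-assoc ε (1/ (C + D)) (C + D) ⟩
    ε * (1/ (C + D) * (C + D))
      ≡⟨ cong (ε *_) (*-inverseˡ (C + D)) ⟩
    ε * 1ℚ
      ≡⟨ *-identityʳ ε ⟩
    ε ∎
    where
    δ = ε * 1/ (C + D)
    0<δ : 0ℚ < δ
    0<δ = positive⁻¹ δ {{pos*pos⇒pos ε {{positive 0<ε}} (1/ (C + D)) {{1/pos⇒pos (C + D)}}}}
    M = proj₁ (cauchy x δ 0<δ)
    hx = proj₂ (cauchy x δ 0<δ)
    N = proj₁ (cauchy y δ 0<δ)
    hy = proj₂ (cauchy y δ 0<δ)

∑ℝ : ℕ → (ℕ → ℝ) → ℝ
∑ℝ zero    f = fromℚ 0ℚ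
∑ℝ (suc n) f = ∑ℝ n f +ℝ f n

_⟶_ : (ℕ → ℝ) → ℝ → Set
a ⟶ L = ∀ ε → 0ℚ < ε → ∃ λ N → ∀ n → N ℕ.≤ n → ∣ a n -ℝ L ∣ℝ ≤ℝ fromℚ ε

-- a n / b n → 1, stated without dividing by b n.
infix 4 _∼_
_∼_ : (ℕ → ℝ) → (ℕ → ℝ) → Set
a ∼ b = ∀ ε → 0ℚ < ε → ∃ λ N → ∀ n → N ℕ.≤ n → ∣ a n -ℝ b n ∣ℝ ≤ℝ fromℚ ε *ℝ ∣ b n ∣ℝ

toℚᵘ-/ : ∀ i d → toℚᵘ (i / suc d) ℚᵘ.≃ ℚᵘ.mkℚᵘ i d
toℚᵘ-/ i d = toℚᵘ-fromℚᵘ (ℚᵘ.mkℚᵘ i d)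

/-mono-≤ : ∀ a b d e → a ℕ.* suc e ℕ.≤ b ℕ.* suc d → + a / suc d ≤ + b / suc e
/-mono-≤ a b d e le = toℚᵘ-cancel-≤ (begin
  toℚᵘ (+ a / suc d)  ≃⟨ toℚᵘ-/ (+ a) d ⟩
  ℚᵘ.mkℚᵘ (+ a) d     ≤⟨ ℚᵘ.*≤* (subst₂ ℤ._≤_ (ℤ.pos-* a (suc e)) (ℤ.pos-* b (suc d)) (+≤+ le)) ⟩
  ℚᵘ.mkℚᵘ (+ b) e     ≃⟨ toℚᵘ-/ (+ b) e ⟨
  toℚᵘ (+ b / suc e)  ∎)
  where open ℚᵘ.≤-Reasoning

/-mono-< : ∀ a b d e → a ℕ.* suc e ℕ.< b ℕ.* suc d → + a / suc d < + b / suc e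
/-mono-< a b d e lt = toℚᵘ-cancel-< (begin-strict
  toℚᵘ (+ a / suc d)  ≃⟨ toℚᵘ-/ (+ a) d ⟩
  ℚᵘ.mkℚᵘ (+ a) d     <⟨ ℚᵘ.*<* (subst₂ ℤ._<_ (ℤ.pos-* a (suc e)) (ℤ.pos-* b (suc d)) (+<+ lt)) ⟩
  ℚᵘ.mkℚᵘ (+ b) e     ≃⟨ toℚᵘ-/ (+ b) e ⟨
  toℚᵘ (+ b / suc e)  ∎)
  where open ℚᵘ.≤-Reasoning

/-suc : ∀ b d → + suc b / suc d ≡ + b / suc d + + 1 / suc d
/-suc b d = toℚᵘ-injective (begin
  toℚᵘ (+ suc b / suc d)                       ≈⟨ toℚᵘ-/ (+ suc b) d ⟩
  ℚᵘ.mkℚᵘ (+ suc b) d                          ≈⟨ ℚᵘ.*≡* (ℤS.solve 2 (λ b d →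
      (ℤS.con (+ 1) ℤS.:+ b) ℤS.:* (d ℤS.:* d) ℤS.:=
      (b ℤS.:* d ℤS.:+ ℤS.con (+ 1) ℤS.:* d) ℤS.:* d) refl (+ b) (+ suc d)) ⟩
  ℚᵘ.mkℚᵘ (+ b) d ℚᵘ.+ ℚᵘ.mkℚᵘ (+ 1) d         ≈⟨ ℚᵘ.+-cong (toℚᵘ-/ (+ b) d) (toℚᵘ-/ (+ 1) d) ⟨
  toℚᵘ (+ b / suc d) ℚᵘ.+ toℚᵘ (+ 1 / suc d)   ≈⟨ toℚᵘ-homo-+ (+ b / suc d) (+ 1 / suc d) ⟨
  toℚᵘ (+ b / suc d + + 1 / suc d)             ∎)
  where open import Relation.Binary.Reasoning.Setoid ℚᵘ.≃-setoid

/-* : ∀ a b d e → + (a ℕ.* b) / (suc d ℕ.* suc e) ≡ (+ a / suc d) * (+ b / suc e)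
/-* a b d e = toℚᵘ-injective (begin
  toℚᵘ (+ (a ℕ.* b) / (suc d ℕ.* suc e))        ≈⟨ toℚᵘ-/ (+ (a ℕ.* b)) (e ℕ.+ d ℕ.* suc e) ⟩
  ℚᵘ.mkℚᵘ (+ (a ℕ.* b)) (e ℕ.+ d ℕ.* suc e)     ≈⟨ ℚᵘ.*≡* (cong (ℤ._* + (suc d ℕ.* suc e)) (ℤ.pos-* a b)) ⟩
  ℚᵘ.mkℚᵘ (+ a) d ℚᵘ.* ℚᵘ.mkℚᵘ (+ b) e          ≈⟨ ℚᵘ.*-cong (toℚᵘ-/ (+ a) d) (toℚᵘ-/ (+ b) e) ⟨
  toℚᵘ (+ a / suc d) ℚᵘ.* toℚᵘ (+ b / suc e)    ≈⟨ toℚᵘ-homo-* (+ a / suc d) (+ b / suc e) ⟨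
  toℚᵘ ((+ a / suc d) * (+ b / suc e))          ∎)
  where open import Relation.Binary.Reasoning.Setoid ℚᵘ.≃-setoid

0≤/ : ∀ a d → 0ℚ ≤ + a / suc d
0≤/ a d = nonNegative⁻¹ (+ a / suc d) {{normalize-nonNeg a (suc d)}}

archimedean : ∀ q → q ≤ fromℕ ℤ.∣ ↥ q ∣
archimedean (mkℚ (+ n) d _) = toℚᵘ-cancel-≤ (ℚᵘ.≤-respʳ-≃ (ℚᵘ.≃-sym (toℚᵘ-/ (+ n) 0))
  (ℚᵘ.*≤* (ℤ.*-monoˡ-≤-nonNeg (+ n) (+≤+ (s≤s z≤n)))))
archimedean q@(mkℚ -[1+ n ] d _) = ≤-trans (<⇒≤ (negative⁻¹ q)) (0≤/ (suc n) 0)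

1/n≤ε : ∀ ε → 0ℚ < ε → ∀ n → ↧ₙ ε ℕ.≤ n → + 1 / suc n ≤ ε
1/n≤ε (mkℚ +[1+ p ] d _) _ n le = toℚᵘ-cancel-≤ (ℚᵘ.≤-respˡ-≃ (ℚᵘ.≃-sym (toℚᵘ-/ (+ 1) n))
  (ℚᵘ.*≤* (+≤+ (ℕ.*-mono-≤ (s≤s (z≤n {p})) (ℕ.m≤n⇒m≤1+n le)))))
1/n≤ε (mkℚ (+ zero) d _) (*<* (+<+ ())) n le
1/n≤ε (mkℚ -[1+ p ] d _) (*<* ()) n le

^-mono-≤ : ∀ q {x y} → 0ℚ ≤ x → x ≤ y → x ^ q ≤ y ^ q
0≤^ : ∀ q {x} → 0ℚ ≤ x → 0ℚ ≤ x ^ q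
0≤^ zero    0≤x = <⇒≤ (positive⁻¹ 1ℚ)
0≤^ (suc q) 0≤x = 0≤p*q 0≤x (0≤^ q 0≤x)
^-mono-≤ zero    0≤x x≤y = ≤-refl
^-mono-≤ (suc q) 0≤x x≤y = *-mono-≤-nonNeg 0≤x (0≤^ q (≤-trans 0≤x x≤y)) x≤y (^-mono-≤ q 0≤x x≤y)

1≤^ : ∀ q {x} → 1ℚ ≤ x → 1ℚ ≤ x ^ q
1≤^ zero    1≤x = ≤-refl
1≤^ (suc q) 1≤x = *-mono-≤-nonNeg (<⇒≤ (positive⁻¹ 1ℚ)) (≤-trans (<⇒≤ (positive⁻¹ 1ℚ)) (1≤^ q 1≤x)) 1≤x (1≤^ q 1≤x)

x≤x^q : ∀ q .{{_ : ℕ.NonZero q}} {x} → 1ℚ ≤ x → x ≤ x ^ q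
x≤x^q (suc q) {x} 1≤x = subst (_≤ x * x ^ q) (*-identityʳ x)
  (*-monoˡ-≤-nonNeg x {{nonNegative (≤-trans (<⇒≤ (positive⁻¹ 1ℚ)) 1≤x)}} (1≤^ q 1≤x))

-- The largest a ≤ b satisfying P, or 0 if there is none.
largest : {P : Pred ℕ 0ℓ} → Decidable P → ℕ → ℕ
largest P? zero    = zero
largest P? (suc b) with P? (suc b)
... | yes _ = suc b
... | no  _ = largest P? b

largest-sat : ∀ {P : Pred ℕ 0ℓ} (P? : Decidable P) b → largest P? b ≡ 0 ⊎ P (largest P? b)
largest-sat P? zero    = inj₁ refl
largest-sat P? (suc b) with P? (suc b)
... | yes p = inj₂ p
... | no  _ = largest-sat P? b

largest-max : ∀ {P : Pred ℕ 0ℓ} (P? : Decidable P) b {a} → largest P? b ℕ.< a → a ℕ.≤ b → ¬ P a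
largest-max P? zero    (s≤s _) ()
largest-max P? (suc b) lt le Pa with P? (suc b)
... | yes _ = ℕ.<⇒≱ lt le
... | no ¬p with ℕ.m≤n⇒m<n∨m≡n le
...   | inj₁ (s≤s le′) = largest-max P? b lt le′ Pa
...   | inj₂ refl      = ¬p Pa

-- For t ≥ 0, the q-th root of t; its n-th approximation is the largest
-- multiple of 1/(n+1) whose q-th power is at most t.
module Root (q : ℕ) .{{_ : ℕ.NonZero q}} (t : ℚ) where

  Below : ℕ → Pred ℕ 0ℓ
  Below n a = (+ a / suc n) ^ q ≤ t

  below? : ∀ n → Decidable (Below n)
  below? n a = (+ a / suc n) ^ q ≤? t

  bound : ℕ → ℕ
  bound n = suc ℤ.∣ ↥ t ∣ ℕ.* suc n

  numerator : ℕ → ℕ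
  numerator n = largest {P = Below n} (below? n) (bound n)

  approx : ℕ → ℚ
  approx n = + numerator n / suc n

  too-big : ∀ c → t ≤ fromℕ c → ∀ n {a} → suc c ℕ.* suc n ℕ.≤ a → ¬ Below n a
  too-big c t≤c n {a} le below = <-irrefl refl (<-≤-trans c<1+c (begin
    fromℕ (suc c)        ≤⟨ x≤x^q q (/-mono-≤ 1 (suc c) 0 0 (s≤s z≤n)) ⟩
    fromℕ (suc c) ^ q    ≤⟨ ^-mono-≤ q (0≤/ (suc c) 0) (/-mono-≤ (suc c) a 0 n
                              (ℕ.≤-trans le (ℕ.≤-reflexive (sym (ℕ.*-identityʳ a))))) ⟩
    (+ a / suc n) ^ q    ≤⟨ below ⟩
    t                    ≤⟨ t≤c ⟩
    fromℕ c              ∎))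
    where
    open ≤-Reasoning
    c<1+c : fromℕ c < fromℕ (suc c)
    c<1+c = /-mono-< c (suc c) 0 0 (ℕ.*-monoˡ-< 1 (ℕ.n<1+n c))

  bound-not-below : ∀ n {a} → bound n ℕ.≤ a → ¬ Below n a
  bound-not-below = too-big ℤ.∣ ↥ t ∣ (archimedean t)

  next-not-below : ∀ n → ¬ Below n (suc (numerator n))
  next-not-below n = case (ℕ.<-≤-connex (numerator n) (bound n))
    where
    case : numerator n ℕ.< bound n ⊎ bound n ℕ.≤ numerator n → ¬ Below n (suc (numerator n))
    case (inj₁ lt) = largest-max {P = Below n} (below? n) (bound n) (ℕ.n<1+n (numerator n)) lt
    case (inj₂ ge) = bound-not-below n (ℕ.m≤n⇒m≤1+n ge)

  approx-close : ∀ m n → approx m ≤ approx n + + 1 / suc n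
  approx-close m n = case (≤-total (approx m) (approx n + + 1 / suc n))
                          (largest-sat {P = Below m} (below? m) (bound m))
    where
    open ≤-Reasoning
    case : approx m ≤ approx n + + 1 / suc n ⊎ approx n + + 1 / suc n ≤ approx m →
           numerator m ≡ 0 ⊎ Below m (numerator m) → approx m ≤ approx n + + 1 / suc n
    case (inj₁ le) _         = le
    case (inj₂ ge) (inj₁ eq) = begin
      approx m                       ≡⟨ cong (λ a → + a / suc m) eq ⟩
      + 0 / suc m                    ≡⟨ 0/n≡0 (suc m) ⟩
      0ℚ                             ≤⟨ 0≤/ (suc (numerator n)) n ⟩
      + suc (numerator n) / suc n    ≡⟨ /-suc (numerator n) n ⟩
      approx n + + 1 / suc n         ∎
    case (inj₂ ge) (inj₂ below) = ⊥-elim (next-not-below n (≤-trans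
      (^-mono-≤ q (0≤/ (suc (numerator n)) n) (≤-trans (≤-reflexive (/-suc (numerator n) n)) ge))
      below))

  approx-cauchy : IsCauchy approx
  approx-cauchy ε 0<ε = ↧ₙ ε , λ m n le le′ →
    ∣p∣≤q (≤-trans (p≤q+r⇒p-q≤r (approx-close m n)) (1/n≤ε ε 0<ε n le′))
          (subst (_≤ ε) (solve 2 (λ a b → b :- a := :- (a :- b)) refl (approx m) (approx n))
            (≤-trans (p≤q+r⇒p-q≤r (approx-close n m)) (1/n≤ε ε 0<ε m le)))
    where
    p≤q+r⇒p-q≤r : ∀ {p q r} → p ≤ q + r → p - q ≤ r
    p≤q+r⇒p-q≤r {p} {q} {r} h = subst (p - q ≤_)
      (solve 2 (λ q r → (q :+ r) :- q := r) refl q r) (+-monoˡ-≤ (- q) h)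

nthRoot : (q : ℕ) .{{_ : ℕ.NonZero q}} → ℚ → ℝ
nthRoot q t = mkℝ (Root.approx q t) (Root.approx-cauchy q t)

intPower : ℚ → ℤ → ℚ
intPower t (+ n)    = t ^ n
intPower t -[1+ n ] = 1ℚ ÷₀ t ^ suc n

-- t to the power r, for t ≥ 0 (t > 0 if r < 0)
infixr 8 _^ℚ_
_^ℚ_ : ℚ → ℚ → ℝ
t ^ℚ r@record{} = nthRoot (↧ₙ r) (intPower t (↥ r))

expTerm : ℚ → ℕ → ℚ
expTerm x i = x ^ i * (+ 1 / (i !)) {{i !≢0}}

module Exp (x : ℚ) where

  partialSum : ℕ → ℚ
  partialSum n = ∑ n (expTerm x)

  u : ℕ → ℚ
  u i = ∣ expTerm x i ∣

  c : ℕ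
  c = ℤ.∣ ↥ ∣ x ∣ ∣

  1/suc! : ∀ i → (+ 1 / (suc i !)) {{suc i !≢0}} ≡ (+ 1 / suc i) * (+ 1 / (i !)) {{i !≢0}}
  1/suc! i = go (i !) {{i !≢0}} {{suc i !≢0}}
    where
    go : ∀ f .{{_ : ℕ.NonZero f}} .{{_ : ℕ.NonZero (suc i ℕ.* f)}} → + 1 / (suc i ℕ.* f) ≡ (+ 1 / suc i) * (+ 1 / f)
    go (suc f) = /-* 1 1 i f

  expTerm-suc : ∀ i → expTerm x (suc i) ≡ (x * (+ 1 / suc i)) * expTerm x i
  expTerm-suc i = trans (cong (x ^ suc i *_) (1/suc! i))
    (solve 4 (λ x p a b → (x :* p) :* (a :* b) := (x :* a) :* (p :* b)) refl
      x (x ^ i) (+ 1 / suc i) ((+ 1 / (i !)) {{i !≢0}}))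

  u-halves : ∀ i → c ℕ.* 2 ℕ.≤ i → u (suc i) ≤ ½ * u i
  u-halves i le = begin
    u (suc i)                                     ≡⟨ cong ∣_∣ (expTerm-suc i) ⟩
    ∣ (x * (+ 1 / suc i)) * expTerm x i ∣         ≡⟨ ∣p*q∣≡∣p∣*∣q∣ (x * (+ 1 / suc i)) (expTerm x i) ⟩
    ∣ x * (+ 1 / suc i) ∣ * u i                   ≤⟨ *-monoʳ-≤-nonNeg (u i) {{∣-∣-nonNeg (expTerm x i)}} (begin
      ∣ x * (+ 1 / suc i) ∣                         ≡⟨ ∣p*q∣≡∣p∣*∣q∣ x (+ 1 / suc i) ⟩
      ∣ x ∣ * ∣ + 1 / suc i ∣                       ≡⟨ cong (∣ x ∣ *_) (0≤p⇒∣p∣≡p (0≤/ 1 i)) ⟩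
      ∣ x ∣ * (+ 1 / suc i)                         ≤⟨ *-monoʳ-≤-nonNeg (+ 1 / suc i) {{nonNegative (0≤/ 1 i)}} (archimedean ∣ x ∣) ⟩
      fromℕ c * (+ 1 / suc i)                       ≡⟨ /-* c 1 0 i ⟨
      + (c ℕ.* 1) / (1 ℕ.* suc i)                   ≤⟨ /-mono-≤ (c ℕ.* 1) 1 (i ℕ.+ 0) 1 c*1*2≤ ⟩
      ½                                             ∎) ⟩
    ½ * u i                                       ∎
    where
    open ≤-Reasoning
    c*1*2≤ : c ℕ.* 1 ℕ.* 2 ℕ.≤ 1 ℕ.* suc (i ℕ.+ 0)
    c*1*2≤ = subst₂ ℕ._≤_ (cong (ℕ._* 2) (sym (ℕ.*-identityʳ c)))
      (sym (trans (ℕ.*-identityˡ (suc (i ℕ.+ 0))) (cong suc (ℕ.+-identityʳ i)))) (ℕ.m≤n⇒m≤1+n le)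

  2ℚ : ℚ
  2ℚ = fromℕ 2

  twice-u : ∀ i → c ℕ.* 2 ℕ.≤ i → 2ℚ * u (suc i) ≤ u i
  twice-u i le = subst (2ℚ * u (suc i) ≤_)
    (trans (sym (*-assoc 2ℚ ½ (u i))) (*-identityˡ (u i)))
    (*-monoˡ-≤-nonNeg 2ℚ (u-halves i le))

  tail : ∀ n → c ℕ.* 2 ℕ.≤ n → ∀ j → ∣ partialSum (j ℕ.+ n) - partialSum n ∣ + 2ℚ * u (j ℕ.+ n) ≤ 2ℚ * u n
  tail n le zero = ≤-reflexive (trans (cong (λ s → ∣ s ∣ + 2ℚ * u n) (+-inverseʳ (partialSum n))) (+-identityˡ (2ℚ * u n)))
  tail n le (suc j) = begin
    ∣ (P + e) - P₀ ∣ + 2ℚ * u (suc j ℕ.+ n)    ≡⟨ cong (λ s → ∣ s ∣ + 2ℚ * u (suc j ℕ.+ n))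
                                                   (solve 3 (λ a b c → (a :+ b) :- c := (a :- c) :+ b) refl P e P₀) ⟩
    ∣ (P - P₀) + e ∣ + 2ℚ * u (suc j ℕ.+ n)    ≤⟨ +-mono-≤ (∣p+q∣≤∣p∣+∣q∣ (P - P₀) e)
                                                   (twice-u (j ℕ.+ n) (ℕ.≤-trans le (ℕ.m≤n+m n j))) ⟩
    (∣ P - P₀ ∣ + ∣ e ∣) + ∣ e ∣               ≡⟨ solve 2 (λ a b → (a :+ b) :+ b := a :+ con 2ℚ :* b) refl ∣ P - P₀ ∣ ∣ e ∣ ⟩
    ∣ P - P₀ ∣ + 2ℚ * u (j ℕ.+ n)              ≤⟨ tail n le j ⟩
    2ℚ * u n                                   ∎
    where
    open ≤-Reasoning
    P = partialSum (j ℕ.+ n)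
    P₀ = partialSum n
    e = expTerm x (j ℕ.+ n)

  tail′ : ∀ n → c ℕ.* 2 ℕ.≤ n → ∀ m → n ℕ.≤ m → ∣ partialSum m - partialSum n ∣ ≤ 2ℚ * u n
  tail′ n le m n≤m = begin
    ∣ partialSum m - partialSum n ∣   ≡⟨ cong (λ m → ∣ partialSum m - partialSum n ∣) (ℕ.m∸n+n≡m n≤m) ⟨
    D                                 ≡⟨ +-identityʳ D ⟨
    D + 0ℚ                            ≤⟨ +-monoʳ-≤ D (0≤p*q (0≤/ 2 0) (0≤∣p∣ (expTerm x (m ℕ.∸ n ℕ.+ n)))) ⟩
    D + 2ℚ * u (m ℕ.∸ n ℕ.+ n)        ≤⟨ tail n le (m ℕ.∸ n) ⟩
    2ℚ * u n                          ∎
    where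
    open ≤-Reasoning
    D = ∣ partialSum (m ℕ.∸ n ℕ.+ n) - partialSum n ∣

  n₀ : ℕ
  n₀ = c ℕ.* 2

  u-small : ∀ j → fromℕ (suc j) * u (j ℕ.+ n₀) ≤ u n₀
  u-small zero = ≤-reflexive (*-identityˡ (u n₀))
  u-small (suc j) = begin
    fromℕ (suc (suc j)) * u (suc j ℕ.+ n₀)     ≤⟨ *-monoʳ-≤-nonNeg (u (suc j ℕ.+ n₀)) {{∣-∣-nonNeg (expTerm x (suc j ℕ.+ n₀))}} ssj≤ ⟩
    (fromℕ (suc j) * 2ℚ) * u (suc j ℕ.+ n₀)    ≡⟨ *-assoc (fromℕ (suc j)) 2ℚ (u (suc j ℕ.+ n₀)) ⟩
    fromℕ (suc j) * (2ℚ * u (suc j ℕ.+ n₀))    ≤⟨ *-monoˡ-≤-nonNeg (fromℕ (suc j)) {{nonNegative (0≤/ (suc j) 0)}}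
                                                    (twice-u (j ℕ.+ n₀) (ℕ.m≤n+m n₀ j)) ⟩
    fromℕ (suc j) * u (j ℕ.+ n₀)               ≤⟨ u-small j ⟩
    u n₀                                       ∎
    where
    open ≤-Reasoning
    ssj≤ : fromℕ (suc (suc j)) ≤ fromℕ (suc j) * 2ℚ
    ssj≤ = subst (fromℕ (suc (suc j)) ≤_) (/-* (suc j) 2 0 0)
      (/-mono-≤ (suc (suc j)) (suc j ℕ.* 2) 0 0 (ℕ.*-monoˡ-≤ 1 (s≤s (s≤s (ℕ.m≤m*n j 2)))))

  partialSum-cauchy : IsCauchy partialSum
  partialSum-cauchy ε 0<ε = N , λ m n le le′ → begin
    ∣ partialSum m - partialSum n ∣                                      ≤⟨ ∣p-r∣≤∣p-q∣+∣q-r∣ (partialSum m) (partialSum N) (partialSum n) ⟩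
    ∣ partialSum m - partialSum N ∣ + ∣ partialSum N - partialSum n ∣    ≤⟨ +-mono-≤ (tail′ N (ℕ.m≤n+m n₀ J) m le)
                                                                             (subst (_≤ 2ℚ * u N) (∣p-q∣≡∣q-p∣ (partialSum n) (partialSum N))
                                                                               (tail′ N (ℕ.m≤n+m n₀ J) n le′)) ⟩
    2ℚ * u N + 2ℚ * u N                                                  ≡⟨ solve 1 (λ a → con 2ℚ :* a :+ con 2ℚ :* a := con (fromℕ 4) :* a) refl (u N) ⟩
    fromℕ 4 * u N                                                        ≤⟨ *-cancelˡ-≤-pos (fromℕ (suc J)) {{normalize-pos (suc J) 1}} scaled ⟩
    ε                                                                    ∎
    where
    open ≤-Reasoning
    instance
      ε-pos : Positive ε
      ε-pos = positive 0<ε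
      ε-nonZero : NonZero ε
      ε-nonZero = pos⇒nonZero ε
    r = (fromℕ 4 * u n₀) * 1/ ε
    J = ℤ.∣ ↥ r ∣
    N = J ℕ.+ n₀
    scaled : fromℕ (suc J) * (fromℕ 4 * u N) ≤ fromℕ (suc J) * ε
    scaled = begin
      fromℕ (suc J) * (fromℕ 4 * u N)    ≡⟨ solve 3 (λ a b c → a :* (b :* c) := b :* (a :* c)) refl (fromℕ (suc J)) (fromℕ 4) (u N) ⟩
      fromℕ 4 * (fromℕ (suc J) * u N)    ≤⟨ *-monoˡ-≤-nonNeg (fromℕ 4) (u-small J) ⟩
      fromℕ 4 * u n₀                     ≡⟨ *-identityʳ (fromℕ 4 * u n₀) ⟨
      fromℕ 4 * u n₀ * 1ℚ                ≡⟨ cong (fromℕ 4 * u n₀ *_) (*-inverseˡ ε) ⟨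
      fromℕ 4 * u n₀ * (1/ ε * ε)        ≡⟨ *-assoc (fromℕ 4 * u n₀) (1/ ε) ε ⟨
      r * ε                              ≤⟨ *-monoʳ-≤-nonNeg ε {{pos⇒nonNeg ε}} (archimedean r) ⟩
      fromℕ J * ε                        ≤⟨ *-monoʳ-≤-nonNeg ε {{pos⇒nonNeg ε}} (/-mono-≤ J (suc J) 0 0 (ℕ.*-monoˡ-≤ 1 (ℕ.n≤1+n J))) ⟩
      fromℕ (suc J) * ε                  ∎

exp : ℚ → ℝ
exp x = mkℝ (Exp.partialSum x) (Exp.partialSum-cauchy x)

riemannSum : (ℚ → ℝ) → ℚ → ℚ → (n : ℕ) .{{_ : ℕ.NonZero n}} → ℝ
riemannSum f a b n = fromℚ h *ℝ ∑ℝ n (λ i → f (a + fromℕ i * h))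
  where h = (b - a) * (+ 1 / n)

-- I is the integral from a to b of the continuous function whose values at
-- rational points are given by f.  For continuous f the equally spaced Riemann
-- sums determine the integral.
IsIntegral : (ℚ → ℝ) → ℚ → ℚ → ℝ → Set
IsIntegral f a b I = (λ n → riemannSum f a b (suc n)) ⟶ I

-- I is the integral of the nonnegative function f from 0 to ∞; by monotonicity
-- only integral upper limits need to be considered.
IsImproperIntegral : (ℚ → ℝ) → ℝ → Set
IsImproperIntegral f I =
  Σ (ℕ → ℝ) λ J → (∀ B → IsIntegral f 0ℚ (fromℕ B) (J B)) × (J ⟶ I)

-- g = Γ(z), by Euler's integral.  Meant for z ≥ 1, where the integrand is
-- continuous at 0.
IsGamma : ℚ → ℝ → Set
IsGamma z g = IsImproperIntegral (λ t → t ^ℚ (z - 1ℚ) *ℝ exp (- t)) g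

-- A child is attached below a node of out-degree d in k (d + 1) of the 1 + (k + 1) n
-- possible ways, so the numbers of pairs (tree, node) with out-degree m satisfy a
-- linear recurrence in n, which the explicit formula satisfies as well.  In the
-- formula, the first difference contributes p m (1 + O(1/n)), and the other terms
-- vanish since n binom (n − k/(k+1)) n is unbounded, by Bernoulli's inequality.
--
-- With z = 2 + 1/k, p m = ((k+1)/k) m! / (z (z+1) ⋯ (z+m)), and the denominator times
-- Γ(z) is the integral of t^(m+2+1/k) e^(−t), by parts.  Bounding t^(1/k) above by
-- its tangent at m, and below by the tangent minus a quadratic error, and integrating
-- against t^(m+2) e^(−t) gives this integral up to a factor 1 + O(1/m).

module Submission where

open import Defs
open import Data.Bool using (true; false; if_then_else_)
open import Data.Empty using (⊥-elim)
open import Data.Fin using (Fin)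
import Data.Fin as Fin
import Data.Fin.Properties as Fin
open import Data.Integer using (+_; -[1+_])
import Data.Integer as ℤ
open import Data.List using (List; []; _∷_; _++_; map; concatMap; allFin; filter; length; cartesianProduct)
open import Data.List.Membership.Propositional using (_∈_)
open import Data.List.Membership.Propositional.Properties using (∈-allFin)
open import Data.List.Properties using (applyUpTo-∷ʳ; length-applyUpTo; length-tabulate)
import Data.List.Relation.Unary.All as All
open import Data.List.Relation.Unary.Any using (here; there)
open import Data.List.Relation.Unary.Unique.Propositional using (Unique; []; _∷_)
import Data.List.Relation.Unary.Unique.Propositional.Properties as Unique
open import Data.Nat using (ℕ; zero; suc; NonZero; _!; s≤s; z≤n)
import Data.Nat as ℕ
open import Data.Nat.Coprimality using (Coprime; coprime-+; 1-coprimeTo)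
import Data.Nat.Properties as ℕ
import Data.Nat.Solver
open import Data.Product using (Σ; ∃; _×_; _,_; proj₁; proj₂)
open import Data.Rational hiding (_≟_; NonZero)
import Data.Rational as ℚ
open import Data.Rational.Properties hiding (_≟_)
import Data.Rational.Properties as ℚ
open import Data.Rational.Solver using (module +-*-Solver)
import Data.Rational.Unnormalised as ℚᵘ
import Data.Rational.Unnormalised.Properties as ℚᵘ
open import Data.Sum using (_⊎_; inj₁; inj₂)
open import Data.Vec using (Vec; []; _∷_; lookup; _[_]≔_)
import Data.Vec as Vec
import Data.Vec.Membership.DecPropositional as VecMembership
import Data.Vec.Membership.Propositional as Vec
import Data.Vec.Membership.Propositional.Properties as Vec
open import Data.Vec.N-ary using (N-ary; Eq; curryⁿ; curryⁿ-cong; _$ⁿ_)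
import Data.Vec.Properties as Vec
import Data.Vec.Relation.Unary.Any as VecAny
import Data.Vec.Relation.Unary.Any.Properties as VecAny
open import Function using (_∘_)
open import Level using (0ℓ)
open import Relation.Binary.Bundles using (Poset)
open import Relation.Binary.Definitions using (DecidableEquality)
open import Relation.Binary.PropositionalEquality using (_≡_; _≢_; refl; sym; trans; cong; cong₂; subst; subst₂; module ≡-Reasoning)
import Relation.Binary.Reasoning.PartialOrder
open import Relation.Nullary using (Dec; yes; no; does; ¬_)
open import Relation.Nullary.Decidable using (dec-true; dec-false)
open import Relation.Unary using (Pred; Decidable)

open +-*-Solver using (solve; _:=_; _:+_; _:*_; _:-_; :-_; con; Polynomial; op; var; _:^_; [+]; [*]; ⟦_⟧; ⟦_⟧N; normalise; prove)

-- The real numbers are Cauchy sequences of rationals, so the value Γ(2 + 1/k) has to be constructed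
-- before anything can be said about it. Riemann sums of Lipschitz functions converge, and t^(1+1/k)
-- is Lipschitz on bounded intervals because, up to a constant, it is the derivative of t^(2+1/k)
-- with a quadratic error. Bounded monotone sequences need not converge constructively, so the
-- passage to ∞ compares increments with those for t + t².
--
-- No calculus of real exponents is developed. What is needed about t^(1/k) is a polynomial
-- inequality between nonnegative rationals a, b and their k-th powers, which holds for all
-- approximations of the roots at once. Two descriptions of a power are identified by comparing
-- their k-th powers.
--
-- The tangent at m is accurate enough because the density t^(m+2) e^(-t) / (m + 2)! has mean m + 3
-- and second moment m + 12 about m, so that a quadratic error is of order 1/m relative to m².

module ℕS = Data.Nat.Solver.+-*-Solver

-- Counting in trees

private
  variable
    𝔸 𝔹 : Set

indicator : {P : Set} → Dec P → ℕ
indicator p? = if does p? then 1 else 0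

indicator-true : {P : Set} (p? : Dec P) → P → indicator p? ≡ 1
indicator-true p? p = cong (if_then 1 else 0) (dec-true p? p)

indicator-false : {P : Set} (p? : Dec P) → ¬ P → indicator p? ≡ 0
indicator-false p? ¬p = cong (if_then 1 else 0) (dec-false p? ¬p)

indicator-*-cong : {P : Set} (p? : Dec P) {a b : ℕ} → (P → a ≡ b) → indicator p? ℕ.* a ≡ indicator p? ℕ.* b
indicator-*-cong (yes p) a≡b = cong (1 ℕ.*_) (a≡b p)
indicator-*-cong (no _)  _   = refl

total : (𝔸 → ℕ) → List 𝔸 → ℕ
total f []       = 0
total f (x ∷ xs) = f x ℕ.+ total f xs

total-cong : {f g : 𝔸 → ℕ} → (∀ x → f x ≡ g x) → ∀ xs → total f xs ≡ total g xs
total-cong f≗g []       = refl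
total-cong f≗g (x ∷ xs) = cong₂ ℕ._+_ (f≗g x) (total-cong f≗g xs)

total-+ : (f g : 𝔸 → ℕ) → ∀ xs → total (λ x → f x ℕ.+ g x) xs ≡ total f xs ℕ.+ total g xs
total-+ f g []       = refl
total-+ f g (x ∷ xs) = trans (cong (f x ℕ.+ g x ℕ.+_) (total-+ f g xs))
  (ℕS.solve 4 (λ a b c d → (a ℕS.:+ b) ℕS.:+ (c ℕS.:+ d) ℕS.:= (a ℕS.:+ c) ℕS.:+ (b ℕS.:+ d)) refl
    (f x) (g x) (total f xs) (total g xs))

total-*ʳ : (f : 𝔸 → ℕ) (c : ℕ) → ∀ xs → total (λ x → f x ℕ.* c) xs ≡ total f xs ℕ.* c
total-*ʳ f c []       = refl
total-*ʳ f c (x ∷ xs) = trans (cong (f x ℕ.* c ℕ.+_) (total-*ʳ f c xs)) (sym (ℕ.*-distribʳ-+ c (f x) (total f xs)))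

total-const : (c : ℕ) (xs : List 𝔸) → total (λ _ → c) xs ≡ length xs ℕ.* c
total-const c []       = refl
total-const c (x ∷ xs) = cong (c ℕ.+_) (total-const c xs)

total-++ : (f : 𝔸 → ℕ) → ∀ xs ys → total f (xs ++ ys) ≡ total f xs ℕ.+ total f ys
total-++ f []       ys = refl
total-++ f (x ∷ xs) ys = trans (cong (f x ℕ.+_) (total-++ f xs ys)) (sym (ℕ.+-assoc (f x) (total f xs) (total f ys)))

total-map : (f : 𝔹 → ℕ) (g : 𝔸 → 𝔹) → ∀ xs → total f (map g xs) ≡ total (f ∘ g) xs
total-map f g []       = refl
total-map f g (x ∷ xs) = cong (f (g x) ℕ.+_) (total-map f g xs)

total-concatMap : (f : 𝔹 → ℕ) (g : 𝔸 → List 𝔹) → ∀ xs → total f (concatMap g xs) ≡ total (total f ∘ g) xs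
total-concatMap f g []       = refl
total-concatMap f g (x ∷ xs) = trans (total-++ f (g x) (concatMap g xs)) (cong (total f (g x) ℕ.+_) (total-concatMap f g xs))

total-swap : (f : 𝔸 → 𝔹 → ℕ) → ∀ xs ys → total (λ x → total (f x) ys) xs ≡ total (λ y → total (λ x → f x y) xs) ys
total-swap f []       ys = sym (trans (total-const 0 ys) (ℕ.*-zeroʳ (length ys)))
total-swap f (x ∷ xs) ys = trans (cong (total (f x) ys ℕ.+_) (total-swap f xs ys))
  (sym (total-+ (f x) (λ y → total (λ x → f x y) xs) ys))

total-cartesianProduct : (f : 𝔸 × 𝔹 → ℕ) → ∀ xs ys →
  total f (cartesianProduct xs ys) ≡ total (λ x → total (λ y → f (x , y)) ys) xs
total-cartesianProduct f []       ys = refl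
total-cartesianProduct f (x ∷ xs) ys = trans (total-++ f (map (x ,_) ys) (cartesianProduct xs ys))
  (cong₂ ℕ._+_ (total-map f (x ,_) ys) (total-cartesianProduct f xs ys))

length≡total : (xs : List 𝔸) → length xs ≡ total (λ _ → 1) xs
length≡total xs = sym (trans (total-const 1 xs) (ℕ.*-identityʳ (length xs)))

length-filter≡total : {P : Pred 𝔸 0ℓ} (P? : Decidable P) → ∀ xs → length (filter P? xs) ≡ total (indicator ∘ P?) xs
length-filter≡total P? []       = refl
length-filter≡total P? (x ∷ xs) with does (P? x)
... | true  = cong suc (length-filter≡total P? xs)
... | false = length-filter≡total P? xs

module _ (_≟_ : DecidableEquality 𝔸) where

  total-indicator-≢ : ∀ {x xs} → All.All (x ≢_) xs → total (λ y → indicator (y ≟ x)) xs ≡ 0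
  total-indicator-≢ All.[]             = refl
  total-indicator-≢ {x} {y ∷ _} (x≢y All.∷ x≢) =
    cong₂ ℕ._+_ (indicator-false (y ≟ x) (x≢y ∘ sym)) (total-indicator-≢ x≢)

  total-indicator-≡ : ∀ {x xs} → Unique xs → x ∈ xs → total (λ y → indicator (y ≟ x)) xs ≡ 1
  total-indicator-≡ {x} (x≢ ∷ _) (here refl) =
    cong₂ ℕ._+_ (indicator-true (x ≟ x) refl) (total-indicator-≢ x≢)
  total-indicator-≡ {x} {y ∷ _} (y≢ ∷ u) (there x∈xs) =
    cong₂ ℕ._+_ (indicator-false (y ≟ x) (All.lookup y≢ x∈xs)) (total-indicator-≡ u x∈xs)

length-allFin : ∀ n → length (allFin n) ≡ n
length-allFin n = length-tabulate (λ i → i)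

module _ {k : ℕ} where

  infix 4 _∈ᵛ_ _∈?_
  _∈ᵛ_ : ∀ {n} → Node k → Vec (Node k) n → Set
  u ∈ᵛ vs = u Vec.∈ vs

  _∈?_ : ∀ {n} (u : Node k) (vs : Vec (Node k) n) → Dec (u ∈ᵛ vs)
  u ∈? vs = VecMembership._∈?_ (_≟ⁿ_ {k}) u vs

  ∈⇒lookup : ∀ {n u} {vs : Vec (Node k) n} → u ∈ᵛ vs → ∃ λ i → lookup vs i ≡ u
  ∈⇒lookup u∈vs = VecAny.index u∈vs , sym (VecAny.lookup-index u∈vs)

  lookup⇒∈ : ∀ {n u} {vs : Vec (Node k) n} i → lookup vs i ≡ u → u ∈ᵛ vs
  lookup⇒∈ {vs = vs} i eq = subst (_∈ᵛ vs) eq (Vec.∈-lookup i vs)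

  lookup-update : ∀ {n} (vs : Vec (Node k) n) w x i →
                  (i ≡ w × lookup (vs [ w ]≔ x) i ≡ x) ⊎ (i ≢ w × lookup (vs [ w ]≔ x) i ≡ lookup vs i)
  lookup-update vs w x i with i Fin.≟ w
  ... | yes refl = inj₁ (refl , Vec.lookup∘update i vs x)
  ... | no i≢w   = inj₂ (i≢w , Vec.lookup∘update′ i≢w vs x)

  Distinct : ∀ {n} → Vec (Node k) n → Set
  Distinct vs = ∀ i j → lookup vs i ≡ lookup vs j → i ≡ j

  node≤size : ∀ {n j} (T : Tree k n) (K : Clique k n) → node j ∈ᵛ vertices T K → j ℕ.≤ n
  node≤size root rootClique j∈ with ∈⇒lookup j∈
  ... | i , eq with trans (sym (Vec.lookup∘tabulate rootNode i)) eq
  ...   | ()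
  node≤size (insert T K p) (old L) j∈ = ℕ.m≤n⇒m≤1+n (node≤size T L j∈)
  node≤size {suc n} (insert T K p) (new w) j∈ with ∈⇒lookup j∈
  ... | i , eq with lookup-update (vertices T K) w (node (suc n)) i
  ...   | inj₁ (_ , eq′) = ℕ.≤-reflexive (sym (node-injective (trans (sym eq′) eq)))
  ...   | inj₂ (_ , eq′) = ℕ.m≤n⇒m≤1+n (node≤size T K (lookup⇒∈ i (trans (sym eq′) eq)))

  fresh : ∀ {n j} (T : Tree k n) (K : Clique k n) → n ℕ.≤ j → ¬ node (suc j) ∈ᵛ vertices T K
  fresh T K n≤j j∈ = ℕ.<⇒≱ (s≤s n≤j) (node≤size T K j∈)

  -- Cliques are stored as vectors, so repetitions have to be excluded: with two copies of a vertex,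
  -- overwriting one would not remove it, and the count in `total-∈-update` would fail.
  vertices-distinct : ∀ {n} (T : Tree k n) (K : Clique k n) → Distinct (vertices T K)
  vertices-distinct root rootClique i j eq = rootNode-injective
    (trans (sym (Vec.lookup∘tabulate rootNode i)) (trans eq (Vec.lookup∘tabulate rootNode j)))
  vertices-distinct (insert T K p) (old L) = vertices-distinct T L
  vertices-distinct {suc n} (insert T K p) (new w) i j eq
    with lookup-update (vertices T K) w (node (suc n)) i | lookup-update (vertices T K) w (node (suc n)) j
  ... | inj₁ (refl , _)  | inj₁ (refl , _)  = refl
  ... | inj₁ (_ , eqᵢ)   | inj₂ (_ , eqⱼ)   =
    ⊥-elim (fresh T K ℕ.≤-refl (lookup⇒∈ j (trans (sym eqⱼ) (trans (sym eq) eqᵢ))))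
  ... | inj₂ (_ , eqᵢ)   | inj₁ (_ , eqⱼ)   =
    ⊥-elim (fresh T K ℕ.≤-refl (lookup⇒∈ i (trans (sym eqᵢ) (trans eq eqⱼ))))
  ... | inj₂ (_ , eqᵢ)   | inj₂ (_ , eqⱼ)   =
    vertices-distinct T K i j (trans (sym eqᵢ) (trans eq eqⱼ))

  outDegree-insert : ∀ {n} (T : Tree k n) K p u →
                     outDegree (insert T K p) u ≡ indicator (u ∈? vertices T K) ℕ.+ outDegree T u
  outDegree-insert T K p u with does (u ∈? vertices T K)
  ... | true  = refl
  ... | false = refl

  outDegree-fresh : ∀ {n j} (T : Tree k n) → n ℕ.≤ j → outDegree T (node (suc j)) ≡ 0
  outDegree-fresh root n≤j = refl
  outDegree-fresh {suc n} {j} (insert T K p) n<j = trans (outDegree-insert T K p (node (suc j)))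
    (cong₂ ℕ._+_ (indicator-false (node (suc j) ∈? vertices T K) (fresh T K (ℕ.<⇒≤ n<j)))
                 (outDegree-fresh T (ℕ.<⇒≤ n<j)))

  -- Replacing one vertex of K destroys the membership of u only if it replaces u itself.
  total-∈-update : ∀ {n u x} (vs : Vec (Node k) n) → Distinct vs → u ≢ x →
    total (λ w → indicator (u ∈? vs [ w ]≔ x)) (allFin n) ℕ.+ indicator (u ∈? vs) ≡ n ℕ.* indicator (u ∈? vs)
  total-∈-update {n} {u} {x} vs distinct u≢x with u ∈? vs
  ... | no u∉vs = trans (ℕ.+-identityʳ _) (trans
          (total-cong (λ w → indicator-false (u ∈? vs [ w ]≔ x) (∉ w)) (allFin n))
          (trans (total-const 0 (allFin n)) (trans (ℕ.*-zeroʳ (length (allFin n))) (sym (ℕ.*-zeroʳ n)))))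
    where
    ∉ : ∀ w → ¬ u ∈ᵛ vs [ w ]≔ x
    ∉ w u∈ with ∈⇒lookup u∈
    ... | i , eq with lookup-update vs w x i
    ...   | inj₁ (_ , eq′) = u≢x (trans (sym eq) eq′)
    ...   | inj₂ (_ , eq′) = u∉vs (lookup⇒∈ i (trans (sym eq′) eq))
  ... | yes u∈vs = begin
    total (λ w → indicator (u ∈? vs [ w ]≔ x)) (allFin n) ℕ.+ 1
      ≡⟨ cong (total _ (allFin n) ℕ.+_) (total-indicator-≡ Fin._≟_ (Unique.allFin⁺ n) (∈-allFin i)) ⟨
    total (λ w → indicator (u ∈? vs [ w ]≔ x)) (allFin n) ℕ.+ total (λ w → indicator (w Fin.≟ i)) (allFin n)
      ≡⟨ total-+ _ _ (allFin n) ⟨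
    total (λ w → indicator (u ∈? vs [ w ]≔ x) ℕ.+ indicator (w Fin.≟ i)) (allFin n)
      ≡⟨ total-cong either (allFin n) ⟩
    total (λ _ → 1) (allFin n)
      ≡⟨ total-const 1 (allFin n) ⟩
    length (allFin n) ℕ.* 1
      ≡⟨ cong (ℕ._* 1) (length-allFin n) ⟩
    n ℕ.* 1 ∎
    where
    open ≡-Reasoning
    i = proj₁ (∈⇒lookup u∈vs)
    lookup-i : lookup vs i ≡ u
    lookup-i = proj₂ (∈⇒lookup u∈vs)
    -- Exactly one of the two indicators is 1: u survives the replacement unless w is its own
    -- position i.
    either : ∀ w → indicator (u ∈? vs [ w ]≔ x) ℕ.+ indicator (w Fin.≟ i) ≡ 1
    either w with lookup-update vs w x i
    ... | inj₂ (i≢w , eq) = cong₂ ℕ._+_ (indicator-true (u ∈? vs [ w ]≔ x) (lookup⇒∈ i (trans eq lookup-i)))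
                                        (indicator-false (w Fin.≟ i) (i≢w ∘ sym))
    ... | inj₁ (i≡w , _)  = cong₂ ℕ._+_ (indicator-false (u ∈? vs [ w ]≔ x) ∉) (indicator-true (w Fin.≟ i) (sym i≡w))
      where
      ∉ : ¬ u ∈ᵛ vs [ w ]≔ x
      ∉ u∈ with ∈⇒lookup u∈
      ... | j , eq with lookup-update vs w x j
      ...   | inj₁ (_ , eq′)   = u≢x (trans (sym eq) eq′)
      ...   | inj₂ (j≢w , eq′) = j≢w (trans (distinct j i (trans (trans (sym eq′) eq) (sym lookup-i))) i≡w)

  positions : ∀ {n} → Tree k n → Clique k n → ℕ
  positions T K = suc (d⁺ T K)

  positions-old : ∀ {n} (T : Tree k n) K p L →
                  positions (insert T K p) (old L) ≡ indicator (L ≟ᶜ K) ℕ.+ positions T L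
  positions-old T K p L with does (L ≟ᶜ K)
  ... | true  = refl
  ... | false = refl

  total-indicator-clique : ∀ {n} (K : Clique k n) → total (λ L → indicator (L ≟ᶜ K)) (allCliques k n) ≡ 1
  total-indicator-clique {n} K = total-indicator-≡ _≟ᶜ_ (allCliques-unique k n) (allCliques-complete K)

  -- Inserting at K adds one position at K and creates k cliques with one position each. The weight
  -- `g` covers both counts below: constant for all insertions, an indicator of containing u for the
  -- insertions below u.
  total-positions-insert : ∀ {n} (T : Tree k n) K p (g : Clique k (suc n) → ℕ) →
    total (λ L → positions (insert T K p) L ℕ.* g L) (allCliques k (suc n)) ≡
    g (old K) ℕ.+ total (λ L → positions T L ℕ.* g (old L)) (allCliques k n) ℕ.+ total (g ∘ new) (allFin k)
  total-positions-insert {n} T K p g = begin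
    total f (map old (allCliques k n) ++ map new (allFin k))
      ≡⟨ total-++ f (map old (allCliques k n)) (map new (allFin k)) ⟩
    total f (map old (allCliques k n)) ℕ.+ total f (map new (allFin k))
      ≡⟨ cong₂ ℕ._+_ (total-map f old (allCliques k n)) (total-map f new (allFin k)) ⟩
    total (f ∘ old) (allCliques k n) ℕ.+ total (f ∘ new) (allFin k)
      ≡⟨ cong₂ ℕ._+_ (total-cong old-term (allCliques k n)) (total-cong (λ w → ℕ.+-identityʳ (g (new w))) (allFin k)) ⟩
    total (λ L → indicator (L ≟ᶜ K) ℕ.* g (old K) ℕ.+ positions T L ℕ.* g (old L)) (allCliques k n)
        ℕ.+ total (g ∘ new) (allFin k)
      ≡⟨ cong (ℕ._+ total (g ∘ new) (allFin k)) (trans (total-+ _ _ (allCliques k n))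
           (cong (ℕ._+ total (λ L → positions T L ℕ.* g (old L)) (allCliques k n))
             (trans (total-*ʳ _ (g (old K)) (allCliques k n))
               (trans (cong (ℕ._* g (old K)) (total-indicator-clique K)) (ℕ.*-identityˡ (g (old K))))))) ⟩
    g (old K) ℕ.+ total (λ L → positions T L ℕ.* g (old L)) (allCliques k n) ℕ.+ total (g ∘ new) (allFin k) ∎
    where
    open ≡-Reasoning
    f : Clique k (suc n) → ℕ
    f L = positions (insert T K p) L ℕ.* g L
    at-K : ∀ L → indicator (L ≟ᶜ K) ℕ.* g (old L) ≡ indicator (L ≟ᶜ K) ℕ.* g (old K)
    at-K L = indicator-*-cong (L ≟ᶜ K) (λ { refl → refl })
    old-term : ∀ L → f (old L) ≡ indicator (L ≟ᶜ K) ℕ.* g (old K) ℕ.+ positions T L ℕ.* g (old L)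
    old-term L = trans (cong (ℕ._* g (old L)) (positions-old T K p L))
      (trans (ℕ.*-distribʳ-+ (g (old L)) (indicator (L ≟ᶜ K)) (positions T L))
        (cong (ℕ._+ positions T L ℕ.* g (old L)) (at-K L)))

  insertions : ℕ → ℕ
  insertions n = 1 ℕ.+ suc k ℕ.* n

  -- An insertion adds 1 + k positions whatever the tree looks like. The factor `c` serves the count
  -- of trees, with c = 1, and those terms of the degree recurrence that do not depend on K.
  total-positions : ∀ {n} (T : Tree k n) (c : ℕ) →
                    total (λ K → positions T K ℕ.* c) (allCliques k n) ≡ insertions n ℕ.* c
  total-positions root c = trans (ℕ.+-identityʳ (1 ℕ.* c)) (cong (ℕ._* c) (cong suc (sym (ℕ.*-zeroʳ (suc k)))))
  total-positions {suc n} (insert T K p) c = begin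
    total (λ L → positions (insert T K p) L ℕ.* c) (allCliques k (suc n))
      ≡⟨ total-positions-insert T K p (λ _ → c) ⟩
    c ℕ.+ total (λ L → positions T L ℕ.* c) (allCliques k n) ℕ.+ total (λ _ → c) (allFin k)
      ≡⟨ cong₂ (λ a b → c ℕ.+ a ℕ.+ b) (total-positions T c)
           (trans (total-const c (allFin k)) (cong (ℕ._* c) (length-allFin k))) ⟩
    c ℕ.+ insertions n ℕ.* c ℕ.+ k ℕ.* c
      ≡⟨ ℕS.solve 3 (λ k n c → c ℕS.:+ (ℕS.con 1 ℕS.:+ (ℕS.con 1 ℕS.:+ k) ℕS.:* n) ℕS.:* c ℕS.:+ k ℕS.:* c
           ℕS.:= (ℕS.con 1 ℕS.:+ (ℕS.con 1 ℕS.:+ k) ℕS.:* (ℕS.con 1 ℕS.:+ n)) ℕS.:* c) refl k n c ⟩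
    insertions (suc n) ℕ.* c ∎
    where open ≡-Reasoning

  -- The number of positions at which a child of u can be inserted.
  total-positions-∋ : ∀ {n j} (T : Tree k n) → j ℕ.< n →
    total (λ K → positions T K ℕ.* indicator (node (suc j) ∈? vertices T K)) (allCliques k n)
      ≡ k ℕ.* suc (outDegree T (node (suc j)))
  total-positions-∋ {suc n} {j} (insert T K p) (s≤s j≤n) = begin
    total (λ L → positions (insert T K p) L ℕ.* indicator (u ∈? vertices (insert T K p) L)) (allCliques k (suc n))
      ≡⟨ total-positions-insert T K p _ ⟩
    u∈K ℕ.+ total (λ L → positions T L ℕ.* indicator (u ∈? vertices T L)) (allCliques k n)
        ℕ.+ total (λ w → indicator (u ∈? vertices T K [ w ]≔ node (suc n))) (allFin k)
      ≡⟨ by-age (ℕ.m≤n⇒m<n∨m≡n j≤n) ⟩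
    k ℕ.* suc (u∈K ℕ.+ outDegree T u)
      ≡⟨ cong (λ d → k ℕ.* suc d) (outDegree-insert T K p u) ⟨
    k ℕ.* suc (outDegree (insert T K p) u) ∎
    where
    open ≡-Reasoning
    u : Node k
    u = node (suc j)
    u∈K = indicator (u ∈? vertices T K)
    by-age : j ℕ.< n ⊎ j ≡ n →
      u∈K ℕ.+ total (λ L → positions T L ℕ.* indicator (u ∈? vertices T L)) (allCliques k n)
        ℕ.+ total (λ w → indicator (u ∈? vertices T K [ w ]≔ node (suc n))) (allFin k)
      ≡ k ℕ.* suc (u∈K ℕ.+ outDegree T u)
    -- For an older node u in K, the position gained at K and the k - 1 new cliques that still
    -- contain u add up to k; if u is not in K, nothing changes.
    by-age (inj₁ j<n) = begin
      u∈K ℕ.+ total (λ L → positions T L ℕ.* indicator (u ∈? vertices T L)) (allCliques k n) ℕ.+ R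
        ≡⟨ cong (λ s → u∈K ℕ.+ s ℕ.+ R) (total-positions-∋ T j<n) ⟩
      u∈K ℕ.+ k ℕ.* suc (outDegree T u) ℕ.+ R
        ≡⟨ ℕS.solve 3 (λ a b c → a ℕS.:+ b ℕS.:+ c ℕS.:= b ℕS.:+ (c ℕS.:+ a)) refl u∈K (k ℕ.* suc (outDegree T u)) R ⟩
      k ℕ.* suc (outDegree T u) ℕ.+ (R ℕ.+ u∈K)
        ≡⟨ cong (k ℕ.* suc (outDegree T u) ℕ.+_) (total-∈-update (vertices T K) (vertices-distinct T K)
             (λ eq → ℕ.<⇒≢ (s≤s j<n) (node-injective eq))) ⟩
      k ℕ.* suc (outDegree T u) ℕ.+ k ℕ.* u∈K
        ≡⟨ ℕS.solve 3 (λ k o i → k ℕS.:* (ℕS.con 1 ℕS.:+ o) ℕS.:+ k ℕS.:* i ℕS.:= k ℕS.:* (ℕS.con 1 ℕS.:+ (i ℕS.:+ o)))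
             refl k (outDegree T u) u∈K ⟩
      k ℕ.* suc (u∈K ℕ.+ outDegree T u) ∎
      where R = total (λ w → indicator (u ∈? vertices T K [ w ]≔ node (suc n))) (allFin k)
    -- The newest node lies in none of the old cliques and in all k new ones, each of which has one
    -- position.
    by-age (inj₂ refl) = begin
      u∈K ℕ.+ total (λ L → positions T L ℕ.* indicator (u ∈? vertices T L)) (allCliques k n)
          ℕ.+ total (λ w → indicator (u ∈? vertices T K [ w ]≔ u)) (allFin k)
        ≡⟨ cong₂ (λ a b → a ℕ.+ b ℕ.+ total (λ w → indicator (u ∈? vertices T K [ w ]≔ u)) (allFin k)) u∉K
             (trans (total-cong (λ L → trans (cong (positions T L ℕ.*_) (indicator-false (u ∈? vertices T L) (fresh T L ℕ.≤-refl)))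
                                              (ℕ.*-zeroʳ (positions T L))) (allCliques k n))
               (trans (total-const 0 (allCliques k n)) (ℕ.*-zeroʳ (length (allCliques k n))))) ⟩
      total (λ w → indicator (u ∈? vertices T K [ w ]≔ u)) (allFin k)
        ≡⟨ total-cong (λ w → indicator-true (u ∈? vertices T K [ w ]≔ u)
             (lookup⇒∈ w (Vec.lookup∘update w (vertices T K) u))) (allFin k) ⟩
      total (λ _ → 1) (allFin k)
        ≡⟨ trans (total-const 1 (allFin k)) (cong (ℕ._* 1) (length-allFin k)) ⟩
      k ℕ.* 1
        ≡⟨ cong (λ d → k ℕ.* suc d) (cong₂ ℕ._+_ u∉K (outDegree-fresh T ℕ.≤-refl)) ⟨
      k ℕ.* suc (u∈K ℕ.+ outDegree T u) ∎
      where
      u∉K : u∈K ≡ 0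
      u∉K = indicator-false (u ∈? vertices T K) (fresh T K ℕ.≤-refl)

  treeCount : ℕ → ℕ
  treeCount n = length (allTrees k n)

  nodesOfDegree : ∀ {n} → Tree k n → ℕ → ℕ → ℕ
  nodesOfDegree T l m = total (λ u → indicator (outDegree T u ℕ.≟ m)) (insertedNodes k l)

  degreeCount : ℕ → ℕ → ℕ
  degreeCount n m = total (λ T → nodesOfDegree T n m) (allTrees k n)

  -- Since `f` ignores the position among the children, position zero represents all of them and
  -- each clique is weighted by its number of positions.
  total-trees : ∀ n (f : Tree k (suc n) → ℕ) → (∀ T K p q → f (insert T K p) ≡ f (insert T K q)) →
    total f (allTrees k (suc n)) ≡
    total (λ T → total (λ K → positions T K ℕ.* f (insert T K Fin.zero)) (allCliques k n)) (allTrees k n)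
  total-trees n f f-const = trans (total-concatMap f _ (allTrees k n)) (total-cong (λ T →
    trans (total-concatMap f _ (allCliques k n)) (total-cong (λ K →
      trans (total-map f (insert T K) (allFin (positions T K)))
        (trans (total-cong (λ p → f-const T K p Fin.zero) (allFin (positions T K)))
          (trans (total-const (f (insert T K Fin.zero)) (allFin (positions T K)))
            (cong (ℕ._* f (insert T K Fin.zero)) (length-allFin (positions T K))))))
      (allCliques k n))) (allTrees k n))

  treeCount-suc : ∀ n → treeCount (suc n) ≡ insertions n ℕ.* treeCount n
  treeCount-suc n = begin
    length (allTrees k (suc n))  ≡⟨ length≡total (allTrees k (suc n)) ⟩
    total (λ _ → 1) (allTrees k (suc n))  ≡⟨ total-trees n (λ _ → 1) (λ _ _ _ _ → refl) ⟩
    total (λ T → total (λ K → positions T K ℕ.* 1) (allCliques k n)) (allTrees k n)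
                                                 ≡⟨ total-cong (λ T → trans (total-positions T 1) (ℕ.*-identityʳ (insertions n))) (allTrees k n) ⟩
    total (λ _ → insertions n) (allTrees k n)  ≡⟨ total-const (insertions n) (allTrees k n) ⟩
    treeCount n ℕ.* insertions n  ≡⟨ ℕ.*-comm (treeCount n) (insertions n) ⟩
    insertions n ℕ.* treeCount n  ∎
    where open ≡-Reasoning

  total-insertedNodes-suc : ∀ (f : Node k → ℕ) n →
    total f (insertedNodes k (suc n)) ≡ total f (insertedNodes k n) ℕ.+ f (node (suc n))
  total-insertedNodes-suc f n = trans (cong (total f) (sym (applyUpTo-∷ʳ (node ∘ suc) n)))
    (trans (total-++ f (insertedNodes k n) (node (suc n) ∷ []))
      (cong (total f (insertedNodes k n) ℕ.+_) (ℕ.+-identityʳ (f (node (suc n))))))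

  -- There are insertions below u with total weight k (d + 1), where d is the
  -- out-degree of u; moved to both sides so that no subtraction occurs.
  total-degree-node : ∀ {n j} (T : Tree k n) → j ℕ.< n → ∀ m → let u = node (suc j) in
    total (λ K → positions T K ℕ.* indicator (outDegree (insert T K Fin.zero) u ℕ.≟ m)) (allCliques k n)
      ℕ.+ indicator (outDegree T u ℕ.≟ m) ℕ.* (k ℕ.* suc m)
    ≡ indicator (outDegree T u ℕ.≟ ℕ.pred m) ℕ.* (k ℕ.* m) ℕ.+ indicator (outDegree T u ℕ.≟ m) ℕ.* insertions n
  total-degree-node {n} {j} T j<n m = begin
    total (λ K → positions T K ℕ.* at K m) (allCliques k n) ℕ.+ I ℕ.* (k ℕ.* suc m)
      ≡⟨ cong (total (λ K → positions T K ℕ.* at K m) (allCliques k n) ℕ.+_) (trans same-degree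
           (sym (trans (total-*ʳ _ I (allCliques k n)) (cong (ℕ._* I) (total-positions-∋ T j<n))))) ⟩
    total (λ K → positions T K ℕ.* at K m) (allCliques k n)
      ℕ.+ total (λ K → positions T K ℕ.* u∈ K ℕ.* I) (allCliques k n)
      ≡⟨ total-+ _ _ (allCliques k n) ⟨
    total (λ K → positions T K ℕ.* at K m ℕ.+ positions T K ℕ.* u∈ K ℕ.* I) (allCliques k n)
      ≡⟨ total-cong split (allCliques k n) ⟩
    total (λ K → positions T K ℕ.* u∈ K ℕ.* I⁺ ℕ.+ positions T K ℕ.* I) (allCliques k n)
      ≡⟨ total-+ _ _ (allCliques k n) ⟩
    total (λ K → positions T K ℕ.* u∈ K ℕ.* I⁺) (allCliques k n) ℕ.+ total (λ K → positions T K ℕ.* I) (allCliques k n)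
      ≡⟨ cong₂ ℕ._+_
           (trans (total-*ʳ _ I⁺ (allCliques k n)) (trans (cong (ℕ._* I⁺) (total-positions-∋ T j<n)) (lower-degree m)))
           (trans (total-positions T I) (ℕ.*-comm (insertions n) I)) ⟩
    indicator (o ℕ.≟ ℕ.pred m) ℕ.* (k ℕ.* m) ℕ.+ I ℕ.* insertions n ∎
    where
    open ≡-Reasoning
    u : Node k
    u = node (suc j)
    o = outDegree T u
    I = indicator (o ℕ.≟ m)
    I⁺ = indicator (suc o ℕ.≟ m)
    u∈ : Clique k n → ℕ
    u∈ K = indicator (u ∈? vertices T K)
    at : Clique k n → ℕ → ℕ
    at K m = indicator (outDegree (insert T K Fin.zero) u ℕ.≟ m)
    same-degree : I ℕ.* (k ℕ.* suc m) ≡ k ℕ.* suc o ℕ.* I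
    same-degree = trans (indicator-*-cong (o ℕ.≟ m) (λ { refl → refl })) (ℕ.*-comm I (k ℕ.* suc o))
    lower-degree : ∀ m → k ℕ.* suc o ℕ.* indicator (suc o ℕ.≟ m) ≡ indicator (o ℕ.≟ ℕ.pred m) ℕ.* (k ℕ.* m)
    -- At m = 0 the default `ℕ.pred 0 = 0` is harmless: the factor m on the right vanishes, and suc
    -- o is never 0.
    lower-degree zero = trans (ℕ.*-zeroʳ (k ℕ.* suc o))
      (sym (trans (cong (indicator (o ℕ.≟ 0) ℕ.*_) (ℕ.*-zeroʳ k)) (ℕ.*-zeroʳ (indicator (o ℕ.≟ 0)))))
    lower-degree (suc m) = trans (ℕ.*-comm (k ℕ.* suc o) _) (indicator-*-cong (o ℕ.≟ m) (λ { refl → refl }))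
    -- If u is in K, its out-degree rises from o to o + 1, so I⁺ counts instead of I; the product
    -- with `u∈ K` on the left restores the I that is lost.
    split : ∀ K → positions T K ℕ.* at K m ℕ.+ positions T K ℕ.* u∈ K ℕ.* I
                ≡ positions T K ℕ.* u∈ K ℕ.* I⁺ ℕ.+ positions T K ℕ.* I
    split K rewrite outDegree-insert T K Fin.zero u with does (u ∈? vertices T K)
    ... | true  = ℕS.solve 3 (λ p a b → p ℕS.:* a ℕS.:+ p ℕS.:* ℕS.con 1 ℕS.:* b ℕS.:=
                    p ℕS.:* ℕS.con 1 ℕS.:* a ℕS.:+ p ℕS.:* b) refl (positions T K) I⁺ I
    ... | false = ℕS.solve 3 (λ p a b → p ℕS.:* b ℕS.:+ p ℕS.:* ℕS.con 0 ℕS.:* b ℕS.:=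
                    p ℕS.:* ℕS.con 0 ℕS.:* a ℕS.:+ p ℕS.:* b) refl (positions T K) I⁺ I

  -- The nodes of `T` contribute through `total-degree-node`; the newest node has out-degree 0 under
  -- every insertion and gives the last term.
  total-degree-tree : ∀ {n} (T : Tree k n) m →
    total (λ K → positions T K ℕ.* nodesOfDegree (insert T K Fin.zero) (suc n) m) (allCliques k n)
      ℕ.+ nodesOfDegree T n m ℕ.* (k ℕ.* suc m)
    ≡ nodesOfDegree T n (ℕ.pred m) ℕ.* (k ℕ.* m) ℕ.+ nodesOfDegree T n m ℕ.* insertions n
      ℕ.+ insertions n ℕ.* indicator (0 ℕ.≟ m)
  total-degree-tree {n} T m = begin
    total (λ K → positions T K ℕ.* nodesOfDegree (insert T K Fin.zero) (suc n) m) Ks ℕ.+ d m ℕ.* (k ℕ.* suc m)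
      ≡⟨ cong (ℕ._+ d m ℕ.* (k ℕ.* suc m)) (trans (total-cong newest Ks) (trans (total-+ _ _ Ks)
           (cong₂ ℕ._+_ (total-swap _ Ks us) (total-positions T (indicator (0 ℕ.≟ m)))))) ⟩
    total (λ u → total (λ K → positions T K ℕ.* at u K) Ks) us ℕ.+ Z ℕ.+ d m ℕ.* (k ℕ.* suc m)
      ≡⟨ trans (ℕS.solve 3 (λ a b c → a ℕS.:+ b ℕS.:+ c ℕS.:= a ℕS.:+ c ℕS.:+ b) refl
            (total (λ u → total (λ K → positions T K ℕ.* at u K) Ks) us) Z (d m ℕ.* (k ℕ.* suc m)))
           (cong (λ s → total (λ u → total (λ K → positions T K ℕ.* at u K) Ks) us ℕ.+ s ℕ.+ Z)
             (sym (total-*ʳ _ (k ℕ.* suc m) us))) ⟩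
    total (λ u → total (λ K → positions T K ℕ.* at u K) Ks) us
      ℕ.+ total (λ u → indicator (outDegree T u ℕ.≟ m) ℕ.* (k ℕ.* suc m)) us ℕ.+ Z
      ≡⟨ cong (ℕ._+ Z) (trans (sym (total-+ _ _ us)) (trans (per-node n ℕ.≤-refl) (total-+ _ _ us))) ⟩
    total (λ u → indicator (outDegree T u ℕ.≟ ℕ.pred m) ℕ.* (k ℕ.* m)) us
      ℕ.+ total (λ u → indicator (outDegree T u ℕ.≟ m) ℕ.* insertions n) us ℕ.+ Z
      ≡⟨ cong (ℕ._+ Z) (cong₂ ℕ._+_ (total-*ʳ _ (k ℕ.* m) us) (total-*ʳ _ (insertions n) us)) ⟩
    d (ℕ.pred m) ℕ.* (k ℕ.* m) ℕ.+ d m ℕ.* insertions n ℕ.+ Z ∎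
    where
    open ≡-Reasoning
    Ks = allCliques k n
    us = insertedNodes k n
    Z = insertions n ℕ.* indicator (0 ℕ.≟ m)
    d : ℕ → ℕ
    d = nodesOfDegree T n
    at : Node k → Clique k n → ℕ
    at u K = indicator (outDegree (insert T K Fin.zero) u ℕ.≟ m)
    newest : ∀ K → positions T K ℕ.* nodesOfDegree (insert T K Fin.zero) (suc n) m
               ≡ total (λ u → positions T K ℕ.* at u K) us ℕ.+ positions T K ℕ.* indicator (0 ℕ.≟ m)
    newest K = begin
      positions T K ℕ.* nodesOfDegree (insert T K Fin.zero) (suc n) m
        ≡⟨ cong (positions T K ℕ.*_) (total-insertedNodes-suc (λ u → at u K) n) ⟩
      positions T K ℕ.* (total (λ u → at u K) us ℕ.+ at (node (suc n)) K)
        ≡⟨ cong (λ o → positions T K ℕ.* (total (λ u → at u K) us ℕ.+ indicator (o ℕ.≟ m)))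
             (trans (outDegree-insert T K Fin.zero (node (suc n))) (cong₂ ℕ._+_
               (indicator-false (node (suc n) ∈? vertices T K) (fresh T K ℕ.≤-refl)) (outDegree-fresh T ℕ.≤-refl))) ⟩
      positions T K ℕ.* (total (λ u → at u K) us ℕ.+ indicator (0 ℕ.≟ m))
        ≡⟨ ℕ.*-distribˡ-+ (positions T K) (total (λ u → at u K) us) (indicator (0 ℕ.≟ m)) ⟩
      positions T K ℕ.* total (λ u → at u K) us ℕ.+ positions T K ℕ.* indicator (0 ℕ.≟ m)
        ≡⟨ cong (ℕ._+ positions T K ℕ.* indicator (0 ℕ.≟ m)) (trans (ℕ.*-comm (positions T K) (total (λ u → at u K) us))
             (trans (sym (total-*ʳ (λ u → at u K) (positions T K) us))
               (total-cong (λ u → ℕ.*-comm (at u K) (positions T K)) us))) ⟩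
      total (λ u → positions T K ℕ.* at u K) us ℕ.+ positions T K ℕ.* indicator (0 ℕ.≟ m) ∎
    lhs rhs : Node k → ℕ
    lhs u = total (λ K → positions T K ℕ.* at u K) Ks ℕ.+ indicator (outDegree T u ℕ.≟ m) ℕ.* (k ℕ.* suc m)
    rhs u = indicator (outDegree T u ℕ.≟ ℕ.pred m) ℕ.* (k ℕ.* m) ℕ.+ indicator (outDegree T u ℕ.≟ m) ℕ.* insertions n
    -- The identity for a single node holds only for nodes that are already in `T`, hence the
    -- induction over initial segments in place of `total-cong`.
    per-node : ∀ l → l ℕ.≤ n → total lhs (insertedNodes k l) ≡ total rhs (insertedNodes k l)
    per-node zero    _   = refl
    per-node (suc l) l<n = trans (total-insertedNodes-suc lhs l)
      (trans (cong₂ ℕ._+_ (per-node l (ℕ.<⇒≤ l<n)) (total-degree-node T l<n m))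
        (sym (total-insertedNodes-suc rhs l)))

  -- Write N for `degreeCount` and t for `treeCount`. With subtraction this reads N(n+1, m) = k m
  -- N(n, m-1) + (ins n - k (m+1)) N(n, m) + [m = 0] t(n+1), where ins n is the number of
  -- insertions.
  degreeCount-suc : ∀ n m →
    degreeCount (suc n) m ℕ.+ degreeCount n m ℕ.* (k ℕ.* suc m)
    ≡ degreeCount n (ℕ.pred m) ℕ.* (k ℕ.* m) ℕ.+ degreeCount n m ℕ.* insertions n
      ℕ.+ treeCount n ℕ.* (insertions n ℕ.* indicator (0 ℕ.≟ m))
  degreeCount-suc n m = begin
    degreeCount (suc n) m ℕ.+ degreeCount n m ℕ.* (k ℕ.* suc m)
      ≡⟨ cong₂ ℕ._+_ (total-trees n (λ T → nodesOfDegree T (suc n) m) (λ _ _ _ _ → refl))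
                     (sym (total-*ʳ _ (k ℕ.* suc m) Ts)) ⟩
    total (λ T → total (λ K → positions T K ℕ.* nodesOfDegree (insert T K Fin.zero) (suc n) m) (allCliques k n)) Ts
      ℕ.+ total (λ T → nodesOfDegree T n m ℕ.* (k ℕ.* suc m)) Ts
      ≡⟨ trans (sym (total-+ _ _ Ts)) (total-cong (λ T → total-degree-tree T m) Ts) ⟩
    total (λ T → nodesOfDegree T n (ℕ.pred m) ℕ.* (k ℕ.* m) ℕ.+ nodesOfDegree T n m ℕ.* insertions n
                 ℕ.+ insertions n ℕ.* indicator (0 ℕ.≟ m)) Ts
      ≡⟨ trans (total-+ _ _ Ts) (cong (ℕ._+ total (λ _ → insertions n ℕ.* indicator (0 ℕ.≟ m)) Ts) (total-+ _ _ Ts)) ⟩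
    total (λ T → nodesOfDegree T n (ℕ.pred m) ℕ.* (k ℕ.* m)) Ts ℕ.+ total (λ T → nodesOfDegree T n m ℕ.* insertions n) Ts
      ℕ.+ total (λ _ → insertions n ℕ.* indicator (0 ℕ.≟ m)) Ts
      ≡⟨ cong₂ ℕ._+_ (cong₂ ℕ._+_ (total-*ʳ _ (k ℕ.* m) Ts) (total-*ʳ _ (insertions n) Ts))
                     (total-const (insertions n ℕ.* indicator (0 ℕ.≟ m)) Ts) ⟩
    degreeCount n (ℕ.pred m) ℕ.* (k ℕ.* m) ℕ.+ degreeCount n m ℕ.* insertions n
      ℕ.+ treeCount n ℕ.* (insertions n ℕ.* indicator (0 ℕ.≟ m)) ∎
    where
    open ≡-Reasoning
    Ts = allTrees k n

-- Rational arithmetic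

fromℕ-suc : ∀ n → fromℕ (suc n) ≡ 1ℚ + fromℕ n
fromℕ-suc n = trans (/-suc n 0) (+-comm (fromℕ n) 1ℚ)

fromℕ-+ : ∀ m n → fromℕ (m ℕ.+ n) ≡ fromℕ m + fromℕ n
fromℕ-+ zero    n = sym (+-identityˡ (fromℕ n))
fromℕ-+ (suc m) n = begin
  fromℕ (suc (m ℕ.+ n))  ≡⟨ fromℕ-suc (m ℕ.+ n) ⟩
  1ℚ + fromℕ (m ℕ.+ n)  ≡⟨ cong (λ s → 1ℚ + s) (fromℕ-+ m n) ⟩
  1ℚ + (fromℕ m + fromℕ n)  ≡⟨ +-assoc 1ℚ (fromℕ m) (fromℕ n) ⟨
  1ℚ + fromℕ m + fromℕ n  ≡⟨ cong (_+ fromℕ n) (fromℕ-suc m) ⟨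
  fromℕ (suc m) + fromℕ n  ∎
  where open ≡-Reasoning

fromℕ-* : ∀ m n → fromℕ (m ℕ.* n) ≡ fromℕ m * fromℕ n
fromℕ-* m n = /-* m n 0 0

fromℕ-mono-≤ : ∀ {m n} → m ℕ.≤ n → fromℕ m ≤ fromℕ n
fromℕ-mono-≤ {m} {n} m≤n = /-mono-≤ m n 0 0 (ℕ.*-monoˡ-≤ 1 m≤n)

fromℕ-mono-< : ∀ {m n} → m ℕ.< n → fromℕ m < fromℕ n
fromℕ-mono-< {m} {n} m<n = /-mono-< m n 0 0 (ℕ.*-monoˡ-< 1 m<n)

0≤fromℕ : ∀ n → 0ℚ ≤ fromℕ n
0≤fromℕ n = 0≤/ n 0

0<fromℕ : ∀ {n} → 0 ℕ.< n → 0ℚ < fromℕ n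
0<fromℕ = fromℕ-mono-<

0<⇒≢0 : ∀ {p} → 0ℚ < p → p ≢ 0ℚ
0<⇒≢0 0<p refl = <-irrefl refl 0<p

0<fromℕ-suc : ∀ n → 0ℚ < fromℕ (suc n)
0<fromℕ-suc n = 0<fromℕ {suc n} (s≤s z≤n)

fromℕ-suc≢0 : ∀ n → fromℕ (suc n) ≢ 0ℚ
fromℕ-suc≢0 n = 0<⇒≢0 (0<fromℕ-suc n)

fromℕ-*-/ : ∀ a d → fromℕ (suc d) * (+ a / suc d) ≡ fromℕ a
fromℕ-*-/ a d = toℚᵘ-injective (begin
  toℚᵘ (fromℕ (suc d) * (+ a / suc d))  ≈⟨ toℚᵘ-homo-* (fromℕ (suc d)) (+ a / suc d) ⟩
  toℚᵘ (fromℕ (suc d)) ℚᵘ.* toℚᵘ (+ a / suc d)  ≈⟨ ℚᵘ.*-cong (toℚᵘ-/ (+ suc d) 0) (toℚᵘ-/ (+ a) d) ⟩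
  ℚᵘ.mkℚᵘ (+ suc d) 0 ℚᵘ.* ℚᵘ.mkℚᵘ (+ a) d  ≈⟨ ℚᵘ.*≡* (ℤS.solve 2 (λ a d →
                                                         d ℤS.:* a ℤS.:* ℤS.con (+ 1) ℤS.:= a ℤS.:* (ℤS.con (+ 1) ℤS.:* d)) refl (+ a) (+ suc d)) ⟩
  ℚᵘ.mkℚᵘ (+ a) 0  ≈⟨ toℚᵘ-/ (+ a) 0 ⟨
  toℚᵘ (fromℕ a)  ∎)
  where open import Relation.Binary.Reasoning.Setoid ℚᵘ.≃-setoid

*-cancelʳ-≢0 : ∀ {p q} r → r ≢ 0ℚ → p * r ≡ q * r → p ≡ q
*-cancelʳ-≢0 {p} {q} r r≢0 eq = begin
  p  ≡⟨ undo p ⟨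
  p * r * 1/ r  ≡⟨ cong (_* 1/ r) eq ⟩
  q * r * 1/ r  ≡⟨ undo q ⟩
  q  ∎
  where
  open ≡-Reasoning
  instance
    r-nonZero : ℚ.NonZero r
    r-nonZero = ≢-nonZero r≢0
  undo : ∀ s → s * r * 1/ r ≡ s
  undo s = trans (*-assoc s r (1/ r)) (trans (cong (s *_) (*-inverseʳ r)) (*-identityʳ s))

*-cancelˡ-≢0 : ∀ {p q} r → r ≢ 0ℚ → r * p ≡ r * q → p ≡ q
*-cancelˡ-≢0 {p} {q} r r≢0 eq = *-cancelʳ-≢0 r r≢0 (trans (*-comm p r) (trans eq (*-comm r q)))

*-≢0 : ∀ {p q} → p ≢ 0ℚ → q ≢ 0ℚ → p * q ≢ 0ℚ
*-≢0 {p} {q} p≢0 q≢0 eq = p≢0 (*-cancelʳ-≢0 q q≢0 (trans eq (sym (*-zeroˡ q))))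

÷₀-* : ∀ p {q} → q ≢ 0ℚ → (p ÷₀ q) * q ≡ p
÷₀-* p {q} q≢0 with q ℚ.≟ 0ℚ
... | yes q≡0 = ⊥-elim (q≢0 q≡0)
... | no q≢0′ = trans (*-assoc p (1/ q) q) (trans (cong (p *_) (*-inverseˡ q)) (*-identityʳ p))
  where
  instance
    q-nonZero : ℚ.NonZero q
    q-nonZero = ≢-nonZero q≢0′

÷₀-unique : ∀ {p q x} → q ≢ 0ℚ → x * q ≡ p → p ÷₀ q ≡ x
÷₀-unique {p} {q} q≢0 eq = *-cancelʳ-≢0 q q≢0 (trans (÷₀-* p q≢0) (sym eq))

*-÷₀-assoc : ∀ p r {q} → q ≢ 0ℚ → (p * r) ÷₀ q ≡ p * (r ÷₀ q)
*-÷₀-assoc p r {q} q≢0 = ÷₀-unique q≢0 (trans (*-assoc p (r ÷₀ q) q) (cong (p *_) (÷₀-* r q≢0)))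

0<÷₀ : ∀ {p q} → 0ℚ < p → 0ℚ < q → 0ℚ < p ÷₀ q
0<÷₀ {p} {q} 0<p 0<q = *-cancelʳ-<-nonNeg q {{nonNegative (<⇒≤ 0<q)}}
  (subst₂ _<_ (sym (*-zeroˡ q)) (sym (÷₀-* p (0<⇒≢0 0<q))) 0<p)

0<p*q : ∀ {p q} → 0ℚ < p → 0ℚ < q → 0ℚ < p * q
0<p*q {p} {q} 0<p 0<q = positive⁻¹ (p * q) {{pos*pos⇒pos p {{positive 0<p}} q {{positive 0<q}}}}

0<^ : ∀ n {x} → 0ℚ < x → 0ℚ < x ^ n
0<^ zero    0<x = positive⁻¹ 1ℚ
0<^ (suc n) 0<x = 0<p*q 0<x (0<^ n 0<x)

∑-cong : ∀ n {f g} → (∀ i → i ℕ.< n → f i ≡ g i) → ∑ n f ≡ ∑ n g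
∑-cong zero    f≗g = refl
∑-cong (suc n) f≗g = cong₂ _+_ (∑-cong n (λ i i<n → f≗g i (ℕ.m≤n⇒m≤1+n i<n))) (f≗g n ℕ.≤-refl)

∑-+ : ∀ n f g → ∑ n (λ i → f i + g i) ≡ ∑ n f + ∑ n g
∑-+ zero    f g = sym (+-identityʳ 0ℚ)
∑-+ (suc n) f g = trans (cong (_+ (f n + g n)) (∑-+ n f g))
  (solve 4 (λ a b c d → (a :+ b) :+ (c :+ d) := (a :+ c) :+ (b :+ d)) refl (∑ n f) (∑ n g) (f n) (g n))

∑-*ˡ : ∀ n c f → ∑ n (λ i → c * f i) ≡ c * ∑ n f
∑-*ˡ zero    c f = sym (*-zeroʳ c)
∑-*ˡ (suc n) c f = trans (cong (_+ c * f n) (∑-*ˡ n c f)) (sym (*-distribˡ-+ c (∑ n f) (f n)))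

∑-mono-≤ : ∀ n {f g} → (∀ i → i ℕ.< n → f i ≤ g i) → ∑ n f ≤ ∑ n g
∑-mono-≤ zero    f≤g = ≤-refl
∑-mono-≤ (suc n) f≤g = +-mono-≤ (∑-mono-≤ n (λ i i<n → f≤g i (ℕ.m≤n⇒m≤1+n i<n))) (f≤g n ℕ.≤-refl)

*-distrib-^ : ∀ x y j → (x * y) ^ j ≡ x ^ j * y ^ j
*-distrib-^ x y zero    = refl
*-distrib-^ x y (suc j) = trans (cong (x * y *_) (*-distrib-^ x y j))
  (solve 4 (λ x y a b → x :* y :* (a :* b) := x :* a :* (y :* b)) refl x y (x ^ j) (y ^ j))

-- Binomial coefficients

-- The definition splits off the last factor. Splitting off the first one is what allows a shift of
-- the upper argument of a binomial.
fallingFactorial-suc : ∀ y n → fallingFactorial (1ℚ + y) (suc n) ≡ (1ℚ + y) * fallingFactorial y n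
fallingFactorial-suc y zero = solve 1 (λ y → con 1ℚ :* (con 1ℚ :+ y :- con 0ℚ) := (con 1ℚ :+ y) :* con 1ℚ) refl y
fallingFactorial-suc y (suc n) = begin
  fallingFactorial (1ℚ + y) (suc n) * (1ℚ + y - fromℕ (suc n))
    ≡⟨ cong₂ (λ f i → f * (1ℚ + y - i)) (fallingFactorial-suc y n) (fromℕ-suc n) ⟩
  (1ℚ + y) * fallingFactorial y n * (1ℚ + y - (1ℚ + fromℕ n))
    ≡⟨ solve 3 (λ y f n → (con 1ℚ :+ y) :* f :* (con 1ℚ :+ y :- (con 1ℚ :+ n)) := (con 1ℚ :+ y) :* (f :* (y :- n))) refl
         y (fallingFactorial y n) (fromℕ n) ⟩
  (1ℚ + y) * fallingFactorial y (suc n) ∎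
  where open ≡-Reasoning

n!≢0 : ∀ n → fromℕ (n !) ≢ 0ℚ
n!≢0 n = 0<⇒≢0 (0<fromℕ {n !} (ℕ.1≤n! n))

binom-*-! : ∀ x m → binom x m * fromℕ (m !) ≡ fallingFactorial x m
binom-*-! x m = ÷₀-* (fallingFactorial x m) (n!≢0 m)

binom-suc : ∀ x m → binom x (suc m) * fromℕ (suc m) ≡ binom x m * (x - fromℕ m)
binom-suc x m = *-cancelʳ-≢0 (fromℕ (m !)) (n!≢0 m) (begin
  binom x (suc m) * fromℕ (suc m) * fromℕ (m !)  ≡⟨ *-assoc (binom x (suc m)) (fromℕ (suc m)) (fromℕ (m !)) ⟩
  binom x (suc m) * (fromℕ (suc m) * fromℕ (m !))  ≡⟨ cong (binom x (suc m) *_) (fromℕ-* (suc m) (m !)) ⟨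
  binom x (suc m) * fromℕ (suc m !)  ≡⟨ binom-*-! x (suc m) ⟩
  fallingFactorial x m * (x - fromℕ m)  ≡⟨ cong (_* (x - fromℕ m)) (binom-*-! x m) ⟨
  binom x m * fromℕ (m !) * (x - fromℕ m)  ≡⟨ solve 3 (λ b f d → b :* f :* d := b :* d :* f) refl (binom x m) (fromℕ (m !)) (x - fromℕ m) ⟩
  binom x m * (x - fromℕ m) * fromℕ (m !)  ∎)
  where open ≡-Reasoning

binom-pred : ∀ y m → (1ℚ + y) * binom y m ≡ (1ℚ + y - fromℕ m) * binom (1ℚ + y) m
binom-pred y m = *-cancelʳ-≢0 (fromℕ (m !)) (n!≢0 m) (begin
  (1ℚ + y) * binom y m * fromℕ (m !)  ≡⟨ *-assoc (1ℚ + y) (binom y m) (fromℕ (m !)) ⟩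
  (1ℚ + y) * (binom y m * fromℕ (m !))  ≡⟨ cong ((1ℚ + y) *_) (binom-*-! y m) ⟩
  (1ℚ + y) * fallingFactorial y m  ≡⟨ fallingFactorial-suc y m ⟨
  fallingFactorial (1ℚ + y) m * (1ℚ + y - fromℕ m)  ≡⟨ cong (_* (1ℚ + y - fromℕ m)) (binom-*-! (1ℚ + y) m) ⟨
  binom (1ℚ + y) m * fromℕ (m !) * (1ℚ + y - fromℕ m)  ≡⟨ solve 3 (λ b f d → b :* f :* d := d :* b :* f) refl
                                                            (binom (1ℚ + y) m) (fromℕ (m !)) (1ℚ + y - fromℕ m) ⟩
  (1ℚ + y - fromℕ m) * binom (1ℚ + y) m * fromℕ (m !)  ∎)
  where open ≡-Reasoning

-- In all binomials in n of the formula the upper argument exceeds the lower one by a constant x.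
-- One step in the lower argument followed by one in the upper gives a first-order recurrence along
-- this diagonal.
binom-diagonal-suc : ∀ x n → binom (fromℕ (suc n) + x) (suc n) * fromℕ (suc n) ≡ binom (fromℕ n + x) n * (fromℕ (suc n) + x)
binom-diagonal-suc x n = begin
  binom (fromℕ (suc n) + x) (suc n) * fromℕ (suc n)
    ≡⟨ binom-suc (fromℕ (suc n) + x) n ⟩
  binom (fromℕ (suc n) + x) n * (fromℕ (suc n) + x - fromℕ n)
    ≡⟨ cong (λ y → binom y n * (y - fromℕ n)) shift ⟩
  binom (1ℚ + (fromℕ n + x)) n * (1ℚ + (fromℕ n + x) - fromℕ n)
    ≡⟨ *-comm (binom (1ℚ + (fromℕ n + x)) n) (1ℚ + (fromℕ n + x) - fromℕ n) ⟩
  (1ℚ + (fromℕ n + x) - fromℕ n) * binom (1ℚ + (fromℕ n + x)) n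
    ≡⟨ binom-pred (fromℕ n + x) n ⟨
  (1ℚ + (fromℕ n + x)) * binom (fromℕ n + x) n
    ≡⟨ *-comm (1ℚ + (fromℕ n + x)) (binom (fromℕ n + x) n) ⟩
  binom (fromℕ n + x) n * (1ℚ + (fromℕ n + x))
    ≡⟨ cong (binom (fromℕ n + x) n *_) shift ⟨
  binom (fromℕ n + x) n * (fromℕ (suc n) + x) ∎
  where
  open ≡-Reasoning
  shift : fromℕ (suc n) + x ≡ 1ℚ + (fromℕ n + x)
  shift = trans (cong (_+ x) (fromℕ-suc n)) (+-assoc 1ℚ (fromℕ n) x)

altBinom : ℕ → ℕ → ℚ
altBinom m ℓ = binom (fromℕ m) ℓ * (- 1ℚ) ^ ℓ

altBinom-pred : ∀ m ℓ → fromℕ (suc m) * altBinom m ℓ ≡ (fromℕ (suc m) - fromℕ ℓ) * altBinom (suc m) ℓ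
altBinom-pred m ℓ = begin
  fromℕ (suc m) * (binom (fromℕ m) ℓ * s)  ≡⟨ *-assoc (fromℕ (suc m)) (binom (fromℕ m) ℓ) s ⟨
  fromℕ (suc m) * binom (fromℕ m) ℓ * s  ≡⟨ cong (λ i → i * binom (fromℕ m) ℓ * s) (fromℕ-suc m) ⟩
  (1ℚ + fromℕ m) * binom (fromℕ m) ℓ * s  ≡⟨ cong (_* s) (binom-pred (fromℕ m) ℓ) ⟩
  (1ℚ + fromℕ m - fromℕ ℓ) * binom (1ℚ + fromℕ m) ℓ * s  ≡⟨ cong (λ i → (i - fromℕ ℓ) * binom i ℓ * s) (fromℕ-suc m) ⟨
  (fromℕ (suc m) - fromℕ ℓ) * binom (fromℕ (suc m)) ℓ * s  ≡⟨ *-assoc (fromℕ (suc m) - fromℕ ℓ) (binom (fromℕ (suc m)) ℓ) s ⟩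
  (fromℕ (suc m) - fromℕ ℓ) * (binom (fromℕ (suc m)) ℓ * s)  ∎
  where
  open ≡-Reasoning
  s = (- 1ℚ) ^ ℓ

-- m times the alternating sum telescopes, since (ℓ + 1) C(m, ℓ + 1) = (m − ℓ) C(m, ℓ).
∑-altBinom-partial : ∀ m L → fromℕ m * ∑ (suc L) (altBinom m) ≡ (fromℕ m - fromℕ L) * altBinom m L
∑-altBinom-partial m zero = solve 2 (λ m c → m :* (con 0ℚ :+ c) := (m :- con 0ℚ) :* c) refl (fromℕ m) (altBinom m 0)
∑-altBinom-partial m (suc L) = begin
  fromℕ m * (∑ (suc L) (altBinom m) + altBinom m (suc L))
    ≡⟨ *-distribˡ-+ (fromℕ m) (∑ (suc L) (altBinom m)) (altBinom m (suc L)) ⟩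
  fromℕ m * ∑ (suc L) (altBinom m) + fromℕ m * altBinom m (suc L)
    ≡⟨ cong (_+ fromℕ m * altBinom m (suc L)) (∑-altBinom-partial m L) ⟩
  (fromℕ m - fromℕ L) * (binom (fromℕ m) L * s) + fromℕ m * altBinom m (suc L)
    ≡⟨ cong (_+ fromℕ m * altBinom m (suc L)) (trans
         (solve 3 (λ d b s → d :* (b :* s) := b :* d :* s) refl (fromℕ m - fromℕ L) (binom (fromℕ m) L) s)
         (cong (_* s) (sym (binom-suc (fromℕ m) L)))) ⟩
  binom (fromℕ m) (suc L) * fromℕ (suc L) * s + fromℕ m * (binom (fromℕ m) (suc L) * ((- 1ℚ) * s))
    ≡⟨ solve 4 (λ b l s m → b :* l :* s :+ m :* (b :* (:- con 1ℚ :* s)) := (m :- l) :* (b :* (:- con 1ℚ :* s))) refl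
         (binom (fromℕ m) (suc L)) (fromℕ (suc L)) s (fromℕ m) ⟩
  (fromℕ m - fromℕ (suc L)) * altBinom m (suc L) ∎
  where
  open ≡-Reasoning
  s = (- 1ℚ) ^ L

∑-altBinom : ∀ m → ∑ (suc (suc m)) (altBinom (suc m)) ≡ 0ℚ
∑-altBinom m = *-cancelˡ-≢0 (fromℕ (suc m)) (fromℕ-suc≢0 m) (begin
  fromℕ (suc m) * ∑ (suc (suc m)) (altBinom (suc m))  ≡⟨ ∑-altBinom-partial (suc m) (suc m) ⟩
  (fromℕ (suc m) - fromℕ (suc m)) * altBinom (suc m) (suc m)  ≡⟨ cong (_* altBinom (suc m) (suc m)) (+-inverseʳ (fromℕ (suc m))) ⟩
  0ℚ * altBinom (suc m) (suc m)  ≡⟨ *-zeroˡ (altBinom (suc m) (suc m)) ⟩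
  0ℚ  ≡⟨ *-zeroʳ (fromℕ (suc m)) ⟨
  fromℕ (suc m) * 0ℚ  ∎)
  where open ≡-Reasoning

-- The term ℓ = suc m on the right vanishes.
∑-altBinom-pred : ∀ m (g : ℕ → ℚ) →
  fromℕ (suc m) * ∑ (suc m) (λ ℓ → altBinom m ℓ * g ℓ)
  ≡ ∑ (suc (suc m)) (λ ℓ → (fromℕ (suc m) - fromℕ ℓ) * (altBinom (suc m) ℓ * g ℓ))
∑-altBinom-pred m g = begin
  fromℕ (suc m) * ∑ (suc m) (λ ℓ → altBinom m ℓ * g ℓ)
    ≡⟨ ∑-*ˡ (suc m) (fromℕ (suc m)) (λ ℓ → altBinom m ℓ * g ℓ) ⟨
  ∑ (suc m) (λ ℓ → fromℕ (suc m) * (altBinom m ℓ * g ℓ))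
    ≡⟨ ∑-cong (suc m) (λ ℓ _ → trans (sym (*-assoc (fromℕ (suc m)) (altBinom m ℓ) (g ℓ)))
         (trans (cong (_* g ℓ) (altBinom-pred m ℓ)) (*-assoc (fromℕ (suc m) - fromℕ ℓ) (altBinom (suc m) ℓ) (g ℓ)))) ⟩
  ∑ (suc m) F
    ≡⟨ +-identityʳ (∑ (suc m) F) ⟨
  ∑ (suc m) F + 0ℚ
    ≡⟨ cong (λ s → ∑ (suc m) F + s) (trans (cong (_* (altBinom (suc m) (suc m) * g (suc m))) (+-inverseʳ (fromℕ (suc m))))
         (*-zeroˡ (altBinom (suc m) (suc m) * g (suc m)))) ⟨
  ∑ (suc (suc m)) F ∎
  where
  open ≡-Reasoning
  F : ℕ → ℚ
  F ℓ = (fromℕ (suc m) - fromℕ ℓ) * (altBinom (suc m) ℓ * g ℓ)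

-- The exact distribution

module Formula (k : ℕ) where

  K : ℚ
  K = fromℕ k

  -- The common denominator of the ratios of consecutive values of `X`, `W` and `Y ℓ`.
  scale : ℕ → ℚ
  scale n = fromℕ (suc n) * fromℕ (suc k)

  scale≢0 : ∀ n → scale n ≢ 0ℚ
  scale≢0 n = *-≢0 (fromℕ-suc≢0 n) (fromℕ-suc≢0 k)

  ins : ℕ → ℚ
  ins n = fromℕ (insertions {k} n)

  ins-def : ∀ n → ins n ≡ 1ℚ + (1ℚ + K) * fromℕ n
  ins-def n = trans (fromℕ-suc (suc k ℕ.* n)) (cong (λ s → 1ℚ + s)
    (trans (fromℕ-* (suc k) n) (cong (_* fromℕ n) (fromℕ-suc k))))

  0<ins : ∀ n → 0ℚ < ins n
  0<ins n = 0<fromℕ-suc (suc k ℕ.* n)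

  scale-def : ∀ n → scale n ≡ (1ℚ + fromℕ n) * (1ℚ + K)
  scale-def n = cong₂ _*_ (fromℕ-suc n) (fromℕ-suc k)

  shift : ℕ → ℚ
  shift ℓ = fromℕ (k ℕ.* (ℓ ℕ.+ 2))

  shift-def : ∀ ℓ → shift ℓ ≡ K * (fromℕ ℓ + fromℕ 2)
  shift-def ℓ = trans (fromℕ-* k (ℓ ℕ.+ 2)) (cong (K *_) (fromℕ-+ ℓ 2))

  denom : ℕ → ℚ
  denom ℓ = fromℕ (k ℕ.* (ℓ ℕ.+ 2) ℕ.+ 1)

  denom-def : ∀ ℓ → denom ℓ ≡ shift ℓ + 1ℚ
  denom-def ℓ = fromℕ-+ (k ℕ.* (ℓ ℕ.+ 2)) 1

  0<denom : ∀ ℓ → 0ℚ < denom ℓ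
  0<denom ℓ = 0<fromℕ {k ℕ.* (ℓ ℕ.+ 2) ℕ.+ 1} (ℕ.m≤n+m 1 (k ℕ.* (ℓ ℕ.+ 2)))

  denom≢0 : ∀ ℓ → denom ℓ ≢ 0ℚ
  denom≢0 ℓ = 0<⇒≢0 (0<denom ℓ)

  -- `W n` is the number of trees divided by n! (k + 1)^n: both are products of the factors `ins j`,
  -- up to the denominators `scale j`.
  X W : ℕ → ℚ
  X n = binom (fromℕ n + + 1 / suc k) n
  W n = binom (fromℕ n - + k / suc k) n

  Y : ℕ → ℕ → ℚ
  Y ℓ n = binom (fromℕ n - + (k ℕ.* (ℓ ℕ.+ 2)) / suc k) n

  diagonal-suc : ∀ x y → fromℕ (suc k) * x ≡ y → ∀ n →
    binom (fromℕ (suc n) + x) (suc n) * scale n ≡ binom (fromℕ n + x) n * (scale n + y)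
  diagonal-suc x y eq n = begin
    binom (fromℕ (suc n) + x) (suc n) * (fromℕ (suc n) * fromℕ (suc k))
      ≡⟨ *-assoc (binom (fromℕ (suc n) + x) (suc n)) (fromℕ (suc n)) (fromℕ (suc k)) ⟨
    binom (fromℕ (suc n) + x) (suc n) * fromℕ (suc n) * fromℕ (suc k)
      ≡⟨ cong (_* fromℕ (suc k)) (binom-diagonal-suc x n) ⟩
    binom (fromℕ n + x) n * (fromℕ (suc n) + x) * fromℕ (suc k)
      ≡⟨ solve 4 (λ b n x k → b :* (n :+ x) :* k := b :* (n :* k :+ k :* x)) refl
           (binom (fromℕ n + x) n) (fromℕ (suc n)) x (fromℕ (suc k)) ⟩
    binom (fromℕ n + x) n * (scale n + fromℕ (suc k) * x)
      ≡⟨ cong (λ y → binom (fromℕ n + x) n * (scale n + y)) eq ⟩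
    binom (fromℕ n + x) n * (scale n + y) ∎
    where open ≡-Reasoning

  *-neg-/ : ∀ a → fromℕ (suc k) * (- (+ a / suc k)) ≡ - fromℕ a
  *-neg-/ a = trans (sym (neg-distribʳ-* (fromℕ (suc k)) (+ a / suc k))) (cong -_ (fromℕ-*-/ a k))

  X-suc : ∀ n → X (suc n) * scale n ≡ X n * (scale n + 1ℚ)
  X-suc = diagonal-suc (+ 1 / suc k) 1ℚ (fromℕ-*-/ 1 k)

  Y-suc : ∀ ℓ n → Y ℓ (suc n) * scale n ≡ Y ℓ n * (scale n - shift ℓ)
  Y-suc ℓ = diagonal-suc (- (+ (k ℕ.* (ℓ ℕ.+ 2)) / suc k)) (- shift ℓ) (*-neg-/ (k ℕ.* (ℓ ℕ.+ 2)))

  W-suc : ∀ n → W (suc n) * scale n ≡ W n * ins n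
  W-suc n = trans (diagonal-suc (- (+ k / suc k)) (- K) (*-neg-/ k) n) (cong (W n *_) (begin
    scale n - K  ≡⟨ cong (_- K) (scale-def n) ⟩
    (1ℚ + fromℕ n) * (1ℚ + K) - K  ≡⟨ solve 2 (λ n k → (con 1ℚ :+ n) :* (con 1ℚ :+ k) :- k := con 1ℚ :+ (con 1ℚ :+ k) :* n) refl (fromℕ n) K ⟩
    1ℚ + (1ℚ + K) * fromℕ n  ≡⟨ ins-def n ⟨
    ins n  ∎))
    where open ≡-Reasoning

  scale+1 : ∀ n → scale n + 1ℚ ≡ ins (suc n)
  scale+1 n = begin
    scale n + 1ℚ  ≡⟨ cong (_+ 1ℚ) (scale-def n) ⟩
    (1ℚ + fromℕ n) * (1ℚ + K) + 1ℚ  ≡⟨ solve 2 (λ n k → (con 1ℚ :+ n) :* (con 1ℚ :+ k) :+ con 1ℚ := con 1ℚ :+ (con 1ℚ :+ k) :* (con 1ℚ :+ n)) refl (fromℕ n) K ⟩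
    1ℚ + (1ℚ + K) * (1ℚ + fromℕ n)  ≡⟨ cong (λ s → 1ℚ + (1ℚ + K) * s) (fromℕ-suc n) ⟨
    1ℚ + (1ℚ + K) * fromℕ (suc n)  ≡⟨ ins-def (suc n) ⟨
    ins (suc n)  ∎
    where open ≡-Reasoning

  -- The ratio of consecutive values has numerator `ins (suc n)` for `X` and `ins n` for `W`, so the
  -- quotient telescopes. This matches the contribution of newly inserted nodes in the count with
  -- the inhomogeneous term `X n` of the formula.
  X≡ins*W : ∀ n → X n ≡ ins n * W n
  X≡ins*W zero    = cong (λ s → fromℕ (suc s) * 1ℚ) (sym (ℕ.*-zeroʳ k))
  X≡ins*W (suc n) = *-cancelʳ-≢0 (scale n) (scale≢0 n) (begin
    X (suc n) * scale n  ≡⟨ X-suc n ⟩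
    X n * (scale n + 1ℚ)  ≡⟨ cong₂ _*_ (X≡ins*W n) (scale+1 n) ⟩
    ins n * W n * ins (suc n)  ≡⟨ solve 3 (λ a b c → a :* b :* c := c :* (b :* a)) refl (ins n) (W n) (ins (suc n)) ⟩
    ins (suc n) * (W n * ins n)  ≡⟨ cong (ins (suc n) *_) (W-suc n) ⟨
    ins (suc n) * (W (suc n) * scale n)  ≡⟨ *-assoc (ins (suc n)) (W (suc n)) (scale n) ⟨
    ins (suc n) * W (suc n) * scale n  ∎)
    where open ≡-Reasoning

  0<W : ∀ n → 0ℚ < W n
  0<W zero    = positive⁻¹ 1ℚ
  0<W (suc n) = *-cancelʳ-<-nonNeg (scale n) {{nonNegative (0≤p*q (0≤fromℕ (suc n)) (0≤fromℕ (suc k)))}}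
    (subst₂ _<_ (sym (*-zeroˡ (scale n))) (sym (W-suc n)) (0<p*q (0<W n) (0<ins n)))

  g : ℕ → ℕ → ℚ
  g n ℓ = (1ℚ ÷₀ denom ℓ) * (X n - Y ℓ n)

  -- The factors in the recurrences of `X` and `Y ℓ` differ by 1 + shift ℓ, which is `denom ℓ` and
  -- cancels the coefficient. The inhomogeneous term is thus free of ℓ, so its alternating sum
  -- vanishes for m > 0.
  g-suc : ∀ n ℓ → scale n * g (suc n) ℓ ≡ (scale n - shift ℓ) * g n ℓ + X n
  g-suc n ℓ = begin
    scale n * (i * (X (suc n) - Y ℓ (suc n)))
      ≡⟨ solve 4 (λ s i x y → s :* (i :* (x :- y)) := i :* (x :* s :- y :* s)) refl (scale n) i (X (suc n)) (Y ℓ (suc n)) ⟩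
    i * (X (suc n) * scale n - Y ℓ (suc n) * scale n)
      ≡⟨ cong₂ (λ a b → i * (a - b)) (X-suc n) (Y-suc ℓ n) ⟩
    i * (X n * (scale n + 1ℚ) - Y ℓ n * (scale n - shift ℓ))
      ≡⟨ solve 5 (λ i x y s c → i :* (x :* (s :+ con 1ℚ) :- y :* (s :- c)) := (s :- c) :* (i :* (x :- y)) :+ i :* (c :+ con 1ℚ) :* x)
           refl i (X n) (Y ℓ n) (scale n) (shift ℓ) ⟩
    (scale n - shift ℓ) * g n ℓ + i * (shift ℓ + 1ℚ) * X n
      ≡⟨ cong (λ s → (scale n - shift ℓ) * g n ℓ + s) (trans (cong (_* X n)
           (trans (cong (i *_) (sym (denom-def ℓ))) (÷₀-* 1ℚ (denom≢0 ℓ)))) (*-identityˡ (X n))) ⟩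
    (scale n - shift ℓ) * g n ℓ + X n ∎
    where
    open ≡-Reasoning
    i = 1ℚ ÷₀ denom ℓ

  altSum : ℕ → (ℕ → ℚ) → ℚ
  altSum m f = ∑ (suc m) (λ ℓ → altBinom m ℓ * f ℓ)

  altSum-0 : ∀ f → altSum 0 f ≡ f 0
  altSum-0 f = trans (+-identityˡ (1ℚ * f 0)) (*-identityˡ (f 0))

  weightedSum : ℕ → (ℕ → ℚ) → ℚ
  weightedSum m f = ∑ (suc m) (λ ℓ → (fromℕ m - fromℕ ℓ) * (altBinom m ℓ * f ℓ))

  -- The factor m - ℓ turns C(m, ℓ) into m C(m - 1, ℓ). For m = 0 both sides are 0, so the value of
  -- `ℕ.pred 0` does not matter.
  weightedSum-pred : ∀ m f → weightedSum m f ≡ fromℕ m * altSum (ℕ.pred m) f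
  weightedSum-pred zero    f = trans (+-identityˡ (0ℚ * (altBinom 0 0 * f 0)))
    (trans (*-zeroˡ (altBinom 0 0 * f 0)) (sym (*-zeroˡ (altSum 0 f))))
  weightedSum-pred (suc m) f = sym (∑-altBinom-pred m f)

  ∑-altBinom-indicator : ∀ m → ∑ (suc m) (altBinom m) ≡ fromℕ (indicator (0 ℕ.≟ m))
  ∑-altBinom-indicator zero    = refl
  ∑-altBinom-indicator (suc m) = ∑-altBinom m

  -- The counterpart of `degreeCount-suc`. The coefficient of the ℓ-th term splits as k (m - ℓ) +
  -- ins n: the first part lowers m by one, the second gives the diagonal term.
  altSum-g-suc : ∀ n m →
    scale n * altSum m (g (suc n)) + altSum m (g n) * (K * fromℕ (suc m))
    ≡ altSum (ℕ.pred m) (g n) * (K * fromℕ m) + altSum m (g n) * ins n + fromℕ (indicator (0 ℕ.≟ m)) * X n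
  altSum-g-suc n m = begin
    scale n * altSum m (g (suc n)) + altSum m (g n) * (K * fromℕ (suc m))
      ≡⟨ cong₂ _+_ (sym (∑-*ˡ (suc m) (scale n) _)) (trans (*-comm (altSum m (g n)) (K * fromℕ (suc m))) (sym (∑-*ˡ (suc m) (K * fromℕ (suc m)) _))) ⟩
    ∑ (suc m) (λ ℓ → scale n * (altBinom m ℓ * g (suc n) ℓ)) + ∑ (suc m) (λ ℓ → (K * fromℕ (suc m)) * (altBinom m ℓ * g n ℓ))
      ≡⟨ ∑-+ (suc m) _ _ ⟨
    ∑ (suc m) (λ ℓ → scale n * (altBinom m ℓ * g (suc n) ℓ) + (K * fromℕ (suc m)) * (altBinom m ℓ * g n ℓ))
      ≡⟨ ∑-cong (suc m) (λ ℓ _ → term ℓ) ⟩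
    ∑ (suc m) (λ ℓ → (K * ((fromℕ m - fromℕ ℓ) * (altBinom m ℓ * g n ℓ)) + ins n * (altBinom m ℓ * g n ℓ)) + X n * altBinom m ℓ)
      ≡⟨ trans (∑-+ (suc m) _ _) (cong₂ _+_ (trans (∑-+ (suc m) _ _) (cong₂ _+_ (∑-*ˡ (suc m) K _) (∑-*ˡ (suc m) (ins n) _))) (∑-*ˡ (suc m) (X n) (altBinom m))) ⟩
    K * weightedSum m (g n) + ins n * altSum m (g n) + X n * ∑ (suc m) (altBinom m)
      ≡⟨ cong₂ (λ a b → K * a + ins n * altSum m (g n) + X n * b) (weightedSum-pred m (g n)) (∑-altBinom-indicator m) ⟩
    K * (fromℕ m * altSum (ℕ.pred m) (g n)) + ins n * altSum m (g n) + X n * fromℕ (indicator (0 ℕ.≟ m))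
      ≡⟨ cong₂ _+_ (cong₂ _+_ (solve 3 (λ k m a → k :* (m :* a) := a :* (k :* m)) refl K (fromℕ m) (altSum (ℕ.pred m) (g n)))
           (*-comm (ins n) (altSum m (g n)))) (*-comm (X n) (fromℕ (indicator (0 ℕ.≟ m)))) ⟩
    altSum (ℕ.pred m) (g n) * (K * fromℕ m) + altSum m (g n) * ins n + fromℕ (indicator (0 ℕ.≟ m)) * X n ∎
    where
    open ≡-Reasoning
    coefficient : ∀ ℓ → scale n - shift ℓ + K * fromℕ (suc m) ≡ K * (fromℕ m - fromℕ ℓ) + ins n
    coefficient ℓ = begin
      scale n - shift ℓ + K * fromℕ (suc m)
        ≡⟨ cong₂ (λ a b → a - b + K * fromℕ (suc m)) (scale-def n) (shift-def ℓ) ⟩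
      (1ℚ + fromℕ n) * (1ℚ + K) - K * (fromℕ ℓ + fromℕ 2) + K * fromℕ (suc m)
        ≡⟨ cong (λ s → (1ℚ + fromℕ n) * (1ℚ + K) - K * (fromℕ ℓ + fromℕ 2) + K * s) (fromℕ-suc m) ⟩
      (1ℚ + fromℕ n) * (1ℚ + K) - K * (fromℕ ℓ + fromℕ 2) + K * (1ℚ + fromℕ m)
        ≡⟨ solve 4 (λ n k l m → (con 1ℚ :+ n) :* (con 1ℚ :+ k) :- k :* (l :+ con (fromℕ 2)) :+ k :* (con 1ℚ :+ m)
              := k :* (m :- l) :+ (con 1ℚ :+ (con 1ℚ :+ k) :* n)) refl (fromℕ n) K (fromℕ ℓ) (fromℕ m) ⟩
      K * (fromℕ m - fromℕ ℓ) + (1ℚ + (1ℚ + K) * fromℕ n)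
        ≡⟨ cong (λ s → K * (fromℕ m - fromℕ ℓ) + s) (ins-def n) ⟨
      K * (fromℕ m - fromℕ ℓ) + ins n ∎
    term : ∀ ℓ → scale n * (altBinom m ℓ * g (suc n) ℓ) + (K * fromℕ (suc m)) * (altBinom m ℓ * g n ℓ)
           ≡ (K * ((fromℕ m - fromℕ ℓ) * (altBinom m ℓ * g n ℓ)) + ins n * (altBinom m ℓ * g n ℓ)) + X n * altBinom m ℓ
    term ℓ = begin
      scale n * (b * g (suc n) ℓ) + (K * fromℕ (suc m)) * (b * g n ℓ)
        ≡⟨ cong (_+ (K * fromℕ (suc m)) * (b * g n ℓ)) (trans
             (solve 3 (λ s b g → s :* (b :* g) := b :* (s :* g)) refl (scale n) b (g (suc n) ℓ)) (cong (b *_) (g-suc n ℓ))) ⟩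
      b * ((scale n - shift ℓ) * g n ℓ + X n) + (K * fromℕ (suc m)) * (b * g n ℓ)
        ≡⟨ solve 5 (λ b s g x e → b :* (s :* g :+ x) :+ e :* (b :* g) := (s :+ e) :* (b :* g) :+ x :* b) refl
             b (scale n - shift ℓ) (g n ℓ) (X n) (K * fromℕ (suc m)) ⟩
      (scale n - shift ℓ + K * fromℕ (suc m)) * (b * g n ℓ) + X n * b
        ≡⟨ cong (λ s → s * (b * g n ℓ) + X n * b) (coefficient ℓ) ⟩
      (K * (fromℕ m - fromℕ ℓ) + ins n) * (b * g n ℓ) + X n * b
        ≡⟨ solve 5 (λ k d i t x → (k :* d :+ i) :* t :+ x := k :* (d :* t) :+ i :* t :+ x) refl
             K (fromℕ m - fromℕ ℓ) (ins n) (b * g n ℓ) (X n * b) ⟩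
      (K * ((fromℕ m - fromℕ ℓ) * (b * g n ℓ)) + ins n * (b * g n ℓ)) + X n * b ∎
      where b = altBinom m ℓ

  t : ℕ → ℚ
  t n = fromℕ (treeCount {k} n)

  N : ℕ → ℕ → ℚ
  N n m = fromℕ (degreeCount {k} n m)

  t-suc : ∀ n → t (suc n) ≡ ins n * t n
  t-suc n = trans (cong fromℕ (treeCount-suc {k} n)) (fromℕ-* (insertions {k} n) (treeCount {k} n))

  0<t : ∀ n → 0ℚ < t n
  0<t zero    = positive⁻¹ 1ℚ
  0<t (suc n) = subst (0ℚ <_) (sym (t-suc n)) (0<p*q (0<ins n) (0<t n))

  N-suc : ∀ n m → N (suc n) m + N n m * (K * fromℕ (suc m))
    ≡ N n (ℕ.pred m) * (K * fromℕ m) + N n m * ins n + t n * (ins n * fromℕ (indicator (0 ℕ.≟ m)))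
  N-suc n m = begin
    N (suc n) m + N n m * (K * fromℕ (suc m))
      ≡⟨ cong (λ s → N (suc n) m + s) (trans (fromℕ-* (degreeCount {k} n m) (k ℕ.* suc m)) (cong (N n m *_) (fromℕ-* k (suc m)))) ⟨
    N (suc n) m + fromℕ (degreeCount {k} n m ℕ.* (k ℕ.* suc m))
      ≡⟨ trans (sym (fromℕ-+ (degreeCount {k} (suc n) m) _)) (trans (cong fromℕ (degreeCount-suc {k} n m))
           (trans (fromℕ-+ (degreeCount {k} n (ℕ.pred m) ℕ.* (k ℕ.* m) ℕ.+ degreeCount {k} n m ℕ.* insertions {k} n) _)
             (cong (_+ fromℕ (treeCount {k} n ℕ.* (insertions {k} n ℕ.* indicator (0 ℕ.≟ m))))
               (fromℕ-+ (degreeCount {k} n (ℕ.pred m) ℕ.* (k ℕ.* m)) (degreeCount {k} n m ℕ.* insertions {k} n))))) ⟩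
    fromℕ (degreeCount {k} n (ℕ.pred m) ℕ.* (k ℕ.* m)) + fromℕ (degreeCount {k} n m ℕ.* insertions {k} n)
      + fromℕ (treeCount {k} n ℕ.* (insertions {k} n ℕ.* indicator (0 ℕ.≟ m)))
      ≡⟨ cong₂ _+_ (cong₂ _+_ (trans (fromℕ-* (degreeCount {k} n (ℕ.pred m)) (k ℕ.* m)) (cong (N n (ℕ.pred m) *_) (fromℕ-* k m)))
                              (fromℕ-* (degreeCount {k} n m) (insertions {k} n)))
           (trans (fromℕ-* (treeCount {k} n) (insertions {k} n ℕ.* indicator (0 ℕ.≟ m)))
             (cong (t n *_) (fromℕ-* (insertions {k} n) (indicator (0 ℕ.≟ m))))) ⟩
    N n (ℕ.pred m) * (K * fromℕ m) + N n m * ins n + t n * (ins n * fromℕ (indicator (0 ℕ.≟ m))) ∎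
    where open ≡-Reasoning

  -- The exact formula cleared of its denominators, by induction on n: both sides obey the same
  -- recurrence. In this form it includes n = 0, where both sides vanish.
  N*W≡t*altSum : ∀ n m → N n m * W n ≡ t n * altSum m (g n)
  N*W≡t*altSum zero m = trans (*-zeroˡ (W 0)) (sym (trans (*-identityˡ (altSum m (g 0)))
    (trans (∑-cong (suc m) (λ ℓ _ → trans (cong (altBinom m ℓ *_) (*-zeroʳ (1ℚ ÷₀ denom ℓ))) (trans (*-zeroʳ (altBinom m ℓ)) (sym (*-zeroˡ 0ℚ)))))
      (trans (∑-*ˡ (suc m) 0ℚ (λ _ → 0ℚ)) (*-zeroˡ (∑ (suc m) (λ _ → 0ℚ)))))))
  -- Both recurrences carry their negative term on the left, so it is added on both sides before
  -- `scale n` is cancelled.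
  N*W≡t*altSum (suc n) m = *-cancelʳ-≢0 (scale n) (scale≢0 n) (+-cancelʳ-≡ (ins n * (N n m * W n) * c) (begin
    N (suc n) m * W (suc n) * scale n + ins n * (N n m * W n) * c
      ≡⟨ cong (_+ ins n * (N n m * W n) * c) (trans (*-assoc (N (suc n) m) (W (suc n)) (scale n)) (cong (N (suc n) m *_) (W-suc n))) ⟩
    N (suc n) m * (W n * ins n) + ins n * (N n m * W n) * c
      ≡⟨ solve 5 (λ a w i b c → a :* (w :* i) :+ i :* (b :* w) :* c := i :* w :* (a :+ b :* c)) refl (N (suc n) m) (W n) (ins n) (N n m) c ⟩
    ins n * W n * (N (suc n) m + N n m * c)
      ≡⟨ cong (ins n * W n *_) (N-suc n m) ⟩
    ins n * W n * (N n (ℕ.pred m) * (K * fromℕ m) + N n m * ins n + t n * (ins n * δ))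
      ≡⟨ distribute (ins n) (W n) (N n (ℕ.pred m)) (K * fromℕ m) (N n m) (t n) δ ⟩
    ins n * (N n (ℕ.pred m) * W n * (K * fromℕ m) + N n m * W n * ins n + t n * (δ * (ins n * W n)))
      ≡⟨ cong₂ (λ a b → ins n * (a * (K * fromℕ m) + b * ins n + t n * (δ * (ins n * W n)))) (N*W≡t*altSum n (ℕ.pred m)) (N*W≡t*altSum n m) ⟩
    ins n * (t n * S⁻ * (K * fromℕ m) + t n * S * ins n + t n * (δ * (ins n * W n)))
      ≡⟨ cong (λ x → ins n * (t n * S⁻ * (K * fromℕ m) + t n * S * ins n + t n * (δ * x))) (X≡ins*W n) ⟨
    ins n * (t n * S⁻ * (K * fromℕ m) + t n * S * ins n + t n * (δ * X n))
      ≡⟨ factor (ins n) (t n) S⁻ (K * fromℕ m) S (δ * X n) ⟩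
    ins n * t n * (S⁻ * (K * fromℕ m) + S * ins n + δ * X n)
      ≡⟨ cong (ins n * t n *_) (altSum-g-suc n m) ⟨
    ins n * t n * (scale n * S⁺ + S * c)
      ≡⟨ solve 6 (λ i t s p q c → i :* t :* (s :* p :+ q :* c) := i :* t :* p :* s :+ i :* (t :* q) :* c) refl (ins n) (t n) (scale n) S⁺ S c ⟩
    ins n * t n * S⁺ * scale n + ins n * (t n * S) * c
      ≡⟨ cong₂ (λ a b → a * S⁺ * scale n + ins n * b * c) (t-suc n) (N*W≡t*altSum n m) ⟨
    t (suc n) * S⁺ * scale n + ins n * (N n m * W n) * c ∎))
    where
    open ≡-Reasoning
    S⁻ = altSum (ℕ.pred m) (g n)
    S = altSum m (g n)
    S⁺ = altSum m (g (suc n))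
    c = K * fromℕ (suc m)
    δ = fromℕ (indicator (0 ℕ.≟ m))
    +-cancelʳ-≡ : ∀ r {p q} → p + r ≡ q + r → p ≡ q
    +-cancelʳ-≡ r {p} {q} eq = trans (solve 2 (λ p r → p := p :+ r :- r) refl p r)
      (trans (cong (_- r) eq) (solve 2 (λ q r → q :+ r :- r := q) refl q r))
    distribute : ∀ i w a b c t d → i * w * (a * b + c * i + t * (i * d)) ≡ i * (a * w * b + c * w * i + t * (d * (i * w)))
    distribute = solve 7 (λ i w a b c t d → i :* w :* (a :* b :+ c :* i :+ t :* (i :* d)) := i :* (a :* w :* b :+ c :* w :* i :+ t :* (d :* (i :* w)))) refl
    factor : ∀ i t a b c d → i * (t * a * b + t * c * i + t * d) ≡ i * t * (a * b + c * i + d)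
    factor = solve 6 (λ i t a b c d → i :* (t :* a :* b :+ t :* c :* i :+ t :* d) := i :* t :* (a :* b :+ c :* i :+ d)) refl

  ∑-exact : ∀ n m → ∑ (suc m) (λ ℓ → altBinom m ℓ ÷₀ denom ℓ * (X n - Y ℓ n)) ≡ altSum m (g n)
  ∑-exact n m = ∑-cong (suc m) (λ ℓ _ → trans (cong (_* (X n - Y ℓ n))
    (trans (cong (_÷₀ denom ℓ) (sym (*-identityʳ (altBinom m ℓ)))) (*-÷₀-assoc (altBinom m ℓ) 1ℚ (denom≢0 ℓ))))
    (*-assoc (altBinom m ℓ) (1ℚ ÷₀ denom ℓ) (X n - Y ℓ n)))

  exactProbability-eq : ∀ n m → exactProbability k n m ≡ 1ℚ ÷₀ (fromℕ n * W n) * altSum m (g n)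
  exactProbability-eq n m = cong (1ℚ ÷₀ (fromℕ n * W n) *_) (∑-exact n m)

  probability-exact : ∀ n .{{_ : ℕ.NonZero n}} m → ℙ[Ȳ_≡_] {k} n m ≡ exactProbability k n m
  probability-exact n@(suc n-1) m = begin
    ℙ[Ȳ_≡_] {k} n m  ≡⟨ cong₂ _÷₀_ (cong fromℕ numerator) (trans (cong fromℕ denominator) (fromℕ-* (treeCount {k} n) n)) ⟩
    N n m ÷₀ (t n * fromℕ n)  ≡⟨ ÷₀-unique (*-≢0 (0<⇒≢0 (0<t n)) (fromℕ-suc≢0 n-1)) (*-cancelʳ-≢0 (W n) (0<⇒≢0 (0<W n)) (begin
      i * altSum m (g n) * (t n * fromℕ n) * W n  ≡⟨ solve 5 (λ i s t n w → i :* s :* (t :* n) :* w := i :* (n :* w) :* (t :* s)) refl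
                                                         i (altSum m (g n)) (t n) (fromℕ n) (W n) ⟩
      i * (fromℕ n * W n) * (t n * altSum m (g n))  ≡⟨ cong₂ _*_ (÷₀-* 1ℚ (*-≢0 (fromℕ-suc≢0 n-1) (0<⇒≢0 (0<W n)))) (sym (N*W≡t*altSum n m)) ⟩
      1ℚ * (N n m * W n)  ≡⟨ *-identityˡ (N n m * W n) ⟩
      N n m * W n  ∎)) ⟩
    i * altSum m (g n)  ≡⟨ exactProbability-eq n m ⟨
    exactProbability k n m  ∎
    where
    open ≡-Reasoning
    i = 1ℚ ÷₀ (fromℕ n * W n)
    Ts = allTrees k n
    us = insertedNodes k n
    numerator : length (filter (λ (T , u) → outDegree T u ℕ.≟ m) (cartesianProduct Ts us)) ≡ degreeCount {k} n m
    numerator = trans (length-filter≡total (λ (T , u) → outDegree T u ℕ.≟ m) (cartesianProduct Ts us))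
      (total-cartesianProduct (λ (T , u) → indicator (outDegree T u ℕ.≟ m)) Ts us)
    denominator : length (cartesianProduct Ts us) ≡ treeCount {k} n ℕ.* n
    denominator = begin
      length (cartesianProduct Ts us)  ≡⟨ length≡total (cartesianProduct Ts us) ⟩
      total (λ _ → 1) (cartesianProduct Ts us)  ≡⟨ total-cartesianProduct (λ _ → 1) Ts us ⟩
      total (λ _ → total (λ _ → 1) us) Ts  ≡⟨ total-const (total (λ _ → 1) us) Ts ⟩
      length Ts ℕ.* total (λ _ → 1) us  ≡⟨ cong (length Ts ℕ.*_) (length≡total us) ⟨
      length Ts ℕ.* length us  ≡⟨ cong (length Ts ℕ.*_) (length-applyUpTo (node {k} ∘ suc) n) ⟩
      length Ts ℕ.* n  ∎

-- Convergence to the limit law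

p*n≤1⇒p≤1/n : ∀ {p} n → p * fromℕ (suc n) ≤ 1ℚ → p ≤ + 1 / suc n
p*n≤1⇒p≤1/n {p} n le = *-cancelʳ-≤-pos (fromℕ (suc n)) {{positive (0<fromℕ-suc n)}}
  (subst (p * fromℕ (suc n) ≤_) (trans (sym (fromℕ-*-/ 1 n)) (*-comm (fromℕ (suc n)) (+ 1 / suc n))) le)

∣-∣-decreasing : ∀ (a : ℕ → ℚ) N → (∀ n → N ℕ.≤ n → ∣ a (suc n) ∣ ≤ ∣ a n ∣) → ∀ n → N ℕ.≤ n → ∣ a n ∣ ≤ ∣ a N ∣
∣-∣-decreasing a N step n N≤n with ℕ.m≤n⇒m<n∨m≡n N≤n
... | inj₂ refl = ≤-refl
∣-∣-decreasing a N step (suc n) _ | inj₁ (s≤s N≤n) = ≤-trans (step n N≤n) (∣-∣-decreasing a N step n N≤n)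

∣∑∣≤∑ : ∀ n f (h : ℕ → ℚ) → (∀ i → i ℕ.< n → ∣ f i ∣ ≤ h i) → ∣ ∑ n f ∣ ≤ ∑ n h
∣∑∣≤∑ zero    f h f≤h = ≤-refl
∣∑∣≤∑ (suc n) f h f≤h = ≤-trans (∣p+q∣≤∣p∣+∣q∣ (∑ n f) (f n))
  (+-mono-≤ (∣∑∣≤∑ n f h (λ i i<n → f≤h i (ℕ.m≤n⇒m≤1+n i<n))) (f≤h n ℕ.≤-refl))

bernoulli : ∀ x → 0ℚ ≤ x → ∀ j → 1ℚ + fromℕ j * x ≤ (1ℚ + x) ^ j
bernoulli x 0≤x zero    = ≤-reflexive (trans (cong (λ s → 1ℚ + s) (*-zeroˡ x)) (+-identityʳ 1ℚ))
bernoulli x 0≤x (suc j) = begin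
  1ℚ + fromℕ (suc j) * x  ≡⟨ cong (λ s → 1ℚ + s * x) (fromℕ-suc j) ⟩
  1ℚ + (1ℚ + fromℕ j) * x  ≡⟨ +-identityʳ (1ℚ + (1ℚ + fromℕ j) * x) ⟨
  1ℚ + (1ℚ + fromℕ j) * x + 0ℚ  ≤⟨ +-monoʳ-≤ (1ℚ + (1ℚ + fromℕ j) * x) (0≤p*q (0≤fromℕ j) (0≤p*q 0≤x 0≤x)) ⟩
  1ℚ + (1ℚ + fromℕ j) * x + fromℕ j * (x * x)  ≡⟨ solve 2 (λ x j → con 1ℚ :+ (con 1ℚ :+ j) :* x :+ j :* (x :* x) := (con 1ℚ :+ x) :* (con 1ℚ :+ j :* x)) refl x (fromℕ j) ⟩
  (1ℚ + x) * (1ℚ + fromℕ j * x)  ≤⟨ *-monoˡ-≤-nonNeg (1ℚ + x) {{nonNegative (+-mono-≤ (0≤fromℕ 1) 0≤x)}} (bernoulli x 0≤x j) ⟩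
  (1ℚ + x) * (1ℚ + x) ^ j  ∎
  where open ≤-Reasoning

⟶ℚ-const : ∀ q → (λ _ → q) ⟶ℚ q
⟶ℚ-const q ε 0<ε = 0 , λ n _ → subst (_≤ ε) (cong ∣_∣ (sym (+-inverseʳ q))) (<⇒≤ 0<ε)

⟶ℚ-+ : ∀ {a b p q} → a ⟶ℚ p → b ⟶ℚ q → (λ n → a n + b n) ⟶ℚ (p + q)
⟶ℚ-+ {a} {b} {p} {q} a⟶p b⟶q ε 0<ε =
  let (M , ha) = a⟶p (½ * ε) (½-pos 0<ε)
      (N , hb) = b⟶q (½ * ε) (½-pos 0<ε)
  in M ℕ.⊔ N , λ n le → let open ≤-Reasoning in begin
    ∣ a n + b n - (p + q) ∣  ≡⟨ cong ∣_∣ (solve 4 (λ a b p q → a :+ b :- (p :+ q) := (a :- p) :+ (b :- q)) refl (a n) (b n) p q) ⟩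
    ∣ (a n - p) + (b n - q) ∣  ≤⟨ ∣p+q∣≤∣p∣+∣q∣ (a n - p) (b n - q) ⟩
    ∣ a n - p ∣ + ∣ b n - q ∣  ≤⟨ +-mono-≤ (ha n (ℕ.m⊔n≤o⇒m≤o M N le)) (hb n (ℕ.m⊔n≤o⇒n≤o M N le)) ⟩
    ½ * ε + ½ * ε  ≡⟨ ½+½ ε ⟩
    ε  ∎

∑-⟶ℚ : ∀ (P : ℕ → ℕ → ℚ) q → (∀ m → (λ n → P n m) ⟶ℚ q m) → ∀ j → (λ n → ∑ j (P n)) ⟶ℚ ∑ j q
∑-⟶ℚ P q P⟶q zero    = ⟶ℚ-const 0ℚ
∑-⟶ℚ P q P⟶q (suc j) = ⟶ℚ-+ {λ n → ∑ j (P n)} {λ n → P n j} (∑-⟶ℚ P q P⟶q j) (P⟶q j)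

-- At a fixed x all the distribution functions are finite sums over the same range, so the limit can
-- be taken term by term.
pointwise⇒⟶ᵈ : ∀ (P : ℕ → ℕ → ℚ) q → (∀ m → (λ n → P n m) ⟶ℚ q m) → P ⟶ᵈ q
pointwise⇒⟶ᵈ P q P⟶q x _ with floor x
... | + j      = ∑-⟶ℚ P q P⟶q (suc j)
... | -[1+ _ ] = ⟶ℚ-const 0ℚ

module LimitLaw (k-1 : ℕ) where

  private
    k : ℕ
    k = suc k-1

  open Formula k

  p : ℕ → ℚ
  p = limitProbability k

  κ : ℚ
  κ = + 1 / suc k

  -- Here the upper argument exceeds the lower one by the constant 1 + 1/k, as `binom-diagonal-suc`
  -- requires. The binomial in `limitProbability k m` is `b (suc m)`.
  b : ℕ → ℚ
  b n = binom (fromℕ n + (1ℚ + + 1 / k)) n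

  b-suc : ∀ n → b (suc n) * (fromℕ (suc n) * K) ≡ b n * denom n
  b-suc n = begin
    b (suc n) * (fromℕ (suc n) * K)  ≡⟨ *-assoc (b (suc n)) (fromℕ (suc n)) K ⟨
    b (suc n) * fromℕ (suc n) * K  ≡⟨ cong (_* K) (binom-diagonal-suc (1ℚ + + 1 / k) n) ⟩
    b n * (fromℕ (suc n) + (1ℚ + + 1 / k)) * K  ≡⟨ solve 4 (λ b n x k → b :* (n :+ (con 1ℚ :+ x)) :* k := b :* (k :* (n :+ con 1ℚ) :+ k :* x)) refl
                                                              (b n) (fromℕ (suc n)) (+ 1 / k) K ⟩
    b n * (K * (fromℕ (suc n) + 1ℚ) + K * (+ 1 / k))  ≡⟨ cong₂ (λ s t → b n * (K * s + t)) n+2 (fromℕ-*-/ 1 k-1) ⟩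
    b n * (K * (fromℕ n + fromℕ 2) + 1ℚ)  ≡⟨ cong (b n *_) (trans (denom-def n) (cong (_+ 1ℚ) (shift-def n))) ⟨
    b n * denom n  ∎
    where
    open ≡-Reasoning
    n+2 : fromℕ (suc n) + 1ℚ ≡ fromℕ n + fromℕ 2
    n+2 = trans (cong (_+ 1ℚ) (fromℕ-suc n)) (solve 1 (λ n → con 1ℚ :+ n :+ con 1ℚ := n :+ con (fromℕ 2)) refl (fromℕ n))

  0<K : 0ℚ < K
  0<K = 0<fromℕ-suc k-1

  0<b : ∀ n → 0ℚ < b n
  0<b zero    = positive⁻¹ 1ℚ
  0<b (suc n) = *-cancelʳ-<-nonNeg (fromℕ (suc n) * K) {{nonNegative (0≤p*q (0≤fromℕ (suc n)) (0≤fromℕ k))}}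
    (subst₂ _<_ (sym (*-zeroˡ (fromℕ (suc n) * K))) (sym (b-suc n)) (0<p*q (0<b n) (0<denom n)))

  q : ℕ → ℚ
  q m = b m * denom m

  q≢0 : ∀ m → q m ≢ 0ℚ
  q≢0 m = 0<⇒≢0 (0<p*q (0<b m) (0<denom m))

  p-def : ∀ m → p m ≡ fromℕ (suc k) ÷₀ q m
  p-def m = cong (fromℕ (suc k) ÷₀_) (begin
    fromℕ (k ℕ.* (m ℕ.+ 1)) * binom (fromℕ (m ℕ.+ 2) + + 1 / k) (m ℕ.+ 1)
      ≡⟨ cong₂ (λ i j → fromℕ (k ℕ.* i) * binom (fromℕ j + + 1 / k) i) (ℕ.+-comm m 1) (ℕ.+-comm m 2) ⟩
    fromℕ (k ℕ.* suc m) * binom (fromℕ (suc (suc m)) + + 1 / k) (suc m)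
      ≡⟨ cong₂ (λ i x → i * binom x (suc m)) (fromℕ-* k (suc m)) (trans (cong (_+ + 1 / k) (fromℕ-suc (suc m)))
           (solve 2 (λ n x → con 1ℚ :+ n :+ x := n :+ (con 1ℚ :+ x)) refl (fromℕ (suc m)) (+ 1 / k))) ⟩
    K * fromℕ (suc m) * b (suc m)
      ≡⟨ solve 3 (λ k n b → k :* n :* b := b :* (n :* k)) refl K (fromℕ (suc m)) (b (suc m)) ⟩
    b (suc m) * (fromℕ (suc m) * K)
      ≡⟨ b-suc m ⟩
    q m ∎)
    where open ≡-Reasoning

  p*q : ∀ m → p m * q m ≡ fromℕ (suc k)
  p*q m = trans (cong (_* q m) (p-def m)) (÷₀-* (fromℕ (suc k)) (q≢0 m))

  0<p : ∀ m → 0ℚ < p m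
  0<p m = subst (0ℚ <_) (sym (p-def m)) (0<÷₀ (0<fromℕ-suc k) (0<p*q (0<b m) (0<denom m)))

  p-suc : ∀ m → p (suc m) * denom (suc m) ≡ p m * (K * fromℕ (suc m))
  p-suc m = *-cancelʳ-≢0 (q m) (q≢0 m) (begin
    p (suc m) * denom (suc m) * (b m * denom m)
      ≡⟨ cong (p (suc m) * denom (suc m) *_) (b-suc m) ⟨
    p (suc m) * denom (suc m) * (b (suc m) * (fromℕ (suc m) * K))
      ≡⟨ solve 5 (λ p d b n k → p :* d :* (b :* (n :* k)) := p :* (b :* d) :* (k :* n)) refl (p (suc m)) (denom (suc m)) (b (suc m)) (fromℕ (suc m)) K ⟩
    p (suc m) * q (suc m) * (K * fromℕ (suc m))
      ≡⟨ cong (_* (K * fromℕ (suc m))) (trans (p*q (suc m)) (sym (p*q m))) ⟩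
    p m * q m * (K * fromℕ (suc m))
      ≡⟨ solve 3 (λ p q c → p :* q :* c := p :* c :* q) refl (p m) (q m) (K * fromℕ (suc m)) ⟩
    p m * (K * fromℕ (suc m)) * q m ∎)
    where open ≡-Reasoning

  p-zero : p 0 * denom 0 ≡ fromℕ (suc k)
  p-zero = trans (cong (p 0 *_) (sym (*-identityˡ (denom 0)))) (p*q 0)

  denom-step : ∀ m → denom m ≡ K * fromℕ (suc m) + fromℕ (suc k)
  denom-step m = begin
    denom m  ≡⟨ trans (denom-def m) (cong (_+ 1ℚ) (shift-def m)) ⟩
    K * (fromℕ m + fromℕ 2) + 1ℚ  ≡⟨ solve 2 (λ k m → k :* (m :+ con (fromℕ 2)) :+ con 1ℚ := k :* (con 1ℚ :+ m) :+ (con 1ℚ :+ k)) refl K (fromℕ m) ⟩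
    K * (1ℚ + fromℕ m) + (1ℚ + K)  ≡⟨ cong₂ (λ s t → K * s + t) (fromℕ-suc m) (fromℕ-suc k) ⟨
    K * fromℕ (suc m) + fromℕ (suc k)  ∎
    where open ≡-Reasoning

  -- ∑_{i ≥ m} p i
  tail : ℕ → ℚ
  tail m = p m * denom m * κ

  -- Since `denom m` is k (m + 1) + (k + 1), its second summand splits off `p m`, and the ratio of
  -- consecutive probabilities turns the first into the next tail.
  tail-suc : ∀ m → p m + tail (suc m) ≡ tail m
  tail-suc m = begin
    p m + p (suc m) * denom (suc m) * κ  ≡⟨ cong₂ (λ s t → s + t * κ) (trans (sym (*-identityʳ (p m))) (cong (p m *_) (sym (fromℕ-*-/ 1 k)))) (p-suc m) ⟩
    p m * (fromℕ (suc k) * κ) + p m * (K * fromℕ (suc m)) * κ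
      ≡⟨ solve 4 (λ p s a c → p :* (s :* c) :+ p :* a :* c := p :* (a :+ s) :* c) refl (p m) (fromℕ (suc k)) (K * fromℕ (suc m)) κ ⟩
    p m * (K * fromℕ (suc m) + fromℕ (suc k)) * κ  ≡⟨ cong (λ s → p m * s * κ) (denom-step m) ⟨
    tail m  ∎
    where open ≡-Reasoning

  ∑p+tail : ∀ n → ∑ n p + tail n ≡ 1ℚ
  ∑p+tail zero    = trans (+-identityˡ (tail 0)) (trans (cong (_* κ) p-zero) (fromℕ-*-/ 1 k))
  ∑p+tail (suc n) = trans (+-assoc (∑ n p) (p n) (tail (suc n))) (trans (cong (λ s → ∑ n p + s) (tail-suc n)) (∑p+tail n))

  0≤tail : ∀ m → 0ℚ ≤ tail m
  0≤tail m = 0≤p*q (0≤p*q (<⇒≤ (0<p m)) (<⇒≤ (0<denom m))) (0≤/ 1 k)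

  tail-denom : ∀ m → tail (suc m) * denom m ≡ tail m * (K * fromℕ (suc m))
  tail-denom m = begin
    p (suc m) * denom (suc m) * κ * denom m  ≡⟨ cong (λ s → s * κ * denom m) (p-suc m) ⟩
    p m * (K * fromℕ (suc m)) * κ * denom m  ≡⟨ solve 4 (λ p a c d → p :* a :* c :* d := p :* d :* c :* a) refl (p m) (K * fromℕ (suc m)) κ (denom m) ⟩
    tail m * (K * fromℕ (suc m))  ∎
    where open ≡-Reasoning

  -- The ratio of consecutive tails is k (m + 1) / denom m, at most (m + 1)/(m + 2) because k (m +
  -- 2) ≤ denom m. So (m + 1) · tail m decreases from its value 1 at m = 0.
  tail-bound : ∀ m → tail m * fromℕ (suc m) ≤ 1ℚ
  tail-bound zero    = ≤-reflexive (trans (*-identityʳ (tail 0)) (trans (sym (+-identityˡ (tail 0))) (∑p+tail 0)))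
  tail-bound (suc m) = *-cancelʳ-≤-pos (denom m) {{positive (0<denom m)}} (begin
    tail (suc m) * fromℕ (suc (suc m)) * denom m  ≡⟨ solve 3 (λ t n d → t :* n :* d := t :* d :* n) refl (tail (suc m)) (fromℕ (suc (suc m))) (denom m) ⟩
    tail (suc m) * denom m * fromℕ (suc (suc m))  ≡⟨ cong (_* fromℕ (suc (suc m))) (tail-denom m) ⟩
    tail m * (K * fromℕ (suc m)) * fromℕ (suc (suc m)) ≡⟨ solve 4 (λ t k n l → t :* (k :* n) :* l := t :* n :* (k :* l)) refl (tail m) K (fromℕ (suc m)) (fromℕ (suc (suc m))) ⟩
    tail m * fromℕ (suc m) * (K * fromℕ (suc (suc m))) ≤⟨ *-mono-≤-nonNeg (0≤p*q (0≤tail m) (0≤fromℕ (suc m))) (<⇒≤ (0<denom m)) (tail-bound m) K*≤denom ⟩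
    1ℚ * denom m  ∎)
    where
    open ≤-Reasoning
    K*≤denom : K * fromℕ (suc (suc m)) ≤ denom m
    K*≤denom = begin
      K * fromℕ (suc (suc m))  ≡⟨ cong (K *_) (fromℕ-suc (suc m)) ⟩
      K * (1ℚ + fromℕ (suc m))  ≡⟨ solve 2 (λ k n → k :* (con 1ℚ :+ n) := k :* n :+ k) refl K (fromℕ (suc m)) ⟩
      K * fromℕ (suc m) + K  ≤⟨ +-monoʳ-≤ (K * fromℕ (suc m)) (fromℕ-mono-≤ (ℕ.n≤1+n k)) ⟩
      K * fromℕ (suc m) + fromℕ (suc k)  ≡⟨ denom-step m ⟨
      denom m  ∎

  isDistribution : IsDistribution p
  isDistribution = (λ m → <⇒≤ (0<p m)) , λ ε 0<ε → ↧ₙ ε , λ n le → begin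
    ∣ ∑ n p - 1ℚ ∣  ≡⟨ cong (λ s → ∣ ∑ n p - s ∣) (∑p+tail n) ⟨
    ∣ ∑ n p - (∑ n p + tail n) ∣  ≡⟨ cong ∣_∣ (solve 2 (λ s t → s :- (s :+ t) := :- t) refl (∑ n p) (tail n)) ⟩
    ∣ - tail n ∣  ≡⟨ trans (∣-p∣≡∣p∣ (tail n)) (0≤p⇒∣p∣≡p (0≤tail n)) ⟩
    tail n  ≤⟨ p*n≤1⇒p≤1/n n (tail-bound n) ⟩
    + 1 / suc n  ≤⟨ 1/n≤ε ε 0<ε n le ⟩
    ε  ∎
    where open ≤-Reasoning

  inv : ℕ → ℚ
  inv ℓ = 1ℚ ÷₀ denom ℓ

  -- With m + 1 as upper index, denom (m + 1) = k (m + 1 - ℓ) + denom ℓ. The second part cancels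
  -- `inv ℓ` and leaves an alternating sum of binomials, which is 0; the first lowers the upper
  -- index to m.
  altSum-inv-suc : ∀ m → altSum (suc m) inv * denom (suc m) ≡ altSum m inv * (K * fromℕ (suc m))
  altSum-inv-suc m = begin
    altSum (suc m) inv * denom (suc m)
      ≡⟨ trans (*-comm (altSum (suc m) inv) (denom (suc m))) (sym (∑-*ˡ (suc (suc m)) (denom (suc m)) _)) ⟩
    ∑ (suc (suc m)) (λ ℓ → denom (suc m) * (altBinom (suc m) ℓ * inv ℓ))
      ≡⟨ ∑-cong (suc (suc m)) (λ ℓ _ → term ℓ) ⟩
    ∑ (suc (suc m)) (λ ℓ → K * ((fromℕ (suc m) - fromℕ ℓ) * (altBinom (suc m) ℓ * inv ℓ)) + altBinom (suc m) ℓ)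
      ≡⟨ trans (∑-+ (suc (suc m)) _ (altBinom (suc m))) (cong₂ _+_ (∑-*ˡ (suc (suc m)) K _) (∑-altBinom m)) ⟩
    K * weightedSum (suc m) inv + 0ℚ
      ≡⟨ trans (+-identityʳ (K * weightedSum (suc m) inv)) (cong (K *_) (weightedSum-pred (suc m) inv)) ⟩
    K * (fromℕ (suc m) * altSum m inv)
      ≡⟨ solve 3 (λ k n s → k :* (n :* s) := s :* (k :* n)) refl K (fromℕ (suc m)) (altSum m inv) ⟩
    altSum m inv * (K * fromℕ (suc m)) ∎
    where
    open ≡-Reasoning
    term : ∀ ℓ → denom (suc m) * (altBinom (suc m) ℓ * inv ℓ)
               ≡ K * ((fromℕ (suc m) - fromℕ ℓ) * (altBinom (suc m) ℓ * inv ℓ)) + altBinom (suc m) ℓ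
    term ℓ = begin
      denom (suc m) * (a * inv ℓ)
        ≡⟨ cong (_* (a * inv ℓ)) (trans (denom-def (suc m)) (cong (_+ 1ℚ) (shift-def (suc m)))) ⟩
      (K * (fromℕ (suc m) + fromℕ 2) + 1ℚ) * (a * inv ℓ)
        ≡⟨ solve 5 (λ k m l a i → (k :* (m :+ con (fromℕ 2)) :+ con 1ℚ) :* (a :* i)
             := k :* ((m :- l) :* (a :* i)) :+ a :* (i :* (k :* (l :+ con (fromℕ 2)) :+ con 1ℚ))) refl
             K (fromℕ (suc m)) (fromℕ ℓ) a (inv ℓ) ⟩
      K * ((fromℕ (suc m) - fromℕ ℓ) * (a * inv ℓ)) + a * (inv ℓ * (K * (fromℕ ℓ + fromℕ 2) + 1ℚ))
        ≡⟨ cong (λ s → K * ((fromℕ (suc m) - fromℕ ℓ) * (a * inv ℓ)) + s) (trans (cong (a *_) (trans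
             (cong (inv ℓ *_) (sym (trans (denom-def ℓ) (cong (_+ 1ℚ) (shift-def ℓ))))) (÷₀-* 1ℚ (denom≢0 ℓ)))) (*-identityʳ a)) ⟩
      K * ((fromℕ (suc m) - fromℕ ℓ) * (a * inv ℓ)) + a ∎
      where a = altBinom (suc m) ℓ

  -- The partial fraction expansion of `p m`: both sides have the same first value and, by `p-suc`
  -- and `altSum-inv-suc`, the same ratios.
  p≡altSum : ∀ m → p m ≡ fromℕ (suc k) * altSum m inv
  p≡altSum zero    = *-cancelʳ-≢0 (denom 0) (denom≢0 0) (trans p-zero (sym (trans (*-assoc (fromℕ (suc k)) (altSum 0 inv) (denom 0))
    (trans (cong (fromℕ (suc k) *_) (trans (cong (_* denom 0) (altSum-0 inv)) (÷₀-* 1ℚ (denom≢0 0)))) (*-identityʳ (fromℕ (suc k)))))))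
  p≡altSum (suc m) = *-cancelʳ-≢0 (denom (suc m)) (denom≢0 (suc m)) (begin
    p (suc m) * denom (suc m)  ≡⟨ p-suc m ⟩
    p m * (K * fromℕ (suc m))  ≡⟨ cong (_* (K * fromℕ (suc m))) (p≡altSum m) ⟩
    fromℕ (suc k) * altSum m inv * (K * fromℕ (suc m))  ≡⟨ *-assoc (fromℕ (suc k)) (altSum m inv) (K * fromℕ (suc m)) ⟩
    fromℕ (suc k) * (altSum m inv * (K * fromℕ (suc m)))  ≡⟨ cong (fromℕ (suc k) *_) (altSum-inv-suc m) ⟨
    fromℕ (suc k) * (altSum (suc m) inv * denom (suc m))  ≡⟨ *-assoc (fromℕ (suc k)) (altSum (suc m) inv) (denom (suc m)) ⟨
    fromℕ (suc k) * altSum (suc m) inv * denom (suc m)  ∎)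
    where open ≡-Reasoning

  0<scale : ∀ n → 0ℚ < scale n
  0<scale n = 0<p*q (0<fromℕ-suc n) (0<fromℕ-suc k)

  W≤1 : ∀ n → W n ≤ 1ℚ
  W≤1 zero    = ≤-refl
  W≤1 (suc n) = *-cancelʳ-≤-pos (scale n) {{positive (0<scale n)}} (begin
    W (suc n) * scale n  ≡⟨ W-suc n ⟩
    W n * ins n  ≤⟨ *-mono-≤-nonNeg (<⇒≤ (0<W n)) (<⇒≤ (0<scale n)) (W≤1 n) ins≤scale ⟩
    1ℚ * scale n  ∎)
    where
    open ≤-Reasoning
    ins≤scale : ins n ≤ scale n
    ins≤scale = subst (ins n ≤_) (fromℕ-* (suc n) (suc k)) (fromℕ-mono-≤ (ℕ.≤-trans
      (ℕ.+-monoˡ-≤ (suc k ℕ.* n) (s≤s (z≤n {k}))) (ℕ.≤-reflexive (trans (sym (ℕ.*-suc (suc k) n)) (ℕ.*-comm (suc k) (suc n))))))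

  -- The normalisation n W n of the formula, times k + 1. It equals W 0 + ... + W (n - 1), and it
  -- has the exact growth factor of `E-growth`.
  E : ℕ → ℚ
  E n = fromℕ n * fromℕ (suc k) * W n

  0≤E : ∀ n → 0ℚ ≤ E n
  0≤E n = 0≤p*q (0≤p*q (0≤fromℕ n) (0≤fromℕ (suc k))) (<⇒≤ (0<W n))

  E-suc : ∀ n → E (suc n) ≡ W n + E n
  E-suc n = begin
    scale n * W (suc n)  ≡⟨ trans (*-comm (scale n) (W (suc n))) (W-suc n) ⟩
    W n * ins n  ≡⟨ cong (W n *_) (trans (fromℕ-suc (suc k ℕ.* n)) (cong (λ s → 1ℚ + s) (fromℕ-* (suc k) n))) ⟩
    W n * (1ℚ + fromℕ (suc k) * fromℕ n)  ≡⟨ solve 3 (λ w k n → w :* (con 1ℚ :+ k :* n) := w :+ n :* k :* w) refl (W n) (fromℕ (suc k)) (fromℕ n) ⟩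
    W n + E n  ∎
    where open ≡-Reasoning

  E-growth : ∀ n → E (suc (suc n)) ≡ E (suc n) * (1ℚ + (+ 1 / suc n) * κ)
  E-growth n = begin
    E (suc (suc n))  ≡⟨ E-suc (suc n) ⟩
    W (suc n) + E (suc n)  ≡⟨ solve 2 (λ w e → w :+ e := con 1ℚ :* (con 1ℚ :* w) :+ e) refl (W (suc n)) (E (suc n)) ⟩
    1ℚ * (1ℚ * W (suc n)) + E (suc n)  ≡⟨ cong₂ (λ s t → s * (t * W (suc n)) + E (suc n)) (fromℕ-*-/ 1 n) (fromℕ-*-/ 1 k) ⟨
    fromℕ (suc n) * (+ 1 / suc n) * (fromℕ (suc k) * κ * W (suc n)) + E (suc n)
      ≡⟨ solve 5 (λ a i s c w → a :* i :* (s :* c :* w) :+ a :* s :* w := a :* s :* w :* (con 1ℚ :+ i :* c)) refl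
           (fromℕ (suc n)) (+ 1 / suc n) (fromℕ (suc k)) κ (W (suc n)) ⟩
    E (suc n) * (1ℚ + (+ 1 / suc n) * κ)  ∎
    where open ≡-Reasoning

  -- A step multiplies E by 1 + 1/((n + 1)(k + 1)), whose (k + 1)-st power is at least 1 + 1/(n + 1)
  -- = (n + 2)/(n + 1) by Bernoulli's inequality.
  n≤E^ : ∀ n → fromℕ (suc n) ≤ E (suc n) ^ suc k
  n≤E^ zero    = 1≤^ (suc k) (≤-reflexive (sym (trans (E-suc 0) (cong (λ s → 1ℚ + s) (trans (*-identityʳ (0ℚ * fromℕ (suc k))) (*-zeroˡ (fromℕ (suc k))))))))
  n≤E^ (suc n) = begin
    fromℕ (suc (suc n))  ≡⟨ trans (fromℕ-suc (suc n)) (+-comm 1ℚ (fromℕ (suc n))) ⟩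
    fromℕ (suc n) + 1ℚ  ≡⟨ cong₂ _+_ (*-identityʳ (fromℕ (suc n))) (fromℕ-*-/ 1 n) ⟨
    fromℕ (suc n) * 1ℚ + fromℕ (suc n) * (+ 1 / suc n)  ≡⟨ *-distribˡ-+ (fromℕ (suc n)) 1ℚ (+ 1 / suc n) ⟨
    fromℕ (suc n) * (1ℚ + + 1 / suc n)  ≤⟨ *-mono-≤-nonNeg (0≤fromℕ (suc n)) (0≤^ (suc k) 0≤1+x) (n≤E^ n)
                                                                  (≤-trans (≤-reflexive (cong (λ s → 1ℚ + s) 1/n≡)) (bernoulli x 0≤x (suc k))) ⟩
    E (suc n) ^ suc k * (1ℚ + x) ^ suc k  ≡⟨ *-distrib-^ (E (suc n)) (1ℚ + x) (suc k) ⟨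
    (E (suc n) * (1ℚ + x)) ^ suc k  ≡⟨ cong (_^ suc k) (E-growth n) ⟨
    E (suc (suc n)) ^ suc k  ∎
    where
    open ≤-Reasoning
    x = (+ 1 / suc n) * κ
    0≤x : 0ℚ ≤ x
    0≤x = 0≤p*q (0≤/ 1 n) (0≤/ 1 k)
    0≤1+x : 0ℚ ≤ 1ℚ + x
    0≤1+x = +-mono-≤ (0≤fromℕ 1) 0≤x
    1/n≡ : + 1 / suc n ≡ fromℕ (suc k) * x
    1/n≡ = sym (trans (solve 3 (λ s i c → s :* (i :* c) := i :* (s :* c)) refl (fromℕ (suc k)) (+ 1 / suc n) κ)
      (trans (cong ((+ 1 / suc n) *_) (fromℕ-*-/ 1 k)) (*-identityʳ (+ 1 / suc n))))

  E-unbounded : ∀ M → 0ℚ ≤ M → ∃ λ N → ∀ n → N ℕ.≤ n → M ≤ E (suc n)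
  E-unbounded M 0≤M = ℤ.∣ ↥ (M ^ suc k) ∣ , bound
    where
    bound : ∀ n → ℤ.∣ ↥ (M ^ suc k) ∣ ℕ.≤ n → M ≤ E (suc n)
    bound n le with ≤-total M (E (suc n))
    ... | inj₁ M≤E = M≤E
    ... | inj₂ E≤M = ⊥-elim (<-irrefl refl (<-≤-trans (fromℕ-mono-< (s≤s le))
      (≤-trans (n≤E^ n) (≤-trans (^-mono-≤ (suc k) (0≤E (suc n)) E≤M) (archimedean (M ^ suc k))))))

  -- The ratio 1 - shift ℓ / scale n of consecutive values lies between 0 and 1 once n ≥ k (ℓ + 2).
  -- Earlier values of n may change the sign, hence the absolute values.
  ∣Y∣-decreasing : ∀ ℓ n → k ℕ.* (ℓ ℕ.+ 2) ℕ.≤ n → ∣ Y ℓ (suc n) ∣ ≤ ∣ Y ℓ n ∣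
  ∣Y∣-decreasing ℓ n le = *-cancelʳ-≤-pos (scale n) {{positive (0<scale n)}} (begin
    ∣ Y ℓ (suc n) ∣ * scale n  ≡⟨ cong (∣ Y ℓ (suc n) ∣ *_) (0≤p⇒∣p∣≡p (<⇒≤ (0<scale n))) ⟨
    ∣ Y ℓ (suc n) ∣ * ∣ scale n ∣  ≡⟨ ∣p*q∣≡∣p∣*∣q∣ (Y ℓ (suc n)) (scale n) ⟨
    ∣ Y ℓ (suc n) * scale n ∣  ≡⟨ cong ∣_∣ (Y-suc ℓ n) ⟩
    ∣ Y ℓ n * (scale n - shift ℓ) ∣  ≡⟨ ∣p*q∣≡∣p∣*∣q∣ (Y ℓ n) (scale n - shift ℓ) ⟩
    ∣ Y ℓ n ∣ * ∣ scale n - shift ℓ ∣  ≡⟨ cong (∣ Y ℓ n ∣ *_) (0≤p⇒∣p∣≡p (p≤q⇒0≤q-p shift≤scale)) ⟩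
    ∣ Y ℓ n ∣ * (scale n - shift ℓ)  ≤⟨ *-monoˡ-≤-nonNeg ∣ Y ℓ n ∣ {{∣-∣-nonNeg (Y ℓ n)}} (subst (scale n - shift ℓ ≤_) (+-identityʳ (scale n))
                                                (+-monoʳ-≤ (scale n) (neg-antimono-≤ (0≤fromℕ (k ℕ.* (ℓ ℕ.+ 2)))))) ⟩
    ∣ Y ℓ n ∣ * scale n  ∎)
    where
    open ≤-Reasoning
    shift≤scale : shift ℓ ≤ scale n
    shift≤scale = subst (shift ℓ ≤_) (fromℕ-* (suc n) (suc k)) (fromℕ-mono-≤
      (ℕ.≤-trans le (ℕ.≤-trans (ℕ.n≤1+n n) (ℕ.m≤m*n (suc n) (suc k)))))

  remainder : ℕ → ℕ → ℚ
  remainder m n = altSum m (λ ℓ → inv ℓ * Y ℓ n)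

  remainder-bounded : ∀ m → ∃ λ C → 0ℚ ≤ C × ∃ λ N → ∀ n → N ℕ.≤ n → ∣ remainder m n ∣ ≤ C
  remainder-bounded m = ∑ (suc m) c , ≤-trans (0≤∣p∣ (remainder m N₀)) (bounded N₀ ℕ.≤-refl) , N₀ , bounded
    where
    open ≤-Reasoning
    N₀ = k ℕ.* (m ℕ.+ 2)
    c : ℕ → ℚ
    c ℓ = ∣ altBinom m ℓ * inv ℓ ∣ * ∣ Y ℓ N₀ ∣
    bounded : ∀ n → N₀ ℕ.≤ n → ∣ remainder m n ∣ ≤ ∑ (suc m) c
    bounded n N₀≤n = ∣∑∣≤∑ (suc m) (λ ℓ → altBinom m ℓ * (inv ℓ * Y ℓ n)) c λ { ℓ (s≤s ℓ≤m) → begin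
      ∣ altBinom m ℓ * (inv ℓ * Y ℓ n) ∣  ≡⟨ cong ∣_∣ (*-assoc (altBinom m ℓ) (inv ℓ) (Y ℓ n)) ⟨
      ∣ altBinom m ℓ * inv ℓ * Y ℓ n ∣  ≡⟨ ∣p*q∣≡∣p∣*∣q∣ (altBinom m ℓ * inv ℓ) (Y ℓ n) ⟩
      ∣ altBinom m ℓ * inv ℓ ∣ * ∣ Y ℓ n ∣  ≤⟨ *-monoˡ-≤-nonNeg ∣ altBinom m ℓ * inv ℓ ∣ {{∣-∣-nonNeg (altBinom m ℓ * inv ℓ)}}
                                                 (∣-∣-decreasing (Y ℓ) N₀ (λ n le → ∣Y∣-decreasing ℓ n
                                                   (ℕ.≤-trans (ℕ.*-monoʳ-≤ k (ℕ.+-monoˡ-≤ 2 ℓ≤m)) le)) n N₀≤n) ⟩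
      c ℓ  ∎ }

  altSum-g : ∀ n m → altSum m (g n) ≡ X n * altSum m inv - remainder m n
  altSum-g n m = begin
    altSum m (g n)
      ≡⟨ ∑-cong (suc m) (λ ℓ _ → solve 4 (λ a i x y → a :* (i :* (x :- y)) := x :* (a :* i) :+ (:- con 1ℚ) :* (a :* (i :* y))) refl
           (altBinom m ℓ) (inv ℓ) (X n) (Y ℓ n)) ⟩
    ∑ (suc m) (λ ℓ → X n * (altBinom m ℓ * inv ℓ) + (- 1ℚ) * (altBinom m ℓ * (inv ℓ * Y ℓ n)))
      ≡⟨ trans (∑-+ (suc m) _ _) (cong₂ _+_ (∑-*ˡ (suc m) (X n) _) (∑-*ˡ (suc m) (- 1ℚ) _)) ⟩
    X n * altSum m inv + (- 1ℚ) * remainder m n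
      ≡⟨ solve 2 (λ a r → a :+ (:- con 1ℚ) :* r := a :- r) refl (X n * altSum m inv) (remainder m n) ⟩
    X n * altSum m inv - remainder m n ∎
    where open ≡-Reasoning

  -- In X n = (1 + (k + 1) n) W n, the part with n cancels against `p m` and the 1 leaves W n times
  -- the alternating sum. For fixed m the right side is bounded in n, whereas E is unbounded.
  error : ∀ n-1 m → let n = suc n-1 in
    (ℙ[Ȳ_≡_] {k} n m - p m) * E n ≡ fromℕ (suc k) * (W n * altSum m inv - remainder m n)
  error n-1 m = begin
    (ℙ[Ȳ_≡_] {k} n m - p m) * E n
      ≡⟨ cong₂ (λ a b → (a - b) * E n) (trans (probability-exact n m) (exactProbability-eq n m)) (p≡altSum m) ⟩
    (i * altSum m (g n) - κ⁻¹ * S) * (fromℕ n * κ⁻¹ * W n)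
      ≡⟨ solve 6 (λ i a c s n w → (i :* a :- c :* s) :* (n :* c :* w) := c :* (i :* (n :* w) :* a :- n :* w :* (c :* s))) refl
           i (altSum m (g n)) κ⁻¹ S (fromℕ n) (W n) ⟩
    κ⁻¹ * (i * (fromℕ n * W n) * altSum m (g n) - fromℕ n * W n * (κ⁻¹ * S))
      ≡⟨ cong (λ s → κ⁻¹ * (s - fromℕ n * W n * (κ⁻¹ * S))) (trans (cong₂ _*_ (÷₀-* 1ℚ (*-≢0 (fromℕ-suc≢0 n-1) (0<⇒≢0 (0<W n)))) (altSum-g n m))
           (*-identityˡ (X n * S - remainder m n))) ⟩
    κ⁻¹ * (X n * S - remainder m n - fromℕ n * W n * (κ⁻¹ * S))
      ≡⟨ cong (λ s → κ⁻¹ * (s * S - remainder m n - fromℕ n * W n * (κ⁻¹ * S))) (trans (X≡ins*W n)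
           (cong (_* W n) (trans (fromℕ-suc (suc k ℕ.* n)) (cong (λ s → 1ℚ + s) (fromℕ-* (suc k) n))))) ⟩
    κ⁻¹ * ((1ℚ + κ⁻¹ * fromℕ n) * W n * S - remainder m n - fromℕ n * W n * (κ⁻¹ * S))
      ≡⟨ cong (κ⁻¹ *_) (solve 5 (λ c n w s r → (con 1ℚ :+ c :* n) :* w :* s :- r :- n :* w :* (c :* s) := w :* s :- r) refl
           κ⁻¹ (fromℕ n) (W n) S (remainder m n)) ⟩
    κ⁻¹ * (W n * S - remainder m n) ∎
    where
    open ≡-Reasoning
    n = suc n-1
    i = 1ℚ ÷₀ (fromℕ n * W n)
    κ⁻¹ = fromℕ (suc k)
    S = altSum m inv

  ℙ⟶p : ∀ m → (λ n → ℙ[Ȳ_≡_] {k} n m) ⟶ℚ p m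
  -- The threshold is a successor because `error` concerns sizes n ≥ 1. N₁ is where the remainder
  -- becomes bounded, N₂ where E exceeds B/ε.
  ℙ⟶p m ε 0<ε = suc (N₁ ℕ.⊔ N₂) , λ { (suc n) (s≤s le) → *-cancelʳ-≤-pos (E (suc n))
      {{positive (0<p*q (0<p*q (0<fromℕ-suc n) (0<fromℕ-suc k)) (0<W (suc n)))}} (begin
    ∣ ℙ[Ȳ_≡_] {k} (suc n) m - p m ∣ * E (suc n)  ≡⟨ cong (∣ ℙ[Ȳ_≡_] {k} (suc n) m - p m ∣ *_) (0≤p⇒∣p∣≡p (0≤E (suc n))) ⟨
    ∣ ℙ[Ȳ_≡_] {k} (suc n) m - p m ∣ * ∣ E (suc n) ∣  ≡⟨ ∣p*q∣≡∣p∣*∣q∣ (ℙ[Ȳ_≡_] {k} (suc n) m - p m) (E (suc n)) ⟨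
    ∣ (ℙ[Ȳ_≡_] {k} (suc n) m - p m) * E (suc n) ∣  ≡⟨ cong ∣_∣ (error n m) ⟩
    ∣ κ⁻¹ * (W (suc n) * S - remainder m (suc n)) ∣  ≡⟨ trans (∣p*q∣≡∣p∣*∣q∣ κ⁻¹ _) (cong (_* ∣ W (suc n) * S - remainder m (suc n) ∣) (0≤p⇒∣p∣≡p (0≤fromℕ (suc k)))) ⟩
    κ⁻¹ * ∣ W (suc n) * S - remainder m (suc n) ∣  ≤⟨ *-monoˡ-≤-nonNeg κ⁻¹ {{nonNegative (0≤fromℕ (suc k))}} (begin
      ∣ W (suc n) * S - remainder m (suc n) ∣  ≤⟨ ∣p+q∣≤∣p∣+∣q∣ (W (suc n) * S) (- remainder m (suc n)) ⟩
      ∣ W (suc n) * S ∣ + ∣ - remainder m (suc n) ∣  ≡⟨ cong₂ _+_ (trans (∣p*q∣≡∣p∣*∣q∣ (W (suc n)) S) (cong (_* ∣ S ∣) (0≤p⇒∣p∣≡p (<⇒≤ (0<W (suc n)))))) (∣-p∣≡∣p∣ (remainder m (suc n))) ⟩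
      W (suc n) * ∣ S ∣ + ∣ remainder m (suc n) ∣  ≤⟨ +-mono-≤ (*-monoʳ-≤-nonNeg ∣ S ∣ {{∣-∣-nonNeg S}} (W≤1 (suc n)))
                                                                (bounded (suc n) (ℕ.m≤n⇒m≤1+n (ℕ.m⊔n≤o⇒m≤o N₁ N₂ le))) ⟩
      1ℚ * ∣ S ∣ + C  ∎) ⟩
    B  ≡⟨ trans (*-comm ε (B ÷₀ ε)) (÷₀-* B (0<⇒≢0 0<ε)) ⟨
    ε * (B ÷₀ ε)  ≤⟨ *-monoˡ-≤-nonNeg ε {{nonNegative (<⇒≤ 0<ε)}} (proj₂ E-large n (ℕ.m⊔n≤o⇒n≤o N₁ N₂ le)) ⟩
    ε * E (suc n)  ∎) }
    where
    open ≤-Reasoning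
    κ⁻¹ = fromℕ (suc k)
    S = altSum m inv
    C = proj₁ (remainder-bounded m)
    0≤C = proj₁ (proj₂ (remainder-bounded m))
    N₁ = proj₁ (proj₂ (proj₂ (remainder-bounded m)))
    bounded = proj₂ (proj₂ (proj₂ (remainder-bounded m)))
    B = κ⁻¹ * (1ℚ * ∣ S ∣ + C)
    0≤B : 0ℚ ≤ B
    0≤B = 0≤p*q (0≤fromℕ (suc k)) (+-mono-≤ (0≤p*q (0≤fromℕ 1) (0≤∣p∣ S)) 0≤C)
    0≤B/ε : 0ℚ ≤ B ÷₀ ε
    0≤B/ε = *-cancelʳ-≤-pos ε {{positive 0<ε}} (subst₂ _≤_ (sym (*-zeroˡ ε)) (sym (÷₀-* B (0<⇒≢0 0<ε))) 0≤B)
    E-large = E-unbounded (B ÷₀ ε) 0≤B/ε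
    N₂ = proj₁ E-large

-- Real arithmetic

private
  variable
    x y z u v w : ℝ

Eventually : (ℕ → Set) → Set
Eventually P = ∃ λ N → ∀ n → N ℕ.≤ n → P n

eventually-map₂ : ∀ {P Q R : ℕ → Set} → (∀ n → P n → Q n → R n) → Eventually P → Eventually Q → Eventually R
eventually-map₂ f (M , p) (N , q) = M ℕ.⊔ N , λ n le → f n (p n (ℕ.m⊔n≤o⇒m≤o M N le)) (q n (ℕ.m⊔n≤o⇒n≤o M N le))

-- Unlike _≤ℝ_, records let Agda infer the two real numbers.
infix 4 _≤ᴿ_ _≈_
record _≤ᴿ_ (x y : ℝ) : Set where
  constructor mk≤
  field un≤ : x ≤ℝ y

record _≈_ (x y : ℝ) : Set where
  constructor mk≈
  field close : ∀ ε → 0ℚ < ε → Eventually (λ n → ∣ seq x n - seq y n ∣ ≤ ε)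

open _≤ᴿ_ public
open _≈_ public

p-q≤r⇒p≤q+r : ∀ {p q r} → p - q ≤ r → p ≤ q + r
p-q≤r⇒p≤q+r {p} {q} {r} le = subst (_≤ q + r) (solve 2 (λ p q → q :+ (p :- q) := p) refl p q) (+-monoʳ-≤ q le)

p≤q+r⇒p-q≤r : ∀ {p q r} → p ≤ q + r → p - q ≤ r
p≤q+r⇒p-q≤r {p} {q} {r} le = subst (p - q ≤_) (solve 2 (λ q r → (q :+ r) :- q := r) refl q r) (+-monoˡ-≤ (- q) le)

∣p-q∣≤r⇒p≤q+r : ∀ {p q r} → ∣ p - q ∣ ≤ r → p ≤ q + r
∣p-q∣≤r⇒p≤q+r {p} {q} le = p-q≤r⇒p≤q+r (≤-trans (p≤∣p∣ (p - q)) le)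

∣p-q∣≤ : ∀ {p q r} → p ≤ q + r → q ≤ p + r → ∣ p - q ∣ ≤ r
∣p-q∣≤ {p} {q} {r} h h′ = ∣p∣≤q (p≤q+r⇒p-q≤r h)
  (subst (_≤ r) (solve 2 (λ p q → q :- p := :- (p :- q)) refl p q) (p≤q+r⇒p-q≤r h′))

≈⇒≤ : x ≈ y → x ≤ᴿ y
≈⇒≤ (mk≈ h) = mk≤ λ ε 0<ε → proj₁ (h ε 0<ε) , λ n le → ∣p-q∣≤r⇒p≤q+r (proj₂ (h ε 0<ε) n le)

≤-antisymᴿ : x ≤ᴿ y → y ≤ᴿ x → x ≈ y
≤-antisymᴿ (mk≤ h) (mk≤ h′) = mk≈ λ ε 0<ε → eventually-map₂ (λ n → ∣p-q∣≤) (h ε 0<ε) (h′ ε 0<ε)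

≈-refl : x ≈ x
≈-refl {x} = mk≈ λ ε 0<ε → 0 , λ n _ → subst (_≤ ε) (cong ∣_∣ (sym (+-inverseʳ (seq x n)))) (<⇒≤ 0<ε)

≈-sym : x ≈ y → y ≈ x
≈-sym {x} {y} (mk≈ h) = mk≈ λ ε 0<ε → proj₁ (h ε 0<ε) , λ n le →
  subst (_≤ ε) (∣p-q∣≡∣q-p∣ (seq x n) (seq y n)) (proj₂ (h ε 0<ε) n le)

≤ᴿ-trans : x ≤ᴿ y → y ≤ᴿ z → x ≤ᴿ z
≤ᴿ-trans {x} {y} {z} (mk≤ h) (mk≤ h′) = mk≤ λ ε 0<ε → eventually-map₂
  (λ n x≤y y≤z → ≤-trans x≤y (≤-trans (+-monoˡ-≤ (½ * ε) y≤z)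
    (≤-reflexive (trans (+-assoc (seq z n) (½ * ε) (½ * ε)) (cong (λ s → seq z n + s) (½+½ ε))))))
  (h (½ * ε) (½-pos 0<ε)) (h′ (½ * ε) (½-pos 0<ε))

≈-trans : x ≈ y → y ≈ z → x ≈ z
≈-trans h h′ = ≤-antisymᴿ (≤ᴿ-trans (≈⇒≤ h) (≈⇒≤ h′)) (≤ᴿ-trans (≈⇒≤ (≈-sym h′)) (≈⇒≤ (≈-sym h)))

≤ᴿ-refl : x ≤ᴿ x
≤ᴿ-refl = ≈⇒≤ ≈-refl

ℝ-poset : Poset 0ℓ 0ℓ 0ℓ
ℝ-poset = record
  { Carrier = ℝ ; _≈_ = _≈_ ; _≤_ = _≤ᴿ_
  ; isPartialOrder = record
    { isPreorder = record
      { isEquivalence = record { refl = ≈-refl ; sym = ≈-sym ; trans = ≈-trans }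
      ; reflexive = ≈⇒≤ ; trans = ≤ᴿ-trans }
    ; antisym = ≤-antisymᴿ } }

module ℝ-Reasoning = Relation.Binary.Reasoning.PartialOrder ℝ-poset

-- The operations are opaque, for otherwise unification compares Cauchy moduli.
infixl 6 _⊕_ _⊝_
infixl 7 _⊗_
infix  8 ⊖_

opaque
  ⌜_⌝ : ℚ → ℝ
  ⌜ q ⌝ = fromℚ q

  _⊕_ _⊗_ : ℝ → ℝ → ℝ
  x ⊕ y = x +ℝ y
  x ⊗ y = x *ℝ y

  ⊖_ ∥_∥ : ℝ → ℝ
  ⊖ x   = -ℝ x
  ∥ x ∥ = ∣ x ∣ℝ

_⊝_ : ℝ → ℝ → ℝ
x ⊝ y = x ⊕ ⊖ y

0ᴿ 1ᴿ : ℝ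
0ᴿ = ⌜ 0ℚ ⌝
1ᴿ = ⌜ 1ℚ ⌝

opaque
  unfolding ⌜_⌝

  seq-⌜⌝ : ∀ q n → seq ⌜ q ⌝ n ≡ q
  seq-⌜⌝ q n = refl

  seq-⊕ : ∀ x y n → seq (x ⊕ y) n ≡ seq x n + seq y n
  seq-⊕ x y n = refl

  seq-⊗ : ∀ x y n → seq (x ⊗ y) n ≡ seq x n * seq y n
  seq-⊗ x y n = refl

  seq-⊖ : ∀ x n → seq (⊖ x) n ≡ - seq x n
  seq-⊖ x n = refl

  seq-⊝ : ∀ x y n → seq (x ⊝ y) n ≡ seq x n - seq y n
  seq-⊝ x y n = refl

  seq-∥∥ : ∀ x n → seq ∥ x ∥ n ≡ ∣ seq x n ∣
  seq-∥∥ x n = refl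

≤-pointwise : ∀ x y → (∀ n → seq x n ≤ seq y n) → x ≤ᴿ y
≤-pointwise x y h = mk≤ λ ε 0<ε → 0 , λ n _ →
  subst (_≤ seq y n + ε) (+-identityʳ (seq x n)) (+-mono-≤ (h n) (<⇒≤ 0<ε))

≈-pointwise : ∀ x y → (∀ n → seq x n ≡ seq y n) → x ≈ y
≈-pointwise x y h = mk≈ λ ε 0<ε → 0 , λ n _ →
  subst (_≤ ε) (cong ∣_∣ (sym (trans (cong (_- seq y n) (h n)) (+-inverseʳ (seq y n))))) (<⇒≤ 0<ε)

opaque
  unfolding ⌜_⌝

  fromℚ≈ : ∀ q → fromℚ q ≈ ⌜ q ⌝
  fromℚ≈ q = ≈-pointwise (fromℚ q) ⌜ q ⌝ λ n → refl

  *ℝ≈⊗ : ∀ x y → x *ℝ y ≈ x ⊗ y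
  *ℝ≈⊗ x y = ≈-pointwise (x *ℝ y) (x ⊗ y) λ n → refl

  ∣-ℝ∣≈∥⊝∥ : ∀ x y → ∣ x -ℝ y ∣ℝ ≈ ∥ x ⊝ y ∥
  ∣-ℝ∣≈∥⊝∥ x y = ≈-pointwise ∣ x -ℝ y ∣ℝ ∥ x ⊝ y ∥ λ n → refl

  *ℝ∣∣≈⊗∥∥ : ∀ q x → fromℚ q *ℝ ∣ x ∣ℝ ≈ ⌜ q ⌝ ⊗ ∥ x ∥
  *ℝ∣∣≈⊗∥∥ q x = ≈-pointwise (fromℚ q *ℝ ∣ x ∣ℝ) (⌜ q ⌝ ⊗ ∥ x ∥) λ n → refl

  ⊕-mono-≤ : x ≤ᴿ y → u ≤ᴿ v → x ⊕ u ≤ᴿ y ⊕ v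
  ⊕-mono-≤ {x} {y} {u} {v} (mk≤ h) (mk≤ h′) = mk≤ λ ε 0<ε → eventually-map₂
    (λ n x≤y u≤v → ≤-trans (+-mono-≤ x≤y u≤v) (≤-reflexive (trans
      (solve 3 (λ a b e → (a :+ e) :+ (b :+ e) := (a :+ b) :+ (e :+ e)) refl (seq y n) (seq v n) (½ * ε))
      (cong (λ s → seq y n + seq v n + s) (½+½ ε)))))
    (h (½ * ε) (½-pos 0<ε)) (h′ (½ * ε) (½-pos 0<ε))

  ⊖-cong : x ≈ y → ⊖ x ≈ ⊖ y
  ⊖-cong {x} {y} (mk≈ h) = mk≈ λ ε 0<ε → proj₁ (h ε 0<ε) , λ n le → subst (_≤ ε)
    (trans (∣p-q∣≡∣q-p∣ (seq x n) (seq y n)) (cong ∣_∣ (solve 2 (λ a b → b :- a := (:- a) :- (:- b)) refl (seq x n) (seq y n))))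
    (proj₂ (h ε 0<ε) n le)

  ⊗-congʳ : ∀ z → x ≈ y → x ⊗ z ≈ y ⊗ z
  ⊗-congʳ {x} {y} z (mk≈ h) = mk≈ λ ε 0<ε →
    eventually-map₂ (λ n x-y≤ z≤ → let open ≤-Reasoning in begin
      ∣ seq x n * seq z n - seq y n * seq z n ∣  ≡⟨ cong ∣_∣ (solve 3 (λ x y z → x :* z :- y :* z := (x :- y) :* z) refl (seq x n) (seq y n) (seq z n)) ⟩
      ∣ (seq x n - seq y n) * seq z n ∣  ≡⟨ ∣p*q∣≡∣p∣*∣q∣ (seq x n - seq y n) (seq z n) ⟩
      ∣ seq x n - seq y n ∣ * ∣ seq z n ∣  ≤⟨ *-mono-≤-nonNeg (0≤∣p∣ (seq x n - seq y n)) (<⇒≤ 0<C) x-y≤ z≤ ⟩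
      (ε ÷₀ C) * C  ≡⟨ ÷₀-* ε (0<⇒≢0 0<C) ⟩
      ε  ∎)
      (h (ε ÷₀ C) (0<÷₀ 0<ε 0<C)) (proj₂ (proj₂ (eventuallyBounded z)))
    where
    C : ℚ
    C = proj₁ (eventuallyBounded z)
    0<C : 0ℚ < C
    0<C = proj₁ (proj₂ (eventuallyBounded z))

  ∥∥-cong : x ≈ y → ∥ x ∥ ≈ ∥ y ∥
  ∥∥-cong {x} {y} (mk≈ h) = mk≈ λ ε 0<ε → proj₁ (h ε 0<ε) , λ n le →
    ≤-trans (∣∣p∣-∣q∣∣≤∣p-q∣ (seq x n) (seq y n)) (proj₂ (h ε 0<ε) n le)

  ⊕-assoc : ∀ x y z → (x ⊕ y) ⊕ z ≈ x ⊕ (y ⊕ z)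
  ⊕-assoc x y z = ≈-pointwise ((x ⊕ y) ⊕ z) (x ⊕ (y ⊕ z)) λ n → +-assoc (seq x n) (seq y n) (seq z n)

  ⊕-comm : ∀ x y → x ⊕ y ≈ y ⊕ x
  ⊕-comm x y = ≈-pointwise (x ⊕ y) (y ⊕ x) λ n → +-comm (seq x n) (seq y n)

  ⊕-identityˡ : ∀ x → 0ᴿ ⊕ x ≈ x
  ⊕-identityˡ x = ≈-pointwise (0ᴿ ⊕ x) x λ n → +-identityˡ (seq x n)

  ⊗-assoc : ∀ x y z → (x ⊗ y) ⊗ z ≈ x ⊗ (y ⊗ z)
  ⊗-assoc x y z = ≈-pointwise ((x ⊗ y) ⊗ z) (x ⊗ (y ⊗ z)) λ n → *-assoc (seq x n) (seq y n) (seq z n)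

  ⊗-comm : ∀ x y → x ⊗ y ≈ y ⊗ x
  ⊗-comm x y = ≈-pointwise (x ⊗ y) (y ⊗ x) λ n → *-comm (seq x n) (seq y n)

  ⊗-identityˡ : ∀ x → 1ᴿ ⊗ x ≈ x
  ⊗-identityˡ x = ≈-pointwise (1ᴿ ⊗ x) x λ n → *-identityˡ (seq x n)

  ⊗-distribˡ-⊕ : ∀ x y z → x ⊗ (y ⊕ z) ≈ x ⊗ y ⊕ x ⊗ z
  ⊗-distribˡ-⊕ x y z = ≈-pointwise (x ⊗ (y ⊕ z)) (x ⊗ y ⊕ x ⊗ z) λ n → *-distribˡ-+ (seq x n) (seq y n) (seq z n)

  0≤⇒≈∥∥ : 0ᴿ ≤ᴿ x → x ≈ ∥ x ∥
  0≤⇒≈∥∥ {x} (mk≤ h) = mk≈ λ ε 0<ε → let (N , h′) = h (½ * ε) (½-pos 0<ε) in N , λ n le →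
    ∣p-q∣≤ (≤-trans (p≤∣p∣ (seq x n)) (subst (_≤ ∣ seq x n ∣ + ε) (+-identityʳ ∣ seq x n ∣) (+-monoʳ-≤ ∣ seq x n ∣ (<⇒≤ 0<ε))))
      (∣p∣≤q (subst (_≤ seq x n + ε) (+-identityʳ (seq x n)) (+-monoʳ-≤ (seq x n) (<⇒≤ 0<ε)))
        (0≤q-p⇒p≤q (subst (0ℚ ≤_) (trans (solve 2 (λ x e → (x :+ e) :+ (x :+ e) := x :+ (e :+ e) :- (:- x)) refl (seq x n) (½ * ε))
          (cong (λ s → seq x n + s - (- seq x n)) (½+½ ε))) (+-mono-≤ (h′ n le) (h′ n le)))))

  0≤∥∥ : ∀ x → 0ᴿ ≤ᴿ ∥ x ∥
  0≤∥∥ x = ≤-pointwise 0ᴿ ∥ x ∥ λ n → 0≤∣p∣ (seq x n)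

  0≤∥∥⊗∥∥ : ∀ x y → 0ᴿ ≤ᴿ ∥ x ∥ ⊗ ∥ y ∥
  0≤∥∥⊗∥∥ x y = ≤-pointwise 0ᴿ (∥ x ∥ ⊗ ∥ y ∥) λ n → 0≤p*q (0≤∣p∣ (seq x n)) (0≤∣p∣ (seq y n))

  x≤∥x∥ : ∀ x → x ≤ᴿ ∥ x ∥
  x≤∥x∥ x = ≤-pointwise x ∥ x ∥ λ n → p≤∣p∣ (seq x n)

  ∥∥≤ : x ≤ᴿ y → ⊖ x ≤ᴿ y → ∥ x ∥ ≤ᴿ y
  ∥∥≤ (mk≤ h) (mk≤ h′) = mk≤ λ ε 0<ε → eventually-map₂ (λ n → ∣p∣≤q) (h ε 0<ε) (h′ ε 0<ε)

  ∥⊕∥≤ : ∀ x y → ∥ x ⊕ y ∥ ≤ᴿ ∥ x ∥ ⊕ ∥ y ∥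
  ∥⊕∥≤ x y = ≤-pointwise ∥ x ⊕ y ∥ (∥ x ∥ ⊕ ∥ y ∥) λ n → ∣p+q∣≤∣p∣+∣q∣ (seq x n) (seq y n)

  ∥⊗∥ : ∀ x y → ∥ x ⊗ y ∥ ≈ ∥ x ∥ ⊗ ∥ y ∥
  ∥⊗∥ x y = ≈-pointwise ∥ x ⊗ y ∥ (∥ x ∥ ⊗ ∥ y ∥) λ n → ∣p*q∣≡∣p∣*∣q∣ (seq x n) (seq y n)

  ∥⌜⌝∥ : ∀ p → ∥ ⌜ p ⌝ ∥ ≈ ⌜ ∣ p ∣ ⌝
  ∥⌜⌝∥ p = ≈-pointwise ∥ ⌜ p ⌝ ∥ ⌜ ∣ p ∣ ⌝ λ n → refl

  ⌜⌝-+ : ∀ p q → ⌜ p + q ⌝ ≈ ⌜ p ⌝ ⊕ ⌜ q ⌝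
  ⌜⌝-+ p q = ≈-pointwise ⌜ p + q ⌝ (⌜ p ⌝ ⊕ ⌜ q ⌝) λ n → refl

  ⌜⌝-* : ∀ p q → ⌜ p * q ⌝ ≈ ⌜ p ⌝ ⊗ ⌜ q ⌝
  ⌜⌝-* p q = ≈-pointwise ⌜ p * q ⌝ (⌜ p ⌝ ⊗ ⌜ q ⌝) λ n → refl

  ⌜⌝-⊖ : ∀ p → ⌜ - p ⌝ ≈ ⊖ ⌜ p ⌝
  ⌜⌝-⊖ p = ≈-pointwise ⌜ - p ⌝ (⊖ ⌜ p ⌝) λ n → refl

  ⌜⌝-mono-≤ : ∀ {p q} → p ≤ q → ⌜ p ⌝ ≤ᴿ ⌜ q ⌝
  ⌜⌝-mono-≤ {p} {q} le = ≤-pointwise ⌜ p ⌝ ⌜ q ⌝ λ _ → le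

  ≤-from-ε : (∀ ε → 0ℚ < ε → x ≤ᴿ y ⊕ ⌜ ε ⌝) → x ≤ᴿ y
  ≤-from-ε {x} {y} h = mk≤ λ ε 0<ε → let (N , h′) = un≤ (h (½ * ε) (½-pos 0<ε)) (½ * ε) (½-pos 0<ε) in N , λ n le →
    ≤-trans (h′ n le) (≤-reflexive (trans (+-assoc (seq y n) (½ * ε) (½ * ε)) (cong (λ s → seq y n + s) (½+½ ε))))

  bound : ∀ x → ∃ λ C → 0ℚ < C × ∥ x ∥ ≤ᴿ ⌜ C ⌝
  bound x = let (C , 0<C , N , h) = eventuallyBounded x in C , 0<C , mk≤ λ ε 0<ε → N , λ n le →
    ≤-trans (h n le) (subst (_≤ C + ε) (+-identityʳ C) (+-monoʳ-≤ C (<⇒≤ 0<ε)))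

  approximation : ∀ x ε → 0ℚ < ε → ∃ λ N → ∀ n → N ℕ.≤ n → ∥ x ⊝ ⌜ seq x n ⌝ ∥ ≤ᴿ ⌜ ε ⌝
  approximation x ε 0<ε = let (N , h) = cauchy x ε 0<ε in N , λ n le → mk≤ λ δ 0<δ → N , λ m le′ →
    ≤-trans (h m n le′ le) (subst (_≤ ε + δ) (+-identityʳ ε) (+-monoʳ-≤ ε (<⇒≤ 0<δ)))

p≤q-from-ε : ∀ {p q} → (∀ ε → 0ℚ < ε → p ≤ q + ε) → p ≤ q
p≤q-from-ε {p} {q} h with p ≤? q
... | yes p≤q = p≤q
... | no p≰q = ⊥-elim (<-irrefl refl (<-≤-trans gap (p≤q+r⇒p-q≤r (h (½ * (p - q)) (½-pos 0<p-q)))))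
  where
  0<p-q : 0ℚ < p - q
  0<p-q = subst (_< p - q) (+-inverseʳ q) (+-monoˡ-< (- q) (≰⇒> p≰q))
  gap : ½ * (p - q) < p - q
  gap = subst₂ _<_ (+-identityʳ (½ * (p - q))) (½+½ (p - q)) (+-monoʳ-< (½ * (p - q)) (½-pos 0<p-q))

opaque
  unfolding ⌜_⌝

  ⌜⌝-cancel-≤ : ∀ {p q} → ⌜ p ⌝ ≤ᴿ ⌜ q ⌝ → p ≤ q
  ⌜⌝-cancel-≤ (mk≤ h) = p≤q-from-ε λ ε 0<ε → proj₂ (h ε 0<ε) _ ℕ.≤-refl

0≤⌜⌝ : ∀ {p} → 0ℚ ≤ p → 0ᴿ ≤ᴿ ⌜ p ⌝
0≤⌜⌝ = ⌜⌝-mono-≤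

⊕-cong : x ≈ y → u ≈ v → x ⊕ u ≈ y ⊕ v
⊕-cong p q = ≤-antisymᴿ (⊕-mono-≤ (≈⇒≤ p) (≈⇒≤ q)) (⊕-mono-≤ (≈⇒≤ (≈-sym p)) (≈⇒≤ (≈-sym q)))

⊝-cong : x ≈ y → u ≈ v → x ⊝ u ≈ y ⊝ v
⊝-cong p q = ⊕-cong p (⊖-cong q)

⊗-cong : x ≈ y → u ≈ v → x ⊗ u ≈ y ⊗ v
⊗-cong {x} {y} {u} {v} p q = ≈-trans (⊗-congʳ u p) (≈-trans (⊗-comm y u) (≈-trans (⊗-congʳ y q) (⊗-comm v y)))

⊗-congˡ : ∀ z → x ≈ y → z ⊗ x ≈ z ⊗ y
⊗-congˡ z p = ⊗-cong (≈-refl {z}) p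

≡⇒≈ : x ≡ y → x ≈ y
≡⇒≈ refl = ≈-refl

infixr 8 _^ᴿ_
_^ᴿ_ : ℝ → ℕ → ℝ
x ^ᴿ zero  = 1ᴿ
x ^ᴿ suc n = x ⊗ x ^ᴿ n

-- A second semantics for the polynomials of the rational solver. It transports identities in
-- `solveᴿ` and inequalities in `rootᴿ-lift`.
⟦_⟧ᴿ : ∀ {n} → Polynomial n → Vec ℝ n → ℝ
⟦ op [+] p q ⟧ᴿ ρ = ⟦ p ⟧ᴿ ρ ⊕ ⟦ q ⟧ᴿ ρ
⟦ op [*] p q ⟧ᴿ ρ = ⟦ p ⟧ᴿ ρ ⊗ ⟦ q ⟧ᴿ ρ
⟦ con c      ⟧ᴿ ρ = ⌜ c ⌝
⟦ var i      ⟧ᴿ ρ = lookup ρ i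
⟦ p :^ n     ⟧ᴿ ρ = ⟦ p ⟧ᴿ ρ ^ᴿ n
⟦ :- p       ⟧ᴿ ρ = ⊖ ⟦ p ⟧ᴿ ρ

seq-^ᴿ : ∀ x n j → seq (x ^ᴿ n) j ≡ seq x j ^ n
seq-^ᴿ x zero    j = seq-⌜⌝ 1ℚ j
seq-^ᴿ x (suc n) j = trans (seq-⊗ x (x ^ᴿ n) j) (cong (seq x j *_) (seq-^ᴿ x n j))

seq-⟦⟧ᴿ : ∀ {n} (p : Polynomial n) ρ j → seq (⟦ p ⟧ᴿ ρ) j ≡ ⟦ p ⟧ (Vec.map (λ x → seq x j) ρ)
seq-⟦⟧ᴿ (op [+] p q) ρ j = trans (seq-⊕ (⟦ p ⟧ᴿ ρ) (⟦ q ⟧ᴿ ρ) j) (cong₂ _+_ (seq-⟦⟧ᴿ p ρ j) (seq-⟦⟧ᴿ q ρ j))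
seq-⟦⟧ᴿ (op [*] p q) ρ j = trans (seq-⊗ (⟦ p ⟧ᴿ ρ) (⟦ q ⟧ᴿ ρ) j) (cong₂ _*_ (seq-⟦⟧ᴿ p ρ j) (seq-⟦⟧ᴿ q ρ j))
seq-⟦⟧ᴿ (con c)      ρ j = seq-⌜⌝ c j
seq-⟦⟧ᴿ (var i)      ρ j = sym (Vec.lookup-map i (λ x → seq x j) ρ)
seq-⟦⟧ᴿ (p :^ n)     ρ j = trans (seq-^ᴿ (⟦ p ⟧ᴿ ρ) n j) (cong (_^ n) (seq-⟦⟧ᴿ p ρ j))
seq-⟦⟧ᴿ (:- p)       ρ j = trans (seq-⊖ (⟦ p ⟧ᴿ ρ) j) (cong -_ (seq-⟦⟧ᴿ p ρ j))

atVars : ∀ n {B : Set} → N-ary n (Polynomial n) B → B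
atVars n f = f $ⁿ Vec.map var (Vec.allFin n)

-- Polynomial identities hold in ℝ because they hold termwise in ℚ.
solveᴿ : ∀ n (f : N-ary n (Polynomial n) (Polynomial n × Polynomial n)) →
         normalise (proj₁ (atVars n f)) ≡ normalise (proj₂ (atVars n f)) →
         Eq n _≈_ (curryⁿ ⟦ proj₁ (atVars n f) ⟧ᴿ) (curryⁿ ⟦ proj₂ (atVars n f) ⟧ᴿ)
solveᴿ n f eq = curryⁿ-cong _≈_ ⟦ p ⟧ᴿ ⟦ q ⟧ᴿ λ ρ → ≈-pointwise (⟦ p ⟧ᴿ ρ) (⟦ q ⟧ᴿ ρ) λ j →
  trans (seq-⟦⟧ᴿ p ρ j) (trans (prove (Vec.map (λ x → seq x j) ρ) p q (cong (λ e → ⟦ e ⟧N (Vec.map (λ x → seq x j) ρ)) eq))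
    (sym (seq-⟦⟧ᴿ q ρ j)))
  where
  p = proj₁ (atVars n f)
  q = proj₂ (atVars n f)

-- A nonnegative real may have negative terms. Its absolute value is the same real with nonnegative
-- terms, and for these the product is nonnegative termwise.
0≤⊗ : 0ᴿ ≤ᴿ x → 0ᴿ ≤ᴿ y → 0ᴿ ≤ᴿ x ⊗ y
0≤⊗ {x} {y} 0≤x 0≤y = ≤ᴿ-trans (0≤∥∥⊗∥∥ x y) (≈⇒≤ (≈-sym (⊗-cong (0≤⇒≈∥∥ 0≤x) (0≤⇒≈∥∥ 0≤y))))

0≤⊕ : 0ᴿ ≤ᴿ x → 0ᴿ ≤ᴿ y → 0ᴿ ≤ᴿ x ⊕ y
0≤⊕ 0≤x 0≤y = ≤ᴿ-trans (≈⇒≤ (≈-sym (⊕-identityˡ 0ᴿ))) (⊕-mono-≤ 0≤x 0≤y)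

≤⇒0≤⊝ : x ≤ᴿ y → 0ᴿ ≤ᴿ y ⊝ x
≤⇒0≤⊝ {x} {y} h = ≤ᴿ-trans (≈⇒≤ (solveᴿ 1 (λ x → con 0ℚ := x :- x) refl x)) (⊕-mono-≤ h ≤ᴿ-refl)

0≤⊝⇒≤ : 0ᴿ ≤ᴿ y ⊝ x → x ≤ᴿ y
0≤⊝⇒≤ {y} {x} h = ≤ᴿ-trans (≈⇒≤ (≈-sym (⊕-identityˡ x))) (≤ᴿ-trans (⊕-mono-≤ h (≤ᴿ-refl {x}))
  (≈⇒≤ (solveᴿ 2 (λ x y → y :- x :+ x := y) refl x y)))

⊗-monoˡ-≤ : ∀ z → 0ᴿ ≤ᴿ z → x ≤ᴿ y → z ⊗ x ≤ᴿ z ⊗ y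
⊗-monoˡ-≤ {x} {y} z 0≤z x≤y = 0≤⊝⇒≤ (≤ᴿ-trans (0≤⊗ 0≤z (≤⇒0≤⊝ x≤y))
  (≈⇒≤ (solveᴿ 3 (λ x y z → z :* (y :- x) := z :* y :- z :* x) refl x y z)))

⊗-monoʳ-≤ : ∀ z → 0ᴿ ≤ᴿ z → x ≤ᴿ y → x ⊗ z ≤ᴿ y ⊗ z
⊗-monoʳ-≤ {x} {y} z 0≤z x≤y = ≤ᴿ-trans (≈⇒≤ (⊗-comm x z)) (≤ᴿ-trans (⊗-monoˡ-≤ z 0≤z x≤y) (≈⇒≤ (⊗-comm z y)))

⊗-mono-≤ : 0ᴿ ≤ᴿ x → 0ᴿ ≤ᴿ v → x ≤ᴿ y → u ≤ᴿ v → x ⊗ u ≤ᴿ y ⊗ v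
⊗-mono-≤ {x} {v} 0≤x 0≤v x≤y u≤v = ≤ᴿ-trans (⊗-monoˡ-≤ x 0≤x u≤v) (⊗-monoʳ-≤ v 0≤v x≤y)

∥⊖∥ : ∀ x → ∥ ⊖ x ∥ ≈ ∥ x ∥
∥⊖∥ x = ≈-trans (∥∥-cong (solveᴿ 1 (λ x → :- x := con (- 1ℚ) :* x) refl x))
  (≈-trans (∥⊗∥ ⌜ - 1ℚ ⌝ x) (≈-trans (⊗-congʳ ∥ x ∥ (∥⌜⌝∥ (- 1ℚ))) (⊗-identityˡ ∥ x ∥)))

∥⊝∥-sym : ∀ x y → ∥ x ⊝ y ∥ ≈ ∥ y ⊝ x ∥
∥⊝∥-sym x y = ≈-trans (∥∥-cong (solveᴿ 2 (λ x y → x :- y := :- (y :- x)) refl x y)) (∥⊖∥ (y ⊝ x))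

∥⊝∥-triangle : ∀ x y z → ∥ x ⊝ z ∥ ≤ᴿ ∥ x ⊝ y ∥ ⊕ ∥ y ⊝ z ∥
∥⊝∥-triangle x y z = ≤ᴿ-trans
  (≈⇒≤ (∥∥-cong (solveᴿ 3 (λ x y z → x :- z := (x :- y) :+ (y :- z)) refl x y z)))
  (∥⊕∥≤ (x ⊝ y) (y ⊝ z))

∥⊝∥≤⇒≤ : ∥ x ⊝ y ∥ ≤ᴿ z → x ≤ᴿ y ⊕ z
∥⊝∥≤⇒≤ {x} {y} {z} h = ≤ᴿ-trans (≈⇒≤ (solveᴿ 2 (λ x y → x := y :+ (x :- y)) refl x y))
  (⊕-mono-≤ (≤ᴿ-refl {y}) (≤ᴿ-trans (x≤∥x∥ (x ⊝ y)) h))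

≤⊕⇒⊝≤ : x ≤ᴿ y ⊕ z → x ⊝ y ≤ᴿ z
≤⊕⇒⊝≤ {x} {y} {z} h = ≤ᴿ-trans (⊕-mono-≤ h (≤ᴿ-refl {⊖ y}))
  (≈⇒≤ (solveᴿ 2 (λ y z → y :+ z :- y := z) refl y z))

≤⇒∥⊝∥≤ : x ≤ᴿ y ⊕ z → y ≤ᴿ x ⊕ z → ∥ x ⊝ y ∥ ≤ᴿ z
≤⇒∥⊝∥≤ {x} {y} h h′ = ∥∥≤ (≤⊕⇒⊝≤ h)
  (≤ᴿ-trans (≈⇒≤ (solveᴿ 2 (λ x y → :- (x :- y) := y :- x) refl x y)) (≤⊕⇒⊝≤ h′))

⌜⌝-cong : ∀ {p q} → p ≡ q → ⌜ p ⌝ ≈ ⌜ q ⌝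
⌜⌝-cong refl = ≈-refl

⌜½⌝+⌜½⌝ : ∀ ε → ⌜ ½ * ε ⌝ ⊕ ⌜ ½ * ε ⌝ ≈ ⌜ ε ⌝
⌜½⌝+⌜½⌝ ε = ≈-trans (≈-sym (⌜⌝-+ (½ * ε) (½ * ε))) (⌜⌝-cong (½+½ ε))

-- Finite sums

∑ᴿ : ℕ → (ℕ → ℝ) → ℝ
∑ᴿ zero    f = 0ᴿ
∑ᴿ (suc n) f = ∑ᴿ n f ⊕ f n

opaque
  unfolding ⌜_⌝

  seq-∑ᴿ : ∀ n f j → seq (∑ℝ n f) j ≡ seq (∑ᴿ n f) j
  seq-∑ᴿ zero    f j = refl
  seq-∑ᴿ (suc n) f j = cong (_+ seq (f n) j) (seq-∑ᴿ n f j)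

∑ᴿ-cong : ∀ n {f g : ℕ → ℝ} → (∀ i → i ℕ.< n → f i ≈ g i) → ∑ᴿ n f ≈ ∑ᴿ n g
∑ᴿ-cong zero    h = ≈-refl
∑ᴿ-cong (suc n) h = ⊕-cong (∑ᴿ-cong n (λ i i<n → h i (ℕ.m≤n⇒m≤1+n i<n))) (h n ℕ.≤-refl)

∑ᴿ-mono : ∀ n {f g : ℕ → ℝ} → (∀ i → i ℕ.< n → f i ≤ᴿ g i) → ∑ᴿ n f ≤ᴿ ∑ᴿ n g
∑ᴿ-mono zero    h = ≤ᴿ-refl
∑ᴿ-mono (suc n) h = ⊕-mono-≤ (∑ᴿ-mono n (λ i i<n → h i (ℕ.m≤n⇒m≤1+n i<n))) (h n ℕ.≤-refl)

∑ᴿ-⊕ : ∀ n (f g : ℕ → ℝ) → ∑ᴿ n (λ i → f i ⊕ g i) ≈ ∑ᴿ n f ⊕ ∑ᴿ n g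
∑ᴿ-⊕ zero    f g = ≈-sym (⊕-identityˡ 0ᴿ)
∑ᴿ-⊕ (suc n) f g = ≈-trans (⊕-cong (∑ᴿ-⊕ n f g) ≈-refl)
  (solveᴿ 4 (λ a b c d → (a :+ b) :+ (c :+ d) := (a :+ c) :+ (b :+ d)) refl (∑ᴿ n f) (∑ᴿ n g) (f n) (g n))

∑ᴿ-⊗ˡ : ∀ n c (f : ℕ → ℝ) → ∑ᴿ n (λ i → c ⊗ f i) ≈ c ⊗ ∑ᴿ n f
∑ᴿ-⊗ˡ zero    c f = solveᴿ 1 (λ c → con 0ℚ := c :* con 0ℚ) refl c
∑ᴿ-⊗ˡ (suc n) c f = ≈-trans (⊕-cong (∑ᴿ-⊗ˡ n c f) ≈-refl) (≈-sym (⊗-distribˡ-⊕ c (∑ᴿ n f) (f n)))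

∑ᴿ-split : ∀ m n (f : ℕ → ℝ) → ∑ᴿ (n ℕ.+ m) f ≈ ∑ᴿ m f ⊕ ∑ᴿ n (λ i → f (i ℕ.+ m))
∑ᴿ-split m zero    f = ≈-sym (≈-trans (⊕-comm (∑ᴿ m f) 0ᴿ) (⊕-identityˡ (∑ᴿ m f)))
∑ᴿ-split m (suc n) f = ≈-trans (⊕-cong (∑ᴿ-split m n f) ≈-refl)
  (⊕-assoc (∑ᴿ m f) (∑ᴿ n (λ i → f (i ℕ.+ m))) (f (n ℕ.+ m)))

0≤∑ᴿ : ∀ n {f : ℕ → ℝ} → (∀ i → i ℕ.< n → 0ᴿ ≤ᴿ f i) → 0ᴿ ≤ᴿ ∑ᴿ n f
0≤∑ᴿ zero    h = ≤ᴿ-refl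
0≤∑ᴿ (suc n) h = 0≤⊕ (0≤∑ᴿ n (λ i i<n → h i (ℕ.m≤n⇒m≤1+n i<n))) (h n ℕ.≤-refl)

-- Limits

infix 4 _⇢_
record _⇢_ (a : ℕ → ℝ) (L : ℝ) : Set where
  constructor mk⇢
  field limit : ∀ ε → 0ℚ < ε → Eventually (λ n → ∥ a n ⊝ L ∥ ≤ᴿ ⌜ ε ⌝)

open _⇢_ public

⇢⇒⟶ : ∀ {a L} → a ⇢ L → a ⟶ L
⇢⇒⟶ {a} {L} (mk⇢ h) ε 0<ε = proj₁ (h ε 0<ε) , λ n le → un≤
  (≤ᴿ-trans (≈⇒≤ (∣-ℝ∣≈∥⊝∥ (a n) L)) (≤ᴿ-trans (proj₂ (h ε 0<ε) n le) (≈⇒≤ (≈-sym (fromℚ≈ ε)))))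

⇢-cong : ∀ {a b L M} → (∀ n → a n ≈ b n) → L ≈ M → a ⇢ L → b ⇢ M
⇢-cong a≈b L≈M (mk⇢ h) = mk⇢ λ ε 0<ε → proj₁ (h ε 0<ε) , λ n le →
  ≤ᴿ-trans (≈⇒≤ (∥∥-cong (⊝-cong (≈-sym (a≈b n)) (≈-sym L≈M)))) (proj₂ (h ε 0<ε) n le)

⇢-const : ∀ x → (λ _ → x) ⇢ x
⇢-const x = mk⇢ λ ε 0<ε → 0 , λ n _ → ≤ᴿ-trans (≈⇒≤ (≈-trans (∥∥-cong (solveᴿ 1 (λ x → x :- x := con 0ℚ) refl x)) (∥⌜⌝∥ 0ℚ))) (0≤⌜⌝ (<⇒≤ 0<ε))

⇢-+ : ∀ {a b L M} → a ⇢ L → b ⇢ M → (λ n → a n ⊕ b n) ⇢ L ⊕ M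
⇢-+ {a} {b} {L} {M} (mk⇢ h) (mk⇢ h′) = mk⇢ λ ε 0<ε → eventually-map₂
  (λ n p q → let open ℝ-Reasoning in begin
    ∥ (a n ⊕ b n) ⊝ (L ⊕ M) ∥  ≈⟨ ∥∥-cong (solveᴿ 4 (λ a b l m → (a :+ b) :- (l :+ m) := (a :- l) :+ (b :- m)) refl (a n) (b n) L M) ⟩
    ∥ (a n ⊝ L) ⊕ (b n ⊝ M) ∥  ≤⟨ ∥⊕∥≤ (a n ⊝ L) (b n ⊝ M) ⟩
    ∥ a n ⊝ L ∥ ⊕ ∥ b n ⊝ M ∥  ≤⟨ ⊕-mono-≤ p q ⟩
    ⌜ ½ * ε ⌝ ⊕ ⌜ ½ * ε ⌝  ≈⟨ ⌜½⌝+⌜½⌝ ε ⟩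
    ⌜ ε ⌝  ∎)
  (h (½ * ε) (½-pos 0<ε)) (h′ (½ * ε) (½-pos 0<ε))

⇢-*ˡ : ∀ c {a L} → a ⇢ L → (λ n → c ⊗ a n) ⇢ c ⊗ L
⇢-*ˡ c {a} {L} (mk⇢ h) = mk⇢ λ ε 0<ε → let (N , h′) = h (ε ÷₀ C) (0<÷₀ 0<ε 0<C) in N , λ n le → let open ℝ-Reasoning in begin
    ∥ c ⊗ a n ⊝ c ⊗ L ∥  ≈⟨ ∥∥-cong (solveᴿ 3 (λ c a l → c :* a :- c :* l := c :* (a :- l)) refl c (a n) L) ⟩
    ∥ c ⊗ (a n ⊝ L) ∥  ≈⟨ ∥⊗∥ c (a n ⊝ L) ⟩
    ∥ c ∥ ⊗ ∥ a n ⊝ L ∥  ≤⟨ ⊗-mono-≤ (0≤∥∥ c) (0≤⌜⌝ (<⇒≤ (0<÷₀ 0<ε 0<C))) c≤ (h′ n le) ⟩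
    ⌜ C ⌝ ⊗ ⌜ ε ÷₀ C ⌝  ≈⟨ ≈-trans (≈-sym (⌜⌝-* C (ε ÷₀ C))) (⌜⌝-cong (trans (*-comm C (ε ÷₀ C)) (÷₀-* ε (0<⇒≢0 0<C)))) ⟩
    ⌜ ε ⌝  ∎
  where
  C = proj₁ (bound c)
  0<C = proj₁ (proj₂ (bound c))
  c≤ = proj₂ (proj₂ (bound c))

⇢-mono : ∀ {a b L M} → Eventually (λ n → a n ≤ᴿ b n) → a ⇢ L → b ⇢ M → L ≤ᴿ M
⇢-mono {a} {b} {L} {M} (N , a≤b) (mk⇢ h) (mk⇢ h′) = ≤-from-ε λ ε 0<ε →
  let (N₁ , p) = h (½ * ε) (½-pos 0<ε)
      (N₂ , q) = h′ (½ * ε) (½-pos 0<ε)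
      n = N ℕ.⊔ (N₁ ℕ.⊔ N₂)
      open ℝ-Reasoning
  in begin
    L  ≤⟨ ∥⊝∥≤⇒≤ (≤ᴿ-trans (≈⇒≤ (∥⊝∥-sym L (a n))) (p n (ℕ.≤-trans (ℕ.m≤m⊔n N₁ N₂) (ℕ.m≤n⊔m N (N₁ ℕ.⊔ N₂))))) ⟩
    a n ⊕ ⌜ ½ * ε ⌝  ≤⟨ ⊕-mono-≤ (a≤b n (ℕ.m≤m⊔n N (N₁ ℕ.⊔ N₂))) ≤ᴿ-refl ⟩
    b n ⊕ ⌜ ½ * ε ⌝  ≤⟨ ⊕-mono-≤ (∥⊝∥≤⇒≤ (q n (ℕ.≤-trans (ℕ.m≤n⊔m N₁ N₂) (ℕ.m≤n⊔m N (N₁ ℕ.⊔ N₂))))) ≤ᴿ-refl ⟩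
    (M ⊕ ⌜ ½ * ε ⌝) ⊕ ⌜ ½ * ε ⌝  ≈⟨ ≈-trans (⊕-assoc M ⌜ ½ * ε ⌝ ⌜ ½ * ε ⌝) (⊕-cong (≈-refl {M}) (⌜½⌝+⌜½⌝ ε)) ⟩
    M ⊕ ⌜ ε ⌝  ∎

⇢-unique : ∀ {a L M} → a ⇢ L → a ⇢ M → L ≈ M
⇢-unique p q = ≤-antisymᴿ (⇢-mono (0 , λ _ _ → ≤ᴿ-refl) p q) (⇢-mono (0 , λ _ _ → ≤ᴿ-refl) q p)

⇢-subsequence : ∀ {a L} (s : ℕ → ℕ) → (∀ n → n ℕ.≤ s n) → a ⇢ L → (λ n → a (s n)) ⇢ L
⇢-subsequence s n≤s (mk⇢ h) = mk⇢ λ ε 0<ε → proj₁ (h ε 0<ε) , λ n le → proj₂ (h ε 0<ε) (s n) (ℕ.≤-trans le (n≤s n))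

C/n-small : ∀ C ε → 0ℚ ≤ C → 0ℚ < ε → Eventually (λ n → C * (+ 1 / suc n) ≤ ε)
C/n-small C ε 0≤C 0<ε = ℤ.∣ ↥ (C ÷₀ ε) ∣ , λ n le → *-cancelˡ-≤-pos (fromℕ (suc n)) {{positive (0<fromℕ-suc n)}} (begin
  fromℕ (suc n) * (C * (+ 1 / suc n))  ≡⟨ trans (solve 3 (λ n c i → n :* (c :* i) := c :* (n :* i)) refl (fromℕ (suc n)) C (+ 1 / suc n))
                                               (trans (cong (C *_) (fromℕ-*-/ 1 n)) (*-identityʳ C)) ⟩
  C  ≡⟨ ÷₀-* C (0<⇒≢0 0<ε) ⟨
  (C ÷₀ ε) * ε  ≤⟨ *-monoʳ-≤-nonNeg ε {{nonNegative (<⇒≤ 0<ε)}} (≤-trans (archimedean (C ÷₀ ε)) (fromℕ-mono-≤ (ℕ.m≤n⇒m≤1+n le))) ⟩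
  fromℕ (suc n) * ε  ∎)
  where open ≤-Reasoning

⇢-C/n : ∀ {a L} C → 0ℚ ≤ C → (∀ n → ∥ a n ⊝ L ∥ ≤ᴿ ⌜ C * (+ 1 / suc n) ⌝) → a ⇢ L
⇢-C/n C 0≤C h = mk⇢ λ ε 0<ε → let (N , h′) = C/n-small C ε 0≤C 0<ε in N , λ n le → ≤ᴿ-trans (h n) (⌜⌝-mono-≤ (h′ n le))

-- Diagonal argument: `r n` is a term of the sequence of `a n` chosen within 1/(n + 1) of `a n`, and
-- the rationals `r n` themselves form the limit.
complete : (a : ℕ → ℝ) → (∀ ε → 0ℚ < ε → ∃ λ N → ∀ m n → N ℕ.≤ m → N ℕ.≤ n → ∥ a m ⊝ a n ∥ ≤ᴿ ⌜ ε ⌝) → ∃ λ L → a ⇢ L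
complete a a-cauchy = L , mk⇢ a⇢L
  where
  1/n : ℕ → ℚ
  1/n n = + 1 / suc n
  0<1/n : ∀ n → 0ℚ < 1/n n
  0<1/n n = /-mono-< 0 1 0 n (s≤s z≤n)
  r : ℕ → ℚ
  r n = seq (a n) (proj₁ (approximation (a n) (1/n n) (0<1/n n)))
  r-close : ∀ n → ∥ a n ⊝ ⌜ r n ⌝ ∥ ≤ᴿ ⌜ 1/n n ⌝
  r-close n = proj₂ (approximation (a n) (1/n n) (0<1/n n)) _ ℕ.≤-refl
  r-cauchy : IsCauchy r
  r-cauchy ε 0<ε = M ℕ.⊔ N , λ m n le le′ → ⌜⌝-cancel-≤ (let open ℝ-Reasoning in begin
    ⌜ ∣ r m - r n ∣ ⌝
      ≈⟨ ≈-trans (≈-sym (∥⌜⌝∥ (r m - r n))) (∥∥-cong (≈-trans (⌜⌝-+ (r m) (- r n)) (⊕-cong ≈-refl (⌜⌝-⊖ (r n))))) ⟩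
    ∥ ⌜ r m ⌝ ⊝ ⌜ r n ⌝ ∥
      ≤⟨ ∥⊝∥-triangle (⌜ r m ⌝) (a m) (⌜ r n ⌝) ⟩
    ∥ ⌜ r m ⌝ ⊝ a m ∥ ⊕ ∥ a m ⊝ ⌜ r n ⌝ ∥
      ≤⟨ ⊕-mono-≤ (≈⇒≤ (∥⊝∥-sym (⌜ r m ⌝) (a m))) (∥⊝∥-triangle (a m) (a n) (⌜ r n ⌝)) ⟩
    ∥ a m ⊝ ⌜ r m ⌝ ∥ ⊕ (∥ a m ⊝ a n ∥ ⊕ ∥ a n ⊝ ⌜ r n ⌝ ∥)
      ≤⟨ ⊕-mono-≤ (≤ᴿ-trans (r-close m) (⌜⌝-mono-≤ (1/n≤ε (½ * δ) (½-pos 0<δ) m (ℕ.m⊔n≤o⇒n≤o M N le))))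
           (⊕-mono-≤ (proj₂ (a-cauchy δ 0<δ) m n (ℕ.m⊔n≤o⇒m≤o M N le) (ℕ.m⊔n≤o⇒m≤o M N le′))
             (≤ᴿ-trans (r-close n) (⌜⌝-mono-≤ (1/n≤ε (½ * δ) (½-pos 0<δ) n (ℕ.m⊔n≤o⇒n≤o M N le′))))) ⟩
    ⌜ ½ * δ ⌝ ⊕ (⌜ δ ⌝ ⊕ ⌜ ½ * δ ⌝)
      ≈⟨ ≈-trans (solveᴿ 2 (λ h d → h :+ (d :+ h) := (h :+ h) :+ d) refl ⌜ ½ * δ ⌝ ⌜ δ ⌝)
           (≈-trans (⊕-cong (⌜½⌝+⌜½⌝ δ) ≈-refl) (⌜½⌝+⌜½⌝ ε)) ⟩
    ⌜ ε ⌝ ∎)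
    where
    -- The three distances are bounded by δ/2, δ and δ/2, which sum to ε.
    δ = ½ * ε
    0<δ : 0ℚ < δ
    0<δ = ½-pos 0<ε
    M = proj₁ (a-cauchy δ 0<δ)
    N = ↧ₙ (½ * δ)
  L : ℝ
  L = mkℝ r r-cauchy
  a⇢L : ∀ ε → 0ℚ < ε → Eventually (λ n → ∥ a n ⊝ L ∥ ≤ᴿ ⌜ ε ⌝)
  a⇢L ε 0<ε = M ℕ.⊔ N , λ n le → let open ℝ-Reasoning in begin
    ∥ a n ⊝ L ∥
      ≤⟨ ∥⊝∥-triangle (a n) (⌜ r n ⌝) L ⟩
    ∥ a n ⊝ ⌜ r n ⌝ ∥ ⊕ ∥ ⌜ r n ⌝ ⊝ L ∥
      ≤⟨ ⊕-mono-≤ (≤ᴿ-trans (r-close n) (⌜⌝-mono-≤ (1/n≤ε (½ * ε) (½-pos 0<ε) n (ℕ.m⊔n≤o⇒n≤o M N le))))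
           (≤ᴿ-trans (≈⇒≤ (∥⊝∥-sym (⌜ r n ⌝) L)) (proj₂ (approximation L (½ * ε) (½-pos 0<ε)) n (ℕ.m⊔n≤o⇒m≤o M N le))) ⟩
    ⌜ ½ * ε ⌝ ⊕ ⌜ ½ * ε ⌝
      ≈⟨ ⌜½⌝+⌜½⌝ ε ⟩
    ⌜ ε ⌝ ∎
    where
    M = proj₁ (approximation L (½ * ε) (½-pos 0<ε))
    N = ↧ₙ (½ * ε)

-- Roots

0≤p² : ∀ p → 0ℚ ≤ p * p
0≤p² p with ≤-total 0ℚ p
... | inj₁ 0≤p = 0≤p*q 0≤p 0≤p
... | inj₂ p≤0 = subst (0ℚ ≤_) (solve 1 (λ p → (:- p) :* (:- p) := p :* p) refl p) (0≤p*q (neg-antimono-≤ p≤0) (neg-antimono-≤ p≤0))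

p≤p+q : ∀ {p q} → 0ℚ ≤ q → p ≤ p + q
p≤p+q {p} {q} 0≤q = subst (_≤ p + q) (+-identityʳ p) (+-monoʳ-≤ p 0≤q)

p≤q+p : ∀ {p q} → 0ℚ ≤ q → p ≤ q + p
p≤q+p {p} {q} 0≤q = subst (_≤ q + p) (+-identityˡ p) (+-monoˡ-≤ p 0≤q)

module PowerDifference {a b : ℚ} (0≤a : 0ℚ ≤ a) (0≤b : 0ℚ ≤ b) where

  -- (b ^ n − a ^ n) / (b − a), and the quotient of its difference from the
  -- derivative n a ^ (n − 1) by b − a.
  geo quo der : ℕ → ℚ
  geo zero    = 0ℚ
  geo (suc n) = b ^ n + a * geo n
  quo zero    = 0ℚ
  quo (suc n) = geo n + a * quo n
  der zero    = 0ℚ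
  der (suc n) = a ^ n + a * der n

  geo-eq : ∀ n → (b - a) * geo n ≡ b ^ n - a ^ n
  geo-eq zero    = *-zeroʳ (b - a)
  geo-eq (suc n) = trans (solve 4 (λ a b p g → (b :- a) :* (p :+ a :* g) := (b :- a) :* p :+ a :* ((b :- a) :* g)) refl a b (b ^ n) (geo n))
    (trans (cong (λ s → (b - a) * b ^ n + a * s) (geo-eq n))
      (solve 4 (λ a b p q → (b :- a) :* p :+ a :* (p :- q) := b :* p :- a :* q) refl a b (b ^ n) (a ^ n)))

  quo-eq : ∀ n → geo n - der n ≡ (b - a) * quo n
  quo-eq zero    = sym (*-zeroʳ (b - a))
  quo-eq (suc n) = begin
    b ^ n + a * geo n - (a ^ n + a * der n)  ≡⟨ solve 5 (λ a p q g d → p :+ a :* g :- (q :+ a :* d) := (p :- q) :+ a :* (g :- d)) refl a (b ^ n) (a ^ n) (geo n) (der n) ⟩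
    (b ^ n - a ^ n) + a * (geo n - der n)  ≡⟨ cong₂ (λ s t → s + a * t) (sym (geo-eq n)) (quo-eq n) ⟩
    (b - a) * geo n + a * ((b - a) * quo n)  ≡⟨ solve 4 (λ a b g q → (b :- a) :* g :+ a :* ((b :- a) :* q) := (b :- a) :* (g :+ a :* q)) refl a b (geo n) (quo n) ⟩
    (b - a) * quo (suc n)  ∎
    where open ≡-Reasoning

  der-eq : ∀ n → der (suc n) ≡ fromℕ (suc n) * a ^ n
  der-eq zero    = trans (cong (λ s → 1ℚ + s) (*-zeroʳ a)) refl
  der-eq (suc n) = trans (cong (λ s → a ^ suc n + a * s) (der-eq n)) (trans
    (solve 3 (λ a p n → a :* p :+ a :* (n :* p) := (con 1ℚ :+ n) :* (a :* p)) refl a (a ^ n) (fromℕ (suc n)))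
    (cong (_* a ^ suc n) (sym (fromℕ-suc (suc n)))))

  0≤geo : ∀ n → 0ℚ ≤ geo n
  0≤geo zero    = ≤-refl
  0≤geo (suc n) = +-mono-≤ (0≤^ n 0≤b) (0≤p*q 0≤a (0≤geo n))

  0≤quo : ∀ n → 0ℚ ≤ quo n
  0≤quo zero    = ≤-refl
  0≤quo (suc n) = +-mono-≤ (0≤geo n) (0≤p*q 0≤a (0≤quo n))

  a^≤geo : ∀ n → a ^ n ≤ geo (suc n)
  a^≤geo zero    = ≤-reflexive (sym (cong (λ s → 1ℚ + s) (*-zeroʳ a)))
  a^≤geo (suc n) = ≤-trans (*-monoˡ-≤-nonNeg a {{nonNegative 0≤a}} (a^≤geo n)) (p≤q+p (0≤^ (suc n) 0≤b))

  -- Unfolded, a · quo n is a sum of n products a^(n-i) geo i, and each is at most geo n because a ·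
  -- geo i ≤ geo (i + 1).
  a*quo≤ : ∀ n → a * quo n ≤ fromℕ n * geo n
  a*quo≤ zero    = ≤-reflexive (*-zeroʳ a)
  a*quo≤ (suc n) = begin
    a * (geo n + a * quo n)  ≤⟨ *-monoˡ-≤-nonNeg a {{nonNegative 0≤a}} (+-monoʳ-≤ (geo n) (a*quo≤ n)) ⟩
    a * (geo n + fromℕ n * geo n)  ≡⟨ trans (solve 3 (λ a g n → a :* (g :+ n :* g) := (con 1ℚ :+ n) :* (a :* g)) refl a (geo n) (fromℕ n))
                                                    (cong (_* (a * geo n)) (sym (fromℕ-suc n))) ⟩
    fromℕ (suc n) * (a * geo n)  ≤⟨ *-monoˡ-≤-nonNeg (fromℕ (suc n)) {{nonNegative (0≤fromℕ (suc n))}} (p≤q+p (0≤^ n 0≤b)) ⟩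
    fromℕ (suc n) * geo (suc n)  ∎
    where open ≤-Reasoning

  geo-bound : ∀ c → 1ℚ ≤ c → a ≤ c → b ≤ c → ∀ n → geo n ≤ fromℕ n * c ^ n
  geo-bound c 1≤c a≤c b≤c zero    = ≤-reflexive (sym (*-zeroˡ 1ℚ))
  geo-bound c 1≤c a≤c b≤c (suc n) = begin
    b ^ n + a * geo n  ≤⟨ +-mono-≤ (≤-trans (^-mono-≤ n 0≤b b≤c) c^n≤) (*-mono-≤-nonNeg 0≤a (0≤p*q (0≤fromℕ n) (0≤^ n 0≤c)) a≤c (geo-bound c 1≤c a≤c b≤c n)) ⟩
    c ^ suc n + c * (fromℕ n * c ^ n)  ≡⟨ solve 3 (λ c p n → c :* p :+ c :* (n :* p) := (con 1ℚ :+ n) :* (c :* p)) refl c (c ^ n) (fromℕ n) ⟩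
    (1ℚ + fromℕ n) * c ^ suc n  ≡⟨ cong (_* c ^ suc n) (fromℕ-suc n) ⟨
    fromℕ (suc n) * c ^ suc n  ∎
    where
    open ≤-Reasoning
    0≤c : 0ℚ ≤ c
    0≤c = ≤-trans (0≤fromℕ 1) 1≤c
    c^n≤ : c ^ n ≤ c * c ^ n
    c^n≤ = subst (_≤ c * c ^ n) (*-identityˡ (c ^ n)) (*-monoʳ-≤-nonNeg (c ^ n) {{nonNegative (0≤^ n 0≤c)}} 1≤c)

  module _ (n : ℕ) where

    private
      k = suc n
      T = a ^ k
      S = b ^ k
      h = S - T
      K = fromℕ k
      E = h - K * a ^ n * (b - a)

    -- `E` is the error in linearising x ↦ x^k at a. The square makes it nonnegative, which is
    -- convexity, and quadratically small.
    E-eq : E ≡ (b - a) * (b - a) * quo k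
    E-eq = begin
      h - K * a ^ n * (b - a)  ≡⟨ cong₂ (λ s t → s - t * (b - a)) (geo-eq k) (der-eq n) ⟨
      (b - a) * geo k - der k * (b - a)  ≡⟨ solve 3 (λ d g e → d :* g :- e :* d := d :* (g :- e)) refl (b - a) (geo k) (der k) ⟩
      (b - a) * (geo k - der k)  ≡⟨ trans (cong ((b - a) *_) (quo-eq k)) (sym (*-assoc (b - a) (b - a) (quo k))) ⟩
      (b - a) * (b - a) * quo k  ∎
      where open ≡-Reasoning

    0≤E : 0ℚ ≤ E
    0≤E = subst (0ℚ ≤_) (sym E-eq) (0≤p*q (0≤p² (b - a)) (0≤quo k))

    -- The square of b - a is to be replaced by that of h = (b - a) geo k, which takes two factors
    -- geo k. The factor T = a · a^n supplies them: one bounds a^n, the other a · quo k. Multiplying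
    -- by T, not dividing by it, keeps a = 0 included.
    T*E≤ : T * E ≤ K * (h * h)
    T*E≤ = begin
      T * E  ≡⟨ cong (T *_) E-eq ⟩
      a * a ^ n * ((b - a) * (b - a) * quo k)  ≡⟨ solve 4 (λ a p d q → a :* p :* (d :* d :* q) := (d :* d) :* (p :* (a :* q))) refl a (a ^ n) (b - a) (quo k) ⟩
      (b - a) * (b - a) * (a ^ n * (a * quo k))  ≤⟨ *-monoˡ-≤-nonNeg ((b - a) * (b - a)) {{nonNegative (0≤p² (b - a))}}
                                                            (*-mono-≤-nonNeg (0≤^ n 0≤a) (0≤p*q (0≤fromℕ k) (0≤geo k)) (a^≤geo n) (a*quo≤ k)) ⟩
      (b - a) * (b - a) * (geo k * (K * geo k))  ≡⟨ solve 3 (λ d g k → d :* d :* (g :* (k :* g)) := k :* (d :* g :* (d :* g))) refl (b - a) (geo k) K ⟩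
      K * ((b - a) * geo k * ((b - a) * geo k))  ≡⟨ cong (λ s → K * (s * s)) (geo-eq k) ⟩
      K * (h * h)  ∎
      where open ≤-Reasoning

    T*∣b-a∣≤ : T * ∣ b - a ∣ ≤ a * ∣ h ∣
    T*∣b-a∣≤ = begin
      a * a ^ n * ∣ b - a ∣  ≡⟨ *-assoc a (a ^ n) ∣ b - a ∣ ⟩
      a * (a ^ n * ∣ b - a ∣)  ≤⟨ *-monoˡ-≤-nonNeg a {{nonNegative 0≤a}} (*-monoʳ-≤-nonNeg ∣ b - a ∣ {{∣-∣-nonNeg (b - a)}} (a^≤geo n)) ⟩
      a * (geo k * ∣ b - a ∣)  ≡⟨ cong (a *_) (trans (*-comm (geo k) ∣ b - a ∣) (trans (cong (∣ b - a ∣ *_) (sym (0≤p⇒∣p∣≡p (0≤geo k))))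
                                             (trans (sym (∣p*q∣≡∣p∣*∣q∣ (b - a) (geo k))) (cong ∣_∣ (geo-eq k))))) ⟩
      a * ∣ h ∣  ∎
      where open ≤-Reasoning

    -- T ↦ T² T^(1/k) has derivative (2 + 1/k) T T^(1/k), with a quadratic error.
    differentiable : ∣ S * (S * b) - T * (T * a) - h * ((fromℕ 2 + + 1 / k) * (T * a)) ∣ ≤ (b + fromℕ 3 * a) * (h * h)
    differentiable = begin
      ∣ S * (S * b) - T * (T * a) - h * ((fromℕ 2 + i) * (T * a)) ∣
        ≡⟨ cong ∣_∣ decompose ⟩
      ∣ (h * (h * b) + fromℕ 2 * h * (T * (b - a))) + (- (i * a * (T * E))) ∣
        ≤⟨ ≤-trans (∣p+q∣≤∣p∣+∣q∣ (h * (h * b) + fromℕ 2 * h * (T * (b - a))) (- (i * a * (T * E)))) (+-monoˡ-≤ ∣ - (i * a * (T * E)) ∣ (∣p+q∣≤∣p∣+∣q∣ (h * (h * b)) (fromℕ 2 * h * (T * (b - a))))) ⟩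
      ∣ h * (h * b) ∣ + ∣ fromℕ 2 * h * (T * (b - a)) ∣ + ∣ - (i * a * (T * E)) ∣
        ≤⟨ +-mono-≤ (+-mono-≤ (≤-reflexive (trans (cong ∣_∣ (solve 2 (λ h b → h :* (h :* b) := h :* h :* b) refl h b)) (0≤p⇒∣p∣≡p (0≤p*q (0≤p² h) 0≤b)))) second) third ⟩
      h * h * b + fromℕ 2 * a * (h * h) + a * (h * h)
        ≡⟨ solve 3 (λ h b a → h :* h :* b :+ con (fromℕ 2) :* a :* (h :* h) :+ a :* (h :* h) := (b :+ con (fromℕ 3) :* a) :* (h :* h)) refl h b a ⟩
      (b + fromℕ 3 * a) * (h * h) ∎
      where
      open ≤-Reasoning
      i = + 1 / k
      K*i≡1 : K * i ≡ 1ℚ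
      K*i≡1 = fromℕ-*-/ 1 n
      decompose : S * (S * b) - T * (T * a) - h * ((fromℕ 2 + i) * (T * a))
                ≡ (h * (h * b) + fromℕ 2 * h * (T * (b - a))) + (- (i * a * (T * E)))
      decompose = trans
        (solve 5 (λ S T a b i → S :* (S :* b) :- T :* (T :* a) :- (S :- T) :* ((con (fromℕ 2) :+ i) :* (T :* a))
           := ((S :- T) :* ((S :- T) :* b) :+ con (fromℕ 2) :* (S :- T) :* (T :* (b :- a)))
              :+ (con 1ℚ :* (T :* (T :* (b :- a))) :- i :* (a :* (T :* (S :- T))))) refl S T a b i)
        -- The coefficient 1 is rewritten as K · (1/k), so that `E` can be factored out.
        (trans (cong (λ s → (h * (h * b) + fromℕ 2 * h * (T * (b - a))) + (s * (T * (T * (b - a))) - i * (a * (T * h)))) (sym K*i≡1))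
          (solve 8 (λ T a d i k p h x → x :+ (k :* i :* ((a :* p) :* (T :* d)) :- i :* (a :* (T :* h)))
             := x :+ (:- (i :* a :* (T :* (h :- k :* p :* d))))) refl
             T a (b - a) i K (a ^ n) h (h * (h * b) + fromℕ 2 * h * (T * (b - a)))))
      second : ∣ fromℕ 2 * h * (T * (b - a)) ∣ ≤ fromℕ 2 * a * (h * h)
      second = begin
        ∣ fromℕ 2 * h * (T * (b - a)) ∣  ≡⟨ trans (cong ∣_∣ (*-assoc (fromℕ 2) h (T * (b - a)))) (trans (∣p*q∣≡∣p∣*∣q∣ (fromℕ 2) (h * (T * (b - a))))
                                                       (cong (fromℕ 2 *_) (trans (∣p*q∣≡∣p∣*∣q∣ h (T * (b - a))) (cong (∣ h ∣ *_) (trans (∣p*q∣≡∣p∣*∣q∣ T (b - a))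
                                                         (cong (_* ∣ b - a ∣) (0≤p⇒∣p∣≡p (0≤^ k 0≤a)))))))) ⟩
        fromℕ 2 * (∣ h ∣ * (T * ∣ b - a ∣))  ≤⟨ *-monoˡ-≤-nonNeg (fromℕ 2) (*-monoˡ-≤-nonNeg ∣ h ∣ {{∣-∣-nonNeg h}} T*∣b-a∣≤) ⟩
        fromℕ 2 * (∣ h ∣ * (a * ∣ h ∣))  ≡⟨ solve 2 (λ a h → con (fromℕ 2) :* (h :* (a :* h)) := con (fromℕ 2) :* a :* (h :* h)) refl a ∣ h ∣ ⟩
        fromℕ 2 * a * (∣ h ∣ * ∣ h ∣)  ≡⟨ cong (fromℕ 2 * a *_) (trans (sym (∣p*q∣≡∣p∣*∣q∣ h h)) (0≤p⇒∣p∣≡p (0≤p² h))) ⟩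
        fromℕ 2 * a * (h * h)  ∎
      third : ∣ - (i * a * (T * E)) ∣ ≤ a * (h * h)
      third = begin
        ∣ - (i * a * (T * E)) ∣  ≡⟨ trans (∣-p∣≡∣p∣ (i * a * (T * E))) (0≤p⇒∣p∣≡p (0≤p*q (0≤p*q (0≤/ 1 n) 0≤a) (0≤p*q (0≤^ k 0≤a) 0≤E))) ⟩
        i * a * (T * E)  ≤⟨ *-monoˡ-≤-nonNeg (i * a) {{nonNegative (0≤p*q (0≤/ 1 n) 0≤a)}} T*E≤ ⟩
        i * a * (K * (h * h))  ≡⟨ solve 4 (λ i a k h → i :* a :* (k :* h) := k :* i :* (a :* h)) refl i a K (h * h) ⟩
        K * i * (a * (h * h))  ≡⟨ trans (cong (_* (a * (h * h))) K*i≡1) (*-identityˡ (a * (h * h))) ⟩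
        a * (h * h)  ∎

    -- The tangent of the concave function T ↦ T^(1/k) at T, from above and below.
    tangent-above : K * T * (a ^ n * b) ≤ K * (T * T) + T * h
    tangent-above = 0≤q-p⇒p≤q (subst (0ℚ ≤_)
      (solve 5 (λ a b p k h → (a :* p) :* (h :- k :* p :* (b :- a)) := (k :* ((a :* p) :* (a :* p)) :+ (a :* p) :* h) :- k :* (a :* p) :* (p :* b)) refl
        a b (a ^ n) K h) (0≤p*q (0≤^ k 0≤a) 0≤E))

    tangent-below : K * (T * T) + T * h - K * (h * h) ≤ K * T * (a ^ n * b)
    tangent-below = 0≤q-p⇒p≤q (subst (0ℚ ≤_)
      (solve 5 (λ a b p k h → k :* (h :* h) :- (a :* p) :* (h :- k :* p :* (b :- a))
         := k :* (a :* p) :* (p :* b) :- (k :* ((a :* p) :* (a :* p)) :+ (a :* p) :* h :- k :* (h :* h))) refl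
        a b (a ^ n) K h) (p≤q⇒0≤q-p T*E≤))

^-superadditive : ∀ n {x y} → 0ℚ ≤ x → 0ℚ ≤ y → x ^ suc n + y ^ suc n ≤ (x + y) ^ suc n
^-superadditive zero    {x} {y} 0≤x 0≤y = ≤-reflexive (solve 2 (λ x y → x :* con 1ℚ :+ y :* con 1ℚ := (x :+ y) :* con 1ℚ) refl x y)
^-superadditive (suc n) {x} {y} 0≤x 0≤y = begin
  x * x ^ suc n + y * y ^ suc n  ≤⟨ +-mono-≤ (*-monoʳ-≤-nonNeg (x ^ suc n) {{nonNegative (0≤^ (suc n) 0≤x)}} (p≤p+q {x} {y} 0≤y))
                                                          (*-monoʳ-≤-nonNeg (y ^ suc n) {{nonNegative (0≤^ (suc n) 0≤y)}} (p≤q+p {y} {x} 0≤x)) ⟩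
  (x + y) * x ^ suc n + (x + y) * y ^ suc n  ≡⟨ *-distribˡ-+ (x + y) (x ^ suc n) (y ^ suc n) ⟨
  (x + y) * (x ^ suc n + y ^ suc n)  ≤⟨ *-monoˡ-≤-nonNeg (x + y) {{nonNegative (+-mono-≤ 0≤x 0≤y)}} (^-superadditive n 0≤x 0≤y) ⟩
  (x + y) * (x + y) ^ suc n  ∎
  where open ≤-Reasoning

-^≤ : ∀ n {x y} → 0ℚ ≤ y → y ≤ x → (x - y) ^ suc n ≤ x ^ suc n - y ^ suc n
-^≤ n {x} {y} 0≤y y≤x = subst (_≤ x ^ suc n - y ^ suc n) (solve 2 (λ p q → q :+ p :- q := p) refl ((x - y) ^ suc n) (y ^ suc n))
  (+-monoˡ-≤ (- y ^ suc n) (subst (λ s → y ^ suc n + (x - y) ^ suc n ≤ s ^ suc n)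
    (solve 2 (λ x y → y :+ (x :- y) := x) refl x y) (^-superadditive n 0≤y (p≤q⇒0≤q-p y≤x))))

-- Superadditivity applied to the smaller number and the difference. It is an explicit modulus of
-- continuity for roots and makes powers injective on nonnegative reals.
∣-∣^≤ : ∀ n {x y} → 0ℚ ≤ x → 0ℚ ≤ y → ∣ x - y ∣ ^ suc n ≤ ∣ x ^ suc n - y ^ suc n ∣
∣-∣^≤ n {x} {y} 0≤x 0≤y with ≤-total y x
... | inj₁ y≤x = ≤-trans (subst (λ d → d ^ suc n ≤ x ^ suc n - y ^ suc n) (sym (0≤p⇒∣p∣≡p (p≤q⇒0≤q-p y≤x))) (-^≤ n 0≤y y≤x))
  (p≤∣p∣ (x ^ suc n - y ^ suc n))
... | inj₂ x≤y = subst₂ _≤_ (cong (_^ suc n) (∣p-q∣≡∣q-p∣ y x)) (∣p-q∣≡∣q-p∣ (y ^ suc n) (x ^ suc n))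
  (≤-trans (subst (λ d → d ^ suc n ≤ y ^ suc n - x ^ suc n) (sym (0≤p⇒∣p∣≡p (p≤q⇒0≤q-p x≤y))) (-^≤ n 0≤x x≤y))
    (p≤∣p∣ (y ^ suc n - x ^ suc n)))

0^≡0 : ∀ q .{{_ : ℕ.NonZero q}} → 0ℚ ^ q ≡ 0ℚ
0^≡0 (suc q) = *-zeroˡ (0ℚ ^ q)

≈-from-rate : ∀ x t C → 0ℚ ≤ C → (∀ j → ∣ seq x j - t ∣ ≤ C * (+ 1 / suc j)) → x ≈ ⌜ t ⌝
≈-from-rate x t C 0≤C h = mk≈ λ ε 0<ε → let (N , h′) = C/n-small C ε 0≤C 0<ε in N , λ j le →
  subst (λ s → ∣ seq x j - s ∣ ≤ ε) (sym (seq-⌜⌝ t j)) (≤-trans (h j) (h′ j le))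

^≤⇒≤1+ : ∀ q .{{_ : ℕ.NonZero q}} {a t} → 0ℚ ≤ t → a ^ q ≤ t → a ≤ 1ℚ + t
^≤⇒≤1+ q {a} {t} 0≤t a^q≤t with ≤-total a 1ℚ
... | inj₁ a≤1 = ≤-trans a≤1 (p≤p+q 0≤t)
... | inj₂ 1≤a = ≤-trans (x≤x^q q 1≤a) (≤-trans a^q≤t (p≤q+p (0≤fromℕ 1)))

power-gap : ∀ q .{{_ : ℕ.NonZero q}} {a h t} → 0ℚ ≤ a → 0ℚ ≤ h → h ≤ 1ℚ → 0ℚ ≤ t → a ^ q ≤ t → t ≤ (a + h) ^ q →
  ∣ a ^ q - t ∣ ≤ fromℕ q * (fromℕ 2 + t) ^ q * h
power-gap q {a} {h} {t} 0≤a 0≤h h≤1 0≤t a^q≤t t≤ = begin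
  ∣ a ^ q - t ∣  ≡⟨ trans (∣p-q∣≡∣q-p∣ (a ^ q) t) (0≤p⇒∣p∣≡p (p≤q⇒0≤q-p a^q≤t)) ⟩
  t - a ^ q  ≤⟨ +-monoˡ-≤ (- a ^ q) t≤ ⟩
  b ^ q - a ^ q  ≡⟨ PD.geo-eq q ⟨
  (b - a) * PD.geo q  ≡⟨ cong (_* PD.geo q) (solve 2 (λ a h → a :+ h :- a := h) refl a h) ⟩
  h * PD.geo q  ≤⟨ *-monoˡ-≤-nonNeg h {{nonNegative 0≤h}} (PD.geo-bound c 1≤c a≤c b≤c q) ⟩
  h * (fromℕ q * c ^ q)  ≡⟨ *-comm h (fromℕ q * c ^ q) ⟩
  fromℕ q * c ^ q * h  ∎
  where
  open ≤-Reasoning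
  b = a + h
  -- From a^q ≤ t follows a ≤ 1 + t, and h ≤ 1 adds another 1.
  c = fromℕ 2 + t
  module PD = PowerDifference {a} {b} 0≤a (+-mono-≤ 0≤a 0≤h)
  1≤c : 1ℚ ≤ c
  1≤c = ≤-trans (fromℕ-mono-≤ {1} {2} (s≤s z≤n)) (p≤p+q 0≤t)
  b≤c : b ≤ c
  b≤c = ≤-trans (+-mono-≤ (^≤⇒≤1+ q 0≤t a^q≤t) h≤1) (≤-reflexive (solve 1 (λ t → con 1ℚ :+ t :+ con 1ℚ := con (fromℕ 2) :+ t) refl t))
  a≤c : a ≤ c
  a≤c = ≤-trans (p≤p+q 0≤h) b≤c

root-power : ∀ q .{{_ : ℕ.NonZero q}} x t → 0ℚ ≤ t → (∀ j → 0ℚ ≤ seq x j) → (∀ j → seq x j ^ q ≤ t) →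
  (∀ j → t ≤ (seq x j + + 1 / suc j) ^ q) → x ^ᴿ q ≈ ⌜ t ⌝
root-power q x t 0≤t 0≤x x^≤t t≤ = ≈-from-rate (x ^ᴿ q) t (fromℕ q * (fromℕ 2 + t) ^ q)
  (0≤p*q (0≤fromℕ q) (0≤^ q (+-mono-≤ (0≤fromℕ 2) 0≤t))) λ j →
  subst (λ s → ∣ s - t ∣ ≤ fromℕ q * (fromℕ 2 + t) ^ q * (+ 1 / suc j)) (sym (seq-^ᴿ x q j))
    (power-gap q (0≤x j) (0≤/ 1 j) (/-mono-≤ 1 1 j 0 (s≤s z≤n)) 0≤t (x^≤t j) (t≤ j))

module _ (q : ℕ) .{{q≢0 : ℕ.NonZero q}} (t : ℚ) where

  0≤nthRoot : ∀ j → 0ℚ ≤ seq (nthRoot q {{q≢0}} t) j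
  0≤nthRoot j = 0≤/ (Root.numerator q {{q≢0}} t j) j

  nthRoot^≤ : 0ℚ ≤ t → ∀ j → seq (nthRoot q {{q≢0}} t) j ^ q ≤ t
  nthRoot^≤ 0≤t j = by-numerator (largest-sat {P = Below j} (below? j) (Root.bound q {{q≢0}} t j))
    where
    open Root q {{q≢0}} t using (Below; below?; numerator)
    by-numerator : numerator j ≡ 0 ⊎ Below j (numerator j) → (+ numerator j / suc j) ^ q ≤ t
    by-numerator (inj₂ below) = below
    by-numerator (inj₁ eq)    = subst (λ a → (+ a / suc j) ^ q ≤ t) (sym eq)
      (subst (λ p → p ^ q ≤ t) (sym (0/n≡0 (suc j))) (≤-trans (≤-reflexive (0^≡0 q)) 0≤t))

  ≤nthRoot^ : ∀ j → t ≤ (seq (nthRoot q {{q≢0}} t) j + + 1 / suc j) ^ q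
  ≤nthRoot^ j = subst (λ p → t ≤ p ^ q) (/-suc (Root.numerator q {{q≢0}} t j) j) (<⇒≤ (≰⇒> (Root.next-not-below q {{q≢0}} t j)))

  nthRoot≤1+ : 0ℚ ≤ t → ∀ j → seq (nthRoot q {{q≢0}} t) j ≤ 1ℚ + t
  nthRoot≤1+ 0≤t j = ^≤⇒≤1+ q 0≤t (nthRoot^≤ 0≤t j)

  nthRoot-^ : 0ℚ ≤ t → nthRoot q {{q≢0}} t ^ᴿ q ≈ ⌜ t ⌝
  nthRoot-^ 0≤t = root-power q {{q≢0}} (nthRoot q {{q≢0}} t) t 0≤t 0≤nthRoot (nthRoot^≤ 0≤t) ≤nthRoot^

0≤^ℚ : ∀ t r j → 0ℚ ≤ seq (t ^ℚ r) j
0≤^ℚ t r@record{} = 0≤nthRoot (↧ₙ r) (intPower t (↥ r))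

^ℚ-^ : ∀ t r → 0ℚ ≤ intPower t (↥ r) → (t ^ℚ r) ^ᴿ ↧ₙ r ≈ ⌜ intPower t (↥ r) ⌝
^ℚ-^ t r@record{} = nthRoot-^ (↧ₙ r) (intPower t (↥ r))

opaque
  rootᴿ : ℕ → ℚ → ℝ
  rootᴿ n t = nthRoot (suc n) t

  0≤rootᴿ : ∀ n t j → 0ℚ ≤ seq (rootᴿ n t) j
  0≤rootᴿ n t = 0≤nthRoot (suc n) t

  rootᴿ≤1+ : ∀ n t → 0ℚ ≤ t → ∀ j → seq (rootᴿ n t) j ≤ 1ℚ + t
  rootᴿ≤1+ n t = nthRoot≤1+ (suc n) t

  rootᴿ-^ : ∀ n t → 0ℚ ≤ t → rootᴿ n t ^ᴿ suc n ≈ ⌜ t ⌝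
  rootᴿ-^ n t = nthRoot-^ (suc n) t

-- By `∣-∣^≤`, powers that differ by less than ε^(n+1) have bases that differ by at most ε. The
-- powers are taken within half of ε^(n+1) to make the comparison strict.
^ᴿ-injective : ∀ n x y → (∀ j → 0ℚ ≤ seq x j) → (∀ j → 0ℚ ≤ seq y j) → x ^ᴿ suc n ≈ y ^ᴿ suc n → x ≈ y
^ᴿ-injective n x y 0≤x 0≤y (mk≈ h) = mk≈ λ ε 0<ε →
  let 0<ε^ = 0<^ (suc n) 0<ε
      (N , h′) = h (½ * ε ^ suc n) (½-pos 0<ε^)
  in N , λ j le → ≰^⇒≤ j 0<ε (<-≤-trans
       (≤-<-trans (∣-∣^≤ n (0≤x j) (0≤y j)) (≤-<-trans
         (subst₂ (λ s t → ∣ s - t ∣ ≤ ½ * ε ^ suc n) (seq-^ᴿ x (suc n) j) (seq-^ᴿ y (suc n) j) (h′ j le))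
         (½*< 0<ε^))) ≤-refl)
  where
  ½*< : ∀ {q} → 0ℚ < q → ½ * q < q
  ½*< {q} 0<q = subst₂ _<_ (+-identityʳ (½ * q)) (½+½ q) (+-monoʳ-< (½ * q) (½-pos 0<q))
  ≰^⇒≤ : ∀ j {ε} → 0ℚ < ε → ∣ seq x j - seq y j ∣ ^ suc n < ε ^ suc n → ∣ seq x j - seq y j ∣ ≤ ε
  ≰^⇒≤ j {ε} 0<ε lt with ≤-total ∣ seq x j - seq y j ∣ ε
  ... | inj₁ le = le
  ... | inj₂ ge = ⊥-elim (<-irrefl refl (<-≤-trans lt (^-mono-≤ (suc n) (<⇒≤ 0<ε) ge)))

^ᴿ-cong : ∀ n {x y} → x ≈ y → x ^ᴿ n ≈ y ^ᴿ n
^ᴿ-cong zero    p = ≈-refl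
^ᴿ-cong (suc n) p = ⊗-cong p (^ᴿ-cong n p)

⊗-distrib-^ᴿ : ∀ n x y → (x ⊗ y) ^ᴿ n ≈ x ^ᴿ n ⊗ y ^ᴿ n
⊗-distrib-^ᴿ zero    x y = ≈-sym (⊗-identityˡ 1ᴿ)
⊗-distrib-^ᴿ (suc n) x y = ≈-trans (⊗-congˡ (x ⊗ y) (⊗-distrib-^ᴿ n x y))
  (solveᴿ 4 (λ x y a b → x :* y :* (a :* b) := x :* a :* (y :* b)) refl x y (x ^ᴿ n) (y ^ᴿ n))

⌜⌝-^ : ∀ n q → ⌜ q ⌝ ^ᴿ n ≈ ⌜ q ^ n ⌝
⌜⌝-^ zero    q = ≈-refl
⌜⌝-^ (suc n) q = ≈-trans (⊗-congˡ ⌜ q ⌝ (⌜⌝-^ n q)) (≈-sym (⌜⌝-* q (q ^ n)))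

⟦⟧ᴿ-cong : ∀ {n} (p : Polynomial n) ρ σ → (∀ i → lookup ρ i ≈ lookup σ i) → ⟦ p ⟧ᴿ ρ ≈ ⟦ p ⟧ᴿ σ
⟦⟧ᴿ-cong (op [+] p q) ρ σ h = ⊕-cong (⟦⟧ᴿ-cong p ρ σ h) (⟦⟧ᴿ-cong q ρ σ h)
⟦⟧ᴿ-cong (op [*] p q) ρ σ h = ⊗-cong (⟦⟧ᴿ-cong p ρ σ h) (⟦⟧ᴿ-cong q ρ σ h)
⟦⟧ᴿ-cong (con c)      ρ σ h = ≈-refl
⟦⟧ᴿ-cong (var i)      ρ σ h = h i
⟦⟧ᴿ-cong (p :^ n)     ρ σ h = ^ᴿ-cong n (⟦⟧ᴿ-cong p ρ σ h)
⟦⟧ᴿ-cong (:- p)       ρ σ h = ⊖-cong (⟦⟧ᴿ-cong p ρ σ h)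

-- A polynomial inequality between nonnegative rationals a, b and their k-th
-- powers holds for the k-th roots of s and t, being true of all approximations.
rootᴿ-lift : ∀ n (p q : Polynomial 4) →
  (∀ a b → 0ℚ ≤ a → 0ℚ ≤ b → let ρ = b ^ suc n ∷ a ^ suc n ∷ b ∷ a ∷ [] in ⟦ p ⟧ ρ ≤ ⟦ q ⟧ ρ) →
  ∀ s t → 0ℚ ≤ s → 0ℚ ≤ t → let ρ = ⌜ s ⌝ ∷ ⌜ t ⌝ ∷ rootᴿ n s ∷ rootᴿ n t ∷ [] in ⟦ p ⟧ᴿ ρ ≤ᴿ ⟦ q ⟧ᴿ ρ
rootᴿ-lift n p q h s t 0≤s 0≤t = ≤ᴿ-trans (≈⇒≤ (≈-sym (⟦⟧ᴿ-cong p ρ σ ρ≈σ)))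
  (≤ᴿ-trans (≤-pointwise (⟦ p ⟧ᴿ ρ) (⟦ q ⟧ᴿ ρ) λ j → subst₂ _≤_ (sym (seq-⟦⟧ᴿ p ρ j)) (sym (seq-⟦⟧ᴿ q ρ j))
      (subst₂ (λ S T → let ρⱼ = S ∷ T ∷ seq (rootᴿ n s) j ∷ seq (rootᴿ n t) j ∷ [] in ⟦ p ⟧ ρⱼ ≤ ⟦ q ⟧ ρⱼ)
        (sym (seq-^ᴿ (rootᴿ n s) (suc n) j)) (sym (seq-^ᴿ (rootᴿ n t) (suc n) j))
        (h (seq (rootᴿ n t) j) (seq (rootᴿ n s) j) (0≤rootᴿ n t j) (0≤rootᴿ n s j))))
    (≈⇒≤ (⟦⟧ᴿ-cong q ρ σ ρ≈σ)))
  where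
  ρ σ : Vec ℝ 4
  ρ = rootᴿ n s ^ᴿ suc n ∷ rootᴿ n t ^ᴿ suc n ∷ rootᴿ n s ∷ rootᴿ n t ∷ []
  σ = ⌜ s ⌝ ∷ ⌜ t ⌝ ∷ rootᴿ n s ∷ rootᴿ n t ∷ []
  ρ≈σ : ∀ i → lookup ρ i ≈ lookup σ i
  ρ≈σ Fin.zero                               = rootᴿ-^ n s 0≤s
  ρ≈σ (Fin.suc Fin.zero)                     = rootᴿ-^ n t 0≤t
  ρ≈σ (Fin.suc (Fin.suc Fin.zero))           = ≈-refl
  ρ≈σ (Fin.suc (Fin.suc (Fin.suc Fin.zero))) = ≈-refl

rootᴿ-lift-∥∥ : ∀ n (p q : Polynomial 4) →
  (∀ a b → 0ℚ ≤ a → 0ℚ ≤ b → let ρ = b ^ suc n ∷ a ^ suc n ∷ b ∷ a ∷ [] in ∣ ⟦ p ⟧ ρ ∣ ≤ ⟦ q ⟧ ρ) →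
  ∀ s t → 0ℚ ≤ s → 0ℚ ≤ t → let ρ = ⌜ s ⌝ ∷ ⌜ t ⌝ ∷ rootᴿ n s ∷ rootᴿ n t ∷ [] in ∥ ⟦ p ⟧ᴿ ρ ∥ ≤ᴿ ⟦ q ⟧ᴿ ρ
rootᴿ-lift-∥∥ n p q h s t 0≤s 0≤t = ∥∥≤
  (rootᴿ-lift n p q (λ a b 0≤a 0≤b → ≤-trans (p≤∣p∣ _) (h a b 0≤a 0≤b)) s t 0≤s 0≤t)
  (rootᴿ-lift n (:- p) q (λ a b 0≤a 0≤b → ≤-trans (≤-trans (p≤∣p∣ _) (≤-reflexive (∣-p∣≡∣p∣ (⟦ p ⟧ _)))) (h a b 0≤a 0≤b)) s t 0≤s 0≤t)

rootᴿ≤ : ∀ n t → 0ℚ ≤ t → rootᴿ n t ≤ᴿ ⌜ 1ℚ + t ⌝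
rootᴿ≤ n t 0≤t = ≤-pointwise (rootᴿ n t) ⌜ 1ℚ + t ⌝ λ j → subst (seq (rootᴿ n t) j ≤_) (sym (seq-⌜⌝ (1ℚ + t) j)) (rootᴿ≤1+ n t 0≤t j)

0≤ᴿrootᴿ : ∀ n t → 0ᴿ ≤ᴿ rootᴿ n t
0≤ᴿrootᴿ n t = ≤-pointwise 0ᴿ (rootᴿ n t) λ j → subst (_≤ seq (rootᴿ n t) j) (sym (seq-⌜⌝ 0ℚ j)) (0≤rootᴿ n t j)

module RootCalculus (n : ℕ) where

  private
    k = suc n
    S T b a : Polynomial 4
    S = var Fin.zero
    T = var (Fin.suc Fin.zero)
    b = var (Fin.suc (Fin.suc Fin.zero))
    a = var (Fin.suc (Fin.suc (Fin.suc Fin.zero)))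

  rootᴿ-differentiable : ∀ s t → 0ℚ ≤ s → 0ℚ ≤ t →
    ∥ ⌜ s ⌝ ⊗ (⌜ s ⌝ ⊗ rootᴿ n s) ⊝ ⌜ t ⌝ ⊗ (⌜ t ⌝ ⊗ rootᴿ n t) ⊝ (⌜ s ⌝ ⊝ ⌜ t ⌝) ⊗ (⌜ fromℕ 2 + + 1 / k ⌝ ⊗ (⌜ t ⌝ ⊗ rootᴿ n t)) ∥
    ≤ᴿ (rootᴿ n s ⊕ ⌜ fromℕ 3 ⌝ ⊗ rootᴿ n t) ⊗ ((⌜ s ⌝ ⊝ ⌜ t ⌝) ⊗ (⌜ s ⌝ ⊝ ⌜ t ⌝))
  rootᴿ-differentiable = rootᴿ-lift-∥∥ n
    (S :* (S :* b) :- T :* (T :* a) :- (S :- T) :* (con (fromℕ 2 + + 1 / k) :* (T :* a)))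
    ((b :+ con (fromℕ 3) :* a) :* ((S :- T) :* (S :- T)))
    (λ a b 0≤a 0≤b → PowerDifference.differentiable 0≤a 0≤b n)

  rootᴿ-tangent-above : ∀ s t → 0ℚ ≤ s → 0ℚ ≤ t →
    ⌜ fromℕ k ⌝ ⊗ ⌜ t ⌝ ⊗ (rootᴿ n t ^ᴿ n ⊗ rootᴿ n s) ≤ᴿ ⌜ fromℕ k ⌝ ⊗ (⌜ t ⌝ ⊗ ⌜ t ⌝) ⊕ ⌜ t ⌝ ⊗ (⌜ s ⌝ ⊝ ⌜ t ⌝)
  rootᴿ-tangent-above = rootᴿ-lift n
    (con (fromℕ k) :* T :* (a :^ n :* b)) (con (fromℕ k) :* (T :* T) :+ T :* (S :- T))
    (λ a b 0≤a 0≤b → PowerDifference.tangent-above 0≤a 0≤b n)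

  rootᴿ-tangent-below : ∀ s t → 0ℚ ≤ s → 0ℚ ≤ t →
    ⌜ fromℕ k ⌝ ⊗ (⌜ t ⌝ ⊗ ⌜ t ⌝) ⊕ ⌜ t ⌝ ⊗ (⌜ s ⌝ ⊝ ⌜ t ⌝) ⊝ ⌜ fromℕ k ⌝ ⊗ ((⌜ s ⌝ ⊝ ⌜ t ⌝) ⊗ (⌜ s ⌝ ⊝ ⌜ t ⌝))
    ≤ᴿ ⌜ fromℕ k ⌝ ⊗ ⌜ t ⌝ ⊗ (rootᴿ n t ^ᴿ n ⊗ rootᴿ n s)
  rootᴿ-tangent-below = rootᴿ-lift n
    (con (fromℕ k) :* (T :* T) :+ T :* (S :- T) :- con (fromℕ k) :* ((S :- T) :* (S :- T))) (con (fromℕ k) :* T :* (a :^ n :* b))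
    (λ a b 0≤a 0≤b → PowerDifference.tangent-below 0≤a 0≤b n)

-- The exponential function

1/!>0 : ∀ i → 0ℚ < (+ 1 / (i !)) {{i ℕ.!≢0}}
1/!>0 i = positive⁻¹ _ {{normalize-pos 1 (i !) {{i ℕ.!≢0}}}}

0≤expTerm : ∀ {x} → 0ℚ ≤ x → ∀ i → 0ℚ ≤ expTerm x i
0≤expTerm 0≤x i = 0≤p*q (0≤^ i 0≤x) (<⇒≤ (1/!>0 i))

∣^∣≤ : ∀ {x R} → ∣ x ∣ ≤ R → ∀ i → ∣ x ^ i ∣ ≤ R ^ i
∣^∣≤ x≤R zero    = ≤-refl
∣^∣≤ {x} {R} x≤R (suc i) = ≤-trans (≤-reflexive (∣p*q∣≡∣p∣*∣q∣ x (x ^ i)))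
  (*-mono-≤-nonNeg (0≤∣p∣ x) (≤-trans (0≤∣p∣ (x ^ i)) (∣^∣≤ x≤R i)) x≤R (∣^∣≤ x≤R i))

∣expTerm∣≤ : ∀ {x R} → ∣ x ∣ ≤ R → ∀ i → ∣ expTerm x i ∣ ≤ expTerm R i
∣expTerm∣≤ {x} {R} x≤R i = ≤-trans
  (≤-reflexive (trans (∣p*q∣≡∣p∣*∣q∣ (x ^ i) _) (cong (∣ x ^ i ∣ *_) (0≤p⇒∣p∣≡p (<⇒≤ (1/!>0 i))))))
  (*-monoʳ-≤-nonNeg _ {{nonNegative (<⇒≤ (1/!>0 i))}} (∣^∣≤ x≤R i))

expTerm-suc : ∀ x i → fromℕ (suc i) * expTerm x (suc i) ≡ x * expTerm x i
expTerm-suc x i = trans (cong (fromℕ (suc i) *_) (Exp.expTerm-suc x i)) (trans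
  (solve 4 (λ n x r t → n :* (x :* r :* t) := n :* r :* (x :* t)) refl (fromℕ (suc i)) x (+ 1 / suc i) (expTerm x i))
  (trans (cong (_* (x * expTerm x i)) (fromℕ-*-/ 1 i)) (*-identityˡ (x * expTerm x i))))

module ExpDifference (R x y : ℚ) (x≤R : ∣ x ∣ ≤ R) (y≤R : ∣ y ∣ ≤ R) where

  private
    0≤R : 0ℚ ≤ R
    0≤R = ≤-trans (0≤∣p∣ x) x≤R
    h = y - x

  -- The remainder of exp y - exp x - (y - x) exp x, term by term. The offset by one arises because
  -- the derivative of term i + 1 is term i.
  D : ℕ → ℚ
  D i = expTerm y (suc i) - expTerm x (suc i) - h * expTerm x i

  D-suc : ∀ i → fromℕ (suc (suc i)) * D (suc i) ≡ y * D i + h * h * expTerm x i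
  D-suc i = begin
    n₂ * (expTerm y (suc (suc i)) - expTerm x (suc (suc i)) - h * x₁)
      ≡⟨ solve 5 (λ n a b h c → n :* (a :- b :- h :* c) := n :* a :- n :* b :- n :* (h :* c)) refl
           n₂ (expTerm y (suc (suc i))) (expTerm x (suc (suc i))) h x₁ ⟩
    n₂ * expTerm y (suc (suc i)) - n₂ * expTerm x (suc (suc i)) - n₂ * (h * x₁)
      ≡⟨ cong₂ (λ a b → a - b - n₂ * (h * x₁)) (expTerm-suc y (suc i)) (expTerm-suc x (suc i)) ⟩
    y * y₁ - x * x₁ - n₂ * (h * x₁)
      ≡⟨ cong (λ n → y * y₁ - x * x₁ - n * (h * x₁)) (fromℕ-suc (suc i)) ⟩
    y * y₁ - x * x₁ - (1ℚ + fromℕ (suc i)) * ((y - x) * x₁)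
      ≡⟨ solve 5 (λ y x a b n → y :* a :- x :* b :- (con 1ℚ :+ n) :* ((y :- x) :* b) := y :* (a :- b) :- (y :- x) :* (n :* b)) refl y x y₁ x₁ (fromℕ (suc i)) ⟩
    y * (y₁ - x₁) - h * (fromℕ (suc i) * x₁)
      ≡⟨ cong (λ s → y * (y₁ - x₁) - h * s) (expTerm-suc x i) ⟩
    y * (y₁ - x₁) - (y - x) * (x * expTerm x i)
      ≡⟨ solve 5 (λ y x a b t → y :* (a :- b) :- (y :- x) :* (x :* t) := y :* (a :- b :- (y :- x) :* t) :+ (y :- x) :* (y :- x) :* t) refl y x y₁ x₁ (expTerm x i) ⟩
    y * D i + h * h * expTerm x i ∎
    where
    open ≡-Reasoning
    n₂ = fromℕ (suc (suc i))
    x₁ = expTerm x (suc i)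
    y₁ = expTerm y (suc i)

  D-zero : D 0 ≡ 0ℚ
  D-zero = solve 2 (λ x y → y :* con 1ℚ :* con 1ℚ :- x :* con 1ℚ :* con 1ℚ :- (y :- x) :* (con 1ℚ :* con 1ℚ) := con 0ℚ) refl x y

  scaled-bound : ∀ i → ∣ fromℕ (suc (suc i)) * D (suc i) ∣ ≤ R * ∣ D i ∣ + h * h * expTerm R i
  scaled-bound i = begin
    ∣ fromℕ (suc (suc i)) * D (suc i) ∣  ≡⟨ cong ∣_∣ (D-suc i) ⟩
    ∣ y * D i + h * h * expTerm x i ∣  ≤⟨ ∣p+q∣≤∣p∣+∣q∣ (y * D i) (h * h * expTerm x i) ⟩
    ∣ y * D i ∣ + ∣ h * h * expTerm x i ∣  ≡⟨ cong₂ _+_ (∣p*q∣≡∣p∣*∣q∣ y (D i)) (trans (∣p*q∣≡∣p∣*∣q∣ (h * h) (expTerm x i))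
                                                     (cong (_* ∣ expTerm x i ∣) (0≤p⇒∣p∣≡p (0≤p² h)))) ⟩
    ∣ y ∣ * ∣ D i ∣ + h * h * ∣ expTerm x i ∣  ≤⟨ +-mono-≤ (*-monoʳ-≤-nonNeg ∣ D i ∣ {{∣-∣-nonNeg (D i)}} y≤R)
                                                              (*-monoˡ-≤-nonNeg (h * h) {{nonNegative (0≤p² h)}} (∣expTerm∣≤ x≤R i)) ⟩
    R * ∣ D i ∣ + h * h * expTerm R i  ∎
    where open ≤-Reasoning

  -- Write M for h² R^i / i!. By `D-suc`, (i + 2) D (i + 1) is y D i plus a term bounded by M. The
  -- induction hypothesis bounds y D i by i M, and i + 1 ≤ i + 2.
  D-bound : ∀ i → ∣ D (suc i) ∣ ≤ h * h * expTerm R i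
  D-bound i = *-cancelˡ-≤-pos n₂ {{positive (0<fromℕ-suc (suc i))}} (begin
    n₂ * ∣ D (suc i) ∣  ≡⟨ trans (∣p*q∣≡∣p∣*∣q∣ n₂ (D (suc i))) (cong (_* ∣ D (suc i) ∣) (0≤p⇒∣p∣≡p (0≤fromℕ (suc (suc i))))) ⟨
    ∣ n₂ * D (suc i) ∣  ≤⟨ scaled-bound i ⟩
    R * ∣ D i ∣ + h * h * expTerm R i  ≤⟨ +-monoˡ-≤ (h * h * expTerm R i) (previous i) ⟩
    fromℕ i * (h * h * expTerm R i) + h * h * expTerm R i
      ≡⟨ trans (solve 2 (λ i t → i :* t :+ t := (con 1ℚ :+ i) :* t) refl (fromℕ i) (h * h * expTerm R i)) (cong (_* (h * h * expTerm R i)) (sym (fromℕ-suc i))) ⟩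
    fromℕ (suc i) * (h * h * expTerm R i)  ≤⟨ *-monoʳ-≤-nonNeg (h * h * expTerm R i) {{nonNegative (0≤p*q (0≤p² h) (0≤expTerm 0≤R i))}} (fromℕ-mono-≤ (ℕ.n≤1+n (suc i))) ⟩
    n₂ * (h * h * expTerm R i)  ∎)
    where
    open ≤-Reasoning
    n₂ = fromℕ (suc (suc i))
    previous : ∀ i → R * ∣ D i ∣ ≤ fromℕ i * (h * h * expTerm R i)
    previous zero    = ≤-reflexive (trans (cong (λ d → R * ∣ d ∣) D-zero) (trans (*-zeroʳ R) (sym (*-zeroˡ (h * h * expTerm R 0)))))
    previous (suc i) = begin
      R * ∣ D (suc i) ∣  ≤⟨ *-monoˡ-≤-nonNeg R {{nonNegative 0≤R}} (D-bound i) ⟩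
      R * (h * h * expTerm R i)  ≡⟨ solve 3 (λ r h t → r :* (h :* t) := h :* (r :* t)) refl R (h * h) (expTerm R i) ⟩
      h * h * (R * expTerm R i)  ≡⟨ cong (h * h *_) (expTerm-suc R i) ⟨
      h * h * (fromℕ (suc i) * expTerm R (suc i))  ≡⟨ solve 3 (λ h n t → h :* (n :* t) := n :* (h :* t)) refl (h * h) (fromℕ (suc i)) (expTerm R (suc i)) ⟩
      fromℕ (suc i) * (h * h * expTerm R (suc i))  ∎

  ∑D-bound : ∀ n → ∣ ∑ (suc n) D ∣ ≤ h * h * Exp.partialSum R n
  ∑D-bound zero    = ≤-reflexive (trans (cong (λ d → ∣ 0ℚ + d ∣) D-zero) (sym (*-zeroʳ (h * h))))
  ∑D-bound (suc n) = ≤-trans (∣p+q∣≤∣p∣+∣q∣ (∑ (suc n) D) (D (suc n))) (≤-trans (+-mono-≤ (∑D-bound n) (D-bound n))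
    (≤-reflexive (sym (*-distribˡ-+ (h * h) (Exp.partialSum R n) (expTerm R n)))))

  ∑D-eq : ∀ n → Exp.partialSum y (suc n) - Exp.partialSum x (suc n) - h * Exp.partialSum x n ≡ ∑ n D
  ∑D-eq zero    = trans (cong (λ s → 0ℚ + 1ℚ * 1ℚ - (0ℚ + 1ℚ * 1ℚ) - s) (*-zeroʳ h)) refl
  ∑D-eq (suc n) = trans
    (solve 6 (λ a b h p c t → (a :+ c) :- (b :+ t) :- h :* p := a :- b :- h :* p :+ (c :- t)) refl
      (Exp.partialSum y (suc n)) (Exp.partialSum x (suc n)) h (Exp.partialSum x (suc n)) (expTerm y (suc n)) (expTerm x (suc n)))
    (trans (solve 6 (λ a b h p c s → a :- b :- h :* (p :+ s) :+ c := a :- b :- h :* p :+ (c :- h :* s)) refl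
      (Exp.partialSum y (suc n)) (Exp.partialSum x (suc n)) h (Exp.partialSum x n) (expTerm y (suc n) - expTerm x (suc n)) (expTerm x n))
      (cong (_+ D n) (∑D-eq n)))

  difference-bound : ∀ n → ∣ Exp.partialSum y (suc n) - Exp.partialSum x (suc n) - h * Exp.partialSum x n ∣ ≤ h * h * Exp.partialSum R n
  difference-bound zero    = subst₂ (λ s t → ∣ s ∣ ≤ t) (sym (∑D-eq 0)) (sym (*-zeroʳ (h * h))) ≤-refl
  difference-bound (suc n) = subst (λ s → ∣ s ∣ ≤ h * h * Exp.partialSum R (suc n)) (sym (∑D-eq (suc n)))
    (≤-trans (∑D-bound n) (*-monoˡ-≤-nonNeg (h * h) {{nonNegative (0≤p² h)}} (p≤p+q (0≤expTerm 0≤R n))))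

partialSum-∣∣≤ : ∀ {x R} → ∣ x ∣ ≤ R → ∀ n → ∣ Exp.partialSum x n ∣ ≤ Exp.partialSum R n
partialSum-∣∣≤ x≤R zero    = ≤-refl
partialSum-∣∣≤ {x} x≤R (suc n) = ≤-trans (∣p+q∣≤∣p∣+∣q∣ (Exp.partialSum x n) (expTerm x n))
  (+-mono-≤ (partialSum-∣∣≤ x≤R n) (∣expTerm∣≤ x≤R n))

0≤partialSum : ∀ {x} → 0ℚ ≤ x → ∀ n → 0ℚ ≤ Exp.partialSum x n
0≤partialSum 0≤x zero    = ≤-refl
0≤partialSum 0≤x (suc n) = +-mono-≤ (0≤partialSum 0≤x n) (0≤expTerm 0≤x n)

expTerm≤partialSum : ∀ {x} → 0ℚ ≤ x → ∀ i n → i ℕ.< n → expTerm x i ≤ Exp.partialSum x n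
expTerm≤partialSum {x} 0≤x i (suc n) (s≤s i≤n) with ℕ.m≤n⇒m<n∨m≡n i≤n
... | inj₁ i<n  = ≤-trans (expTerm≤partialSum 0≤x i n i<n) (p≤p+q (0≤expTerm 0≤x n))
... | inj₂ refl = p≤q+p (0≤partialSum 0≤x n)

partialSum-0 : ∀ n → Exp.partialSum 0ℚ (suc n) ≡ 1ℚ
partialSum-0 zero    = refl
partialSum-0 (suc n) = trans (cong₂ _+_ (partialSum-0 n) (trans (cong (_* (+ 1 / (suc n !)) {{suc n ℕ.!≢0}}) (*-zeroˡ (0ℚ ^ n))) (*-zeroˡ ((+ 1 / (suc n !)) {{suc n ℕ.!≢0}})))) (+-identityʳ 1ℚ)

opaque
  expᴿ : ℚ → ℝ
  expᴿ x = exp x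

  exp≈expᴿ : ∀ x → exp x ≈ expᴿ x
  exp≈expᴿ x = ≈-refl

  seq-expᴿ : ∀ x n → seq (expᴿ x) n ≡ Exp.partialSum x n
  seq-expᴿ x n = refl

  -- Drops the first term. `difference-bound` compares partial sums with n + 1 and with n terms, so
  -- the exponentials in the difference are read one term later than the derivative.
  shift : ℝ → ℝ
  shift x = mkℝ (λ n → seq x (suc n)) λ ε 0<ε → let (N , h) = cauchy x ε 0<ε in
    N , λ m n le le′ → h (suc m) (suc n) (ℕ.m≤n⇒m≤1+n le) (ℕ.m≤n⇒m≤1+n le′)

  seq-shift : ∀ x n → seq (shift x) n ≡ seq x (suc n)
  seq-shift x n = refl

  shift≈ : ∀ x → shift x ≈ x
  shift≈ x = mk≈ λ ε 0<ε → let (N , h) = cauchy x ε 0<ε in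
    N , λ n le → h (suc n) n (ℕ.m≤n⇒m≤1+n le) le

expᴿ-differentiable : ∀ R x y → ∣ x ∣ ≤ R → ∣ y ∣ ≤ R →
  ∥ expᴿ y ⊝ expᴿ x ⊝ ⌜ y - x ⌝ ⊗ expᴿ x ∥ ≤ᴿ ⌜ (y - x) * (y - x) ⌝ ⊗ expᴿ R
expᴿ-differentiable R x y x≤R y≤R = ≤ᴿ-trans
  (≈⇒≤ (∥∥-cong (⊝-cong (⊝-cong (≈-sym (shift≈ (expᴿ y))) (≈-sym (shift≈ (expᴿ x)))) ≈-refl)))
  (≤-pointwise ∥ shift (expᴿ y) ⊝ shift (expᴿ x) ⊝ ⌜ y - x ⌝ ⊗ expᴿ x ∥ (⌜ (y - x) * (y - x) ⌝ ⊗ expᴿ R) λ n →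
    subst₂ _≤_ (sym (trans (seq-∥∥ (shift (expᴿ y) ⊝ shift (expᴿ x) ⊝ ⌜ y - x ⌝ ⊗ expᴿ x) n) (cong ∣_∣ (left n)))) (sym (right n))
      (ExpDifference.difference-bound R x y x≤R y≤R n))
  where
  shifted : ∀ x n → seq (shift (expᴿ x)) n ≡ Exp.partialSum x (suc n)
  shifted x n = trans (seq-shift (expᴿ x) n) (seq-expᴿ x (suc n))
  left : ∀ n → seq (shift (expᴿ y) ⊝ shift (expᴿ x) ⊝ ⌜ y - x ⌝ ⊗ expᴿ x) n
             ≡ Exp.partialSum y (suc n) - Exp.partialSum x (suc n) - (y - x) * Exp.partialSum x n
  left n = trans (seq-⊝ (shift (expᴿ y) ⊝ shift (expᴿ x)) (⌜ y - x ⌝ ⊗ expᴿ x) n) (cong₂ _-_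
    (trans (seq-⊝ (shift (expᴿ y)) (shift (expᴿ x)) n) (cong₂ _-_ (shifted y n) (shifted x n)))
    (trans (seq-⊗ ⌜ y - x ⌝ (expᴿ x) n) (cong₂ _*_ (seq-⌜⌝ (y - x) n) (seq-expᴿ x n))))
  right : ∀ n → seq (⌜ (y - x) * (y - x) ⌝ ⊗ expᴿ R) n ≡ (y - x) * (y - x) * Exp.partialSum R n
  right n = trans (seq-⊗ ⌜ (y - x) * (y - x) ⌝ (expᴿ R) n) (cong₂ _*_ (seq-⌜⌝ ((y - x) * (y - x)) n) (seq-expᴿ R n))

∥expᴿ∥≤ : ∀ {x R} → ∣ x ∣ ≤ R → ∥ expᴿ x ∥ ≤ᴿ expᴿ R
∥expᴿ∥≤ {x} {R} x≤R = ≤-pointwise ∥ expᴿ x ∥ (expᴿ R) λ n → subst₂ _≤_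
  (sym (trans (seq-∥∥ (expᴿ x) n) (cong ∣_∣ (seq-expᴿ x n)))) (sym (seq-expᴿ R n)) (partialSum-∣∣≤ x≤R n)

expᴿ-0 : expᴿ 0ℚ ≈ 1ᴿ
expᴿ-0 = ≈-trans (≈-sym (shift≈ (expᴿ 0ℚ))) (≈-pointwise (shift (expᴿ 0ℚ)) 1ᴿ λ n →
  trans (seq-shift (expᴿ 0ℚ) n) (trans (seq-expᴿ 0ℚ (suc n)) (trans (partialSum-0 n) (sym (seq-⌜⌝ 1ℚ n)))))

expTerm≤expᴿ : ∀ {x} → 0ℚ ≤ x → ∀ i → ⌜ expTerm x i ⌝ ≤ᴿ expᴿ x
expTerm≤expᴿ {x} 0≤x i = mk≤ λ ε 0<ε → suc i , λ n le → subst₂ (λ s t → s ≤ t + ε) (sym (seq-⌜⌝ (expTerm x i) n)) (sym (seq-expᴿ x n))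
  (≤-trans (expTerm≤partialSum 0≤x i n le) (p≤p+q (<⇒≤ 0<ε)))

-- Meant for x = e^(-t), whose partial sums can be negative. Eventually the terms satisfy y ≥ ½ and
-- x y ≥ ½, which rules out x ≤ 0.
0≤-from-inverse : ∀ x y → x ⊗ y ≈ 1ᴿ → 1ᴿ ≤ᴿ y → 0ᴿ ≤ᴿ x
0≤-from-inverse x y (mk≈ xy≈1) (mk≤ 1≤y) = mk≤ λ ε 0<ε → eventually-map₂ (λ n → go ε 0<ε n) (xy≈1 ½ (positive⁻¹ ½)) (1≤y ½ (positive⁻¹ ½))
  where
  go : ∀ ε → 0ℚ < ε → ∀ n → ∣ seq (x ⊗ y) n - seq 1ᴿ n ∣ ≤ ½ → seq 1ᴿ n ≤ seq y n + ½ → seq 0ᴿ n ≤ seq x n + ε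
  go ε 0<ε n close lower with ≤-total 0ℚ (seq x n)
  ... | inj₁ 0≤x = subst (_≤ seq x n + ε) (sym (seq-⌜⌝ 0ℚ n)) (+-mono-≤ 0≤x (<⇒≤ 0<ε))
  ... | inj₂ x≤0 = ⊥-elim (<-irrefl refl (<-≤-trans ½<1 (≤-trans 1≤xy+½ (subst (seq x n * seq y n + ½ ≤_) (+-identityˡ ½) (+-monoˡ-≤ ½ xy≤0)))))
    where
    ½<1 : ½ < 1ℚ
    ½<1 = /-mono-< 1 1 1 0 (s≤s (s≤s z≤n))
    1≤xy+½ : 1ℚ ≤ seq x n * seq y n + ½
    1≤xy+½ = ∣p-q∣≤r⇒p≤q+r {1ℚ} {seq x n * seq y n} (subst (_≤ ½) (trans (∣p-q∣≡∣q-p∣ (seq (x ⊗ y) n) (seq 1ᴿ n)) (cong₂ (λ s t → ∣ s - t ∣) (seq-⌜⌝ 1ℚ n) (seq-⊗ x y n))) close)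
    0≤y : 0ℚ ≤ seq y n
    0≤y = ≤-trans (<⇒≤ (positive⁻¹ ½)) (p≤q+r⇒p-q≤r {1ℚ} {½} {seq y n} (subst (1ℚ ≤_) (+-comm (seq y n) ½) (subst (_≤ seq y n + ½) (seq-⌜⌝ 1ℚ n) lower)))
    xy≤0 : seq x n * seq y n ≤ 0ℚ
    xy≤0 = subst (seq x n * seq y n ≤_) (*-zeroˡ (seq y n)) (*-monoʳ-≤-nonNeg (seq y n) {{nonNegative 0≤y}} x≤0)

-- Differentiation and integration

∥∥≤-resp : ∀ {p} → x ≈ y → ∥ x ∥ ≤ᴿ p → ∥ y ∥ ≤ᴿ p
∥∥≤-resp x≈y h = ≤ᴿ-trans (≈⇒≤ (∥∥-cong (≈-sym x≈y))) h

∥∥≤-weaken : ∀ {p q} → p ≤ q → ∥ x ∥ ≤ᴿ ⌜ p ⌝ → ∥ x ∥ ≤ᴿ ⌜ q ⌝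
∥∥≤-weaken p≤q h = ≤ᴿ-trans h (⌜⌝-mono-≤ p≤q)

0≤bound : ∀ x {p} → ∥ x ∥ ≤ᴿ ⌜ p ⌝ → 0ℚ ≤ p
0≤bound x h = ⌜⌝-cancel-≤ (≤ᴿ-trans (0≤∥∥ x) h)

∥⊕∥-bound : ∀ {p q} → ∥ x ∥ ≤ᴿ ⌜ p ⌝ → ∥ y ∥ ≤ᴿ ⌜ q ⌝ → ∥ x ⊕ y ∥ ≤ᴿ ⌜ p + q ⌝
∥⊕∥-bound {x} {y} {p} {q} h h′ = ≤ᴿ-trans (∥⊕∥≤ x y) (≤ᴿ-trans (⊕-mono-≤ h h′) (≈⇒≤ (≈-sym (⌜⌝-+ p q))))

∥⊗∥-bound : ∀ {p q} → ∥ x ∥ ≤ᴿ ⌜ p ⌝ → ∥ y ∥ ≤ᴿ ⌜ q ⌝ → ∥ x ⊗ y ∥ ≤ᴿ ⌜ p * q ⌝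
∥⊗∥-bound {x} {y} {p} {q} h h′ = ≤ᴿ-trans (≈⇒≤ (∥⊗∥ x y)) (≤ᴿ-trans
  (⊗-mono-≤ (0≤∥∥ x) (0≤⌜⌝ (0≤bound y h′)) h h′) (≈⇒≤ (≈-sym (⌜⌝-* p q))))

∥⊝∥-bound : ∀ {p q} → ∥ x ∥ ≤ᴿ ⌜ p ⌝ → ∥ y ∥ ≤ᴿ ⌜ q ⌝ → ∥ x ⊝ y ∥ ≤ᴿ ⌜ p + q ⌝
∥⊝∥-bound {x} {y} h h′ = ∥⊕∥-bound h (≤ᴿ-trans (≈⇒≤ (∥⊖∥ y)) h′)

∥⌜⌝∥-bound : ∀ p → ∥ ⌜ p ⌝ ∥ ≤ᴿ ⌜ ∣ p ∣ ⌝
∥⌜⌝∥-bound p = ≈⇒≤ (∥⌜⌝∥ p)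

⌜⌝-⊝ : ∀ p q → ⌜ p - q ⌝ ≈ ⌜ p ⌝ ⊝ ⌜ q ⌝
⌜⌝-⊝ p q = ≈-trans (⌜⌝-+ p (- q)) (⊕-cong ≈-refl (⌜⌝-⊖ q))

∥0∥≤ : ∀ {p} → 0ℚ ≤ p → x ≈ 0ᴿ → ∥ x ∥ ≤ᴿ ⌜ p ⌝
∥0∥≤ 0≤p x≈0 = ∥∥≤-resp (≈-sym x≈0) (≤ᴿ-trans (∥⌜⌝∥-bound 0ℚ) (⌜⌝-mono-≤ 0≤p))

InRange : ℚ → ℚ → Set
InRange B t = 0ℚ ≤ t × t ≤ B

∣s-t∣≤B : ∀ {B s t} → InRange B s → InRange B t → ∣ s - t ∣ ≤ B
∣s-t∣≤B {B} {s} {t} (0≤s , s≤B) (0≤t , t≤B) = ∣p-q∣≤ (≤-trans s≤B (p≤q+p 0≤t)) (≤-trans t≤B (p≤q+p 0≤s))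

∣p∣*∣p∣≡p*p : ∀ p → ∣ p ∣ * ∣ p ∣ ≡ p * p
∣p∣*∣p∣≡p*p p = trans (sym (∣p*q∣≡∣p∣*∣q∣ p p)) (0≤p⇒∣p∣≡p (0≤p² p))

-- Differentiability on [0, B], uniformly with a quadratic error.
record Differentiable (B : ℚ) (F f : ℚ → ℝ) : Set where
  field
    C         : ℚ
    0≤C       : 0ℚ ≤ C
    bounded   : ∀ t → InRange B t → ∥ F t ∥ ≤ᴿ ⌜ C ⌝
    bounded′  : ∀ t → InRange B t → ∥ f t ∥ ≤ᴿ ⌜ C ⌝
    quadratic : ∀ s t → InRange B s → InRange B t → ∥ F s ⊝ F t ⊝ ⌜ s - t ⌝ ⊗ f t ∥ ≤ᴿ ⌜ C * ((s - t) * (s - t)) ⌝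

Lipschitz : ℚ → (ℚ → ℝ) → Set
Lipschitz B f = ∃ λ L → 0ℚ ≤ L × (∀ s t → InRange B s → InRange B t → ∥ f s ⊝ f t ∥ ≤ᴿ ⌜ L * ∣ s - t ∣ ⌝)

Bounded : ℚ → (ℚ → ℝ) → Set
Bounded B f = ∃ λ C → 0ℚ ≤ C × (∀ t → InRange B t → ∥ f t ∥ ≤ᴿ ⌜ C ⌝)

module _ {B : ℚ} (0≤B : 0ℚ ≤ B) where

  -- On [0, B] one has (s - t)² ≤ B |s - t|, so the quadratic error contributes C B and the linear
  -- term C.
  differentiable⇒lipschitz : ∀ {F f} → Differentiable B F f → Lipschitz B F
  differentiable⇒lipschitz {F} {f} d = C * (1ℚ + B) , 0≤p*q 0≤C (+-mono-≤ (0≤fromℕ 1) 0≤B) , λ s t s∈ t∈ →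
    ∥∥≤-resp (solveᴿ 3 (λ a b c → (a :- b :- c) :+ c := a :- b) refl (F s) (F t) (⌜ s - t ⌝ ⊗ f t))
      (∥∥≤-weaken (≤-trans (+-monoˡ-≤ (∣ s - t ∣ * C) (*-monoˡ-≤-nonNeg C {{nonNegative 0≤C}}
          (subst (_≤ B * ∣ s - t ∣) (∣p∣*∣p∣≡p*p (s - t)) (*-monoʳ-≤-nonNeg ∣ s - t ∣ {{∣-∣-nonNeg (s - t)}} (∣s-t∣≤B s∈ t∈)))))
          (≤-reflexive (solve 3 (λ c b h → c :* (b :* h) :+ h :* c := c :* (con 1ℚ :+ b) :* h) refl C B ∣ s - t ∣)))
        (∥⊕∥-bound (quadratic s t s∈ t∈) (∥⊗∥-bound (∥⌜⌝∥-bound (s - t)) (bounded′ t t∈))))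
    where open Differentiable d

  differentiable-× : ∀ {F f G g} → Differentiable B F f → Differentiable B G g →
    Differentiable B (λ t → F t ⊗ G t) (λ t → f t ⊗ G t ⊕ F t ⊗ g t)
  differentiable-× {F} {f} {G} {g} dF dG = record
    { C = C
    ; 0≤C = 0≤C
    ; bounded = λ t t∈ → ∥∥≤-weaken P≤C (∥⊗∥-bound (dF.bounded t t∈) (dG.bounded t t∈))
    ; bounded′ = λ t t∈ → ∥∥≤-weaken 2P≤C (∥⊕∥-bound (∥⊗∥-bound (dF.bounded′ t t∈) (dG.bounded t t∈)) (∥⊗∥-bound (dF.bounded t t∈) (dG.bounded′ t t∈)))
    ; quadratic = λ s t s∈ t∈ →
        ∥∥≤-resp (solveᴿ 7 (λ Fs Ft ft Gs Gt gt h → (Fs :* (Gs :- Gt :- h :* gt) :+ Gt :* (Fs :- Ft :- h :* ft)) :+ h :* (gt :* (Fs :- Ft))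
                     := Fs :* Gs :- Ft :* Gt :- h :* (ft :* Gt :+ Ft :* gt)) refl (F s) (F t) (f t) (G s) (G t) (g t) ⌜ s - t ⌝)
          (∥∥≤-weaken (≤-reflexive (combine (s - t)))
            (∥⊕∥-bound (∥⊕∥-bound (∥⊗∥-bound (dF.bounded s s∈) (dG.quadratic s t s∈ t∈)) (∥⊗∥-bound (dG.bounded t t∈) (dF.quadratic s t s∈ t∈)))
              (∥⊗∥-bound (∥⌜⌝∥-bound (s - t)) (∥⊗∥-bound (dG.bounded′ t t∈) (proj₂ (proj₂ (differentiable⇒lipschitz dF)) s t s∈ t∈)))))
    }
    where
    module dF = Differentiable dF
    module dG = Differentiable dG
    P = dF.C * dG.C
    0≤P : 0ℚ ≤ P
    0≤P = 0≤p*q dF.0≤C dG.0≤C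
    -- 2 P comes from the two quadratic remainders, and P (1 + B) from the mixed term, in which F is
    -- Lipschitz.
    C = P * (fromℕ 3 + B)
    0≤C : 0ℚ ≤ C
    0≤C = 0≤p*q 0≤P (+-mono-≤ (0≤fromℕ 3) 0≤B)
    2P≤C : P + P ≤ C
    2P≤C = subst (_≤ C) (solve 1 (λ p → p :* con (fromℕ 2) := p :+ p) refl P)
      (*-monoˡ-≤-nonNeg P {{nonNegative 0≤P}} (≤-trans (fromℕ-mono-≤ {2} {3} (s≤s (s≤s z≤n))) (p≤p+q 0≤B)))
    P≤C : P ≤ C
    P≤C = ≤-trans (p≤p+q 0≤P) 2P≤C
    combine : ∀ h → dF.C * (dG.C * (h * h)) + dG.C * (dF.C * (h * h)) + ∣ h ∣ * (dG.C * (dF.C * (1ℚ + B) * ∣ h ∣)) ≡ C * (h * h)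
    combine h = trans (solve 5 (λ a b c h p → a :* (b :* p) :+ b :* (a :* p) :+ h :* (b :* (a :* (con 1ℚ :+ c) :* h))
                         := con (fromℕ 2) :* (a :* b) :* p :+ a :* b :* (con 1ℚ :+ c) :* (h :* h)) refl dF.C dG.C B ∣ h ∣ (h * h))
      (trans (cong (λ s → fromℕ 2 * P * (h * h) + P * (1ℚ + B) * s) (∣p∣*∣p∣≡p*p h))
        (solve 3 (λ p c h → con (fromℕ 2) :* p :* h :+ p :* (con 1ℚ :+ c) :* h := p :* (con (fromℕ 3) :+ c) :* h) refl P B (h * h)))

  differentiable-cong : ∀ {F f G g} → (∀ t → InRange B t → F t ≈ G t) → (∀ t → InRange B t → f t ≈ g t) →
    Differentiable B F f → Differentiable B G g
  differentiable-cong F≈G f≈g d = record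
    { C = C ; 0≤C = 0≤C
    ; bounded = λ t t∈ → ∥∥≤-resp (F≈G t t∈) (bounded t t∈)
    ; bounded′ = λ t t∈ → ∥∥≤-resp (f≈g t t∈) (bounded′ t t∈)
    ; quadratic = λ s t s∈ t∈ → ∥∥≤-resp (⊝-cong (⊝-cong (F≈G s s∈) (F≈G t t∈)) (⊗-congˡ ⌜ s - t ⌝ (f≈g t t∈))) (quadratic s t s∈ t∈) }
    where open Differentiable d

  differentiable-id : Differentiable B ⌜_⌝ (λ _ → 1ᴿ)
  differentiable-id = record
    { C = 1ℚ + B ; 0≤C = 0≤C
    ; bounded = λ t (0≤t , t≤B) → ∥∥≤-weaken (≤-trans (≤-reflexive (0≤p⇒∣p∣≡p 0≤t)) (≤-trans t≤B (p≤q+p (0≤fromℕ 1)))) (∥⌜⌝∥-bound t)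
    ; bounded′ = λ t _ → ∥∥≤-weaken (p≤p+q 0≤B) (∥⌜⌝∥-bound 1ℚ)
    ; quadratic = λ s t _ _ → ∥0∥≤ (0≤p*q 0≤C (0≤p² (s - t))) (≈-trans (⊝-cong (≈-sym (⌜⌝-⊝ s t)) ≈-refl)
        (solveᴿ 1 (λ h → h :- h :* con 1ℚ := con 0ℚ) refl ⌜ s - t ⌝)) }
    where
    0≤C : 0ℚ ≤ 1ℚ + B
    0≤C = +-mono-≤ (0≤fromℕ 1) 0≤B

  differentiable-const : ∀ c → Differentiable B (λ _ → ⌜ c ⌝) (λ _ → 0ᴿ)
  differentiable-const c = record
    { C = ∣ c ∣ ; 0≤C = 0≤∣p∣ c
    ; bounded = λ t _ → ∥⌜⌝∥-bound c
    ; bounded′ = λ t _ → ∥0∥≤ (0≤∣p∣ c) ≈-refl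
    ; quadratic = λ s t _ _ → ∥0∥≤ (0≤p*q (0≤∣p∣ c) (0≤p² (s - t)))
        (solveᴿ 2 (λ c h → c :- c :- h :* con 0ℚ := con 0ℚ) refl ⌜ c ⌝ ⌜ s - t ⌝) }

  private
    expBound : ∃ λ C → 0ℚ < C × ∥ expᴿ B ∥ ≤ᴿ ⌜ C ⌝
    expBound = bound (expᴿ B)
    C₀ = proj₁ expBound
    0≤C₀ : 0ℚ ≤ C₀
    0≤C₀ = <⇒≤ (proj₁ (proj₂ expBound))
    expᴿ≤C₀ : expᴿ B ≤ᴿ ⌜ C₀ ⌝
    expᴿ≤C₀ = ≤ᴿ-trans (x≤∥x∥ (expᴿ B)) (proj₂ (proj₂ expBound))
    expᴿ-quadratic : ∀ s t → ∣ s ∣ ≤ B → ∣ t ∣ ≤ B → ∥ expᴿ s ⊝ expᴿ t ⊝ ⌜ s - t ⌝ ⊗ expᴿ t ∥ ≤ᴿ ⌜ C₀ * ((s - t) * (s - t)) ⌝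
    expᴿ-quadratic s t s≤ t≤ = ≤ᴿ-trans (expᴿ-differentiable B t s t≤ s≤) (≤ᴿ-trans
      (⊗-monoˡ-≤ ⌜ (s - t) * (s - t) ⌝ (0≤⌜⌝ (0≤p² (s - t))) expᴿ≤C₀)
      (≈⇒≤ (≈-trans (≈-sym (⌜⌝-* ((s - t) * (s - t)) C₀)) (⌜⌝-cong (*-comm ((s - t) * (s - t)) C₀)))))
    ∣t∣≤B : ∀ {t} → InRange B t → ∣ t ∣ ≤ B
    ∣t∣≤B (0≤t , t≤B) = subst (_≤ B) (sym (0≤p⇒∣p∣≡p 0≤t)) t≤B

  differentiable-exp : Differentiable B expᴿ expᴿ
  differentiable-exp = record
    { C = C₀ ; 0≤C = 0≤C₀
    ; bounded = λ t t∈ → ≤ᴿ-trans (∥expᴿ∥≤ (∣t∣≤B t∈)) expᴿ≤C₀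
    ; bounded′ = λ t t∈ → ≤ᴿ-trans (∥expᴿ∥≤ (∣t∣≤B t∈)) expᴿ≤C₀
    ; quadratic = λ s t s∈ t∈ → expᴿ-quadratic s t (∣t∣≤B s∈) (∣t∣≤B t∈) }

  differentiable-exp⁻ : Differentiable B (λ t → expᴿ (- t)) (λ t → ⊖ expᴿ (- t))
  differentiable-exp⁻ = record
    { C = C₀ ; 0≤C = 0≤C₀
    ; bounded = λ t t∈ → bounded t t∈
    ; bounded′ = λ t t∈ → ≤ᴿ-trans (≈⇒≤ (∥⊖∥ (expᴿ (- t)))) (bounded t t∈)
    ; quadratic = λ s t s∈ t∈ → ∥∥≤-resp
        (⊝-cong ≈-refl (≈-trans (⊗-congʳ (expᴿ (- t)) (≈-trans (⌜⌝-cong (solve 2 (λ s t → (:- s) :- (:- t) := :- (s :- t)) refl s t)) (⌜⌝-⊖ (s - t))))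
          (solveᴿ 2 (λ h e → (:- h) :* e := h :* (:- e)) refl ⌜ s - t ⌝ (expᴿ (- t)))))
        (∥∥≤-weaken (≤-reflexive (cong (C₀ *_) (solve 2 (λ s t → ((:- s) :- (:- t)) :* ((:- s) :- (:- t)) := (s :- t) :* (s :- t)) refl s t)))
          (expᴿ-quadratic (- s) (- t) (∣-t∣≤B s∈) (∣-t∣≤B t∈))) }
    where
    ∣-t∣≤B : ∀ {t} → InRange B t → ∣ - t ∣ ≤ B
    ∣-t∣≤B {t} t∈ = subst (_≤ B) (sym (∣-p∣≡∣p∣ t)) (∣t∣≤B t∈)
    bounded : ∀ t → InRange B t → ∥ expᴿ (- t) ∥ ≤ᴿ ⌜ C₀ ⌝
    bounded t t∈ = ≤ᴿ-trans (∥expᴿ∥≤ (∣-t∣≤B t∈)) expᴿ≤C₀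

  -- The exponent 2 + 1/k is chosen so that the error stays quadratic at t = 0: for k > 1, already
  -- s^(1+1/k) is not O(s²) there.
  differentiable-root : ∀ n → Differentiable B (λ t → ⌜ t ⌝ ⊗ (⌜ t ⌝ ⊗ rootᴿ n t)) (λ t → ⌜ fromℕ 2 + + 1 / suc n ⌝ ⊗ (⌜ t ⌝ ⊗ rootᴿ n t))
  differentiable-root n = record
    { C = C ; 0≤C = 0≤C
    ; bounded = λ t t∈ → ∥∥≤-weaken (≤-trans (≤-trans (p≤p+q (0≤p*q 0≤ζ (0≤p*q 0≤B 0≤M))) (≤-reflexive (+-comm (B * (B * M)) (ζ * (B * M))))) (p≤p+q (0≤p*q (0≤fromℕ 4) 0≤M)))
        (∥⊗∥-bound (t-bound t t∈) (ta-bound t t∈))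
    ; bounded′ = λ t t∈ → ∥∥≤-weaken (≤-trans (p≤p+q (0≤p*q 0≤B (0≤p*q 0≤B 0≤M))) (p≤p+q (0≤p*q (0≤fromℕ 4) 0≤M)))
        (∥⊗∥-bound (≤ᴿ-trans (∥⌜⌝∥-bound ζ) (⌜⌝-mono-≤ (≤-reflexive (0≤p⇒∣p∣≡p 0≤ζ)))) (ta-bound t t∈))
    ; quadratic = λ s t s∈ t∈ → ∥∥≤-resp (⊝-cong ≈-refl (⊗-congʳ _ (≈-sym (⌜⌝-⊝ s t))))
        (≤ᴿ-trans (RootCalculus.rootᴿ-differentiable n s t (proj₁ s∈) (proj₁ t∈)) (≤ᴿ-trans
          (⊗-mono-≤ (0≤⊕ (0≤ᴿrootᴿ n s) (0≤⊗ (0≤⌜⌝ (0≤fromℕ 3)) (0≤ᴿrootᴿ n t))) (0≤⌜⌝ (0≤p² (s - t)))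
            (≤ᴿ-trans (⊕-mono-≤ (root-bound s s∈) (⊗-monoˡ-≤ ⌜ fromℕ 3 ⌝ (0≤⌜⌝ (0≤fromℕ 3)) (root-bound t t∈)))
              (≈⇒≤ (≈-trans (⊕-cong ≈-refl (≈-sym (⌜⌝-* (fromℕ 3) M))) (≈-trans (≈-sym (⌜⌝-+ M (fromℕ 3 * M)))
                (⌜⌝-cong (solve 1 (λ m → m :+ con (fromℕ 3) :* m := con (fromℕ 4) :* m) refl M))))))
            (≈⇒≤ (square s t)))
          (≤ᴿ-trans (≈⇒≤ (≈-sym (⌜⌝-* (fromℕ 4 * M) ((s - t) * (s - t))))) (⌜⌝-mono-≤ (*-monoʳ-≤-nonNeg ((s - t) * (s - t)) {{nonNegative (0≤p² (s - t))}}
            (p≤q+p (+-mono-≤ (0≤p*q 0≤ζ (0≤p*q 0≤B 0≤M)) (0≤p*q 0≤B (0≤p*q 0≤B 0≤M)))))))))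
    }
    where
    M = 1ℚ + B
    ζ = fromℕ 2 + + 1 / suc n
    C = ζ * (B * M) + B * (B * M) + fromℕ 4 * M
    0≤M : 0ℚ ≤ M
    0≤M = +-mono-≤ (0≤fromℕ 1) 0≤B
    0≤ζ : 0ℚ ≤ ζ
    0≤ζ = +-mono-≤ (0≤fromℕ 2) (0≤/ 1 n)
    0≤C : 0ℚ ≤ C
    0≤C = +-mono-≤ (+-mono-≤ (0≤p*q 0≤ζ (0≤p*q 0≤B 0≤M)) (0≤p*q 0≤B (0≤p*q 0≤B 0≤M))) (0≤p*q (0≤fromℕ 4) 0≤M)
    t-bound : ∀ t → InRange B t → ∥ ⌜ t ⌝ ∥ ≤ᴿ ⌜ B ⌝
    t-bound t t∈ = ∥∥≤-weaken (∣t∣≤B t∈) (∥⌜⌝∥-bound t)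
    root-bound : ∀ t → InRange B t → rootᴿ n t ≤ᴿ ⌜ M ⌝
    root-bound t (0≤t , t≤B) = ≤ᴿ-trans (rootᴿ≤ n t 0≤t) (⌜⌝-mono-≤ (+-monoʳ-≤ 1ℚ t≤B))
    ta-bound : ∀ t → InRange B t → ∥ ⌜ t ⌝ ⊗ rootᴿ n t ∥ ≤ᴿ ⌜ B * M ⌝
    ta-bound t t∈ = ∥⊗∥-bound (t-bound t t∈) (≤ᴿ-trans (≈⇒≤ (≈-sym (0≤⇒≈∥∥ (0≤ᴿrootᴿ n t)))) (root-bound t t∈))
    square : ∀ s t → (⌜ s ⌝ ⊝ ⌜ t ⌝) ⊗ (⌜ s ⌝ ⊝ ⌜ t ⌝) ≈ ⌜ (s - t) * (s - t) ⌝
    square s t = ≈-trans (⊗-cong (≈-sym (⌜⌝-⊝ s t)) (≈-sym (⌜⌝-⊝ s t))) (≈-sym (⌜⌝-* (s - t) (s - t)))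

  -- The derivative, being determined up to O(s − t) by difference quotients, is Lipschitz.
  differentiable⇒lipschitz′ : ∀ {F f} → Differentiable B F f → Lipschitz B f
  differentiable⇒lipschitz′ {F} {f} d = fromℕ 2 * C , 0≤p*q (0≤fromℕ 2) 0≤C , go
    where
    open Differentiable d
    -- Adding the estimates for (s, t) and (t, s) cancels the values of F.
    scaled : ∀ s t → InRange B s → InRange B t → ∥ ⌜ s - t ⌝ ⊗ (f s ⊝ f t) ∥ ≤ᴿ ⌜ fromℕ 2 * C * ((s - t) * (s - t)) ⌝
    scaled s t s∈ t∈ = ∥∥≤-resp
      (≈-trans (⊕-cong ≈-refl (⊝-cong ≈-refl (⊗-congʳ (f s) (≈-trans (⌜⌝-cong (solve 2 (λ s t → t :- s := :- (s :- t)) refl s t)) (⌜⌝-⊖ (s - t))))))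
        (solveᴿ 5 (λ a b x y h → (a :- b :- h :* y) :+ (b :- a :- (:- h) :* x) := h :* (x :- y)) refl (F s) (F t) (f s) (f t) ⌜ s - t ⌝))
      (∥∥≤-weaken (≤-reflexive (solve 3 (λ c s t → c :* ((s :- t) :* (s :- t)) :+ c :* ((t :- s) :* (t :- s)) := con (fromℕ 2) :* c :* ((s :- t) :* (s :- t))) refl C s t))
        (∥⊕∥-bound (quadratic s t s∈ t∈) (quadratic t s t∈ s∈)))
    go : ∀ s t → InRange B s → InRange B t → ∥ f s ⊝ f t ∥ ≤ᴿ ⌜ fromℕ 2 * C * ∣ s - t ∣ ⌝
    go s t s∈ t∈ with s - t ℚ.≟ 0ℚ
    ... | yes s-t≡0 = ∥0∥≤ (0≤p*q (0≤p*q (0≤fromℕ 2) 0≤C) (0≤∣p∣ (s - t)))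
          (subst (λ s → f s ⊝ f t ≈ 0ᴿ) (sym s≡t) (solveᴿ 1 (λ x → x :- x := con 0ℚ) refl (f t)))
      where
      s≡t : s ≡ t
      s≡t = trans (solve 2 (λ s t → s := (s :- t) :+ t) refl s t) (trans (cong (_+ t) s-t≡0) (+-identityˡ t))
    ... | no s-t≢0 = ∥∥≤-resp
          (≈-trans (≈-sym (⊗-assoc ⌜ 1/h ⌝ ⌜ s - t ⌝ (f s ⊝ f t))) (≈-trans (⊗-congʳ (f s ⊝ f t) (≈-trans (≈-sym (⌜⌝-* 1/h (s - t))) (⌜⌝-cong (÷₀-* 1ℚ s-t≢0)))) (⊗-identityˡ (f s ⊝ f t))))
          (∥∥≤-weaken (≤-reflexive (trans (cong (λ q → ∣ 1/h ∣ * (fromℕ 2 * C * q)) (sym (∣p∣*∣p∣≡p*p (s - t))))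
              (trans (solve 3 (λ i c h → i :* (c :* (h :* h)) := c :* (i :* h :* h)) refl (∣ 1/h ∣) (fromℕ 2 * C) (∣ s - t ∣))
                (cong (fromℕ 2 * C *_) (trans (cong (_* ∣ s - t ∣) (trans (sym (∣p*q∣≡∣p∣*∣q∣ 1/h (s - t))) (cong ∣_∣ (÷₀-* 1ℚ s-t≢0)))) (*-identityˡ ∣ s - t ∣))))))
            (∥⊗∥-bound (∥⌜⌝∥-bound 1/h) (scaled s t s∈ t∈)))
      where
      1/h = 1ℚ ÷₀ (s - t)

  lipschitz-× : ∀ {f g} → Bounded B f → Bounded B g → Lipschitz B f → Lipschitz B g → Lipschitz B (λ t → f t ⊗ g t)
  lipschitz-× {f} {g} (C , 0≤C , f≤) (D , 0≤D , g≤) (L , 0≤L , fL) (M , 0≤M , gM) =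
    C * M + D * L , +-mono-≤ (0≤p*q 0≤C 0≤M) (0≤p*q 0≤D 0≤L) , λ s t s∈ t∈ →
      ∥∥≤-resp (solveᴿ 4 (λ fs ft gs gt → fs :* (gs :- gt) :+ gt :* (fs :- ft) := fs :* gs :- ft :* gt) refl (f s) (f t) (g s) (g t))
        (∥∥≤-weaken (≤-reflexive (solve 5 (λ c m d l h → c :* (m :* h) :+ d :* (l :* h) := (c :* m :+ d :* l) :* h) refl C M D L ∣ s - t ∣))
          (∥⊕∥-bound (∥⊗∥-bound (f≤ s s∈) (gM s t s∈ t∈)) (∥⊗∥-bound (g≤ t t∈) (fL s t s∈ t∈))))

-- Riemann sums

mesh : ℚ → ℕ → ℚ
mesh B n = B * (+ 1 / suc n)

riemann : (ℚ → ℝ) → ℚ → ℕ → ℝ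
riemann f B n = ⌜ mesh B n ⌝ ⊗ ∑ᴿ (suc n) (λ i → f (fromℕ i * mesh B n))

mesh-* : ∀ B n → fromℕ (suc n) * mesh B n ≡ B
mesh-* B n = trans (solve 3 (λ n b i → n :* (b :* i) := b :* (n :* i)) refl (fromℕ (suc n)) B (+ 1 / suc n))
  (trans (cong (B *_) (fromℕ-*-/ 1 n)) (*-identityʳ B))

∑ᴿ-≡ : ∀ n {f g : ℕ → ℝ} → (∀ i → f i ≡ g i) → ∑ᴿ n f ≡ ∑ᴿ n g
∑ᴿ-≡ zero    h = refl
∑ᴿ-≡ (suc n) h = cong₂ _⊕_ (∑ᴿ-≡ n h) (h n)

riemannSum≈riemann : ∀ f B n → riemannSum f 0ℚ B (suc n) ≈ riemann f B n
riemannSum≈riemann f B n = ≈-pointwise (riemannSum f 0ℚ B (suc n)) (riemann f B n) λ j → trans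
  (cong₂ _*_ h≡mesh (trans (seq-∑ᴿ (suc n) (λ i → f (0ℚ + fromℕ i * h)) j)
    (cong (λ x → seq x j) (∑ᴿ-≡ (suc n) (λ i → cong f (trans (+-identityˡ (fromℕ i * h)) (cong (fromℕ i *_) h≡mesh)))))))
  (sym (trans (seq-⊗ ⌜ mesh B n ⌝ (∑ᴿ (suc n) (λ i → f (fromℕ i * mesh B n))) j)
    (cong (_* seq (∑ᴿ (suc n) (λ i → f (fromℕ i * mesh B n))) j) (seq-⌜⌝ (mesh B n) j))))
  where
  h = (B - 0ℚ) * (+ 1 / suc n)
  h≡mesh : h ≡ mesh B n
  h≡mesh = cong (_* (+ 1 / suc n)) (+-identityʳ B)

module _ {B : ℚ} (0≤B : 0ℚ ≤ B) where

  0≤mesh : ∀ n → 0ℚ ≤ mesh B n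
  0≤mesh n = 0≤p*q 0≤B (0≤/ 1 n)

  mesh-range : ∀ n i → i ℕ.≤ suc n → InRange B (fromℕ i * mesh B n)
  mesh-range n i i≤ = 0≤p*q (0≤fromℕ i) (0≤mesh n) ,
    ≤-trans (*-monoʳ-≤-nonNeg (mesh B n) {{nonNegative (0≤mesh n)}} (fromℕ-mono-≤ i≤)) (≤-reflexive (mesh-* B n))

  riemann-cong : ∀ {f g} → (∀ t → InRange B t → f t ≈ g t) → ∀ n → riemann f B n ≈ riemann g B n
  riemann-cong f≈g n = ⊗-congˡ ⌜ mesh B n ⌝ (∑ᴿ-cong (suc n) (λ i i<n → f≈g _ (mesh-range n i (ℕ.<⇒≤ i<n))))

  riemann-mono : ∀ {f g} → (∀ t → InRange B t → f t ≤ᴿ g t) → ∀ n → riemann f B n ≤ᴿ riemann g B n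
  riemann-mono f≤g n = ⊗-monoˡ-≤ ⌜ mesh B n ⌝ (0≤⌜⌝ (0≤mesh n)) (∑ᴿ-mono (suc n) (λ i i<n → f≤g _ (mesh-range n i (ℕ.<⇒≤ i<n))))

  -- Telescoping along the subdivision.
  fundamental-theorem : ∀ {F f} → Differentiable B F f → riemann f B ⇢ F B ⊝ F 0ℚ
  fundamental-theorem {F} {f} d = ⇢-C/n (C * B * B) (0≤p*q (0≤p*q 0≤C 0≤B) 0≤B) λ n →
    subst₂ (λ b c → ∥ riemann f B n ⊝ (F b ⊝ F 0ℚ) ∥ ≤ᴿ ⌜ c ⌝) (mesh-* B n) (error n) (telescope n (suc n) ℕ.≤-refl)
    where
    open Differentiable d
    error : ∀ n → fromℕ (suc n) * (C * (mesh B n * mesh B n)) ≡ C * B * B * (+ 1 / suc n)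
    error n = trans (solve 3 (λ n c h → n :* (c :* (h :* h)) := c :* (n :* h) :* h) refl (fromℕ (suc n)) C (mesh B n))
      (trans (cong (λ b → C * b * mesh B n) (mesh-* B n)) (sym (*-assoc (C * B) B (+ 1 / suc n))))
    telescope : ∀ n N → N ℕ.≤ suc n → let h = mesh B n in
      ∥ ⌜ h ⌝ ⊗ ∑ᴿ N (λ i → f (fromℕ i * h)) ⊝ (F (fromℕ N * h) ⊝ F 0ℚ) ∥ ≤ᴿ ⌜ fromℕ N * (C * (h * h)) ⌝
    telescope n zero    _    = ∥0∥≤ (≤-reflexive (sym (*-zeroˡ (C * (mesh B n * mesh B n)))))
      (≈-trans (⊝-cong ≈-refl (⊝-cong (≡⇒≈ (cong F (*-zeroˡ (mesh B n)))) ≈-refl))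
        (solveᴿ 2 (λ h x → h :* con 0ℚ :- (x :- x) := con 0ℚ) refl ⌜ mesh B n ⌝ (F 0ℚ)))
    telescope n (suc N) N<n = ∥∥≤-resp
      (solveᴿ 6 (λ h s x y o g → (h :* s :- (x :- o)) :- (y :- x :- h :* g) := h :* (s :+ g) :- (y :- o)) refl
        ⌜ h ⌝ (∑ᴿ N (λ i → f (fromℕ i * h))) (F (fromℕ N * h)) (F (fromℕ (suc N) * h)) (F 0ℚ) (f (fromℕ N * h)))
      (∥∥≤-weaken (≤-reflexive (trans (cong (λ s → fromℕ N * (C * (h * h)) + C * (s * s)) step)
          (trans (solve 2 (λ n c → n :* c :+ c := (con 1ℚ :+ n) :* c) refl (fromℕ N) (C * (h * h))) (cong (_* (C * (h * h))) (sym (fromℕ-suc N))))))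
        (∥⊝∥-bound (telescope n N (ℕ.<⇒≤ N<n))
          (∥∥≤-resp (⊝-cong ≈-refl (⊗-congʳ _ (⌜⌝-cong step)))
            (quadratic (fromℕ (suc N) * h) (fromℕ N * h) (mesh-range n (suc N) N<n) (mesh-range n N (ℕ.<⇒≤ N<n))))))
      where
      h = mesh B n
      step : fromℕ (suc N) * h - fromℕ N * h ≡ h
      step = trans (cong (λ s → s * h - fromℕ N * h) (fromℕ-suc N)) (solve 2 (λ n h → (con 1ℚ :+ n) :* h :- n :* h := h) refl (fromℕ N) h)

  -- The Riemann sums of the derivative tend both to F B - F 0 and to 0.
  constant : ∀ {F} → Differentiable B F (λ _ → 0ᴿ) → F B ≈ F 0ℚ
  constant {F} d = ≈-trans (solveᴿ 2 (λ x y → x := x :- y :+ y) refl (F B) (F 0ℚ))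
    (≈-trans (⊕-cong (⇢-unique (fundamental-theorem d) (⇢-cong zeroes ≈-refl (⇢-const 0ᴿ))) ≈-refl) (⊕-identityˡ (F 0ℚ)))
    where
    zeroes : ∀ n → 0ᴿ ≈ riemann (λ _ → 0ᴿ) B n
    zeroes n = ≈-sym (≈-trans (⊗-congˡ ⌜ mesh B n ⌝ (≈-trans (∑ᴿ-cong (suc n) (λ _ _ → ≈-sym (⊗-zero 0ᴿ))) (∑ᴿ-⊗ˡ (suc n) 0ᴿ (λ _ → 0ᴿ))))
      (solveᴿ 2 (λ h s → h :* (con 0ℚ :* s) := con 0ℚ) refl ⌜ mesh B n ⌝ (∑ᴿ (suc n) (λ _ → 0ᴿ))))
      where
      ⊗-zero : ∀ x → 0ᴿ ⊗ x ≈ 0ᴿ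
      ⊗-zero x = solveᴿ 1 (λ x → con 0ℚ :* x := con 0ℚ) refl x

  module _ {f : ℚ → ℝ} {L : ℚ} (0≤L : 0ℚ ≤ L)
           (lipschitz : ∀ s t → InRange B s → InRange B t → ∥ f s ⊝ f t ∥ ≤ᴿ ⌜ L * ∣ s - t ∣ ⌝) where

    -- Every interval of the coarse subdivision consists of suc m intervals of the fine one.
    module Refinement (n m : ℕ) where

      -- Chosen so that `suc fine` computes to (n + 1)(m + 1), the number of intervals of the
      -- refinement.
      fine : ℕ
      fine = m ℕ.+ n ℕ.* suc m
      h = mesh B n
      h′ = mesh B fine

      h≡ : fromℕ (suc m) * h′ ≡ h
      h≡ = *-cancelˡ-≢0 (fromℕ (suc n)) (fromℕ-suc≢0 n) (begin
        fromℕ (suc n) * (fromℕ (suc m) * h′)  ≡⟨ *-assoc (fromℕ (suc n)) (fromℕ (suc m)) h′ ⟨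
        fromℕ (suc n) * fromℕ (suc m) * h′  ≡⟨ cong (_* h′) (fromℕ-* (suc n) (suc m)) ⟨
        fromℕ (suc n ℕ.* suc m) * h′  ≡⟨ mesh-* B fine ⟩
        B  ≡⟨ mesh-* B n ⟨
        fromℕ (suc n) * h  ∎)
        where open ≡-Reasoning

      point : ∀ q p → fromℕ (q ℕ.+ p ℕ.* suc m) * h′ ≡ fromℕ p * h + fromℕ q * h′
      point q p = begin
        fromℕ (q ℕ.+ p ℕ.* suc m) * h′  ≡⟨ cong (_* h′) (trans (fromℕ-+ q (p ℕ.* suc m)) (cong (λ s → fromℕ q + s) (fromℕ-* p (suc m)))) ⟩
        (fromℕ q + fromℕ p * fromℕ (suc m)) * h′  ≡⟨ solve 4 (λ q p m h → (q :+ p :* m) :* h := p :* (m :* h) :+ q :* h) refl (fromℕ q) (fromℕ p) (fromℕ (suc m)) h′ ⟩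
        fromℕ p * (fromℕ (suc m) * h′) + fromℕ q * h′  ≡⟨ cong (λ s → fromℕ p * s + fromℕ q * h′) h≡ ⟩
        fromℕ p * h + fromℕ q * h′  ∎
        where open ≡-Reasoning

      block : ∀ p → p ℕ.< suc n → ∀ q → q ℕ.≤ suc m →
        ∥ ⌜ fromℕ q * h′ ⌝ ⊗ f (fromℕ p * h) ⊝ ⌜ h′ ⌝ ⊗ ∑ᴿ q (λ j → f (fromℕ (j ℕ.+ p ℕ.* suc m) * h′)) ∥ ≤ᴿ ⌜ fromℕ q * (h′ * (L * h)) ⌝
      block p p<n zero    _   = ∥0∥≤ (≤-reflexive (sym (*-zeroˡ (h′ * (L * h)))))
        (≈-trans (⊝-cong (⊗-congʳ (f (fromℕ p * h)) (⌜⌝-cong (*-zeroˡ h′))) ≈-refl)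
          (solveᴿ 2 (λ x h → con 0ℚ :* x :- h :* con 0ℚ := con 0ℚ) refl (f (fromℕ p * h)) ⌜ h′ ⌝))
      block p p<n (suc q) q<m = ∥∥≤-resp
        (≈-trans (solveᴿ 5 (λ a h x s y → (a :* x :- h :* s) :+ h :* (x :- y) := (a :+ h) :* x :- h :* (s :+ y)) refl
            ⌜ fromℕ q * h′ ⌝ ⌜ h′ ⌝ (f (fromℕ p * h)) (∑ᴿ q (λ j → f (fromℕ (j ℕ.+ p ℕ.* suc m) * h′))) (f (fromℕ (q ℕ.+ p ℕ.* suc m) * h′)))
          (⊝-cong (⊗-congʳ (f (fromℕ p * h)) (≈-trans (≈-sym (⌜⌝-+ (fromℕ q * h′) h′)) (⌜⌝-cong (suc-* q h′)))) ≈-refl))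
        (∥∥≤-weaken (≤-reflexive (suc-* q (h′ * (L * h))))
          (∥⊕∥-bound (block p p<n q (ℕ.<⇒≤ q<m)) (∥⊗∥-bound (≤ᴿ-trans (∥⌜⌝∥-bound h′) (⌜⌝-mono-≤ (≤-reflexive (0≤p⇒∣p∣≡p (0≤mesh fine)))))
            (∥∥≤-weaken (*-monoˡ-≤-nonNeg L {{nonNegative 0≤L}} distance)
              (lipschitz (fromℕ p * h) (fromℕ (q ℕ.+ p ℕ.* suc m) * h′) (mesh-range n p (ℕ.<⇒≤ p<n)) (mesh-range fine (q ℕ.+ p ℕ.* suc m) index≤))))))
        where
        suc-* : ∀ q c → fromℕ q * c + c ≡ fromℕ (suc q) * c
        suc-* q c = trans (solve 2 (λ q c → q :* c :+ c := (con 1ℚ :+ q) :* c) refl (fromℕ q) c) (cong (_* c) (sym (fromℕ-suc q)))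
        index≤ : q ℕ.+ p ℕ.* suc m ℕ.≤ suc fine
        index≤ = ℕ.≤-trans (ℕ.+-monoˡ-≤ (p ℕ.* suc m) (ℕ.<⇒≤ q<m)) (ℕ.*-monoˡ-≤ (suc m) p<n)
        distance : ∣ fromℕ p * h - fromℕ (q ℕ.+ p ℕ.* suc m) * h′ ∣ ≤ h
        distance = begin
          ∣ fromℕ p * h - fromℕ (q ℕ.+ p ℕ.* suc m) * h′ ∣  ≡⟨ cong (λ s → ∣ fromℕ p * h - s ∣) (point q p) ⟩
          ∣ fromℕ p * h - (fromℕ p * h + fromℕ q * h′) ∣  ≡⟨ cong ∣_∣ (solve 2 (λ a b → a :- (a :+ b) := :- b) refl (fromℕ p * h) (fromℕ q * h′)) ⟩
          ∣ - (fromℕ q * h′) ∣  ≡⟨ trans (∣-p∣≡∣p∣ (fromℕ q * h′)) (0≤p⇒∣p∣≡p (0≤p*q (0≤fromℕ q) (0≤mesh fine))) ⟩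
          fromℕ q * h′  ≤⟨ *-monoʳ-≤-nonNeg h′ {{nonNegative (0≤mesh fine)}} (fromℕ-mono-≤ (ℕ.<⇒≤ q<m)) ⟩
          fromℕ (suc m) * h′  ≡⟨ h≡ ⟩
          h  ∎
          where open ≤-Reasoning

      blocks : ∀ p → p ℕ.≤ suc n →
        ∥ ⌜ h ⌝ ⊗ ∑ᴿ p (λ i → f (fromℕ i * h)) ⊝ ⌜ h′ ⌝ ⊗ ∑ᴿ (p ℕ.* suc m) (λ j → f (fromℕ j * h′)) ∥ ≤ᴿ ⌜ fromℕ p * (h * (L * h)) ⌝
      blocks zero    _   = ∥0∥≤ (≤-reflexive (sym (*-zeroˡ (h * (L * h)))))
        (solveᴿ 2 (λ x h → x :* con 0ℚ :- h :* con 0ℚ := con 0ℚ) refl ⌜ h ⌝ ⌜ h′ ⌝)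
      blocks (suc p) p<n = ∥∥≤-resp
        (≈-trans (solveᴿ 6 (λ h s k r x y → (h :* s :- k :* r) :+ (h :* x :- k :* y) := h :* (s :+ x) :- k :* (r :+ y)) refl
            ⌜ h ⌝ (∑ᴿ p (λ i → f (fromℕ i * h))) ⌜ h′ ⌝ (∑ᴿ (p ℕ.* suc m) (λ j → f (fromℕ j * h′)))
            (f (fromℕ p * h)) (∑ᴿ (suc m) (λ j → f (fromℕ (j ℕ.+ p ℕ.* suc m) * h′))))
          (⊝-cong ≈-refl (⊗-congˡ ⌜ h′ ⌝ (≈-sym (∑ᴿ-split (p ℕ.* suc m) (suc m) (λ j → f (fromℕ j * h′)))))))
        (∥∥≤-weaken (≤-reflexive (trans (solve 2 (λ q c → q :* c :+ c := (con 1ℚ :+ q) :* c) refl (fromℕ p) (h * (L * h))) (cong (_* (h * (L * h))) (sym (fromℕ-suc p)))))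
          (∥⊕∥-bound (blocks p (ℕ.<⇒≤ p<n)) (∥∥≤-resp (⊝-cong (⊗-congʳ (f (fromℕ p * h)) (⌜⌝-cong h≡)) ≈-refl)
            (∥∥≤-weaken (≤-reflexive (trans (sym (*-assoc (fromℕ (suc m)) h′ (L * h))) (cong (_* (L * h)) h≡))) (block p p<n (suc m) ℕ.≤-refl)))))

      refinement : ∥ riemann f B n ⊝ riemann f B fine ∥ ≤ᴿ ⌜ L * B * B * (+ 1 / suc n) ⌝
      refinement = ∥∥≤-weaken (≤-reflexive (trans (solve 3 (λ n h l → n :* (h :* (l :* h)) := l :* (n :* h) :* h) refl (fromℕ (suc n)) h L)
        (trans (cong (λ b → L * b * h) (mesh-* B n)) (sym (*-assoc (L * B) B (+ 1 / suc n)))))) (blocks (suc n) ℕ.≤-refl)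

    -- The sums for m and n are both compared with the one over (m + 1)(n + 1) intervals, which
    -- refines either subdivision. This makes them a Cauchy sequence.
    integrable : ∃ λ I → riemann f B ⇢ I
    integrable = complete (riemann f B) λ ε 0<ε →
      let (N , small) = C/n-small K (½ * ε) 0≤K (½-pos 0<ε) in N , λ m n le le′ → let open ℝ-Reasoning in begin
        ∥ riemann f B m ⊝ riemann f B n ∥
          ≤⟨ ∥⊝∥-triangle (riemann f B m) (riemann f B (Refinement.fine m n)) (riemann f B n) ⟩
        ∥ riemann f B m ⊝ riemann f B (Refinement.fine m n) ∥ ⊕ ∥ riemann f B (Refinement.fine m n) ⊝ riemann f B n ∥
          ≤⟨ ⊕-mono-≤ (≤ᴿ-trans (Refinement.refinement m n) (⌜⌝-mono-≤ (small m le)))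
               (≤ᴿ-trans (≈⇒≤ (∥⊝∥-sym (riemann f B (Refinement.fine m n)) (riemann f B n)))
                 (≤ᴿ-trans (subst (λ r → ∥ riemann f B n ⊝ riemann f B r ∥ ≤ᴿ ⌜ K * (+ 1 / suc n) ⌝) (fine-sym n m) (Refinement.refinement n m))
                   (⌜⌝-mono-≤ (small n le′)))) ⟩
        ⌜ ½ * ε ⌝ ⊕ ⌜ ½ * ε ⌝
          ≈⟨ ⌜½⌝+⌜½⌝ ε ⟩
        ⌜ ε ⌝ ∎
      where
      K = L * B * B
      0≤K : 0ℚ ≤ K
      0≤K = 0≤p*q (0≤p*q 0≤L 0≤B) 0≤B
      fine-sym : ∀ n m → Refinement.fine n m ≡ Refinement.fine m n
      fine-sym n m = ℕ.suc-injective (ℕ.*-comm (suc n) (suc m))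

riemann-⊕ : ∀ f g B n → riemann (λ t → f t ⊕ g t) B n ≈ riemann f B n ⊕ riemann g B n
riemann-⊕ f g B n = ≈-trans (⊗-congˡ ⌜ mesh B n ⌝ (∑ᴿ-⊕ (suc n) (λ i → f (fromℕ i * mesh B n)) (λ i → g (fromℕ i * mesh B n))))
  (⊗-distribˡ-⊕ ⌜ mesh B n ⌝ (∑ᴿ (suc n) (λ i → f (fromℕ i * mesh B n))) (∑ᴿ (suc n) (λ i → g (fromℕ i * mesh B n))))

riemann-⊗ : ∀ c f B n → riemann (λ t → c ⊗ f t) B n ≈ c ⊗ riemann f B n
riemann-⊗ c f B n = ≈-trans (⊗-congˡ ⌜ mesh B n ⌝ (∑ᴿ-⊗ˡ (suc n) c (λ i → f (fromℕ i * mesh B n))))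
  (solveᴿ 3 (λ h c s → h :* (c :* s) := c :* (h :* s)) refl ⌜ mesh B n ⌝ c (∑ᴿ (suc n) (λ i → f (fromℕ i * mesh B n))))

-- Along subsequences with mesh exactly 1/(n + 1), the Riemann sum over [0, b] is an initial part of
-- the one over [0, c]. The case b = 0 is separate, since there the mesh is 0.
integral-mono-interval : ∀ {f I J} → (∀ t → 0ℚ ≤ t → 0ᴿ ≤ᴿ f t) → ∀ b c → b ℕ.≤ c →
  riemann f (fromℕ b) ⇢ I → riemann f (fromℕ c) ⇢ J → I ≤ᴿ J
integral-mono-interval {f} 0≤f zero c _ ⇢I ⇢J = ⇢-mono (0 , λ n _ → ≤ᴿ-trans (≈⇒≤ (empty n)) (nonneg n)) ⇢I ⇢J
  where
  empty : ∀ n → riemann f 0ℚ n ≈ 0ᴿ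
  empty n = ≈-trans (⊗-congʳ _ (⌜⌝-cong (*-zeroˡ (+ 1 / suc n)))) (solveᴿ 1 (λ s → con 0ℚ :* s := con 0ℚ) refl (∑ᴿ (suc n) (λ i → f (fromℕ i * mesh 0ℚ n))))
  nonneg : ∀ n → 0ᴿ ≤ᴿ riemann f (fromℕ c) n
  nonneg n = 0≤⊗ (0≤⌜⌝ (0≤mesh (0≤fromℕ c) n)) (0≤∑ᴿ (suc n) (λ i i<n → 0≤f _ (proj₁ (mesh-range (0≤fromℕ c) n i (ℕ.<⇒≤ i<n)))))
integral-mono-interval {f} 0≤f (suc b) (suc c) b≤c ⇢I ⇢J =
  ⇢-mono (0 , λ n _ → compare n) (⇢-subsequence (index b) (index≥ b) ⇢I) (⇢-subsequence (index c) (index≥ c) ⇢J)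
  where
  index : ℕ → ℕ → ℕ
  index b n = b ℕ.+ n ℕ.* suc b
  index≥ : ∀ b n → n ℕ.≤ index b n
  index≥ b n = ℕ.≤-trans (ℕ.m≤m*n n (suc b)) (ℕ.m≤n+m (n ℕ.* suc b) b)
  mesh-index : ∀ b n → mesh (fromℕ (suc b)) (index b n) ≡ + 1 / suc n
  mesh-index b n = *-cancelˡ-≢0 (fromℕ (suc n)) (fromℕ-suc≢0 n) (*-cancelˡ-≢0 (fromℕ (suc b)) (fromℕ-suc≢0 b) (begin
    fromℕ (suc b) * (fromℕ (suc n) * mesh (fromℕ (suc b)) (index b n))  ≡⟨ solve 3 (λ b n h → b :* (n :* h) := n :* b :* h) refl (fromℕ (suc b)) (fromℕ (suc n)) (mesh (fromℕ (suc b)) (index b n)) ⟩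
    fromℕ (suc n) * fromℕ (suc b) * mesh (fromℕ (suc b)) (index b n)  ≡⟨ cong (_* mesh (fromℕ (suc b)) (index b n)) (fromℕ-* (suc n) (suc b)) ⟨
    fromℕ (suc n ℕ.* suc b) * mesh (fromℕ (suc b)) (index b n)  ≡⟨ mesh-* (fromℕ (suc b)) (index b n) ⟩
    fromℕ (suc b)  ≡⟨ trans (cong (fromℕ (suc b) *_) (fromℕ-*-/ 1 n)) (*-identityʳ (fromℕ (suc b))) ⟨
    fromℕ (suc b) * (fromℕ (suc n) * (+ 1 / suc n))  ∎))
    where open ≡-Reasoning
  fixed : ∀ b n → riemann f (fromℕ (suc b)) (index b n) ≈ ⌜ + 1 / suc n ⌝ ⊗ ∑ᴿ (suc n ℕ.* suc b) (λ i → f (fromℕ i * (+ 1 / suc n)))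
  fixed b n = ≡⇒≈ (cong (λ h → ⌜ h ⌝ ⊗ ∑ᴿ (suc n ℕ.* suc b) (λ i → f (fromℕ i * h))) (mesh-index b n))
  compare : ∀ n → riemann f (fromℕ (suc b)) (index b n) ≤ᴿ riemann f (fromℕ (suc c)) (index c n)
  compare n = ≤ᴿ-trans (≈⇒≤ (fixed b n)) (≤ᴿ-trans (⊗-monoˡ-≤ ⌜ + 1 / suc n ⌝ (0≤⌜⌝ (0≤/ 1 n)) longer) (≈⇒≤ (≈-sym (fixed c n))))
    where
    g : ℕ → ℝ
    g i = f (fromℕ i * (+ 1 / suc n))
    0≤g : ∀ i → 0ᴿ ≤ᴿ g i
    0≤g i = 0≤f _ (0≤p*q (0≤fromℕ i) (0≤/ 1 n))
    p = suc n ℕ.* suc b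
    d = suc n ℕ.* suc c ℕ.∸ p
    longer : ∑ᴿ p g ≤ᴿ ∑ᴿ (suc n ℕ.* suc c) g
    longer = subst (λ r → ∑ᴿ p g ≤ᴿ ∑ᴿ r g) (ℕ.m∸n+n≡m (ℕ.*-monoʳ-≤ (suc n) b≤c))
      (≤ᴿ-trans (≈⇒≤ (≈-sym (≈-trans (⊕-comm (∑ᴿ p g) 0ᴿ) (⊕-identityˡ (∑ᴿ p g)))))
        (≤ᴿ-trans (⊕-mono-≤ ≤ᴿ-refl (0≤∑ᴿ d (λ i _ → 0≤g (i ℕ.+ p)))) (≈⇒≤ (≈-sym (∑ᴿ-split p d g)))))

-- Integrals from 0 to ∞ against e^(-t)

e : ℚ → ℝ
e t = expᴿ (- t)

-- The product has derivative 0 and value 1 at 0, which avoids multiplying the two series.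
e-inverse : ∀ t → 0ℚ ≤ t → e t ⊗ expᴿ t ≈ 1ᴿ
e-inverse t 0≤t = ≈-trans
  (constant 0≤t (differentiable-cong 0≤t (λ s _ → ≈-refl)
    (λ s _ → solveᴿ 2 (λ a b → (:- a) :* b :+ a :* b := con 0ℚ) refl (e s) (expᴿ s))
    (differentiable-× 0≤t (differentiable-exp⁻ 0≤t) (differentiable-exp 0≤t))))
  (≈-trans (⊗-cong expᴿ-0 expᴿ-0) (⊗-identityˡ 1ᴿ))

0≤e : ∀ t → 0ℚ ≤ t → 0ᴿ ≤ᴿ e t
0≤e t 0≤t = 0≤-from-inverse (e t) (expᴿ t) (e-inverse t 0≤t) (expTerm≤expᴿ 0≤t 0)

-- t^i / i! is a single term of the series for e^t.
power⊗e≤ : ∀ t → 0ℚ ≤ t → ∀ i → ⌜ t ^ i ⌝ ⊗ e t ≤ᴿ ⌜ fromℕ (i !) ⌝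
power⊗e≤ t 0≤t i = begin
  ⌜ t ^ i ⌝ ⊗ e t  ≈⟨ ⊗-congʳ (e t) (≈-trans (⌜⌝-cong (sym t^i)) (⌜⌝-* (fromℕ (i !)) (expTerm t i))) ⟩
  ⌜ fromℕ (i !) ⌝ ⊗ ⌜ expTerm t i ⌝ ⊗ e t  ≈⟨ ⊗-assoc ⌜ fromℕ (i !) ⌝ ⌜ expTerm t i ⌝ (e t) ⟩
  ⌜ fromℕ (i !) ⌝ ⊗ (⌜ expTerm t i ⌝ ⊗ e t)  ≤⟨ ⊗-monoˡ-≤ ⌜ fromℕ (i !) ⌝ (0≤⌜⌝ (0≤fromℕ (i !))) (⊗-monoʳ-≤ (e t) (0≤e t 0≤t) (expTerm≤expᴿ 0≤t i)) ⟩
  ⌜ fromℕ (i !) ⌝ ⊗ (expᴿ t ⊗ e t)  ≈⟨ ⊗-congˡ ⌜ fromℕ (i !) ⌝ (≈-trans (⊗-comm (expᴿ t) (e t)) (e-inverse t 0≤t)) ⟩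
  ⌜ fromℕ (i !) ⌝ ⊗ 1ᴿ  ≈⟨ ≈-trans (⊗-comm ⌜ fromℕ (i !) ⌝ 1ᴿ) (⊗-identityˡ ⌜ fromℕ (i !) ⌝) ⟩
  ⌜ fromℕ (i !) ⌝  ∎
  where
  open ℝ-Reasoning
  i!*1/i! : ∀ f .{{_ : ℕ.NonZero f}} → fromℕ f * (+ 1 / f) ≡ 1ℚ
  i!*1/i! (suc f) = fromℕ-*-/ 1 f
  t^i : fromℕ (i !) * expTerm t i ≡ t ^ i
  t^i = trans (solve 3 (λ f p r → f :* (p :* r) := p :* (f :* r)) refl (fromℕ (i !)) (t ^ i) ((+ 1 / (i !)) {{i ℕ.!≢0}}))
    (trans (cong (t ^ i *_) (i!*1/i! (i !) {{i ℕ.!≢0}})) (*-identityʳ (t ^ i)))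

Decays : (ℚ → ℝ) → Set
Decays F = (λ B → F (fromℕ B) ⊗ e (fromℕ B)) ⇢ 0ᴿ

-- Writing t^j as (t^(j+1) + t^j)/(t + 1) gains a factor 1/(B + 1) at t = B, while both numerators
-- stay bounded after multiplication by e^(-t).
decays-power : ∀ j → Decays (λ t → ⌜ t ^ j ⌝)
decays-power j = ⇢-C/n C (+-mono-≤ (0≤fromℕ (suc j !)) (0≤fromℕ (j !))) λ B →
  let t = fromℕ B
      0≤te = 0≤⊗ (0≤⌜⌝ (0≤^ j (0≤fromℕ B))) (0≤e t (0≤fromℕ B))
      open ℝ-Reasoning
  in begin
    ∥ ⌜ t ^ j ⌝ ⊗ e t ⊝ 0ᴿ ∥
      ≈⟨ ∥∥-cong (solveᴿ 1 (λ x → x :- con 0ℚ := x) refl (⌜ t ^ j ⌝ ⊗ e t)) ⟩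
    ∥ ⌜ t ^ j ⌝ ⊗ e t ∥
      ≈⟨ ≈-sym (0≤⇒≈∥∥ 0≤te) ⟩
    ⌜ t ^ j ⌝ ⊗ e t
      ≈⟨ ⊗-congʳ (e t) (≈-trans (⌜⌝-cong (rescale B)) (≈-trans (⌜⌝-* (+ 1 / suc B) (t ^ suc j + t ^ j)) (⊗-congˡ ⌜ + 1 / suc B ⌝ (⌜⌝-+ (t ^ suc j) (t ^ j))))) ⟩
    ⌜ + 1 / suc B ⌝ ⊗ (⌜ t ^ suc j ⌝ ⊕ ⌜ t ^ j ⌝) ⊗ e t
      ≈⟨ solveᴿ 4 (λ r a b x → r :* (a :+ b) :* x := r :* (a :* x :+ b :* x)) refl ⌜ + 1 / suc B ⌝ ⌜ t ^ suc j ⌝ ⌜ t ^ j ⌝ (e t) ⟩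
    ⌜ + 1 / suc B ⌝ ⊗ (⌜ t ^ suc j ⌝ ⊗ e t ⊕ ⌜ t ^ j ⌝ ⊗ e t)
      ≤⟨ ⊗-monoˡ-≤ ⌜ + 1 / suc B ⌝ (0≤⌜⌝ (0≤/ 1 B)) (⊕-mono-≤ (power⊗e≤ t (0≤fromℕ B) (suc j)) (power⊗e≤ t (0≤fromℕ B) j)) ⟩
    ⌜ + 1 / suc B ⌝ ⊗ (⌜ fromℕ (suc j !) ⌝ ⊕ ⌜ fromℕ (j !) ⌝)
      ≈⟨ ≈-trans (⊗-comm ⌜ + 1 / suc B ⌝ _) (≈-trans (⊗-congʳ ⌜ + 1 / suc B ⌝ (≈-sym (⌜⌝-+ (fromℕ (suc j !)) (fromℕ (j !))))) (≈-sym (⌜⌝-* C (+ 1 / suc B)))) ⟩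
    ⌜ C * (+ 1 / suc B) ⌝ ∎
  where
  C = fromℕ (suc j !) + fromℕ (j !)
  rescale : ∀ B → fromℕ B ^ j ≡ (+ 1 / suc B) * (fromℕ B ^ suc j + fromℕ B ^ j)
  rescale B = sym (trans (cong (λ s → (+ 1 / suc B) * s) (trans (solve 2 (λ t p → t :* p :+ p := (con 1ℚ :+ t) :* p) refl (fromℕ B) (fromℕ B ^ j)) (cong (_* fromℕ B ^ j) (sym (fromℕ-suc B)))))
    (trans (solve 3 (λ r n p → r :* (n :* p) := n :* r :* p) refl (+ 1 / suc B) (fromℕ (suc B)) (fromℕ B ^ j))
      (trans (cong (_* fromℕ B ^ j) (fromℕ-*-/ 1 B)) (*-identityˡ (fromℕ B ^ j)))))

decays-⊕ : ∀ {F G} → Decays F → Decays G → Decays (λ t → F t ⊕ G t)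
decays-⊕ {F} {G} dF dG = ⇢-cong (λ B → solveᴿ 3 (λ f g x → f :* x :+ g :* x := (f :+ g) :* x) refl (F (fromℕ B)) (G (fromℕ B)) (e (fromℕ B)))
  (⊕-identityˡ 0ᴿ) (⇢-+ dF dG)

decays-dominated : ∀ {F G} → (∀ t → 0ℚ ≤ t → 0ᴿ ≤ᴿ F t) → (∀ t → 0ℚ ≤ t → F t ≤ᴿ G t) → Decays G → Decays F
decays-dominated {F} {G} 0≤F F≤G (mk⇢ h) = mk⇢ λ ε 0<ε → let (N , h′) = h ε 0<ε in N , λ B le →
  let t = fromℕ B ; 0≤t = 0≤fromℕ B ; open ℝ-Reasoning in begin
    ∥ F t ⊗ e t ⊝ 0ᴿ ∥  ≈⟨ ∥∥-cong (solveᴿ 1 (λ x → x :- con 0ℚ := x) refl (F t ⊗ e t)) ⟩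
    ∥ F t ⊗ e t ∥  ≈⟨ ≈-sym (0≤⇒≈∥∥ (0≤⊗ (0≤F t 0≤t) (0≤e t 0≤t))) ⟩
    F t ⊗ e t  ≤⟨ ⊗-monoʳ-≤ (e t) (0≤e t 0≤t) (F≤G t 0≤t) ⟩
    G t ⊗ e t  ≤⟨ x≤∥x∥ (G t ⊗ e t) ⟩
    ∥ G t ⊗ e t ∥  ≈⟨ ∥∥-cong (solveᴿ 1 (λ x → x := x :- con 0ℚ) refl (G t ⊗ e t)) ⟩
    ∥ G t ⊗ e t ⊝ 0ᴿ ∥  ≤⟨ h′ B le ⟩
    ⌜ ε ⌝  ∎

-- I = ∫₀^∞ f(t) e^(−t) dt
record HasIntegral (f : ℚ → ℝ) (I : ℝ) : Set where
  field
    J         : ℕ → ℝ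
    converges : ∀ B → riemann (λ t → f t ⊗ e t) (fromℕ B) ⇢ J B
    tends     : J ⇢ I

integral-cong : ∀ {f g I} → (∀ t → 0ℚ ≤ t → f t ≈ g t) → HasIntegral f I → HasIntegral g I
integral-cong f≈g hf = record
  { J = J ; tends = tends
  ; converges = λ B → ⇢-cong (riemann-cong (0≤fromℕ B) (λ t t∈ → ⊗-congʳ (e t) (f≈g t (proj₁ t∈)))) ≈-refl (converges B) }
  where open HasIntegral hf

integral-resp : ∀ {f I I′} → I ≈ I′ → HasIntegral f I → HasIntegral f I′
integral-resp I≈I′ hf = record { J = J ; converges = converges ; tends = ⇢-cong (λ _ → ≈-refl) I≈I′ tends }
  where open HasIntegral hf

integral-⊕ : ∀ {f g I J} → HasIntegral f I → HasIntegral g J → HasIntegral (λ t → f t ⊕ g t) (I ⊕ J)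
integral-⊕ {f} {g} hf hg = record
  { J = λ B → hf.J B ⊕ hg.J B
  ; converges = λ B → ⇢-cong (λ n → ≈-trans (≈-sym (riemann-⊕ (λ t → f t ⊗ e t) (λ t → g t ⊗ e t) (fromℕ B) n))
      (riemann-cong (0≤fromℕ B) (λ t _ → solveᴿ 3 (λ f g x → f :* x :+ g :* x := (f :+ g) :* x) refl (f t) (g t) (e t)) n))
      ≈-refl (⇢-+ (hf.converges B) (hg.converges B))
  ; tends = ⇢-+ hf.tends hg.tends }
  where
  module hf = HasIntegral hf
  module hg = HasIntegral hg

integral-⊗ : ∀ {f I} c → HasIntegral f I → HasIntegral (λ t → c ⊗ f t) (c ⊗ I)
integral-⊗ {f} c hf = record
  { J = λ B → c ⊗ J B
  ; converges = λ B → ⇢-cong (λ n → ≈-trans (≈-sym (riemann-⊗ c (λ t → f t ⊗ e t) (fromℕ B) n))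
      (riemann-cong (0≤fromℕ B) (λ t _ → ≈-sym (⊗-assoc c (f t) (e t))) n)) ≈-refl (⇢-*ˡ c (converges B))
  ; tends = ⇢-*ˡ c tends }
  where open HasIntegral hf

integral-mono : ∀ {f g I J} → (∀ t → 0ℚ ≤ t → f t ≤ᴿ g t) → HasIntegral f I → HasIntegral g J → I ≤ᴿ J
integral-mono f≤g hf hg = ⇢-mono (0 , λ B _ → ⇢-mono (0 , λ n _ →
    riemann-mono (0≤fromℕ B) (λ t t∈ → ⊗-monoʳ-≤ (e t) (0≤e t (proj₁ t∈)) (f≤g t (proj₁ t∈))) n) (hf.converges B) (hg.converges B))
  hf.tends hg.tends
  where
  module hf = HasIntegral hf
  module hg = HasIntegral hg

-- (f - F) e^(-t) is the derivative of F e^(-t). The boundary value at B decays, the one at 0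
-- remains.
integral-by-parts : ∀ {F f} → (∀ B → 0ℚ ≤ B → Differentiable B F f) → Decays F → HasIntegral (λ t → f t ⊝ F t) (⊖ F 0ℚ)
integral-by-parts {F} {f} d decays = record
  { J = λ B → F (fromℕ B) ⊗ e (fromℕ B) ⊝ F 0ℚ ⊗ e 0ℚ
  ; converges = λ B → ⇢-cong (riemann-cong (0≤fromℕ B) (λ t _ →
        solveᴿ 3 (λ f g x → f :* x :+ g :* (:- x) := (f :- g) :* x) refl (f t) (F t) (e t))) ≈-refl
      (fundamental-theorem (0≤fromℕ B) (differentiable-× (0≤fromℕ B) (d (fromℕ B) (0≤fromℕ B)) (differentiable-exp⁻ (0≤fromℕ B))))
  ; tends = ⇢-cong (λ _ → ≈-refl) (≈-trans (⊕-identityˡ (⊖ (F 0ℚ ⊗ e 0ℚ))) (⊖-cong (≈-trans (⊗-congˡ (F 0ℚ) expᴿ-0)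
      (≈-trans (⊗-comm (F 0ℚ) 1ᴿ) (⊗-identityˡ (F 0ℚ)))))) (⇢-+ decays (⇢-const (⊖ (F 0ℚ ⊗ e 0ℚ)))) }

-- Monotonicity and a bound do not yield a limit constructively. But f and g - f are nonnegative, so
-- the increments of `J` lie between 0 and those of the convergent integrals of g, and `J` is Cauchy
-- along with them.
integral-dominated : ∀ {f g I} → (∀ t → 0ℚ ≤ t → 0ᴿ ≤ᴿ f t) → (∀ t → 0ℚ ≤ t → f t ≤ᴿ g t) →
  (∀ B → ∃ λ J → riemann (λ t → f t ⊗ e t) (fromℕ B) ⇢ J) → HasIntegral g I → ∃ λ I′ → HasIntegral f I′
integral-dominated {f} {g} 0≤f f≤g hf hg = proj₁ limit-J , record { J = J ; converges = λ B → proj₂ (hf B) ; tends = proj₂ limit-J }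
  where
  module hg = HasIntegral hg
  J : ℕ → ℝ
  J B = proj₁ (hf B)
  J-mono : ∀ b c → b ℕ.≤ c → J b ≤ᴿ J c
  J-mono b c b≤c = integral-mono-interval (λ t 0≤t → 0≤⊗ (0≤f t 0≤t) (0≤e t 0≤t)) b c b≤c (proj₂ (hf b)) (proj₂ (hf c))
  rest : ∀ B → riemann (λ t → (g t ⊝ f t) ⊗ e t) (fromℕ B) ⇢ hg.J B ⊕ ⌜ - 1ℚ ⌝ ⊗ J B
  rest B = ⇢-cong (λ n → ≈-trans (⊕-cong ≈-refl (≈-sym (riemann-⊗ ⌜ - 1ℚ ⌝ (λ t → f t ⊗ e t) (fromℕ B) n)))
      (≈-trans (≈-sym (riemann-⊕ (λ t → g t ⊗ e t) (λ t → ⌜ - 1ℚ ⌝ ⊗ (f t ⊗ e t)) (fromℕ B) n))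
        (riemann-cong (0≤fromℕ B) (λ t _ → solveᴿ 3 (λ g f x → g :* x :+ con (- 1ℚ) :* (f :* x) := (g :- f) :* x) refl (g t) (f t) (e t)) n)))
    ≈-refl (⇢-+ (hg.converges B) (⇢-*ˡ ⌜ - 1ℚ ⌝ (proj₂ (hf B))))
  increment : ∀ b c → b ℕ.≤ c → J c ⊝ J b ≤ᴿ hg.J c ⊝ hg.J b
  increment b c b≤c = 0≤⊝⇒≤ (≤ᴿ-trans
    (≤⇒0≤⊝ (integral-mono-interval (λ t 0≤t → 0≤⊗ (≤⇒0≤⊝ (f≤g t 0≤t)) (0≤e t 0≤t)) b c b≤c (rest b) (rest c)))
    (≈⇒≤ (solveᴿ 4 (λ gc gb jc jb → (gc :+ con (- 1ℚ) :* jc) :- (gb :+ con (- 1ℚ) :* jb) := (gc :- gb) :- (jc :- jb)) refl (hg.J c) (hg.J b) (J c) (J b))))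
  ordered : ∀ b c → b ℕ.≤ c → ∥ J c ⊝ J b ∥ ≤ᴿ ∥ hg.J c ⊝ hg.J b ∥
  ordered b c b≤c = ≤ᴿ-trans (≈⇒≤ (≈-sym (0≤⇒≈∥∥ (≤⇒0≤⊝ (J-mono b c b≤c))))) (≤ᴿ-trans (increment b c b≤c) (x≤∥x∥ _))
  controlled : ∀ b c → ∥ J c ⊝ J b ∥ ≤ᴿ ∥ hg.J c ⊝ hg.J b ∥
  controlled b c with ℕ.≤-total b c
  ... | inj₁ b≤c = ordered b c b≤c
  ... | inj₂ c≤b = ≤ᴿ-trans (≈⇒≤ (∥⊝∥-sym (J c) (J b))) (≤ᴿ-trans (ordered c b c≤b) (≈⇒≤ (∥⊝∥-sym (hg.J b) (hg.J c))))
  limit-J : ∃ λ I′ → J ⇢ I′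
  limit-J = complete J λ ε 0<ε → let (N , h) = limit hg.tends (½ * ε) (½-pos 0<ε) in N , λ m n le le′ →
    ≤ᴿ-trans (controlled n m) (≤ᴿ-trans (∥⊝∥-triangle (hg.J m) _ (hg.J n))
      (≤ᴿ-trans (⊕-mono-≤ (h m le) (≤ᴿ-trans (≈⇒≤ (∥⊝∥-sym _ (hg.J n))) (h n le′))) (≈⇒≤ (⌜½⌝+⌜½⌝ ε))))

rising : ℚ → ℕ → ℚ
rising c zero    = 1ℚ
rising c (suc j) = (c + fromℕ j) * rising c j

-- The equation (t ψ)′ = c ψ is that of ψ = t^(c-1), and then the moments are Γ(c + j). It is used
-- for ψ = 1 with c = 1, which gives the factorials, and for ψ = t^(1+1/k) with c = 2 + 1/k. The
-- polynomial bound on ψ provides the decay of the boundary terms.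
module Moments
  (ψ : ℚ → ℝ) (c : ℚ)
  (ψ-diff : ∀ B → 0ℚ ≤ B → Differentiable B (λ t → ⌜ t ⌝ ⊗ ψ t) (λ t → ⌜ c ⌝ ⊗ ψ t))
  (0≤ψ : ∀ t → 0ℚ ≤ t → 0ᴿ ≤ᴿ ψ t)
  (ψ≤ : ∀ t → 0ℚ ≤ t → ψ t ≤ᴿ ⌜ 1ℚ + t + t * t ⌝)
  where

  power : ℕ → ℚ → ℝ
  power j t = ⌜ t ^ j ⌝ ⊗ ψ t

  power-suc : ∀ j t → ⌜ t ⌝ ⊗ power j t ≈ power (suc j) t
  power-suc j t = ≈-trans (≈-sym (⊗-assoc ⌜ t ⌝ ⌜ t ^ j ⌝ (ψ t))) (⊗-congʳ (ψ t) (≈-sym (⌜⌝-* t (t ^ j))))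

  power-differentiable : ∀ B → 0ℚ ≤ B → ∀ j → Differentiable B (power (suc j)) (λ t → ⌜ c + fromℕ j ⌝ ⊗ power j t)
  power-differentiable B 0≤B zero = differentiable-cong 0≤B
    (λ t _ → ⊗-congʳ (ψ t) (⌜⌝-cong (sym (*-identityʳ t))))
    (λ t _ → ⊗-cong (⌜⌝-cong (sym (+-identityʳ c))) (≈-sym (⊗-identityˡ (ψ t))))
    (ψ-diff B 0≤B)
  power-differentiable B 0≤B (suc j) = differentiable-cong 0≤B
    (λ t _ → power-suc (suc j) t)
    (λ t _ → ≈-trans
      (⊕-cong (⊗-congˡ 1ᴿ (≈-sym (power-suc j t))) ≈-refl)
      (≈-trans (solveᴿ 3 (λ t d p → con 1ℚ :* (t :* p) :+ t :* (d :* p) := (d :+ con 1ℚ) :* (t :* p)) refl ⌜ t ⌝ ⌜ c + fromℕ j ⌝ (power j t))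
        (⊗-cong (≈-trans (≈-sym (⌜⌝-+ (c + fromℕ j) 1ℚ)) (⌜⌝-cong (trans (solve 2 (λ c j → c :+ j :+ con 1ℚ := c :+ (con 1ℚ :+ j)) refl c (fromℕ j)) (cong (λ s → c + s) (sym (fromℕ-suc j))))))
          (power-suc j t))))
    (differentiable-× 0≤B (differentiable-id 0≤B) (power-differentiable B 0≤B j))

  0≤power : ∀ j t → 0ℚ ≤ t → 0ᴿ ≤ᴿ power j t
  0≤power j t 0≤t = 0≤⊗ (0≤⌜⌝ (0≤^ j 0≤t)) (0≤ψ t 0≤t)

  power-decays : ∀ j → Decays (power j)
  power-decays j = decays-dominated {power j} {λ t → ⌜ t ^ j ⌝ ⊕ ⌜ t ^ suc j ⌝ ⊕ ⌜ t ^ suc (suc j) ⌝} (0≤power j)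
    (λ t 0≤t → ≤ᴿ-trans (⊗-monoˡ-≤ ⌜ t ^ j ⌝ (0≤⌜⌝ (0≤^ j 0≤t)) (ψ≤ t 0≤t)) (≈⇒≤ (≈-trans (≈-sym (⌜⌝-* (t ^ j) (1ℚ + t + t * t)))
      (≈-trans (⌜⌝-cong (solve 2 (λ p t → p :* (con 1ℚ :+ t :+ t :* t) := p :+ t :* p :+ t :* (t :* p)) refl (t ^ j) t))
        (≈-trans (⌜⌝-+ (t ^ j + t ^ suc j) (t ^ suc (suc j))) (⊕-cong (⌜⌝-+ (t ^ j) (t ^ suc j)) ≈-refl))))))
    (decays-⊕ {λ t → ⌜ t ^ j ⌝ ⊕ ⌜ t ^ suc j ⌝} {λ t → ⌜ t ^ suc (suc j) ⌝}
      (decays-⊕ {λ t → ⌜ t ^ j ⌝} {λ t → ⌜ t ^ suc j ⌝} (decays-power j) (decays-power (suc j))) (decays-power (suc (suc j))))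

  -- By parts with F = t^(j+1) ψ, which vanishes at 0 and has derivative (c + j) t^j ψ.
  moment-suc : ∀ j {I} → HasIntegral (power j) I → HasIntegral (power (suc j)) (⌜ c + fromℕ j ⌝ ⊗ I)
  moment-suc j {I} hI = integral-resp
    (≈-trans (⊕-cong ≈-refl (⊗-congˡ ⌜ - 1ℚ ⌝ (⊖-cong (⊗-congʳ (ψ 0ℚ) (⌜⌝-cong (*-zeroˡ (0ℚ ^ j)))))))
      (solveᴿ 2 (λ x p → x :+ con (- 1ℚ) :* (:- (con 0ℚ :* p)) := x) refl (⌜ c + fromℕ j ⌝ ⊗ I) (ψ 0ℚ)))
    (integral-cong (λ t _ → solveᴿ 2 (λ x y → x :+ con (- 1ℚ) :* (x :- y) := y) refl (⌜ c + fromℕ j ⌝ ⊗ power j t) (power (suc j) t))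
      (integral-⊕ (integral-⊗ ⌜ c + fromℕ j ⌝ hI)
        (integral-⊗ ⌜ - 1ℚ ⌝ (integral-by-parts (λ B 0≤B → power-differentiable B 0≤B j) (power-decays (suc j))))))

  moments : ∀ {I} → HasIntegral (power 0) I → ∀ j → HasIntegral (power j) (⌜ rising c j ⌝ ⊗ I)
  moments {I} hI zero    = integral-resp (≈-sym (⊗-identityˡ I)) hI
  moments {I} hI (suc j) = integral-resp
    (≈-trans (≈-sym (⊗-assoc ⌜ c + fromℕ j ⌝ ⌜ rising c j ⌝ I)) (⊗-congʳ I (≈-sym (⌜⌝-* (c + fromℕ j) (rising c j)))))
    (moment-suc j (moments hI j))

rising-1 : ∀ j → rising 1ℚ j ≡ fromℕ (j !)
rising-1 zero    = refl
rising-1 (suc j) = trans (cong₂ _*_ (sym (fromℕ-suc j)) (rising-1 j)) (sym (fromℕ-* (suc j) (j !)))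

1≤1+t+t² : ∀ t → 0ℚ ≤ t → 1ℚ ≤ 1ℚ + t + t * t
1≤1+t+t² t 0≤t = ≤-trans (p≤p+q 0≤t) (p≤p+q (0≤p² t))

module Factorial = Moments (λ _ → 1ᴿ) 1ℚ
  (λ B 0≤B → differentiable-cong 0≤B (λ t _ → ≈-trans (≈-sym (⊗-identityˡ ⌜ t ⌝)) (⊗-comm 1ᴿ ⌜ t ⌝)) (λ t _ → ≈-sym (⊗-identityˡ 1ᴿ)) (differentiable-id 0≤B))
  (λ _ _ → 0≤⌜⌝ (0≤fromℕ 1)) (λ t 0≤t → ⌜⌝-mono-≤ (1≤1+t+t² t 0≤t))

factorial-integral : ∀ j → HasIntegral (λ t → ⌜ t ^ j ⌝) ⌜ fromℕ (j !) ⌝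
factorial-integral j = integral-cong (λ t _ → ⊗-1 ⌜ t ^ j ⌝)
  (integral-resp (≈-trans (⊗-1 ⌜ rising 1ℚ j ⌝) (⌜⌝-cong (rising-1 j))) (Factorial.moments base j))
  where
  ⊗-1 : ∀ x → x ⊗ 1ᴿ ≈ x
  ⊗-1 x = ≈-trans (⊗-comm x 1ᴿ) (⊗-identityˡ x)
  -- By parts with the constant F = 1: the integral of (0 - 1) e^(-t) is -1.
  base : HasIntegral (Factorial.power 0) 1ᴿ
  base = integral-resp (solveᴿ 0 (con (- 1ℚ) :* (:- con 1ℚ) := con 1ℚ) refl)
    (integral-cong (λ t _ → solveᴿ 0 (con (- 1ℚ) :* (con 0ℚ :- con 1ℚ) := con 1ℚ :* con 1ℚ) refl)
      (integral-⊗ ⌜ - 1ℚ ⌝ (integral-by-parts (λ B 0≤B → differentiable-const 0≤B 1ℚ) (decays-power 0))))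

-- ∫₀^∞ t^(j + 1 + 1/k) e^(−t) dt for k = suc n
module RootMoments (n : ℕ) where

  ζ : ℚ
  ζ = fromℕ 2 + + 1 / suc n

  0<ζ : 0ℚ < ζ
  0<ζ = <-≤-trans (0<fromℕ-suc 1) (p≤p+q (0≤/ 1 n))

  ψ : ℚ → ℝ
  ψ t = ⌜ t ⌝ ⊗ rootᴿ n t

  0≤ψ : ∀ t → 0ℚ ≤ t → 0ᴿ ≤ᴿ ψ t
  0≤ψ t 0≤t = 0≤⊗ (0≤⌜⌝ 0≤t) (0≤ᴿrootᴿ n t)

  ψ≤t+t² : ∀ t → 0ℚ ≤ t → ψ t ≤ᴿ ⌜ t + t * t ⌝
  ψ≤t+t² t 0≤t = ≤ᴿ-trans (⊗-monoˡ-≤ ⌜ t ⌝ (0≤⌜⌝ 0≤t) (rootᴿ≤ n t 0≤t))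
    (≈⇒≤ (≈-trans (≈-sym (⌜⌝-* t (1ℚ + t))) (⌜⌝-cong (solve 1 (λ t → t :* (con 1ℚ :+ t) := t :+ t :* t) refl t))))

  open Moments ψ ζ (λ B 0≤B → differentiable-root 0≤B n) 0≤ψ
    (λ t 0≤t → ≤ᴿ-trans (ψ≤t+t² t 0≤t) (⌜⌝-mono-≤ (≤-trans (p≤q+p (0≤fromℕ 1)) (≤-reflexive (sym (+-assoc 1ℚ t (t * t)))))))
    public

  -- ζ ψ is Lipschitz as the derivative in `differentiable-root`. So ζ ψ e^(-t) is integrated first,
  -- and ζ is divided out afterwards.
  integrable-ψ : ∀ B → ∃ λ J → riemann (λ t → ψ t ⊗ e t) (fromℕ B) ⇢ J
  integrable-ψ B = ⌜ 1ℚ ÷₀ ζ ⌝ ⊗ proj₁ scaled , ⇢-cong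
    (λ m → ≈-trans (≈-sym (riemann-⊗ ⌜ 1ℚ ÷₀ ζ ⌝ (λ t → (⌜ ζ ⌝ ⊗ ψ t) ⊗ e t) (fromℕ B) m))
      (riemann-cong 0≤B (λ t _ → ≈-trans (solveᴿ 4 (λ i z p x → i :* (z :* p :* x) := (i :* z) :* (p :* x)) refl ⌜ 1ℚ ÷₀ ζ ⌝ ⌜ ζ ⌝ (ψ t) (e t))
        (≈-trans (⊗-congʳ (ψ t ⊗ e t) (≈-trans (≈-sym (⌜⌝-* (1ℚ ÷₀ ζ) ζ)) (⌜⌝-cong (÷₀-* 1ℚ (0<⇒≢0 0<ζ))))) (⊗-identityˡ (ψ t ⊗ e t)))) m))
    ≈-refl (⇢-*ˡ ⌜ 1ℚ ÷₀ ζ ⌝ (proj₂ scaled))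
    where
    0≤B = 0≤fromℕ B
    module dψ = Differentiable (differentiable-root 0≤B n)
    module de = Differentiable (differentiable-exp⁻ 0≤B)
    lip : Lipschitz (fromℕ B) (λ t → (⌜ ζ ⌝ ⊗ ψ t) ⊗ e t)
    lip = lipschitz-× 0≤B (dψ.C , dψ.0≤C , dψ.bounded′) (de.C , de.0≤C , de.bounded)
      (differentiable⇒lipschitz′ 0≤B (differentiable-root 0≤B n)) (differentiable⇒lipschitz 0≤B (differentiable-exp⁻ 0≤B))
    scaled : ∃ λ J → riemann (λ t → (⌜ ζ ⌝ ⊗ ψ t) ⊗ e t) (fromℕ B) ⇢ J
    scaled = integrable 0≤B (proj₁ (proj₂ lip)) (proj₂ (proj₂ lip))

  integral-ψ : ∃ λ Γ → HasIntegral ψ Γ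
  integral-ψ = integral-dominated 0≤ψ ψ≤t+t² integrable-ψ
    (integral-cong (λ t _ → ≈-trans (≈-sym (⌜⌝-+ (t ^ 1) (t ^ 2))) (⌜⌝-cong (solve 1 (λ t → t :* con 1ℚ :+ t :* (t :* con 1ℚ) := t :+ t :* t) refl t)))
      (integral-⊕ (factorial-integral 1) (factorial-integral 2)))

  Γ : ℝ
  Γ = proj₁ integral-ψ

  moment : ∀ j → HasIntegral (power j) (⌜ rising ζ j ⌝ ⊗ Γ)
  moment = moments (integral-cong (λ t _ → ≈-sym (⊗-identityˡ (ψ t))) (proj₂ integral-ψ))

-- The exponents in lowest terms

n/n≡1 : ∀ n → + suc n / suc n ≡ 1ℚ
n/n≡1 n = *-cancelˡ-≢0 (fromℕ (suc n)) (fromℕ-suc≢0 n) (trans (fromℕ-*-/ (suc n) n) (sym (*-identityʳ (fromℕ (suc n)))))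

suc-coprime : ∀ k → Coprime (suc k) k
suc-coprime k = subst (λ i → Coprime i k) (ℕ.+-comm k 1) (coprime-+ (1-coprimeTo k))

-- `_^ℚ_` reads numerator and denominator off the reduced fraction. With a literal and a proof of
-- coprimality, t to this power computes to the k-th root of t^(k+1).
1+1/k : ℕ → ℚ
1+1/k n = mkℚ (+ suc (suc n)) n (suc-coprime (suc n))

2+1/k-1≡ : ∀ n → fromℕ 2 + + 1 / suc n - 1ℚ ≡ 1+1/k n
2+1/k-1≡ n = begin
  fromℕ 2 + + 1 / suc n - 1ℚ  ≡⟨ solve 1 (λ i → con (fromℕ 2) :+ i :- con 1ℚ := con 1ℚ :+ i) refl (+ 1 / suc n) ⟩
  1ℚ + + 1 / suc n  ≡⟨ cong (_+ + 1 / suc n) (n/n≡1 n) ⟨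
  + suc n / suc n + + 1 / suc n  ≡⟨ /-suc (suc n) n ⟨
  + suc (suc n) / suc n  ≡⟨ ↥p/↧p≡p (1+1/k n) ⟩
  1+1/k n  ∎
  where open ≡-Reasoning

-- The numerator -(2 k + 1) is stored as 2 k under `-[1+_]`, so that `intPower` yields 1 / t^(2k+1).
-[2+1/k] : ℕ → ℚ
-[2+1/k] n = mkℚ -[1+ suc n ℕ.+ suc n ] n
  (subst (λ i → Coprime i (suc n)) (ℕ.+-suc (suc n) (suc n)) (coprime-+ (suc-coprime (suc n))))

-2-1/k≡ : ∀ n → - (fromℕ 2) - + 1 / suc n ≡ -[2+1/k] n
-2-1/k≡ n = begin
  - (fromℕ 2) - + 1 / suc n  ≡⟨ solve 1 (λ i → :- con (fromℕ 2) :- i := :- (con 1ℚ :+ con 1ℚ :+ i)) refl (+ 1 / suc n) ⟩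
  - (1ℚ + 1ℚ + + 1 / suc n)  ≡⟨ cong (λ s → - (s + + 1 / suc n)) 2k/k ⟨
  - (+ (suc n ℕ.+ suc n) / suc n + + 1 / suc n)  ≡⟨ cong -_ (/-suc (suc n ℕ.+ suc n) n) ⟨
  - (+ suc (suc n ℕ.+ suc n) / suc n)  ≡⟨ ↥p/↧p≡p (-[2+1/k] n) ⟩
  -[2+1/k] n  ∎
  where
  open ≡-Reasoning
  2k/k : + (suc n ℕ.+ suc n) / suc n ≡ 1ℚ + 1ℚ
  2k/k = *-cancelˡ-≢0 (fromℕ (suc n)) (fromℕ-suc≢0 n) (trans (fromℕ-*-/ (suc n ℕ.+ suc n) n) (trans (fromℕ-+ (suc n) (suc n))
    (solve 1 (λ k → k :+ k := k :* (con 1ℚ :+ con 1ℚ)) refl (fromℕ (suc n)))))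

isIntegral : ∀ f g B → 0ℚ ≤ B → ∀ I → (∀ t → 0ℚ ≤ t → f t ≈ g t) → riemann g B ⇢ I → IsIntegral f 0ℚ B I
isIntegral f g B 0≤B I f≈g g⇢I = ⇢⇒⟶ {λ i → riemannSum f 0ℚ B (suc i)} {I} (⇢-cong
  (λ i → ≈-trans {riemann g B i} {riemann f B i} {riemannSum f 0ℚ B (suc i)}
    (riemann-cong 0≤B (λ t t∈ → ≈-sym (f≈g t (proj₁ t∈))) i) (≈-sym (riemannSum≈riemann f B i))) ≈-refl g⇢I)

isImproperIntegral : ∀ f g I → (∀ t → 0ℚ ≤ t → f t ≈ g t ⊗ e t) → HasIntegral g I → IsImproperIntegral f I
isImproperIntegral f g I f≈ge hg = J , (λ B → isIntegral f (λ t → g t ⊗ e t) (fromℕ B) (0≤fromℕ B) (J B) f≈ge (converges B)) , ⇢⇒⟶ {J} {I} tends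
  where open HasIntegral hg

⊗-cancelˡ-≤ : ∀ {q} → 0ℚ < q → ⌜ q ⌝ ⊗ x ≤ᴿ ⌜ q ⌝ ⊗ y → x ≤ᴿ y
⊗-cancelˡ-≤ {x} {y} {q} 0<q h = ≤ᴿ-trans (≈⇒≤ (≈-sym (undo x))) (≤ᴿ-trans
  (⊗-monoˡ-≤ ⌜ 1ℚ ÷₀ q ⌝ (0≤⌜⌝ (<⇒≤ (0<÷₀ (0<fromℕ-suc 0) 0<q))) h) (≈⇒≤ (undo y)))
  where
  undo : ∀ x → ⌜ 1ℚ ÷₀ q ⌝ ⊗ (⌜ q ⌝ ⊗ x) ≈ x
  undo x = ≈-trans (≈-sym (⊗-assoc ⌜ 1ℚ ÷₀ q ⌝ ⌜ q ⌝ x))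
    (≈-trans (⊗-congʳ x (≈-trans (≈-sym (⌜⌝-* (1ℚ ÷₀ q) q)) (⌜⌝-cong (÷₀-* 1ℚ (0<⇒≢0 0<q))))) (⊗-identityˡ x))

-- Asymptotics of the limit probabilities

module GammaAsymptotics (n : ℕ) where

  open RootMoments n
  module LL = LimitLaw n
  module FF = Formula (suc n)

  private
    k : ℕ
    k = suc n

  K κ : ℚ
  K = fromℕ k
  κ = + suc k / k

  0<κ : 0ℚ < κ
  0<κ = /-mono-< 0 (suc k) 0 n (s≤s z≤n)

  0<K : 0ℚ < K
  0<K = 0<fromℕ-suc n

  1≤K : 1ℚ ≤ K
  1≤K = fromℕ-mono-≤ {1} {k} (s≤s z≤n)

  0≤seq-ψ : ∀ t → 0ℚ ≤ t → ∀ j → 0ℚ ≤ seq (ψ t) j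
  0≤seq-ψ t 0≤t j = subst (0ℚ ≤_) (sym (trans (seq-⊗ ⌜ t ⌝ (rootᴿ n t) j) (cong (_* seq (rootᴿ n t) j) (seq-⌜⌝ t j)))) (0≤p*q 0≤t (0≤rootᴿ n t j))

  ψ-^ : ∀ t → 0ℚ ≤ t → ψ t ^ᴿ k ≈ ⌜ t ^ suc k ⌝
  ψ-^ t 0≤t = ≈-trans (⊗-distrib-^ᴿ k ⌜ t ⌝ (rootᴿ n t)) (≈-trans (⊗-cong (⌜⌝-^ k t) (rootᴿ-^ n t 0≤t))
    (≈-trans (≈-sym (⌜⌝-* (t ^ k) t)) (⌜⌝-cong (*-comm (t ^ k) t))))

  -- Both sides have nonnegative terms and the k-th power t^(k+1).
  power≈ψ : ∀ t → 0ℚ ≤ t → t ^ℚ (fromℕ 2 + + 1 / suc n - 1ℚ) ≈ ψ t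
  power≈ψ t 0≤t = subst (λ r → t ^ℚ r ≈ ψ t) (sym (2+1/k-1≡ n))
    (^ᴿ-injective n (t ^ℚ 1+1/k n) (ψ t) (0≤^ℚ t (1+1/k n)) (0≤seq-ψ t 0≤t)
      (≈-trans (^ℚ-^ t (1+1/k n) (0≤^ (suc k) 0≤t)) (≈-sym (ψ-^ t 0≤t))))

  isGamma : IsGamma (fromℕ 2 + + 1 / suc n) Γ
  isGamma = isImproperIntegral (λ t → t ^ℚ (fromℕ 2 + + 1 / suc n - 1ℚ) *ℝ exp (- t)) ψ Γ
    (λ t 0≤t → ≈-trans (*ℝ≈⊗ (t ^ℚ (fromℕ 2 + + 1 / suc n - 1ℚ)) (exp (- t))) (⊗-cong (power≈ψ t 0≤t) (exp≈expᴿ (- t))))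
    (proj₂ integral-ψ)

  ρ : ℕ → ℚ
  ρ m = rising ζ (suc m)

  0<ρ : ∀ m → 0ℚ < ρ m
  0<ρ m = 0<rising (suc m)
    where
    0<rising : ∀ j → 0ℚ < rising ζ j
    0<rising zero    = 0<fromℕ-suc 0
    0<rising (suc j) = 0<p*q (<-≤-trans 0<ζ (p≤p+q (0≤fromℕ j))) (0<rising j)

  K*[ζ+j] : ∀ j → K * (ζ + fromℕ j) ≡ FF.denom j
  K*[ζ+j] j = begin
    K * (fromℕ 2 + + 1 / k + fromℕ j)  ≡⟨ solve 3 (λ k i j → k :* (con (fromℕ 2) :+ i :+ j) := k :* (j :+ con (fromℕ 2)) :+ k :* i) refl K (+ 1 / k) (fromℕ j) ⟩
    K * (fromℕ j + fromℕ 2) + K * (+ 1 / k)  ≡⟨ cong (λ s → K * (fromℕ j + fromℕ 2) + s) (fromℕ-*-/ 1 n) ⟩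
    K * (fromℕ j + fromℕ 2) + 1ℚ  ≡⟨ trans (FF.denom-def j) (cong (_+ 1ℚ) (FF.shift-def j)) ⟨
    FF.denom j  ∎
    where open ≡-Reasoning

  -- p m = ((k + 1)/k) m! / ((2 + 1/k) ⋯ (m + 2 + 1/k))
  ρ*p : ∀ m → ρ m * LL.p m ≡ κ * fromℕ (m !)
  ρ*p zero = *-cancelˡ-≢0 K (0<⇒≢0 0<K) (begin
    K * ((ζ + 0ℚ) * 1ℚ * LL.p 0)  ≡⟨ solve 3 (λ k s p → k :* (s :* con 1ℚ :* p) := p :* (k :* s)) refl K (ζ + 0ℚ) (LL.p 0) ⟩
    LL.p 0 * (K * (ζ + 0ℚ))  ≡⟨ cong (LL.p 0 *_) (K*[ζ+j] 0) ⟩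
    LL.p 0 * FF.denom 0  ≡⟨ LL.p-zero ⟩
    fromℕ (suc k)  ≡⟨ fromℕ-*-/ (suc k) n ⟨
    K * κ  ≡⟨ cong (K *_) (*-identityʳ κ) ⟨
    K * (κ * 1ℚ)  ∎)
    where open ≡-Reasoning
  ρ*p (suc m) = *-cancelˡ-≢0 K (0<⇒≢0 0<K) (begin
    K * ((ζ + fromℕ (suc m)) * ρ m * LL.p (suc m))  ≡⟨ solve 4 (λ k s r p → k :* (s :* r :* p) := r :* (p :* (k :* s))) refl K (ζ + fromℕ (suc m)) (ρ m) (LL.p (suc m)) ⟩
    ρ m * (LL.p (suc m) * (K * (ζ + fromℕ (suc m))))  ≡⟨ cong (λ d → ρ m * (LL.p (suc m) * d)) (K*[ζ+j] (suc m)) ⟩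
    ρ m * (LL.p (suc m) * FF.denom (suc m))  ≡⟨ cong (ρ m *_) (LL.p-suc m) ⟩
    ρ m * (LL.p m * (K * fromℕ (suc m)))  ≡⟨ solve 4 (λ r p k m → r :* (p :* (k :* m)) := r :* p :* (k :* m)) refl (ρ m) (LL.p m) K (fromℕ (suc m)) ⟩
    ρ m * LL.p m * (K * fromℕ (suc m))  ≡⟨ cong (_* (K * fromℕ (suc m))) (ρ*p m) ⟩
    κ * fromℕ (m !) * (K * fromℕ (suc m))  ≡⟨ solve 4 (λ c f k m → c :* f :* (k :* m) := k :* (c :* (m :* f))) refl κ (fromℕ (m !)) K (fromℕ (suc m)) ⟩
    K * (κ * (fromℕ (suc m) * fromℕ (m !)))  ≡⟨ cong (λ s → K * (κ * s)) (fromℕ-* (suc m) (m !)) ⟨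
    K * (κ * fromℕ (suc m !))  ∎)
    where open ≡-Reasoning

  module At (m : ℕ) where

    M φ : ℚ
    M = fromℕ m
    φ = fromℕ (suc (suc m) !)

    0≤M : 0ℚ ≤ M
    0≤M = 0≤fromℕ m

    ω : ℝ
    ω = rootᴿ n M

    -- The integral of t^(m+2) e^(-t) · k m ω^(k-1) t^(1/k), where ω = m^(1/k). The factor k m
    -- ω^(k-1) clears the tangent ω + (t - m) ω / (k m) of all roots: it becomes k m² + m (t - m).
    weighted : ℝ
    weighted = ⌜ K ⌝ ⊗ ⌜ M ⌝ ⊗ ω ^ᴿ n ⊗ (⌜ ρ m ⌝ ⊗ Γ)

    f₃ : fromℕ (suc (suc (suc m)) !) ≡ (M + fromℕ 3) * φ
    f₃ = trans (fromℕ-* (suc (suc (suc m))) (suc (suc m) !)) (cong (_* φ) (trans (fromℕ-+ 3 m) (+-comm (fromℕ 3) M)))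

    f₄ : fromℕ (suc (suc (suc (suc m))) !) ≡ (M + fromℕ 4) * ((M + fromℕ 3) * φ)
    f₄ = trans (fromℕ-* (suc (suc (suc (suc m)))) (suc (suc (suc m)) !)) (cong₂ _*_ (trans (fromℕ-+ 4 m) (+-comm (fromℕ 4) M)) f₃)

    tangent-integral : HasIntegral (λ t → ⌜ K ⌝ ⊗ ⌜ M ⌝ ⊗ ω ^ᴿ n ⊗ power (suc m) t) weighted
    tangent-integral = integral-⊗ (⌜ K ⌝ ⊗ ⌜ M ⌝ ⊗ ω ^ᴿ n) (moment (suc m))

    integrand-eq : ∀ t → ⌜ t ^ suc (suc m) ⌝ ⊗ (⌜ K ⌝ ⊗ ⌜ M ⌝ ⊗ (ω ^ᴿ n ⊗ rootᴿ n t)) ≈ ⌜ K ⌝ ⊗ ⌜ M ⌝ ⊗ ω ^ᴿ n ⊗ power (suc m) t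
    integrand-eq t = ≈-trans (⊗-congʳ (⌜ K ⌝ ⊗ ⌜ M ⌝ ⊗ (ω ^ᴿ n ⊗ rootᴿ n t)) (⌜⌝-* t (t ^ suc m)))
      (solveᴿ 5 (λ t s c o a → t :* s :* (c :* (o :* a)) := c :* o :* (s :* (t :* a))) refl ⌜ t ⌝ ⌜ t ^ suc m ⌝ (⌜ K ⌝ ⊗ ⌜ M ⌝) (ω ^ᴿ n) (rootᴿ n t))

    polynomial-integral : ∀ a b c → HasIntegral (λ t → ⌜ a ⌝ ⊗ ⌜ t ^ suc (suc m) ⌝ ⊕ ⌜ b ⌝ ⊗ ⌜ t ^ suc (suc (suc m)) ⌝ ⊕ ⌜ c ⌝ ⊗ ⌜ t ^ suc (suc (suc (suc m))) ⌝)
      ⌜ φ * (a + b * (M + fromℕ 3) + c * ((M + fromℕ 4) * (M + fromℕ 3))) ⌝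
    polynomial-integral a b c = integral-resp
      (≈-trans (⊕-cong (⊕-cong (≈-sym (⌜⌝-* a φ)) (≈-trans (⊗-congˡ ⌜ b ⌝ (⌜⌝-cong f₃)) (≈-sym (⌜⌝-* b ((M + fromℕ 3) * φ)))))
          (≈-trans (⊗-congˡ ⌜ c ⌝ (⌜⌝-cong f₄)) (≈-sym (⌜⌝-* c ((M + fromℕ 4) * ((M + fromℕ 3) * φ))))))
        (≈-trans (⊕-cong (≈-sym (⌜⌝-+ (a * φ) (b * ((M + fromℕ 3) * φ)))) ≈-refl)
          (≈-trans (≈-sym (⌜⌝-+ (a * φ + b * ((M + fromℕ 3) * φ)) (c * ((M + fromℕ 4) * ((M + fromℕ 3) * φ)))))
            (⌜⌝-cong (solve 6 (λ a b c f x y → a :* f :+ b :* (x :* f) :+ c :* (y :* (x :* f)) := f :* (a :+ b :* x :+ c :* (y :* x))) refl a b c φ (M + fromℕ 3) (M + fromℕ 4))))))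
      (integral-⊕ (integral-⊕ (integral-⊗ ⌜ a ⌝ (factorial-integral (suc (suc m)))) (integral-⊗ ⌜ b ⌝ (factorial-integral (suc (suc (suc m))))))
        (integral-⊗ ⌜ c ⌝ (factorial-integral (suc (suc (suc (suc m)))))))

    expand : ∀ t a b c → ⌜ t ^ suc (suc m) ⌝ ⊗ ⌜ a + b * t + c * (t * t) ⌝
      ≈ ⌜ a ⌝ ⊗ ⌜ t ^ suc (suc m) ⌝ ⊕ ⌜ b ⌝ ⊗ ⌜ t ^ suc (suc (suc m)) ⌝ ⊕ ⌜ c ⌝ ⊗ ⌜ t ^ suc (suc (suc (suc m))) ⌝
    expand t a b c = ≈-trans (≈-sym (⌜⌝-* s (a + b * t + c * (t * t))))
      (≈-trans (⌜⌝-cong (solve 5 (λ s t a b c → s :* (a :+ b :* t :+ c :* (t :* t)) := a :* s :+ b :* (t :* s) :+ c :* (t :* (t :* s))) refl s t a b c))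
        (≈-trans (⌜⌝-+ (a * s + b * (t * s)) (c * (t * (t * s)))) (⊕-cong
          (≈-trans (⌜⌝-+ (a * s) (b * (t * s))) (⊕-cong (⌜⌝-* a s) (⌜⌝-* b (t * s)))) (⌜⌝-* c (t * (t * s))))))
      where s = t ^ suc (suc m)

    -- With respect to t^(m+2) e^(-t) / φ, the mean of t - m is 3, which gives the term 3 m.
    weighted≤ : weighted ≤ᴿ ⌜ φ * (K * (M * M) + fromℕ 3 * M) ⌝
    weighted≤ = ≤ᴿ-trans (integral-mono bounded tangent-integral (polynomial-integral (K * (M * M) - M * M) M 0ℚ))
      (≈⇒≤ (⌜⌝-cong (cong (φ *_) (solve 2 (λ k m → k :* (m :* m) :- m :* m :+ m :* (m :+ con (fromℕ 3)) :+ con 0ℚ :* ((m :+ con (fromℕ 4)) :* (m :+ con (fromℕ 3)))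
        := k :* (m :* m) :+ con (fromℕ 3) :* m) refl K M))))
      where
      bounded : ∀ t → 0ℚ ≤ t → ⌜ K ⌝ ⊗ ⌜ M ⌝ ⊗ ω ^ᴿ n ⊗ power (suc m) t ≤ᴿ _
      bounded t 0≤t = ≤ᴿ-trans (≈⇒≤ (≈-sym (integrand-eq t))) (≤ᴿ-trans
        (⊗-monoˡ-≤ ⌜ t ^ suc (suc m) ⌝ (0≤⌜⌝ (0≤^ (suc (suc m)) 0≤t)) (RootCalculus.rootᴿ-tangent-above n t M 0≤t 0≤M))
        (≈⇒≤ (≈-trans (⊗-congˡ ⌜ t ^ suc (suc m) ⌝ polynomial) (expand t (K * (M * M) - M * M) M 0ℚ))))
        where
        polynomial : ⌜ K ⌝ ⊗ (⌜ M ⌝ ⊗ ⌜ M ⌝) ⊕ ⌜ M ⌝ ⊗ (⌜ t ⌝ ⊝ ⌜ M ⌝) ≈ ⌜ K * (M * M) - M * M + M * t + 0ℚ * (t * t) ⌝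
        polynomial = ≈-trans (⊕-cong (≈-trans (⊗-congˡ ⌜ K ⌝ (≈-sym (⌜⌝-* M M))) (≈-sym (⌜⌝-* K (M * M))))
            (≈-trans (⊗-congˡ ⌜ M ⌝ (≈-sym (⌜⌝-⊝ t M))) (≈-sym (⌜⌝-* M (t - M)))))
          (≈-trans (≈-sym (⌜⌝-+ (K * (M * M)) (M * (t - M))))
            (⌜⌝-cong (solve 3 (λ k m t → k :* (m :* m) :+ m :* (t :- m) := k :* (m :* m) :- m :* m :+ m :* t :+ con 0ℚ :* (t :* t)) refl K M t)))

    -- With respect to t^(m+2) e^(-t) / φ, the mean of (t - m)² is m + 12. So the quadratic error
    -- lowers k m² by k (m + 12) only.
    weighted≥ : ⌜ φ * (fromℕ 3 * M + K * (M * M - M - fromℕ 12)) ⌝ ≤ᴿ weighted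
    weighted≥ = ≤ᴿ-trans
      (≈⇒≤ (⌜⌝-cong (cong (φ *_) (solve 2 (λ k m → con (fromℕ 3) :* m :+ k :* (m :* m :- m :- con (fromℕ 12))
        := :- (m :* m) :+ (m :+ con (fromℕ 2) :* k :* m) :* (m :+ con (fromℕ 3)) :+ (:- k) :* ((m :+ con (fromℕ 4)) :* (m :+ con (fromℕ 3)))) refl K M))))
      (integral-mono bounded (polynomial-integral (- (M * M)) (M + fromℕ 2 * K * M) (- K)) tangent-integral)
      where
      bounded : ∀ t → 0ℚ ≤ t → _ ≤ᴿ ⌜ K ⌝ ⊗ ⌜ M ⌝ ⊗ ω ^ᴿ n ⊗ power (suc m) t
      bounded t 0≤t = ≤ᴿ-trans
        (≈⇒≤ (≈-sym (≈-trans (⊗-congˡ ⌜ t ^ suc (suc m) ⌝ polynomial) (expand t (- (M * M)) (M + fromℕ 2 * K * M) (- K)))))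
        (≤ᴿ-trans (⊗-monoˡ-≤ ⌜ t ^ suc (suc m) ⌝ (0≤⌜⌝ (0≤^ (suc (suc m)) 0≤t)) (RootCalculus.rootᴿ-tangent-below n t M 0≤t 0≤M))
          (≈⇒≤ (integrand-eq t)))
        where
        polynomial : ⌜ K ⌝ ⊗ (⌜ M ⌝ ⊗ ⌜ M ⌝) ⊕ ⌜ M ⌝ ⊗ (⌜ t ⌝ ⊝ ⌜ M ⌝) ⊝ ⌜ K ⌝ ⊗ ((⌜ t ⌝ ⊝ ⌜ M ⌝) ⊗ (⌜ t ⌝ ⊝ ⌜ M ⌝))
                   ≈ ⌜ - (M * M) + (M + fromℕ 2 * K * M) * t + (- K) * (t * t) ⌝
        polynomial = ≈-trans (⊝-cong
            (⊕-cong (≈-trans (⊗-congˡ ⌜ K ⌝ (≈-sym (⌜⌝-* M M))) (≈-sym (⌜⌝-* K (M * M))))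
              (≈-trans (⊗-congˡ ⌜ M ⌝ (≈-sym (⌜⌝-⊝ t M))) (≈-sym (⌜⌝-* M (t - M)))))
            (≈-trans (⊗-congˡ ⌜ K ⌝ (≈-trans (⊗-cong (≈-sym (⌜⌝-⊝ t M)) (≈-sym (⌜⌝-⊝ t M))) (≈-sym (⌜⌝-* (t - M) (t - M)))))
              (≈-sym (⌜⌝-* K ((t - M) * (t - M))))))
          (≈-trans (⊝-cong (≈-sym (⌜⌝-+ (K * (M * M)) (M * (t - M)))) ≈-refl)
            (≈-trans (≈-sym (⌜⌝-⊝ (K * (M * M) + M * (t - M)) (K * ((t - M) * (t - M)))))
              (⌜⌝-cong (solve 3 (λ k m t → k :* (m :* m) :+ m :* (t :- m) :- k :* ((t :- m) :* (t :- m))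
                := :- (m :* m) :+ (m :+ con (fromℕ 2) :* k :* m) :* t :+ (:- k) :* (t :* t)) refl K M t))))

  factorial-eq : ∀ m → fromℕ (suc (suc m) !) ≡ (fromℕ m + fromℕ 2) * ((fromℕ m + 1ℚ) * fromℕ (m !))
  factorial-eq m = trans (fromℕ-* (suc (suc m)) (suc m !)) (cong₂ _*_ (trans (fromℕ-+ 2 m) (+-comm (fromℕ 2) (fromℕ m)))
    (trans (fromℕ-* (suc m) (m !)) (cong (_* fromℕ (m !)) (trans (fromℕ-suc m) (+-comm 1ℚ (fromℕ m))))))

  module Ratio (m-1 : ℕ) where

    private
      m : ℕ
      m = suc m-1

    open At m

    -- `Q` is k m² ρ m, the factor for which κ υ² times `weighted` is `Q` times the asymptotic
    -- expression; one of its factors m is ω^k.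
    υ Q : ℚ
    υ = + 1 / m
    Q = K * M * ρ m * M

    Mυ : M * υ ≡ 1ℚ
    Mυ = fromℕ-*-/ 1 m-1

    0≤υ : 0ℚ ≤ υ
    0≤υ = 0≤/ 1 m-1

    υ≤1 : υ ≤ 1ℚ
    υ≤1 = /-mono-≤ 1 1 m-1 0 (s≤s z≤n)

    0<Q : 0ℚ < Q
    0<Q = 0<p*q (0<p*q (0<p*q 0<K (0<fromℕ-suc m-1)) (0<ρ m)) (0<fromℕ-suc m-1)

    0≤1-υ : 0ℚ ≤ 1ℚ - υ
    0≤1-υ = p≤q⇒0≤q-p υ≤1

    -- (m + 2)(m + 1)/m², which is (m + 2)! divided by m² m!.
    S : ℚ
    S = (1ℚ + fromℕ 2 * υ) * (1ℚ + υ)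

    0≤S : 0ℚ ≤ S
    0≤S = 0≤p*q (+-mono-≤ (0≤fromℕ 1) (0≤p*q (0≤fromℕ 2) 0≤υ)) (+-mono-≤ (0≤fromℕ 1) 0≤υ)

    -- Powers of M are homogenised with M υ = 1.
    scaled : ∀ a → κ * (υ * υ) * (φ * a) ≡ κ * fromℕ (m !) * (S * a)
    scaled a = begin
      κ * (υ * υ) * (φ * a)
        ≡⟨ cong (λ f → κ * (υ * υ) * (f * a)) (factorial-eq m) ⟩
      κ * (υ * υ) * ((M + fromℕ 2) * ((M + 1ℚ) * fromℕ (m !)) * a)
        ≡⟨ solve 5 (λ c i m f a → c :* (i :* i) :* ((m :+ con (fromℕ 2)) :* ((m :+ con 1ℚ) :* f) :* a)
             := c :* f :* ((m :* i :+ con (fromℕ 2) :* i) :* (m :* i :+ i) :* a)) refl κ υ M (fromℕ (m !)) a ⟩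
      κ * fromℕ (m !) * ((M * υ + fromℕ 2 * υ) * (M * υ + υ) * a)
        ≡⟨ cong (λ s → κ * fromℕ (m !) * ((s + fromℕ 2 * υ) * (s + υ) * a)) Mυ ⟩
      κ * fromℕ (m !) * (S * a) ∎
      where open ≡-Reasoning

    Q*p : ∀ a → Q * (LL.p m * a) ≡ κ * fromℕ (m !) * (K * (M * M) * a)
    Q*p a = trans (solve 5 (λ k m r p a → k :* m :* r :* m :* (p :* a) := r :* p :* (k :* (m :* m) :* a)) refl K M (ρ m) (LL.p m) a)
      (cong (_* (K * (M * M) * a)) (ρ*p m))

    0≤factor : 0ℚ ≤ κ * fromℕ (m !)
    0≤factor = 0≤p*q (<⇒≤ 0<κ) (0≤fromℕ (m !))

    0≤KMM : 0ℚ ≤ K * (M * M)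
    0≤KMM = 0≤p*q (<⇒≤ 0<K) (0≤p² M)

    3M≤ : fromℕ 3 * M ≤ K * (M * M) * (fromℕ 3 * υ)
    3M≤ = begin
      fromℕ 3 * M  ≡⟨ trans (cong (fromℕ 3 * M *_) Mυ) (*-identityʳ (fromℕ 3 * M)) ⟨
      fromℕ 3 * M * (M * υ)  ≡⟨ solve 2 (λ m i → con (fromℕ 3) :* m :* (m :* i) := con 1ℚ :* (m :* m :* (con (fromℕ 3) :* i))) refl M υ ⟩
      1ℚ * (M * M * (fromℕ 3 * υ))  ≤⟨ *-monoʳ-≤-nonNeg (M * M * (fromℕ 3 * υ)) {{nonNegative (0≤p*q (0≤p² M) (0≤p*q (0≤fromℕ 3) 0≤υ))}} 1≤K ⟩
      K * (M * M * (fromℕ 3 * υ))  ≡⟨ *-assoc K (M * M) (fromℕ 3 * υ) ⟨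
      K * (M * M) * (fromℕ 3 * υ)  ∎
      where open ≤-Reasoning

    -- S (1 + 3 υ) = 1 + 6 υ + 11 υ² + 6 υ³, and 6 + 11 + 6 = 23 bounds the excess over 1 by 23 υ
    -- for υ ≤ 1.
    rational-upper : κ * (υ * υ) * (φ * (K * (M * M) + fromℕ 3 * M)) ≤ Q * (LL.p m * (1ℚ + fromℕ 23 * υ))
    rational-upper = begin
      κ * (υ * υ) * (φ * (K * (M * M) + fromℕ 3 * M))  ≡⟨ scaled (K * (M * M) + fromℕ 3 * M) ⟩
      κ * fromℕ (m !) * (S * (K * (M * M) + fromℕ 3 * M))  ≤⟨ *-monoˡ-≤-nonNeg (κ * fromℕ (m !)) {{nonNegative 0≤factor}} (begin
        S * (K * (M * M) + fromℕ 3 * M)  ≤⟨ *-monoˡ-≤-nonNeg S {{nonNegative 0≤S}} (+-monoʳ-≤ (K * (M * M)) 3M≤) ⟩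
        S * (K * (M * M) + K * (M * M) * (fromℕ 3 * υ))  ≤⟨ p≤p+q (0≤p*q 0≤KMM (0≤p*q (0≤p*q 0≤υ 0≤1-υ) (+-mono-≤ (0≤fromℕ 17) (0≤p*q (0≤fromℕ 6) 0≤υ)))) ⟩
        S * (K * (M * M) + K * (M * M) * (fromℕ 3 * υ)) + K * (M * M) * (υ * (1ℚ - υ) * (fromℕ 17 + fromℕ 6 * υ))
          ≡⟨ solve 2 (λ c i → (con 1ℚ :+ con (fromℕ 2) :* i) :* (con 1ℚ :+ i) :* (c :+ c :* (con (fromℕ 3) :* i))
               :+ c :* (i :* (con 1ℚ :- i) :* (con (fromℕ 17) :+ con (fromℕ 6) :* i)) := c :* (con 1ℚ :+ con (fromℕ 23) :* i)) refl (K * (M * M)) υ ⟩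
        K * (M * M) * (1ℚ + fromℕ 23 * υ)  ∎) ⟩
      κ * fromℕ (m !) * (K * (M * M) * (1ℚ + fromℕ 23 * υ))  ≡⟨ Q*p (1ℚ + fromℕ 23 * υ) ⟨
      Q * (LL.p m * (1ℚ + fromℕ 23 * υ))  ∎
      where open ≤-Reasoning

    -- S (1 - υ - 12 υ²) = 1 + 2 υ - 13 υ² - 38 υ³ - 24 υ⁴. As 13 + 38 + 24 = 75, the gain 2 υ
    -- outweighs the rest once 75 υ ≤ 1, and no error term is left.
    rational-lower : fromℕ 75 * υ ≤ 1ℚ → Q * (LL.p m * 1ℚ) ≤ κ * (υ * υ) * (φ * (fromℕ 3 * M + K * (M * M - M - fromℕ 12)))
    rational-lower 75υ≤1 = begin
      Q * (LL.p m * 1ℚ)  ≡⟨ Q*p 1ℚ ⟩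
      κ * fromℕ (m !) * (K * (M * M) * 1ℚ)  ≤⟨ *-monoˡ-≤-nonNeg (κ * fromℕ (m !)) {{nonNegative 0≤factor}} (begin
        c * 1ℚ  ≤⟨ p≤p+q (0≤p*q 0≤KMM (0≤p*q 0≤υ 0≤gap)) ⟩
        c * 1ℚ + c * (υ * gap)  ≡⟨ solve 2 (λ c i →
            c :* con 1ℚ :+ c :* (i :* (con (fromℕ 2) :* (con 1ℚ :- con (fromℕ 75) :* i) :+ con (fromℕ 38) :* i :* (con 1ℚ :- i)
              :+ con (fromℕ 24) :* i :* ((con 1ℚ :- i) :* (con 1ℚ :+ i)) :+ con (fromℕ 75) :* i))
            := (con 1ℚ :+ con (fromℕ 2) :* i) :* (con 1ℚ :+ i) :* (c :* (con 1ℚ :- i :- con (fromℕ 12) :* (i :* i)))) refl c υ ⟩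
        S * (c * (1ℚ - υ - fromℕ 12 * (υ * υ)))  ≡⟨ cong (S *_) homogeneous ⟩
        S * (K * (M * M - M - fromℕ 12))  ≤⟨ *-monoˡ-≤-nonNeg S {{nonNegative 0≤S}} (p≤q+p (0≤p*q (0≤fromℕ 3) 0≤M)) ⟩
        S * (fromℕ 3 * M + K * (M * M - M - fromℕ 12))  ∎) ⟩
      κ * fromℕ (m !) * (S * (fromℕ 3 * M + K * (M * M - M - fromℕ 12)))  ≡⟨ scaled (fromℕ 3 * M + K * (M * M - M - fromℕ 12)) ⟨
      κ * (υ * υ) * (φ * (fromℕ 3 * M + K * (M * M - M - fromℕ 12)))  ∎
      where
      open ≤-Reasoning
      c = K * (M * M)
      gap = fromℕ 2 * (1ℚ - fromℕ 75 * υ) + fromℕ 38 * υ * (1ℚ - υ) + fromℕ 24 * υ * ((1ℚ - υ) * (1ℚ + υ)) + fromℕ 75 * υ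
      0≤gap : 0ℚ ≤ gap
      0≤gap = +-mono-≤ (+-mono-≤ (+-mono-≤ (0≤p*q (0≤fromℕ 2) (p≤q⇒0≤q-p 75υ≤1)) (0≤p*q (0≤p*q (0≤fromℕ 38) 0≤υ) 0≤1-υ))
        (0≤p*q (0≤p*q (0≤fromℕ 24) 0≤υ) (0≤p*q 0≤1-υ (+-mono-≤ (0≤fromℕ 1) 0≤υ)))) (0≤p*q (0≤fromℕ 75) 0≤υ)
      homogeneous : c * (1ℚ - υ - fromℕ 12 * (υ * υ)) ≡ K * (M * M - M - fromℕ 12)
      homogeneous = trans
        (solve 3 (λ k m i → k :* (m :* m) :* (con 1ℚ :- i :- con (fromℕ 12) :* (i :* i)) := k :* (m :* m :- m :* (m :* i) :- con (fromℕ 12) :* ((m :* i) :* (m :* i)))) refl K M υ)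
        (trans (cong (λ s → K * (M * M - M * s - fromℕ 12 * (s * s))) Mυ)
          (solve 2 (λ k m → k :* (m :* m :- m :* con 1ℚ :- con (fromℕ 12) :* (con 1ℚ :* con 1ℚ)) := k :* (m :* m :- m :- con (fromℕ 12))) refl K M))

    -- β stands for m^(-2-1/k). It is characterised by β ω = m^(-2), which together with ω · ω^(k-1)
    -- = m removes all roots from `weighted-X`.
    module _ (β : ℝ) (0≤β : 0ᴿ ≤ᴿ β) (β⊗ω : β ⊗ ω ≈ ⌜ υ * υ ⌝) where

      X : ℝ
      X = ⌜ κ ⌝ ⊗ Γ ⊗ β

      weighted-X : ⌜ κ * (υ * υ) ⌝ ⊗ weighted ≈ ⌜ Q ⌝ ⊗ X
      weighted-X = begin-equality
        ⌜ κ * (υ * υ) ⌝ ⊗ weighted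
          ≈⟨ ⊗-congʳ weighted (≈-trans (⌜⌝-* κ (υ * υ)) (⊗-congˡ ⌜ κ ⌝ (≈-sym β⊗ω))) ⟩
        ⌜ κ ⌝ ⊗ (β ⊗ ω) ⊗ (⌜ K ⌝ ⊗ ⌜ M ⌝ ⊗ ω ^ᴿ n ⊗ (⌜ ρ m ⌝ ⊗ Γ))
          ≈⟨ solveᴿ 8 (λ c b o k m p r g → c :* (b :* o) :* (k :* m :* p :* (r :* g)) := k :* m :* r :* (o :* p) :* (c :* g :* b)) refl
               ⌜ κ ⌝ β ω ⌜ K ⌝ ⌜ M ⌝ (ω ^ᴿ n) ⌜ ρ m ⌝ Γ ⟩
        ⌜ K ⌝ ⊗ ⌜ M ⌝ ⊗ ⌜ ρ m ⌝ ⊗ (ω ^ᴿ suc n) ⊗ X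
          ≈⟨ ⊗-congʳ X (⊗-cong (≈-trans (⊗-congʳ ⌜ ρ m ⌝ (≈-sym (⌜⌝-* K M))) (≈-sym (⌜⌝-* (K * M) (ρ m)))) (rootᴿ-^ n M 0≤M)) ⟩
        ⌜ K * M * ρ m ⌝ ⊗ ⌜ M ⌝ ⊗ X
          ≈⟨ ⊗-congʳ X (≈-sym (⌜⌝-* (K * M * ρ m) M)) ⟩
        ⌜ Q ⌝ ⊗ X ∎
        where open ℝ-Reasoning

      0≤κυυ : 0ᴿ ≤ᴿ ⌜ κ * (υ * υ) ⌝
      0≤κυυ = 0≤⌜⌝ (0≤p*q (<⇒≤ 0<κ) (0≤p² υ))

      X≤ : X ≤ᴿ ⌜ LL.p m * (1ℚ + fromℕ 23 * υ) ⌝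
      X≤ = ⊗-cancelˡ-≤ 0<Q (begin
        ⌜ Q ⌝ ⊗ X  ≈⟨ weighted-X ⟨
        ⌜ κ * (υ * υ) ⌝ ⊗ weighted  ≤⟨ ⊗-monoˡ-≤ ⌜ κ * (υ * υ) ⌝ 0≤κυυ weighted≤ ⟩
        ⌜ κ * (υ * υ) ⌝ ⊗ ⌜ φ * (K * (M * M) + fromℕ 3 * M) ⌝  ≈⟨ ⌜⌝-* (κ * (υ * υ)) (φ * (K * (M * M) + fromℕ 3 * M)) ⟨
        ⌜ κ * (υ * υ) * (φ * (K * (M * M) + fromℕ 3 * M)) ⌝  ≤⟨ ⌜⌝-mono-≤ rational-upper ⟩
        ⌜ Q * (LL.p m * (1ℚ + fromℕ 23 * υ)) ⌝  ≈⟨ ⌜⌝-* Q (LL.p m * (1ℚ + fromℕ 23 * υ)) ⟩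
        ⌜ Q ⌝ ⊗ ⌜ LL.p m * (1ℚ + fromℕ 23 * υ) ⌝  ∎)
        where open ℝ-Reasoning

      p≤X : fromℕ 75 * υ ≤ 1ℚ → ⌜ LL.p m ⌝ ≤ᴿ X
      p≤X 75υ≤1 = ⊗-cancelˡ-≤ 0<Q (begin
        ⌜ Q ⌝ ⊗ ⌜ LL.p m ⌝  ≈⟨ ≈-trans (⊗-congˡ ⌜ Q ⌝ (⌜⌝-cong (sym (*-identityʳ (LL.p m))))) (≈-sym (⌜⌝-* Q (LL.p m * 1ℚ))) ⟩
        ⌜ Q * (LL.p m * 1ℚ) ⌝  ≤⟨ ⌜⌝-mono-≤ (rational-lower 75υ≤1) ⟩
        ⌜ κ * (υ * υ) * (φ * (fromℕ 3 * M + K * (M * M - M - fromℕ 12))) ⌝  ≈⟨ ⌜⌝-* (κ * (υ * υ)) (φ * (fromℕ 3 * M + K * (M * M - M - fromℕ 12))) ⟩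
        ⌜ κ * (υ * υ) ⌝ ⊗ ⌜ φ * (fromℕ 3 * M + K * (M * M - M - fromℕ 12)) ⌝  ≤⟨ ⊗-monoˡ-≤ ⌜ κ * (υ * υ) ⌝ 0≤κυυ weighted≥ ⟩
        ⌜ κ * (υ * υ) ⌝ ⊗ weighted  ≈⟨ weighted-X ⟩
        ⌜ Q ⌝ ⊗ X  ∎)
        where open ℝ-Reasoning

      p∼X : ∀ ε → fromℕ 75 * υ ≤ 1ℚ → fromℕ 23 * υ ≤ ε → ∥ ⌜ LL.p m ⌝ ⊝ X ∥ ≤ᴿ ⌜ ε ⌝ ⊗ ∥ X ∥
      p∼X ε 75υ≤1 23υ≤ε = ≤⇒∥⊝∥≤
        (≤ᴿ-trans (p≤X 75υ≤1) (≤ᴿ-trans (≈⇒≤ (≈-sym (≈-trans (⊕-comm X 0ᴿ) (⊕-identityˡ X)))) (⊕-mono-≤ ≤ᴿ-refl (0≤⊗ (0≤⌜⌝ 0≤ε) (0≤∥∥ X)))))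
        (begin
          X  ≤⟨ X≤ ⟩
          ⌜ LL.p m * (1ℚ + fromℕ 23 * υ) ⌝  ≈⟨ ≈-trans (⌜⌝-cong (solve 2 (λ p d → p :* (con 1ℚ :+ d) := p :+ d :* p) refl (LL.p m) (fromℕ 23 * υ)))
                                                                   (≈-trans (⌜⌝-+ (LL.p m) (fromℕ 23 * υ * LL.p m)) (⊕-cong ≈-refl (⌜⌝-* (fromℕ 23 * υ) (LL.p m)))) ⟩
          ⌜ LL.p m ⌝ ⊕ ⌜ fromℕ 23 * υ ⌝ ⊗ ⌜ LL.p m ⌝  ≤⟨ ⊕-mono-≤ ≤ᴿ-refl (⊗-mono-≤ (0≤⌜⌝ (0≤p*q (0≤fromℕ 23) 0≤υ)) (0≤∥∥ X) (⌜⌝-mono-≤ 23υ≤ε)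
                                                                   (≤ᴿ-trans (p≤X 75υ≤1) (x≤∥x∥ X))) ⟩
          ⌜ LL.p m ⌝ ⊕ ⌜ ε ⌝ ⊗ ∥ X ∥  ∎)
        where
        open ℝ-Reasoning
        0≤ε : 0ℚ ≤ ε
        0≤ε = ≤-trans (0≤p*q (0≤fromℕ 23) 0≤υ) 23υ≤ε

    1÷M^ : (1ℚ ÷₀ M ^ suc (k ℕ.+ k)) * M ≡ (υ * υ) ^ k
    1÷M^ = *-cancelʳ-≢0 (M ^ suc (k ℕ.+ k)) M^≢0 (begin
      (1ℚ ÷₀ M ^ suc (k ℕ.+ k)) * M * M ^ suc (k ℕ.+ k)  ≡⟨ solve 3 (λ a m p → a :* m :* p := a :* p :* m) refl (1ℚ ÷₀ M ^ suc (k ℕ.+ k)) M (M ^ suc (k ℕ.+ k)) ⟩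
      (1ℚ ÷₀ M ^ suc (k ℕ.+ k)) * M ^ suc (k ℕ.+ k) * M  ≡⟨ cong (_* M) (÷₀-* 1ℚ M^≢0) ⟩
      1ℚ * M  ≡⟨ cong (_* M) (cong₂ _*_ υ^k υ^k) ⟨
      υ ^ k * M ^ k * (υ ^ k * M ^ k) * M  ≡⟨ solve 3 (λ u p m → u :* p :* (u :* p) :* m := u :* u :* (m :* (p :* p))) refl (υ ^ k) (M ^ k) M ⟩
      υ ^ k * υ ^ k * (M * (M ^ k * M ^ k))  ≡⟨ cong₂ (λ a b → a * (M * b)) (*-distrib-^ υ υ k) (^-+ M k k) ⟨
      (υ * υ) ^ k * M ^ suc (k ℕ.+ k)  ∎)
      where
      open ≡-Reasoning
      ^-+ : ∀ x i j → x ^ (i ℕ.+ j) ≡ x ^ i * x ^ j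
      ^-+ x zero    j = sym (*-identityˡ (x ^ j))
      ^-+ x (suc i) j = trans (cong (x *_) (^-+ x i j)) (sym (*-assoc x (x ^ i) (x ^ j)))
      M^≢0 : M ^ suc (k ℕ.+ k) ≢ 0ℚ
      M^≢0 = 0<⇒≢0 (0<^ (suc (k ℕ.+ k)) (0<fromℕ-suc m-1))
      1^ : ∀ i → 1ℚ ^ i ≡ 1ℚ
      1^ zero    = refl
      1^ (suc i) = trans (*-identityˡ (1ℚ ^ i)) (1^ i)
      υ^k : υ ^ k * M ^ k ≡ 1ℚ
      υ^k = trans (sym (*-distrib-^ υ M k)) (trans (cong (_^ k) (trans (*-comm υ M) Mυ)) (1^ k))

    0≤intPower : 0ℚ ≤ 1ℚ ÷₀ M ^ suc (k ℕ.+ k)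
    0≤intPower = <⇒≤ (0<÷₀ (0<fromℕ-suc 0) (0<^ (suc (k ℕ.+ k)) (0<fromℕ-suc m-1)))

    -- Compared through k-th powers, where the claim is m^(-(2k+1)) · m = m^(-2k).
    decay⊗ω : ∀ β → (∀ j → 0ℚ ≤ seq β j) → β ^ᴿ k ≈ ⌜ 1ℚ ÷₀ M ^ suc (k ℕ.+ k) ⌝ → β ⊗ ω ≈ ⌜ υ * υ ⌝
    decay⊗ω β 0≤β β^k = ^ᴿ-injective n (β ⊗ ω) ⌜ υ * υ ⌝
      (λ j → subst (0ℚ ≤_) (sym (seq-⊗ β ω j)) (0≤p*q (0≤β j) (0≤rootᴿ n M j)))
      (λ j → subst (0ℚ ≤_) (sym (seq-⌜⌝ (υ * υ) j)) (0≤p² υ))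
      (≈-trans (⊗-distrib-^ᴿ k β ω) (≈-trans (⊗-cong β^k (rootᴿ-^ n M 0≤M))
        (≈-trans (≈-sym (⌜⌝-* (1ℚ ÷₀ M ^ suc (k ℕ.+ k)) M)) (≈-trans (⌜⌝-cong 1÷M^) (≈-sym (⌜⌝-^ k (υ * υ)))))))

product≈ : ∀ q x y → fromℚ q *ℝ x *ℝ y ≈ ⌜ q ⌝ ⊗ x ⊗ y
product≈ q x y = ≈-trans (*ℝ≈⊗ (fromℚ q *ℝ x) y) (⊗-congʳ y (≈-trans (*ℝ≈⊗ (fromℚ q) x) (⊗-congʳ x (fromℚ≈ q))))

relative-error : ∀ p x X ε → x ≈ X → ∥ ⌜ p ⌝ ⊝ X ∥ ≤ᴿ ⌜ ε ⌝ ⊗ ∥ X ∥ → ∣ fromℚ p -ℝ x ∣ℝ ≤ℝ fromℚ ε *ℝ ∣ x ∣ℝ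
relative-error p x X ε x≈X h = un≤ (≤ᴿ-trans
  (≈⇒≤ (≈-trans (∣-ℝ∣≈∥⊝∥ (fromℚ p) x) (∥∥-cong (⊝-cong (fromℚ≈ p) x≈X))))
  (≤ᴿ-trans h (≈⇒≤ (≈-sym (≈-trans (*ℝ∣∣≈⊗∥∥ ε x) (⊗-congˡ ⌜ ε ⌝ (∥∥-cong x≈X)))))))

limitProbability-∼ : ∀ n → let k = suc n ; Γ = RootMoments.Γ n in
  (λ m → fromℚ (limitProbability k m)) ∼ (λ m → fromℚ (+ suc k / k) *ℝ Γ *ℝ (fromℕ m ^ℚ (- (fromℕ 2) - + 1 / k)))
-- The threshold is a successor so that m = 0 is excluded. Beyond N₁ the lower bound applies, since
-- 75/m ≤ 1; beyond N₂ the upper bound is sharp enough, since 23/m ≤ ε.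
limitProbability-∼ n ε 0<ε = suc (N₁ ℕ.⊔ N₂) , λ { (suc m) (s≤s le) →
    let r = - (fromℕ 2) - + 1 / suc n
        β = fromℕ (suc m) ^ℚ r
        module R = GammaAsymptotics.Ratio n m
        0≤β = 0≤^ℚ (fromℕ (suc m)) r
    in relative-error (limitProbability (suc n) (suc m)) (fromℚ (+ suc (suc n) / suc n) *ℝ RootMoments.Γ n *ℝ β) _ ε
         (product≈ (+ suc (suc n) / suc n) (RootMoments.Γ n) β)
         (R.p∼X β (≤-pointwise 0ᴿ β λ j → subst (_≤ seq β j) (sym (seq-⌜⌝ 0ℚ j)) (0≤β j)) (R.decay⊗ω β 0≤β (power n m)) ε
           (proj₂ (C/n-small (fromℕ 75) 1ℚ (0≤fromℕ 75) (0<fromℕ-suc 0)) m (ℕ.m⊔n≤o⇒m≤o N₁ N₂ le))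
           (proj₂ (C/n-small (fromℕ 23) ε (0≤fromℕ 23) 0<ε) m (ℕ.m⊔n≤o⇒n≤o N₁ N₂ le))) }
  where
  N₁ = proj₁ (C/n-small (fromℕ 75) 1ℚ (0≤fromℕ 75) (0<fromℕ-suc 0))
  N₂ = proj₁ (C/n-small (fromℕ 23) ε (0≤fromℕ 23) 0<ε)
  power : ∀ n m → (fromℕ (suc m) ^ℚ (- (fromℕ 2) - + 1 / suc n)) ^ᴿ suc n ≈ ⌜ 1ℚ ÷₀ fromℕ (suc m) ^ suc (suc n ℕ.+ suc n) ⌝
  power n m = subst (λ r → (fromℕ (suc m) ^ℚ r) ^ᴿ suc n ≈ ⌜ 1ℚ ÷₀ fromℕ (suc m) ^ suc (suc n ℕ.+ suc n) ⌝) (sym (-2-1/k≡ n))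
    (^ℚ-^ (fromℕ (suc m)) (-[2+1/k] n) (GammaAsymptotics.Ratio.0≤intPower n m))

-- The quotient for the given proof of k ≢ 0 and the one for the proof inferred for `suc n` agree
-- definitionally, by irrelevance; this lets `isGamma` pass from one to the other.
1/k-irrelevant : ∀ k .(i j : NonZero k) → (+ 1 / k) {{i}} ≡ (+ 1 / k) {{j}}
1/k-irrelevant k i j = refl

isGamma : ∀ n .{{i : NonZero (suc n)}} → IsGamma (fromℕ 2 + (+ 1 / suc n) {{i}}) (RootMoments.Γ n)
isGamma n {{i}} = subst (λ q → IsGamma (fromℕ 2 + q) (RootMoments.Γ n)) {+ 1 / suc n} {(+ 1 / suc n) {{i}}}
  (1/k-irrelevant (suc n) _ i) (GammaAsymptotics.isGamma n)

-- A record type, so that Agda changes the irrelevant proof of k ≢ 0 without unfolding the fields.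
record LimitBehaviour (k : ℕ) .{{_ : NonZero k}} (Γ : ℝ) : Set where
  field
    isDistribution : IsDistribution (limitProbability k)
    converges      : ℙ[Ȳ_≡_] {k} ⟶ᵈ limitProbability k
    asymptotic     : (λ m → fromℚ (limitProbability k m)) ∼
                     (λ m → fromℚ (+ suc k / k) *ℝ Γ *ℝ (fromℕ m ^ℚ (- (fromℕ 2) - + 1 / k)))

limitBehaviour : ∀ n → LimitBehaviour (suc n) (RootMoments.Γ n)
limitBehaviour n = record
  { isDistribution = LimitLaw.isDistribution n
  ; converges      = pointwise⇒⟶ᵈ (ℙ[Ȳ_≡_] {suc n}) (limitProbability (suc n)) (LimitLaw.ℙ⟶p n)
  ; asymptotic     = limitProbability-∼ n }

theorem3 : (k : ℕ) .{{_ : NonZero k}} →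
    ((n : ℕ) .{{_ : NonZero n}} (m : ℕ) → ℙ[Ȳ_≡_] {k} n m ≡ exactProbability k n m)
    × (IsDistribution (limitProbability k) × (ℙ[Ȳ_≡_] {k} ⟶ᵈ limitProbability k))
    × (Σ ℝ λ Γ → IsGamma (fromℕ 2 + + 1 / k) Γ
        × ((λ m → fromℚ (limitProbability k m))
            ∼ (λ m → fromℚ (+ suc k / k) *ℝ Γ *ℝ (fromℕ m ^ℚ (- (fromℕ 2) - + 1 / k)))))
theorem3 zero          = ⊥-elim (ℕ.≢-nonZero⁻¹ 0 refl)
theorem3 (suc n) {{i}} = Formula.probability-exact (suc n)
  , (LimitBehaviour.isDistribution {suc n} {{i}} limits , LimitBehaviour.converges {suc n} {{i}} limits)
  , (RootMoments.Γ n , isGamma n {{i}} , LimitBehaviour.asymptotic {suc n} {{i}} limits)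
  where
  limits : LimitBehaviour (suc n) {{i}} (RootMoments.Γ n)
  limits = limitBehaviour n
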